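{- There is a function $f:\mathbb{N}\to\mathbb{R}_{>0}$ with $f(n) = n^{5/4+o(1)}$ as $n\to\infty$ such that, for every sufficiently large $n$, every nontrivial monotone property of graphs on $n$ vertices all of whose members have at most $f(n)$ edges is evasive.
   Context: A graph property $\mathcal{P}_n$ of $n$-vertex graphs is a collection of (simple, undirected) graphs on the vertex set $\{1,\ldots,n\}$ that is invariant under relabelling of the vertices. It is monotone if it is preserved under deletion of edges, and nontrivial if it is neither empty nor the set of all graphs on $\{1,\ldots,n\}$. A Boolean function of $m$ variables is evasive if its deterministic query (decision-tree) complexity equals $m$. The property $\mathcal{P}_n$ is evasive if the Boolean function on $m=n(n-1)/2$ variables (the entries of the adjacency matrix, one per unordered pair of vertices) that decides whether the given graph belongs to $\mathcal{P}_n$ is evasive. "A property of graphs with at most $f(n)$ edges" means a property every member graph of which has at most $f(n)$ edges. -}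

module Defs where

open import Data.Nat using (ℕ; zero; suc; _+_; _*_; _∸_; _⊔_; _≤_)
open import Data.Bool using (Bool; true; false; if_then_else_)
open import Data.Fin using (Fin; _<_; _<?_)
open import Data.Fin.Permutation using (Permutation′; _⟨$⟩ʳ_)
open import Data.Product using (Σ; _×_; _,_; ∃)
open import Data.List using (List; map; allFin)
open import Data.Nat.ListAction using (sum)
open import Relation.Nullary using (Dec; yes; no)
open import Relation.Binary.PropositionalEquality using (_≡_)

-- Potential edges of a graph on vertex set Fin n: unordered pairs {i,j},
-- represented canonically as ordered pairs (i , j) with i < j.
Edge : ℕ → Set
Edge n = Σ (Fin n × Fin n) (λ p → Data.Product.proj₁ p < Data.Product.proj₂ p)

Graph : ℕ → Set
Graph n = Edge n → Bool

adj : ∀ {n} → Graph n → Fin n → Fin n → Bool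
adj {n} G i j = go (i <? j) (j <? i)
  where
  go : Dec (i < j) → Dec (j < i) → Bool
  go (yes p) _       = G ((i , j) , p)
  go (no _)  (yes q) = G ((j , i) , q)
  go (no _)  (no _)  = false

relabel : ∀ {n} → Permutation′ n → Graph n → Graph n
relabel σ G ((i , j) , _) = adj G (σ ⟨$⟩ʳ i) (σ ⟨$⟩ʳ j)

bit : Bool → ℕ
bit true  = 1
bit false = 0

edgeCount : ∀ {n} → Graph n → ℕ
edgeCount {n} G = sum (map (λ i → sum (map (λ j → pairBit i j (i <? j)) (allFin n))) (allFin n))
  where
  pairBit : (i j : Fin n) → Dec (i < j) → ℕ
  pairBit i j (yes p) = bit (G ((i , j) , p))
  pairBit i j (no _)  = 0

IsGraphProperty : ∀ {n} → (Graph n → Bool) → Set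
IsGraphProperty {n} P = ∀ (σ : Permutation′ n) (G : Graph n) → P (relabel σ G) ≡ P G

_⊑_ : ∀ {n} → Graph n → Graph n → Set
H ⊑ G = ∀ e → H e ≡ true → G e ≡ true

Monotone : ∀ {n} → (Graph n → Bool) → Set
Monotone {n} P = ∀ (G H : Graph n) → H ⊑ G → P G ≡ true → P H ≡ true

Nontrivial : ∀ {n} → (Graph n → Bool) → Set
Nontrivial {n} P = (∃ λ (G : Graph n) → P G ≡ true) × (∃ λ (G : Graph n) → P G ≡ false)

data DecisionTree (V : Set) : Set where
  leaf  : Bool → DecisionTree V
  query : V → (ifFalse ifTrue : DecisionTree V) → DecisionTree V

eval : ∀ {V} → DecisionTree V → (V → Bool) → Bool
eval (leaf b) x = b
eval (query v t₀ t₁) x = if x v then eval t₁ x else eval t₀ x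

depth : ∀ {V} → DecisionTree V → ℕ
depth (leaf _) = 0
depth (query _ t₀ t₁) = suc (depth t₀ ⊔ depth t₁)

Computes : ∀ {V} → DecisionTree V → ((V → Bool) → Bool) → Set
Computes t F = ∀ x → eval t x ≡ F x

-- F on m variables is evasive iff its query complexity (min depth of a
-- computing tree) equals m; since D(F) ≤ m always, this is: every computing tree has depth ≥ m.
Evasive : ∀ {V} → (m : ℕ) → ((V → Bool) → Bool) → Set
Evasive {V} m F = ∀ (t : DecisionTree V) → Computes t F → m ≤ depth t

-- a graph property on n vertices is evasive: m = n(n-1)/2 variables (= Edge n)
EvasiveProperty : ∀ n → (Graph n → Bool) → Set
EvasiveProperty n P = Evasive (n * (n ∸ 1) Data.Nat./ 2) P

{-# OPTIONS --safe #-}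
-- If a monotone property is not evasive, its complex of edge sets is collapsible, so by Oliver's fixed point theorem
-- every group that has a normal p-subgroup with cyclic-by-prime quotient leaves some nonempty member graph invariant.
-- It is therefore enough to find such a group of vertex permutations all of whose nonempty invariant graphs have more
-- edges than the members may have.
--
-- Write n = c + k p with primes c, p and a prime q dividing c - 1, where p and q exceed n^(1/4), and let the group be
-- generated by the translations of k copies of ℤ/p, by one permutation that rotates these copies with a twist by a
-- primitive root and translates ℤ/c, and by a multiplication of order q on ℤ/c. Every nonempty invariant graph has at
-- least half of min(c q, k p (p - 1), c k p) edges, which is n^(5/4) up to a logarithmic factor once c and k p are
-- within a logarithmic factor of n.
--
-- Such primes exist: by Chebyshev there are at least n / (log₂ n + 1), up to O(1), primes c ≤ n, and few of them have
-- c - 1 or n - c free of prime factors above r = n^(1/4). Indeed a number m near n with that defect has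
-- Σ (log l₁)(log l₂) ≥ (3/4 - ε)(log n)² over its ordered pairs of distinct prime factors l₁, l₂ ≤ r, whereas the
-- Brun–Titchmarsh inequality (Selberg's sieve) for the moduli l₁ l₂ bounds the total of these sums over all primes c.
--
-- The fixed point theorem follows Smith and Lefschetz, with cochains over ℤ considered modulo p: acyclicity modulo p
-- passes to the fixed points of a map of order p, and it makes the Lefschetz number of the reduced complex divisible
-- by every power of p, hence zero, which the count of fixed points then exploits.
module Submission where

-- The exponent 1/4 is what sieving by pairs of primes allows. For moduli l₁ l₂ with l₁, l₂ ≤ r the
-- sieve level z has to satisfy z² r² ≤ n up to logarithms, so z is near r when r is near n^(1/4).
-- In units of n / log₂ n the sieve then leaves at most (4 / 0.68) (1/16) / (3/4), about 0.49, of
-- bad primes for each of c - 1 and n - c. With all roundings the total is about 0.99, just below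
-- the 1 that Chebyshev's method guarantees. Summing log l over single primes with the same sieve
-- would give about 1.5 for each condition; hence the second moment. The thin margin dictates the
-- precision of the harmonic sum (0.68 against log 2 = 0.693) and the size of the constants near
-- 10000. On the side of the group, the middle quotient has to be cyclic although it must act
-- independently on ℤ/c and on the copies of ℤ/p. One permutation achieves this when c does not
-- divide k (p - 1), its order on the copies; the primes c that violate this are few and are
-- discarded.

-- Congruence of integers modulo a fixed integer.

module Congruence where

  open import Data.Integer
  open import Data.Integer.Properties
  open import Data.Integer.Tactic.RingSolver using (solve-∀)
  open import Relation.Binary.PropositionalEquality

  module Modulo (P : ℤ) where

    infix 4 _≈_
    -- The quotient is kept as data: the Lefschetz argument reads an integer matrix off from it. A
    -- record lets `a` and `b` be inferred from the type.
    record _≈_ (a b : ℤ) : Set where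
      constructor congruent
      field
        quotient : ℤ
        equality : a ≡ b + quotient * P

    ≈-reflexive : ∀ {a b} → a ≡ b → a ≈ b
    ≈-reflexive {a} refl = congruent 0ℤ (lem a P)
      where lem : ∀ a P → a ≡ a + 0ℤ * P
            lem = solve-∀

    ≈-refl : ∀ {a} → a ≈ a
    ≈-refl = ≈-reflexive refl

    ≈-sym : ∀ {a b} → a ≈ b → b ≈ a
    ≈-sym {b = b} (congruent k refl) = congruent (- k) (lem b k P)
      where lem : ∀ b k P → b ≡ (b + k * P) + - k * P
            lem = solve-∀

    ≈-trans : ∀ {a b c} → a ≈ b → b ≈ c → a ≈ c
    ≈-trans {c = c} (congruent k refl) (congruent l refl) = congruent (l + k) (lem c k l P)
      where lem : ∀ c k l P → (c + l * P) + k * P ≡ c + (l + k) * P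
            lem = solve-∀

    +-≈ : ∀ {a b c d} → a ≈ b → c ≈ d → a + c ≈ b + d
    +-≈ {b = b} {d = d} (congruent k refl) (congruent l refl) = congruent (k + l) (lem b d k l P)
      where lem : ∀ b d k l P → (b + k * P) + (d + l * P) ≡ (b + d) + (k + l) * P
            lem = solve-∀

    neg-≈ : ∀ {a b} → a ≈ b → - a ≈ - b
    neg-≈ {b = b} (congruent k refl) = congruent (- k) (lem b k P)
      where lem : ∀ b k P → - (b + k * P) ≡ - b + - k * P
            lem = solve-∀

    minus-≈ : ∀ {a b c d} → a ≈ b → c ≈ d → a - c ≈ b - d
    minus-≈ h h' = +-≈ h (neg-≈ h')

    *-≈ˡ : ∀ x {a b} → a ≈ b → x * a ≈ x * b
    *-≈ˡ x {b = b} (congruent k refl) = congruent (x * k) (lem x b k P)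
      where lem : ∀ x b k P → x * (b + k * P) ≡ x * b + (x * k) * P
            lem = solve-∀

    0-≈ : ∀ {a b} → a ≈ 0ℤ → b ≈ 0ℤ → a - b ≈ 0ℤ
    0-≈ h h' = minus-≈ h h'

    ≈0⇒≈ : ∀ {a b} → a - b ≈ 0ℤ → a ≈ b
    ≈0⇒≈ {a} {b} (congruent k e) = congruent (k) (trans (lem a b) (trans (cong (_+ b) e) (lem2 k P b)))
      where lem : ∀ a b → a ≡ (a - b) + b
            lem = solve-∀
            lem2 : ∀ k P b → (0ℤ + k * P) + b ≡ b + k * P
            lem2 = solve-∀

    ≈⇒≈0 : ∀ {a b} → a ≈ b → a - b ≈ 0ℤ
    ≈⇒≈0 {a} {b} h = ≈-trans (minus-≈ h ≈-refl) (≈-reflexive (i≡j⇒i-j≡0 {b} refl))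

-- Normalised simplicial cochains of posets, and acyclicity modulo an integer.

module Cochain where

  open import Data.Integer using (ℤ; 0ℤ; _+_; _-_; _*_; -_)
  open import Data.Integer.Properties hiding (_≟_)
  open import Data.Integer.Tactic.RingSolver using (solve-∀)
  open import Data.List using (List; []; _∷_; map)
  open import Data.List.Relation.Unary.All as All using (All; []; _∷_)
  open import Data.List.Relation.Unary.All.Properties using (map⁺)
  open import Data.List.Relation.Unary.Any using (here; there)
  open import Data.List.Membership.Propositional using (_∈_; _∉_)
  open import Data.List.Relation.Binary.Sublist.Propositional using (_⊆_; []; _∷_; _∷ʳ_; ⊆-refl)
  open import Data.List.Relation.Binary.Sublist.Propositional.Properties using (All-resp-⊆)
  open import Data.Product using (Σ; _,_; _×_; proj₁; proj₂)
  open import Data.Empty using (⊥-elim)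
  open import Function using (_∘_)
  open import Relation.Nullary using (Dec; yes; no)
  open import Relation.Binary.Definitions using (DecidableEquality)
  open import Relation.Binary.PropositionalEquality
  open Congruence

  -- Cochains of all degrees at once: f c is the value on the simplex c, in degree length c - 1;
  -- the empty list makes the complex augmented.
  module Differential {A : Set} where

    Cochain : Set
    Cochain = List A → ℤ

    slice : A → Cochain → Cochain
    slice x f c = f (x ∷ c)

    -- The alternating sum over omitted vertices, by recursion on the first one: omitting it leaves
    -- `c`, and omitting a later vertex is the same operation on the slice, with the sign changed
    -- once. The formula makes sense on all lists, chains or not, and so does `δδ`.
    δ : Cochain → Cochain
    δ f []      = 0ℤ
    δ f (x ∷ c) = f c - δ (slice x f) c

    δ-ext : ∀ {f g} c → (∀ d → d ⊆ c → f d ≡ g d) → δ f c ≡ δ g c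
    δ-ext []      h = refl
    δ-ext (x ∷ c) h = cong₂ _-_ (h c (x ∷ʳ ⊆-refl)) (δ-ext c (λ d i → h (x ∷ d) (refl ∷ i)))

    δ-+ : ∀ f g c → δ (λ d → f d + g d) c ≡ δ f c + δ g c
    δ-+ f g []      = refl
    δ-+ f g (x ∷ c) = trans (cong (λ t → f c + g c - t) (δ-+ (slice x f) (slice x g) c)) (lem (f c) (g c) _ _)
      where lem : ∀ a b u v → a + b - (u + v) ≡ (a - u) + (b - v)
            lem = solve-∀

    δ-neg : ∀ f c → δ (λ d → - f d) c ≡ - δ f c
    δ-neg f []      = refl
    δ-neg f (x ∷ c) = trans (cong (λ t → - f c - t) (δ-neg (slice x f) c)) (lem (f c) _)
      where lem : ∀ a u → - a - (- u) ≡ - (a - u)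
            lem = solve-∀

    δ-minus : ∀ f g c → δ (λ d → f d - g d) c ≡ δ f c - δ g c
    δ-minus f g c = trans (δ-+ f (λ d → - g d) c) (cong (λ t → δ f c + t) (δ-neg g c))

    δ-* : ∀ a f c → δ (λ d → a * f d) c ≡ a * δ f c
    δ-* a f []      = sym (*-zeroʳ a)
    δ-* a f (x ∷ c) = trans (cong (λ t → a * f c - t) (δ-* a (slice x f) c)) (lem a (f c) _)
      where lem : ∀ a b u → a * b - a * u ≡ a * (b - u)
            lem = solve-∀

    δδ : ∀ f c → δ (δ f) c ≡ 0ℤ
    δδ f []      = refl
    δδ f (x ∷ c) = trans (cong (λ t → δ f c - t) (δ-minus f (δ (slice x f)) c))
      (trans (cong (λ t → δ f c - (δ f c - t)) (δδ (slice x f) c)) (lem (δ f c)))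
      where lem : ∀ a → a - (a - 0ℤ) ≡ 0ℤ
            lem = solve-∀

    δ-map : ∀ (r : A → A) f c → δ (f ∘ map r) c ≡ δ f (map r c)
    δ-map r f []      = refl
    δ-map r f (x ∷ c) = cong (λ t → f (map r c) - t) (δ-map r (slice (r x) f) c)

    -- Chains increase only weakly, so vertices may repeat; normalised cochains vanish where
    -- neighbours are equal. A monotone map that identifies vertices can then be applied to chains
    -- without leaving the complex.
    data Deg : List A → Set where
      here  : ∀ {x c} → Deg (x ∷ x ∷ c)
      there : ∀ {x c} → Deg c → Deg (x ∷ c)

    Deg-map : ∀ (r : A → A) {c} → Deg c → Deg (map r c)
    Deg-map r here      = here
    Deg-map r (there d) = there (Deg-map r d)

    -- The prism operator between `r` and the identity: the alternating sum of `f` at the lists r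
    -- x₀, ..., r xᵢ, xᵢ, ..., xₙ.
    homotopy : (A → A) → Cochain → Cochain
    homotopy r f []      = 0ℤ
    homotopy r f (x ∷ c) = f (r x ∷ x ∷ c) - homotopy r (slice (r x) f) c

    homotopy-minus : ∀ r f g c → homotopy r (λ d → f d - g d) c ≡ homotopy r f c - homotopy r g c
    homotopy-minus r f g []      = refl
    homotopy-minus r f g (x ∷ c) =
      trans (cong (λ t → f (r x ∷ x ∷ c) - g (r x ∷ x ∷ c) - t) (homotopy-minus r (slice (r x) f) (slice (r x) g) c))
            (lem (f (r x ∷ x ∷ c)) (g (r x ∷ x ∷ c)) _ _)
      where lem : ∀ a b u v → a - b - (u - v) ≡ (a - u) - (b - v)
            lem = solve-∀

    -- Induction on the list: the terms that begin with r x regroup into the identity for the slice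
    -- at r x, and the rest is the exchange of the first vertex x for r x.
    homotopy-identity : ∀ r f c → δ (homotopy r f) c + homotopy r (δ f) c ≡ f c - f (map r c)
    homotopy-identity r f [] = sym (i≡j⇒i-j≡0 {f []} refl)
    homotopy-identity r f (x ∷ c) =
      trans (cong₂ (λ a b → (homotopy r f c - a) + (δ f (r x ∷ x ∷ c) - b))
              (δ-minus (slice x (slice (r x) f)) (homotopy r (slice (r x) f)) c)
              (homotopy-minus r f (δ (slice (r x) f)) c))
      (trans (lem (homotopy r f c) (δ f′′ c) (δ (homotopy r f′) c) (f (x ∷ c)) (f (r x ∷ c)) (homotopy r (δ f′) c))
      (trans (cong (λ t → f (x ∷ c) - f (r x ∷ c) + t) (homotopy-identity r f′ c))
             (lem2 (f (x ∷ c)) (f (r x ∷ c)) _)))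
      where
      f′ = slice (r x) f
      f′′ = slice x (slice (r x) f)
      lem : ∀ h d e a b k → (h - (d - e)) + ((a - (b - d)) - (h - k)) ≡ a - b + (e + k)
      lem = solve-∀
      lem2 : ∀ a b u → a - b + (b - u) ≡ a - u
      lem2 = solve-∀

  module Acyclicity (A : Set) (_≟_ : DecidableEquality A) (_⊑_ : A → A → Set)
    (⊑-refl : ∀ {x} → x ⊑ x) (⊑-trans : ∀ {x y z} → x ⊑ y → y ⊑ z → x ⊑ z)
    (P : ℤ) where

    open Differential {A} public
    open Modulo P public

    Pred : Set₁
    Pred = A → Set

    -- Every entry is compared with all later ones and not only with the next, so that sublists of
    -- chains are chains without appeal to transitivity.
    data Chain (X : Pred) : List A → Set where
      []  : Chain X []
      _∷_ : ∀ {x c} → X x × All (x ⊑_) c → Chain X c → Chain X (x ∷ c)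

    Chain-⊆ : ∀ {X c d} → d ⊆ c → Chain X c → Chain X d
    Chain-⊆ []          []               = []
    Chain-⊆ (y ∷ʳ i)    (_ ∷ ch)         = Chain-⊆ i ch
    Chain-⊆ (refl ∷ i)  ((x , a) ∷ ch)   = (x , All-resp-⊆ i a) ∷ Chain-⊆ i ch

    Chain-sub : ∀ {X Y : Pred} {c} → (∀ {x} → X x → Y x) → Chain X c → Chain Y c
    Chain-sub s []             = []
    Chain-sub s ((x , a) ∷ ch) = (s x , a) ∷ Chain-sub s ch

    Chain-elements : ∀ {X c} → Chain X c → All X c
    Chain-elements []             = []
    Chain-elements ((x , _) ∷ ch) = x ∷ Chain-elements ch

    Chain-map : ∀ {X Y : Pred} (r : A → A) → (∀ {x} → X x → Y (r x)) →
      (∀ {x y} → X x → X y → x ⊑ y → r x ⊑ r y) → ∀ {c} → Chain X c → Chain Y (map r c)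
    Chain-map r h m [] = []
    Chain-map {X} r h m {x ∷ c} ((X₀ , a) ∷ ch) = (h X₀ , map⁺ (go (Chain-elements ch) a)) ∷ Chain-map r h m ch
      where
      go : ∀ {c} → All X c → All (x ⊑_) c → All (λ y → r x ⊑ r y) c
      go []        []        = []
      go (X₁ ∷ Xs) (x⊑ ∷ xs) = m X₀ X₁ x⊑ ∷ go Xs xs

    Chain-both : ∀ {X Y : Pred} {c} → Chain X c → All Y c → Chain (λ x → X x × Y x) c
    Chain-both []             []       = []
    Chain-both ((x , a) ∷ ch) (y ∷ ys) = ((x , y) , a) ∷ Chain-both ch ys

    δ-≈ : ∀ {f g} c → (∀ d → d ⊆ c → f d ≈ g d) → δ f c ≈ δ g c
    δ-≈ []      h = ≈-refl
    δ-≈ (x ∷ c) h = minus-≈ (h c (x ∷ʳ ⊆-refl)) (δ-≈ c (λ d i → h (x ∷ d) (refl ∷ i)))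

    δ-≈0 : ∀ {f} c → (∀ d → d ⊆ c → f d ≈ 0ℤ) → δ f c ≈ 0ℤ
    δ-≈0 {f} c h = ≈-trans (δ-≈ {g = λ _ → 0ℤ} c h) (≈-reflexive (zero c))
      where zero : ∀ c → δ (λ _ → 0ℤ) c ≡ 0ℤ
            zero []      = refl
            zero (x ∷ c) = cong (λ t → 0ℤ - t) (zero c)

    -- Omitting either of two equal neighbours gives the same list with opposite signs; every other
    -- omission leaves the repetition in place.
    δ-degenerate : ∀ {f} c → (∀ d → d ⊆ c → Deg d → f d ≈ 0ℤ) → Deg c → δ f c ≈ 0ℤ
    δ-degenerate {f} (x ∷ x ∷ c) h here =
      ≈-trans (≈-reflexive (lem (f (x ∷ c)) (δ (slice x (slice x f)) c)))
              (δ-≈0 c (λ d i → h (x ∷ x ∷ d) (refl ∷ refl ∷ i) here))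
      where lem : ∀ a b → a - (a - b) ≡ b
            lem = solve-∀
    δ-degenerate (x ∷ c) h (there dg) =
      0-≈ (h c (x ∷ʳ ⊆-refl) dg) (δ-degenerate c (λ d i e → h (x ∷ d) (refl ∷ i) (there e)) dg)

    Zero : Pred → Cochain → Set
    Zero X f = ∀ c → Chain X c → f c ≈ 0ℤ

    Normal : Pred → Cochain → Set
    Normal X f = ∀ c → Chain X c → Deg c → f c ≈ 0ℤ

    δ-Normal : ∀ {X f} → Normal X f → Normal X (δ f)
    δ-Normal n c ch dg = δ-degenerate c (λ d i → n d (Chain-⊆ i ch)) dg

    -- All degrees are treated together, and the empty list makes the cohomology reduced: there a
    -- cocycle has to vanish modulo `P`, which fails for empty `X` unless `P` is a unit. Off the
    -- chains of `X` cochains are arbitrary.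
    Acyclic : Pred → Set
    Acyclic X = ∀ f → Normal X f → Zero X (δ f) →
      Σ Cochain λ u → Normal X u × (∀ c → Chain X c → f c ≈ δ u c)

    Acyclic-⇔ : ∀ {X Y : Pred} → (∀ {x} → X x → Y x) → (∀ {x} → Y x → X x) → Acyclic X → Acyclic Y
    Acyclic-⇔ to from ac f n z with ac f (λ c ch → n c (Chain-sub to ch)) (λ c ch → z c (Chain-sub to ch))
    ... | u , nu , e = u , (λ c ch → nu c (Chain-sub from ch)) , (λ c ch → e c (Chain-sub from ch))

    Acyclic-point : ∀ {X : Pred} a → X a → (∀ {x} → X x → x ≡ a) → Acyclic X
    Acyclic-point {X} a Xa uniq f n z = u , nu , ok
      where
      u : Cochain
      u []      = f (a ∷ [])
      u (_ ∷ _) = 0ℤ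
      nu : Normal X u
      nu (x ∷ c) ch d = ≈-refl
      ok : ∀ c → Chain X c → f c ≈ δ u c
      ok [] ch = ≈-trans (≈-reflexive (sym (+-identityʳ (f [])))) (z (a ∷ []) ((Xa , []) ∷ []))
      ok (x ∷ []) ((Xx , _) ∷ _) with uniq Xx
      ... | refl = ≈-reflexive (sym (+-identityʳ (f (a ∷ []))))
      ok (x ∷ y ∷ c) ch@((Xx , _) ∷ (Xy , _) ∷ _) with uniq Xx | uniq Xy
      ... | refl | refl = ≈-trans (n _ ch here) (≈-sym (δ-Normal nu _ ch here))

    -- A monotone map below the identity deforms `Y` into `Z`: the prism operator applied to a
    -- cocycle, plus the pullback along `r` of a primitive on `Z`, is a primitive on `Y`.
    module Retraction {Y Z : Pred} (r : A → A) (Z⊆Y : ∀ {x} → Z x → Y x) (rZ : ∀ {x} → Y x → Z (r x))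
      (r⊑ : ∀ {x} → Y x → r x ⊑ x) (r-mono : ∀ {x y} → Y x → Y y → x ⊑ y → r x ⊑ r y) where

      private
        above : A → Pred → Pred
        above b W y = W y × b ⊑ y

        cons-above : ∀ {W : Pred} {b d} → W b → Chain (above b W) d → Chain W (b ∷ d)
        cons-above wb ch = (wb , All.map proj₂ (Chain-elements ch)) ∷ Chain-sub proj₁ ch

        step : ∀ {W : Pred} {x c} → Y x → All Y c → All (x ⊑_) c → All W c → All (above (r x) W) c
        step yx []       []       []       = []
        step yx (y ∷ ys) (a ∷ as) (w ∷ ws) = (w , ⊑-trans (r⊑ yx) a) ∷ step yx ys as ws

        stepʳ : ∀ {W : Pred} {x c} → Y x → All Y c → All (x ⊑_) c → All (W ∘ r) c → All (above (r x) W ∘ r) c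
        stepʳ yx []       []       []       = []
        stepʳ {W} yx (y ∷ ys) (a ∷ as) (w ∷ ws) = (w , r-mono yx y a) ∷ stepʳ {W} yx ys as ws

        prism : ∀ {W : Pred} {x c} → Chain Y (x ∷ c) → All W (x ∷ c) → W (r x) → Chain W (r x ∷ x ∷ c)
        prism ((yx , a) ∷ ch) (w ∷ ws) wr =
          (wr , r⊑ yx ∷ All.map (⊑-trans (r⊑ yx)) a) ∷ Chain-sub proj₂ (Chain-both ((yx , a) ∷ ch) (w ∷ ws))

      -- `W` varies because the recursion passes to the slice at r x, about which something is known
      -- only on the elements of `W` above r x.
      homotopy-Zero : ∀ {W : Pred} {f} c → Chain Y c → All W c → All (W ∘ r) c → Zero W f → homotopy r f c ≈ 0ℤ
      homotopy-Zero [] ch ws wr z = ≈-refl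
      homotopy-Zero {W} (x ∷ c) ch@((yx , a) ∷ ch′) (w ∷ ws) (w′ ∷ wr) z =
        0-≈ (z _ (prism ch (w ∷ ws) w′))
            (homotopy-Zero {above (r x) W} c ch′ (step yx (Chain-elements ch′) a ws) (stepʳ {W} yx (Chain-elements ch′) a wr)
               (λ d chd → z _ (cons-above w′ chd)))

      homotopy-degenerate : ∀ {W : Pred} {f} c → Chain Y c → All W c → All (W ∘ r) c → Normal W f → Deg c → homotopy r f c ≈ 0ℤ
      homotopy-degenerate {W} {f} (x ∷ x ∷ c) ch@((yx , a) ∷ ch₁@((_ , a′) ∷ ch′)) (w ∷ (_ ∷ ws)) (w′ ∷ (_ ∷ wr)) n here =
        0-≈ (n _ (prism ch (w ∷ w ∷ ws) w′) (there here))
        (0-≈ (n _ ((w′ , ⊑-refl ∷ r⊑ yx ∷ All.map (⊑-trans (r⊑ yx)) a′) ∷ prism ch₁ (w ∷ ws) w′) here)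
             (homotopy-Zero {above (r x) W} c ch′ (step yx (Chain-elements ch′) a′ ws) (stepʳ {W} yx (Chain-elements ch′) a′ wr)
               (λ d chd → n _ ((w′ , ⊑-refl ∷ All.map proj₂ (Chain-elements chd)) ∷ cons-above w′ chd) here)))
      homotopy-degenerate {W} (x ∷ c) ch@((yx , a) ∷ ch′) (w ∷ ws) (w′ ∷ wr) n (there dg) =
        0-≈ (n _ (prism ch (w ∷ ws) w′) (there (there dg)))
            (homotopy-degenerate {above (r x) W} c ch′ (step yx (Chain-elements ch′) a ws) (stepʳ {W} yx (Chain-elements ch′) a wr)
               (λ d chd dg′ → n _ (cons-above w′ chd) (there dg′)) dg)

      private
        ranges : ∀ {c} → All Y c → All (Y ∘ r) c
        ranges []       = []
        ranges (y ∷ ys) = Z⊆Y (rZ y) ∷ ranges ys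

      Acyclic-retract : Acyclic Z → Acyclic Y
      Acyclic-retract ac f n z with ac f (λ c ch → n c (Chain-sub Z⊆Y ch)) (λ c ch → z c (Chain-sub Z⊆Y ch))
      ... | u , nu , e = v , nv , ok
        where
        v : Cochain
        v c = homotopy r f c + u (map r c)
        nv : Normal Y v
        nv c ch dg = +-≈ (homotopy-degenerate {Y} {f} c ch (Chain-elements ch) (ranges (Chain-elements ch)) n dg)
                         (nu _ (Chain-map r rZ r-mono ch) (Deg-map r dg))
        ok : ∀ c → Chain Y c → f c ≈ δ v c
        ok c ch = ≈-trans (≈-reflexive (trans (lem (f c) (f (map r c))) (cong (_+ f (map r c)) (sym (homotopy-identity r f c)))))
          (≈-trans (+-≈ (+-≈ (≈-refl {δ (homotopy r f) c}) (homotopy-Zero {Y} {δ f} c ch (Chain-elements ch) (ranges (Chain-elements ch)) z)) (e _ (Chain-map r rZ r-mono ch)))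
          (≈-reflexive (trans (cong₂ _+_ (+-identityʳ (δ (homotopy r f) c)) (sym (δ-map r u c))) (sym (δ-+ (homotopy r f) (u ∘ map r) c)))))
          where lem : ∀ a b → a ≡ (a - b) + b
                lem = solve-∀

    _∈?_ : ∀ (b : A) (c : List A) → Dec (b ∈ c)
    b ∈? []      = no λ ()
    b ∈? (x ∷ c) with b ≟ x | b ∈? c
    ... | yes e | _     = yes (here e)
    ... | no _  | yes i = yes (there i)
    ... | no ne | no ni = no λ { (here e) → ne e ; (there i) → ni i }

    ∉-⊆ : ∀ {b : A} {c d} → d ⊆ c → b ∉ c → b ∉ d
    ∉-⊆ (y ∷ʳ i)   nb j          = ∉-⊆ i (nb ∘ there) j
    ∉-⊆ (refl ∷ i) nb (here e)   = nb (here e)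
    ∉-⊆ (refl ∷ i) nb (there j)  = ∉-⊆ i (nb ∘ there) j

    private
      double-neg : ∀ a → 0ℤ - (- a) ≡ a
      double-neg = solve-∀

    -- For minimal `b` the order complex of `X` is that of `Rest` with a cone attached, whose apex
    -- is `b` and whose base is the complex of `Above`. What follows is the exact sequence of this
    -- pair, made explicit on cochains.
    module Cone {X : Pred} (b : A) (Xb : X b) (b-min : ∀ {x} → X x → x ⊑ b → x ≡ b) where

      Rest Above : Pred
      Rest x = X x × x ≢ b
      Above x = Rest x × b ⊑ x

      toRest : ∀ {c} → Chain X c → b ∉ c → Chain Rest c
      toRest []             nb = []
      toRest ((x , a) ∷ ch) nb = ((x , λ e → nb (here (sym e))) , a) ∷ toRest ch (nb ∘ there)

      module Extension (u : Cochain) where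

        ũ : Cochain
        ũ c with b ∈? c
        ... | yes _ = 0ℤ
        ... | no  _ = u c
        ũ∉ : ∀ {c} → b ∉ c → ũ c ≡ u c
        ũ∉ {c} nb with b ∈? c
        ... | yes i = ⊥-elim (nb i)
        ... | no  _ = refl
        nũ : Normal Rest u → Normal X ũ
        nũ nu c ch dg with b ∈? c
        ... | yes _ = ≈-refl
        ... | no nb = nu c (toRest ch nb) dg

      -- `w` is supported on the chains with `b` in front and not repeated; its minus sign cancels
      -- the one that `δ` gives to the slice at `b`.
      module Apex (ψ : Cochain) where

        w : Cochain
        w [] = 0ℤ
        w (x ∷ c) with b ≟ x | b ∈? c
        ... | yes _ | no _ = - ψ c
        ... | _     | _    = 0ℤ
        wb : ∀ {c} → b ∉ c → w (b ∷ c) ≡ - ψ c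
        wb {c} nb with b ≟ b | b ∈? c
        ... | yes _ | no _  = refl
        ... | yes _ | yes i = ⊥-elim (nb i)
        ... | no ne | _     = ⊥-elim (ne refl)
        w∉ : ∀ {c} → b ∉ c → w c ≡ 0ℤ
        w∉ {[]} nb = refl
        w∉ {x ∷ c} nb with b ≟ x | b ∈? c
        ... | yes e | _     = ⊥-elim (nb (here e))
        ... | no _  | yes _ = refl
        ... | no _  | no _  = refl
        toAbove : ∀ {c} → Chain X c → All (b ⊑_) c → b ∉ c → Chain Above c
        toAbove []             []       nb = []
        toAbove ((x , a) ∷ ch) (p ∷ ps) nb = (((x , λ e → nb (here (sym e))) , p) , a) ∷ toAbove ch ps (nb ∘ there)
        nw : Normal Above ψ → Normal X w
        nw nψ (x ∷ c) ch dg with b ≟ x | b ∈? c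
        nw nψ (x ∷ c) ch dg | yes e | yes _ = ≈-refl
        nw nψ (x ∷ c) ch dg | no _  | yes _ = ≈-refl
        nw nψ (x ∷ c) ch dg | no _  | no _  = ≈-refl
        nw nψ (x ∷ c) (_ ∷ _) here | yes e | no nb = ⊥-elim (nb (here e))
        nw nψ (x ∷ c) ((_ , a) ∷ ch) (there dg) | yes refl | no nb = neg-≈ (nψ c (toAbove ch a nb) dg)
        head-b : ∀ {x c} → Chain X (x ∷ c) → b ∈ c → x ≡ b
        head-b ((x , a) ∷ ch) i = b-min x (All.lookup a i)
        apex-δ : Normal Above ψ → ∀ f₁ → Normal X f₁ → (∀ c → Chain X c → b ∉ c → f₁ c ≈ 0ℤ) →
          (∀ c → Chain Above c → f₁ (b ∷ c) ≈ δ ψ c) → ∀ c → Chain X c → f₁ c ≈ δ w c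
        apex-δ nψ f₁ nf₁ f₁0 eψ [] ch = f₁0 [] ch λ ()
        apex-δ nψ f₁ nf₁ f₁0 eψ (x ∷ c) ch = cases ch (b ∈? (x ∷ c)) (b ∈? c)
          where
          dup : ∀ {y c} → Chain X (y ∷ c) → b ∈ (y ∷ c) → y ≡ b
          dup ch (here e)  = sym e
          dup ch (there k) = head-b ch k
          dg : ∀ {x c} → Chain X (x ∷ c) → b ∈ c → Deg (x ∷ c)
          dg {x} {y ∷ c} ch@(_ ∷ ch′) i = subst₂ (λ s t → Deg (s ∷ t ∷ c)) (sym (head-b ch i)) (sym (dup ch′ i)) here
          cases : ∀ {x c} → Chain X (x ∷ c) → Dec (b ∈ (x ∷ c)) → Dec (b ∈ c) → f₁ (x ∷ c) ≈ δ w (x ∷ c)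
          cases {x} {c} ch (no nb) _ = ≈-trans (f₁0 _ ch nb) (≈-sym (≈-trans (≈-reflexive (δ-ext (x ∷ c) (λ d i → w∉ (∉-⊆ i nb)))) (δ-≈0 {f = λ _ → 0ℤ} (x ∷ c) (λ _ _ → ≈-refl))))
          cases ch (yes _) (yes j) = ≈-trans (nf₁ _ ch (dg ch j)) (≈-sym (δ-Normal (nw nψ) _ ch (dg ch j)))
          cases ch (yes (there i)) (no nb) = ⊥-elim (nb i)
          cases {c = c} ((Xx , a) ∷ ch′) (yes (here refl)) (no nb) =
            ≈-trans (eψ c (toAbove ch′ a nb)) (≈-reflexive (sym (trans (cong₂ _-_ (w∉ nb) (trans (δ-ext c (λ d i → wb (∉-⊆ i nb))) (δ-neg ψ c))) (double-neg (δ ψ c)))))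

      -- Subtracting the coboundary of a primitive on `Rest`, extended by zero, leaves a cocycle
      -- that vanishes on chains avoiding `b`. Its slice at `b` is a cocycle on `Above`, and a
      -- primitive of this slice, placed at the apex, finishes.
      Acyclic-cone : Acyclic Rest → Acyclic Above → Acyclic X
      Acyclic-cone acR acA f n z = (λ c → ũ c + w c) , nuw , ok
        where
        R⊆X : ∀ {c} → Chain Rest c → Chain X c
        R⊆X = Chain-sub proj₁
        hypR = acR f (λ c ch → n c (R⊆X ch)) (λ c ch → z c (R⊆X ch))
        u = proj₁ hypR
        nu = proj₁ (proj₂ hypR)
        eu = proj₂ (proj₂ hypR)
        open Extension u hiding (nũ)
        nũ = Extension.nũ u nu
        f₁ : Cochain
        f₁ c = f c - δ ũ c
        nf₁ : Normal X f₁
        nf₁ c ch dg = 0-≈ (n c ch dg) (δ-Normal nũ c ch dg)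
        zf₁ : Zero X (δ f₁)
        zf₁ c ch = ≈-trans (≈-reflexive (δ-minus f (δ ũ) c)) (0-≈ (z c ch) (≈-reflexive (δδ ũ c)))
        f₁0 : ∀ c → Chain X c → b ∉ c → f₁ c ≈ 0ℤ
        f₁0 c ch nb = ≈⇒≈0 (≈-trans (eu c (toRest ch nb)) (≈-reflexive (δ-ext c (λ d i → sym (ũ∉ (∉-⊆ i nb))))))
        b∉Above : ∀ {c} → Chain Above c → b ∉ c
        b∉Above (((( _ , ne) , _) , _) ∷ ch) (here e)  = ne (sym e)
        b∉Above (_ ∷ ch)                     (there i) = b∉Above ch i
        consb : ∀ {c} → Chain Above c → Chain X (b ∷ c)
        consb ch = (Xb , All.map proj₂ (Chain-elements ch)) ∷ Chain-sub (proj₁ ∘ proj₁) ch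
        φ : Cochain
        φ = slice b f₁
        hypA = acA φ (λ c ch dg → nf₁ _ (consb ch) (there dg))
          (λ c ch → ≈-trans (≈-reflexive (lem (f₁ c) (δ φ c))) (0-≈ (f₁0 c (Chain-sub (proj₁ ∘ proj₁) ch) (b∉Above ch)) (zf₁ _ (consb ch))))
          where lem : ∀ a d → d ≡ a - (a - d)
                lem = solve-∀
        ψ = proj₁ hypA
        nψ = proj₁ (proj₂ hypA)
        eψ = proj₂ (proj₂ hypA)
        open Apex ψ using (w)
        nw = Apex.nw ψ nψ
        ok₁ = Apex.apex-δ ψ nψ f₁ nf₁ f₁0 eψ
        nuw : Normal X (λ c → ũ c + w c)
        nuw c ch dg = +-≈ (nũ c ch dg) (nw c ch dg)
        ok : ∀ c → Chain X c → f c ≈ δ (λ d → ũ d + w d) c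
        ok c ch = ≈-trans (≈-reflexive (lem (f c) (δ ũ c))) (≈-trans (+-≈ (≈-refl {δ ũ c}) (ok₁ c ch)) (≈-reflexive (sym (δ-+ ũ w c))))
          where lem : ∀ a d → a ≡ d + (a - d)
                lem = solve-∀

-- Decision trees that spare a query make the complex acyclic.

module Nonevasive where

  open import Defs using (DecisionTree; leaf; query; eval; depth; bit)
  open import Data.Nat using (ℕ; zero; suc; _+_; _≤_; _<_; _⊔_; z≤n; s≤s; _<?_)
  open import Data.Nat.Properties
  open import Data.Integer using (ℤ)
  open import Data.Bool using (Bool; true; false; if_then_else_)
  import Data.Bool.Properties as Bool
  open import Data.Fin using (Fin; zero; suc)
  import Data.Fin.Properties as Fin
  open import Data.Vec using (Vec; []; _∷_; lookup; _[_]≔_)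
  open import Data.Vec.Properties using (lookup∘update; lookup∘update′; tabulate∘lookup; tabulate-cong; ≡-dec)
  open import Data.Product using (_,_; _×_; ∃)
  open import Data.Empty using (⊥-elim)
  open import Function using (_∘_)
  open import Relation.Nullary using (Dec; yes; no)
  open import Relation.Binary.PropositionalEquality
  open Cochain

  Face : ℕ → Set
  Face m = Vec Bool m

  infix 4 _⊑ᶠ_
  record _⊑ᶠ_ {m} (F G : Face m) : Set where
    constructor sub
    field at : ∀ i → lookup F i ≡ true → lookup G i ≡ true
  open _⊑ᶠ_

  ⊑ᶠ-refl : ∀ {m} {F : Face m} → F ⊑ᶠ F
  ⊑ᶠ-refl = sub λ _ e → e

  ⊑ᶠ-trans : ∀ {m} {F G H : Face m} → F ⊑ᶠ G → G ⊑ᶠ H → F ⊑ᶠ H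
  ⊑ᶠ-trans h k = sub λ i → at k i ∘ at h i

  _≟ᶠ_ : ∀ {m} (F G : Face m) → Dec (F ≡ G)
  _≟ᶠ_ = ≡-dec Bool._≟_

  vec-ext : ∀ {A : Set} {m} {F G : Vec A m} → (∀ i → lookup F i ≡ lookup G i) → F ≡ G
  vec-ext {F = F} {G} h = trans (sym (tabulate∘lookup F)) (trans (tabulate-cong h) (tabulate∘lookup G))

  iff-bool : ∀ {a b : Bool} → (a ≡ true → b ≡ true) → (b ≡ true → a ≡ true) → a ≡ b
  iff-bool {true}  {b}     f g = sym (f refl)
  iff-bool {false} {true}  f g = g refl
  iff-bool {false} {false} f g = refl

  ⊑ᶠ-antisym : ∀ {m} {F G : Face m} → F ⊑ᶠ G → G ⊑ᶠ F → F ≡ G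
  ⊑ᶠ-antisym h k = vec-ext (λ i → iff-bool (at h i) (at k i))

  size : ∀ {m} → Face m → ℕ
  size []      = 0
  size (b ∷ F) = bit b + size F

  bit-mono : ∀ {a b} → (a ≡ true → b ≡ true) → bit a ≤ bit b
  bit-mono {true}  {b} f rewrite f refl = ≤-refl
  bit-mono {false} f = z≤n

  size-mono : ∀ {m} {F G : Face m} → F ⊑ᶠ G → size F ≤ size G
  size-mono {F = []}    {[]}    h = z≤n
  size-mono {F = a ∷ F} {b ∷ G} h = +-mono-≤ (bit-mono (at h zero)) (size-mono {F = F} {G} (sub (at h ∘ suc)))

  size-≡ : ∀ {m} {F G : Face m} → F ⊑ᶠ G → size G ≤ size F → F ≡ G
  size-≡ {F = []} {[]} h le = refl
  size-≡ {F = true ∷ F} {b ∷ G} h le with at h zero refl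
  ... | refl = cong (true ∷_) (size-≡ (sub (at h ∘ suc)) (≤-pred le))
  size-≡ {F = false ∷ F} {true ∷ G} h le = ⊥-elim (<-irrefl refl (≤-trans le (size-mono {F = F} {G} (sub (at h ∘ suc)))))
  size-≡ {F = false ∷ F} {false ∷ G} h le = cong (false ∷_) (size-≡ (sub (at h ∘ suc)) le)

  size-≤ : ∀ {m} (F : Face m) → size F ≤ m
  size-≤ []          = z≤n
  size-≤ (true ∷ F)  = s≤s (size-≤ F)
  size-≤ (false ∷ F) = m≤n⇒m≤1+n (size-≤ F)

  free-vertex : ∀ {m} {S U : Face m} → S ⊑ᶠ U → size S < size U → ∃ λ v → lookup S v ≡ false × lookup U v ≡ true
  free-vertex {S = []} {[]} h ()
  free-vertex {S = true ∷ S} {b ∷ U} h lt with at h zero refl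
  ... | refl with free-vertex {S = S} {U} (sub (at h ∘ suc)) (≤-pred lt)
  ...   | v , p , q = suc v , p , q
  free-vertex {S = false ∷ S} {true ∷ U} h lt = zero , refl , refl
  free-vertex {S = false ∷ S} {false ∷ U} h lt with free-vertex {S = S} {U} (sub (at h ∘ suc)) lt
  ... | v , p , q = suc v , p , q

  size-remove : ∀ {m} (U : Face m) v → lookup U v ≡ true → suc (size (U [ v ]≔ false)) ≡ size U
  size-remove (true ∷ U) zero    refl = refl
  size-remove (b ∷ U)    (suc v) e    = trans (sym (+-suc (bit b) _)) (cong (bit b +_) (size-remove U v e))

  size-add : ∀ {m} (S : Face m) v → lookup S v ≡ false → size (S [ v ]≔ true) ≡ suc (size S)
  size-add (false ∷ S) zero    refl = refl
  size-add (b ∷ S)     (suc v) e    = trans (cong (bit b +_) (size-add S v e)) (+-suc (bit b) _)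

  module _ {m : ℕ} where

    update-⊑ : ∀ {F : Face m} v → F [ v ]≔ false ⊑ᶠ F
    at (update-⊑ {F} v) i e with i Fin.≟ v
    ... | yes refl with trans (sym (lookup∘update v F false)) e
    ...   | ()
    at (update-⊑ {F} v) i e | no ne = trans (sym (lookup∘update′ ne F false)) e

    ⊑-update : ∀ {F : Face m} v → F ⊑ᶠ F [ v ]≔ true
    at (⊑-update {F} v) i e with i Fin.≟ v
    ... | yes refl = lookup∘update v F true
    ... | no ne = trans (lookup∘update′ ne F true) e

    remove-mono : ∀ {F G : Face m} v → F ⊑ᶠ G → F [ v ]≔ false ⊑ᶠ G [ v ]≔ false
    at (remove-mono {F} {G} v h) i e with i Fin.≟ v
    ... | yes refl with trans (sym (lookup∘update v F false)) e
    ...   | ()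
    at (remove-mono {F} {G} v h) i e | no ne = trans (lookup∘update′ ne G false) (at h i (trans (sym (lookup∘update′ ne F false)) e))

    ⊑-remove : ∀ {S F : Face m} v → lookup S v ≡ false → S ⊑ᶠ F → S ⊑ᶠ F [ v ]≔ false
    at (⊑-remove {S} {F} v Sv h) i e with i Fin.≟ v
    ... | yes refl with trans (sym Sv) e
    ...   | ()
    at (⊑-remove {S} {F} v Sv h) i e | no ne = trans (lookup∘update′ ne F false) (at h i e)

    add-⊑ : ∀ {S F : Face m} v → lookup F v ≡ true → S ⊑ᶠ F → S [ v ]≔ true ⊑ᶠ F
    at (add-⊑ {S} {F} v Fv h) i e with i Fin.≟ v
    ... | yes refl = Fv
    ... | no ne = at h i (trans (sym (lookup∘update′ ne S true)) e)

    remove-id : ∀ {F : Face m} v → lookup F v ≡ false → F [ v ]≔ false ≡ F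
    remove-id {F} v Fv = ⊑ᶠ-antisym (update-⊑ v) (⊑-remove v Fv ⊑ᶠ-refl)

    remove-lookup : ∀ {F U : Face m} v → F ⊑ᶠ U [ v ]≔ false → lookup F v ≡ false
    remove-lookup {F} {U} v h with lookup F v in e
    ... | false = refl
    ... | true with trans (sym (lookup∘update v U false)) (at h v e)
    ...   | ()

    add-remove : ∀ {S F : Face m} v → lookup F v ≡ true → F [ v ]≔ false ≡ S → F ≡ S [ v ]≔ true
    add-remove {S} {F} v Fv e = vec-ext go
      where
      go : ∀ i → lookup F i ≡ lookup (S [ v ]≔ true) i
      go i with i Fin.≟ v
      ... | yes refl = trans Fv (sym (lookup∘update v S true))
      ... | no ne = trans (sym (lookup∘update′ ne F false)) (trans (cong (λ T → lookup T i) e) (sym (lookup∘update′ ne S true)))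

  module _ {m : ℕ} (P : Face m → Bool) (P-mono : ∀ {F G} → F ⊑ᶠ G → P G ≡ true → P F ≡ true) (modulus : ℤ) where

    open Acyclicity (Face m) _≟ᶠ_ _⊑ᶠ_ ⊑ᶠ-refl ⊑ᶠ-trans modulus

    -- Excluding `S` itself makes this the poset of nonempty faces of the link of `S` inside `U`;
    -- for empty `S` and full `U` it consists of the nonempty members.
    Interval : Face m → Face m → Pred
    Interval S U F = S ⊑ᶠ F × F ⊑ᶠ U × F ≢ S × P F ≡ true

    module _ (S U : Face m) (S⊑U : S ⊑ᶠ U) (v : Fin m) (Sv : lookup S v ≡ false) (Uv : lookup U v ≡ true) where

      private
        S⁺ = S [ v ]≔ true
        U⁻ = U [ v ]≔ false

        S⁺v : lookup S⁺ v ≡ true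
        S⁺v = lookup∘update v S true

      Acyclic-step-absent : P S⁺ ≡ false → Acyclic (Interval S U⁻) → Acyclic (Interval S U)
      Acyclic-step-absent PS⁺ = Acyclic-⇔ to from
        where
        to : ∀ {F} → Interval S U⁻ F → Interval S U F
        to (a , b , c , d) = a , ⊑ᶠ-trans b (update-⊑ v) , c , d
        from : ∀ {F} → Interval S U F → Interval S U⁻ F
        from {F} (a , b , c , d) with lookup F v in e
        ... | false = a , subst (_⊑ᶠ _) (remove-id v e) (remove-mono v b) , c , d
        ... | true with trans (sym PS⁺) (P-mono (add-⊑ v e a) d)
        ...   | ()

      module _ (PS⁺ : P S⁺ ≡ true) where

        private
          ≢S : ∀ {F} → lookup F v ≡ true → F ≢ S
          ≢S Fv refl with trans (sym Sv) Fv
          ... | ()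

          min : ∀ {F} → Interval S U F → F ⊑ᶠ S⁺ → F ≡ S⁺
          min {F} (a , b , c , d) h with lookup F v in e
          ... | true  = ⊑ᶠ-antisym h (add-⊑ v e a)
          ... | false = ⊥-elim (c (⊑ᶠ-antisym below a))
            where
            below : F ⊑ᶠ S
            at below i x with i Fin.≟ v
            ... | yes refl with trans (sym e) x
            ...   | ()
            at below i x | no ne = trans (sym (lookup∘update′ ne S true)) (at h i x)

          S⁺-in : Interval S U S⁺
          S⁺-in = ⊑-update v , add-⊑ v Uv S⊑U , ≢S S⁺v , PS⁺

        open Cone {Interval S U} S⁺ S⁺-in min

        private
          r : Face m → Face m
          r F = F [ v ]≔ false

          Z⊆Y : ∀ {F} → Interval S U⁻ F → Rest F
          Z⊆Y {F} (a , b , c , d) = (a , ⊑ᶠ-trans b (update-⊑ v) , c , d) , ne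
            where
            ne : F ≢ S⁺
            ne refl with trans (sym (remove-lookup v b)) S⁺v
            ... | ()

          rZ : ∀ {F} → Rest F → Interval S U⁻ (r F)
          rZ {F} ((a , b , c , d) , ne) = ⊑-remove v Sv a , remove-mono v b , nS , P-mono (update-⊑ v) d
            where
            nS : r F ≢ S
            nS e with lookup F v in Fv
            ... | true  = ne (add-remove v Fv e)
            ... | false = c (trans (sym (remove-id v Fv)) e)

          open Retraction {Rest} {Interval S U⁻} r Z⊆Y rZ (λ {F} _ → update-⊑ {F = F} v) (λ {F} {G} _ _ → remove-mono {F = F} {G} v)

          to : ∀ {F} → Interval S⁺ U F → Above F
          to (a , b , c , d) = (((⊑ᶠ-trans (⊑-update v) a) , b , ≢S (at a v S⁺v) , d) , c) , a

          from : ∀ {F} → Above F → Interval S⁺ U F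
          from (((a , b , c , d) , ne) , h) = h , b , ne , d

        -- With `S⁺` as the minimal element, the elements above it form the link of `v`, and the
        -- remaining ones retract onto the deletion of `v` by removing `v`. Setting `S⁺` apart is
        -- essential: removing `v` from it would give the excluded `S`.
        Acyclic-step-present : Acyclic (Interval S U⁻) → Acyclic (Interval S⁺ U) → Acyclic (Interval S U)
        Acyclic-step-present acD acL = Acyclic-cone (Acyclic-retract acD) (Acyclic-⇔ to from acL)

      Acyclic-step : Acyclic (Interval S U⁻) → (P S⁺ ≡ true → Acyclic (Interval S⁺ U)) → Acyclic (Interval S U)
      Acyclic-step acD acL with P S⁺ in e
      ... | true  = Acyclic-step-present e acD (acL refl)
      ... | false = Acyclic-step-absent e acD

    ComputesOn : DecisionTree (Fin m) → Face m → Face m → Set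
    ComputesOn t S U = ∀ F → S ⊑ᶠ F → F ⊑ᶠ U → eval t (lookup F) ≡ P F

    private
      ComputesOn-delete : ∀ {t S U} v → ComputesOn t S U → ComputesOn t S (U [ v ]≔ false)
      ComputesOn-delete {U = U} v ct F a b = ct F a (⊑ᶠ-trans b (update-⊑ v))

      ComputesOn-add : ∀ {t S U} v → ComputesOn t S U → ComputesOn t (S [ v ]≔ true) U
      ComputesOn-add {S = S} v ct F a b = ct F (⊑ᶠ-trans (⊑-update v) a) b

    -- A leaf that leaves vertices undecided makes `P` constant on the interval, and true because it
    -- is true at `S`. The interval is then a full simplex, contracted vertex by vertex; `k` bounds
    -- the number of undecided vertices.
    leaf-acyclic : ∀ b k S U → S ⊑ᶠ U → ComputesOn (leaf b) S U → size S < size U → size U ≤ k + size S →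
      P S ≡ true → Acyclic (Interval S U)
    leaf-acyclic b zero S U h ct lt le PS = ⊥-elim (<-irrefl refl (≤-trans lt le))
    leaf-acyclic b (suc k) S U h ct lt le PS with free-vertex {S = S} {U} h lt | suc (size S) <? size U
    ... | v , Sv , Uv | no nlt = Acyclic-point U U-in uniq
      where
      b≡ : b ≡ true
      b≡ = trans (ct S ⊑ᶠ-refl h) PS
      U-in : Interval S U U
      U-in = h , ⊑ᶠ-refl , (λ { refl → <-irrefl refl lt }) , trans (sym (ct U h ⊑ᶠ-refl)) b≡
      uniq : ∀ {F} → Interval S U F → F ≡ U
      uniq {F} (a , b , c , d) = size-≡ b (≤-trans (≮⇒≥ nlt) (≰⇒> λ sle → c (sym (size-≡ a sle))))
    ... | v , Sv , Uv | yes lt′ = Acyclic-step S U h v Sv Uv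
        (leaf-acyclic b k S (U [ v ]≔ false) (⊑-remove {S = S} {U} v Sv h) (ComputesOn-delete {leaf b} {S} {U} v ct)
          (≤-pred (subst (suc (suc (size S)) ≤_) (sym (size-remove U v Uv)) lt′))
          (≤-pred (subst (_≤ suc (k + size S)) (sym (size-remove U v Uv)) le)) PS)
        (λ PS⁺ → leaf-acyclic b k (S [ v ]≔ true) U (add-⊑ {S = S} {U} v Uv h) (ComputesOn-add {leaf b} {S} {U} v ct)
          (subst (_< size U) (sym (size-add S v Sv)) lt′)
          (≤-trans le (≤-reflexive (trans (sym (+-suc k (size S))) (cong (k +_) (sym (size-add S v Sv)))))) PS⁺)

    -- A query of an undecided vertex splits the interval into its deletion, where the answer is no,
    -- and its link, where it is yes; a query of a decided vertex only selects a branch. The depth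
    -- stays below the number of undecided vertices, so every leaf leaves at least one.
    Acyclic-tree : ∀ t S U → S ⊑ᶠ U → ComputesOn t S U → depth t + size S < size U → P S ≡ true → Acyclic (Interval S U)
    Acyclic-tree (leaf b) S U h ct lt PS = leaf-acyclic b (size U) S U h ct lt (m≤m+n (size U) (size S)) PS
    Acyclic-tree (query v t₀ t₁) S U h ct lt PS = cases (lookup S v) refl (lookup U v) refl
      where
      d₀ : suc (depth t₀) ≤ suc (depth t₀ ⊔ depth t₁)
      d₀ = s≤s (m≤m⊔n _ _)
      d₁ : suc (depth t₁) ≤ suc (depth t₀ ⊔ depth t₁)
      d₁ = s≤s (m≤n⊔m _ _)
      choose : ∀ {F : Face m} {b} → lookup F v ≡ b → eval (if b then t₁ else t₀) (lookup F) ≡ eval (query v t₀ t₁) (lookup F)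
      choose {F} {true}  e rewrite e = refl
      choose {F} {false} e rewrite e = refl
      cases : ∀ a → lookup S v ≡ a → ∀ b → lookup U v ≡ b → Acyclic (Interval S U)
      cases true Sv _ _ = Acyclic-tree t₁ S U h
        (λ F p q → trans (choose {F} (at p v Sv)) (ct F p q)) (≤-trans (s≤s (+-monoˡ-≤ (size S) (<⇒≤ d₁))) lt) PS
      cases false Sv false Uv = Acyclic-tree t₀ S U h
        (λ F p q → trans (choose {F} (absent F q)) (ct F p q)) (≤-trans (s≤s (+-monoˡ-≤ (size S) (<⇒≤ d₀))) lt) PS
        where
        absent : ∀ F → F ⊑ᶠ U → lookup F v ≡ false
        absent F q with lookup F v in e
        ... | false = refl
        ... | true with trans (sym Uv) (at q v e)
        ...   | ()
      cases false Sv true Uv = Acyclic-step S U h v Sv Uv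
        (Acyclic-tree t₀ S (U [ v ]≔ false) (⊑-remove {S = S} {U} v Sv h)
          (λ F p q → trans (choose {F} (remove-lookup {F = F} {U} v q)) (ComputesOn-delete {query v t₀ t₁} {S} {U} v ct F p q))
          (≤-pred (subst (suc (suc (depth t₀ + size S)) ≤_) (sym (size-remove U v Uv)) (≤-trans (s≤s (+-monoˡ-≤ (size S) d₀)) lt))) PS)
        (λ PS⁺ → Acyclic-tree t₁ (S [ v ]≔ true) U (add-⊑ {S = S} {U} v Uv h)
          (λ F p q → trans (choose {F} (at p v (lookup∘update v S true))) (ComputesOn-add {query v t₀ t₁} {S} {U} v ct F p q))
          (≤-trans (s≤s (≤-trans (≤-reflexive (trans (cong (depth t₁ +_) (size-add S v Sv)) (+-suc (depth t₁) (size S)))) (+-monoˡ-≤ (size S) d₁))) lt)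
          PS⁺)

-- Finite sums of integers.

module FiniteSum where

  open import Data.Nat as ℕ using (ℕ; zero; suc)
  import Data.Nat.Properties as ℕ
  open import Data.Integer using (ℤ; +_; 0ℤ; 1ℤ; _+_; _-_; _*_; -_)
  open import Data.Integer.Properties using (+-identityˡ; +-identityʳ; +-assoc; *-zeroʳ; *-distribˡ-+)
  open import Data.Integer.Tactic.RingSolver using (solve-∀)
  open import Relation.Binary.PropositionalEquality
  open Congruence

  ∑ : ℕ → (ℕ → ℤ) → ℤ
  ∑ zero    f = 0ℤ
  ∑ (suc n) f = ∑ n f + f n

  ∑-cong : ∀ n {f g} → (∀ i → i ℕ.< n → f i ≡ g i) → ∑ n f ≡ ∑ n g
  ∑-cong zero    h = refl
  ∑-cong (suc n) h = cong₂ _+_ (∑-cong n (λ i lt → h i (ℕ.m<n⇒m<1+n lt))) (h n ℕ.≤-refl)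

  ∑-zero : ∀ n → ∑ n (λ _ → 0ℤ) ≡ 0ℤ
  ∑-zero zero    = refl
  ∑-zero (suc n) = trans (+-identityʳ _) (∑-zero n)

  ∑-shift : ∀ n f → ∑ (suc n) f ≡ f 0 + ∑ n (λ i → f (suc i))
  ∑-shift zero    f = trans (+-identityˡ (f 0)) (sym (+-identityʳ (f 0)))
  ∑-shift (suc n) f = trans (cong (_+ f (suc n)) (∑-shift n f)) (+-assoc (f 0) (∑ n _) (f (suc n)))

  ∑-+ : ∀ n f g → ∑ n (λ i → f i + g i) ≡ ∑ n f + ∑ n g
  ∑-+ zero    f g = refl
  ∑-+ (suc n) f g = trans (cong (_+ (f n + g n)) (∑-+ n f g)) (lem (∑ n f) (∑ n g) (f n) (g n))
    where lem : ∀ a b c d → a + b + (c + d) ≡ (a + c) + (b + d)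
          lem = solve-∀

  ∑-* : ∀ n a f → ∑ n (λ i → a * f i) ≡ a * ∑ n f
  ∑-* zero    a f = sym (*-zeroʳ a)
  ∑-* (suc n) a f = trans (cong (_+ a * f n) (∑-* n a f)) (sym (*-distribˡ-+ a (∑ n f) (f n)))

  ∑-const : ∀ n a → ∑ n (λ _ → a) ≡ + n * a
  ∑-const zero    a = refl
  ∑-const (suc n) a = trans (cong (_+ a) (∑-const n a)) (lem (+ n) a)
    where lem : ∀ m a → m * a + a ≡ (1ℤ + m) * a
          lem = solve-∀

  ∑-telescope : ∀ n (f : ℕ → ℤ) → ∑ n (λ i → f i - f (suc i)) ≡ f 0 - f n
  ∑-telescope zero    f = lem (f 0)
    where lem : ∀ a → 0ℤ ≡ a - a
          lem = solve-∀
  ∑-telescope (suc n) f = trans (cong (_+ (f n - f (suc n))) (∑-telescope n f)) (lem (f 0) (f n) (f (suc n)))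
    where lem : ∀ a b c → (a - b) + (b - c) ≡ a - c
          lem = solve-∀

  module _ (P : ℤ) where
    open Modulo P

    ∑-≈ : ∀ n {f g} → (∀ i → i ℕ.< n → f i ≈ g i) → ∑ n f ≈ ∑ n g
    ∑-≈ zero    h = ≈-refl
    ∑-≈ (suc n) h = +-≈ (∑-≈ n (λ i lt → h i (ℕ.m<n⇒m<1+n lt))) (h n ℕ.≤-refl)

    ∑-≈0 : ∀ n {f} → (∀ i → i ℕ.< n → f i ≈ 0ℤ) → ∑ n f ≈ 0ℤ
    ∑-≈0 n h = ≈-trans (∑-≈ n h) (≈-reflexive (∑-zero n))

-- Orbits of a map of prime period.

module Orbit where

  open import Data.Nat as ℕ using (ℕ; zero; suc; _⊓_; s≤s; z≤n; _≤_; _<_)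
  import Data.Nat.Properties as ℕ
  open import Data.Nat.Primality using (Prime)
  open import Data.Nat.Coprimality using (prime⇒coprime; coprime-Bézout)
  open import Data.Nat.GCD using (module Bézout)
  open import Data.Integer using (ℤ; +_; 0ℤ; 1ℤ; _+_; _*_)
  open import Data.Integer.Properties using (+-identityˡ; +-identityʳ)
  open import Data.Product using (_,_; _×_; ∃)
  open import Data.Sum using (inj₁; inj₂)
  open import Data.Empty using (⊥-elim)
  open import Relation.Nullary using (¬_; Dec; yes; no)
  open import Relation.Binary.Definitions using (tri<; tri≈; tri>)
  open import Relation.Binary.PropositionalEquality
  open FiniteSum

  indicator : ∀ {X : Set} → Dec X → ℤ
  indicator (yes _) = 1ℤ
  indicator (no _)  = 0ℤ

  indicator-yes : ∀ {X : Set} (d : Dec X) → X → indicator d ≡ 1ℤ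
  indicator-yes (yes _) x = refl
  indicator-yes (no n)  x = ⊥-elim (n x)

  indicator-no : ∀ {X : Set} (d : Dec X) → ¬ X → indicator d ≡ 0ℤ
  indicator-no (yes x) n = ⊥-elim (n x)
  indicator-no (no _)  n = refl

  -- The indices run from 0 to `n` inclusive, which matches the period suc n and makes the range
  -- nonempty.
  minimum : ℕ → (ℕ → ℕ) → ℕ
  minimum zero    e = e 0
  minimum (suc n) e = minimum n e ⊓ e (suc n)

  minimum-shift : ∀ n e → minimum (suc n) e ≡ e 0 ⊓ minimum n (λ i → e (suc i))
  minimum-shift zero    e = refl
  minimum-shift (suc n) e = trans (cong (_⊓ e (suc (suc n))) (minimum-shift n e)) (ℕ.⊓-assoc (e 0) _ _)

  minimum-cong : ∀ n {e e′} → (∀ i → e i ≡ e′ i) → minimum n e ≡ minimum n e′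
  minimum-cong zero    h = h 0
  minimum-cong (suc n) h = cong₂ _⊓_ (minimum-cong n h) (h (suc n))

  minimum-cycle : ∀ n e → e (suc n) ≡ e 0 → minimum n (λ i → e (suc i)) ≡ minimum n e
  minimum-cycle zero e h = h
  minimum-cycle (suc n) e h = trans (cong (minimum n (λ i → e (suc i)) ⊓_) h)
    (trans (ℕ.⊓-comm _ (e 0)) (sym (minimum-shift n e)))

  minimum-≤ : ∀ n e i → i ≤ n → minimum n e ≤ e i
  minimum-≤ zero e .0 z≤n = ℕ.≤-refl
  minimum-≤ (suc n) e i le with i ℕ.≟ suc n
  ... | yes refl = ℕ.m⊓n≤n _ _
  ... | no ne = ℕ.≤-trans (ℕ.m⊓n≤m _ _) (minimum-≤ n e i (ℕ.≤-pred (ℕ.≤∧≢⇒< le ne)))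

  minimum-attained : ∀ n e → ∃ λ i → i ≤ n × minimum n e ≡ e i
  minimum-attained zero e = 0 , z≤n , refl
  minimum-attained (suc n) e with minimum-attained n e | ℕ.⊓-sel (minimum n e) (e (suc n))
  ... | i , le , q | inj₁ s = i , ℕ.m≤n⇒m≤1+n le , trans s q
  ... | i , le , q | inj₂ s = suc n , ℕ.≤-refl , s

  count-minimum : ∀ n e → (∀ i j → i ≤ n → j ≤ n → e i ≡ e j → i ≡ j) →
    ∑ (suc n) (λ i → indicator (e i ℕ.≟ minimum n e)) ≡ 1ℤ
  count-minimum zero e inj = trans (+-identityˡ _) (indicator-yes (e 0 ℕ.≟ e 0) refl)
  count-minimum (suc n) e inj with ℕ.<-cmp (e (suc n)) (minimum n e)
  ... | tri< lt _ _ = trans (cong₂ _+_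
          (trans (∑-cong (suc n) (λ i i< → indicator-no (e i ℕ.≟ _) (λ q → ℕ.<-irrefl (sym q)
            (ℕ.≤-trans (subst (_< minimum n e) (sym eq) lt) (minimum-≤ n e i (ℕ.≤-pred i<)))))) (∑-zero (suc n)))
          (indicator-yes (e (suc n) ℕ.≟ _) (sym eq))) (+-identityˡ 1ℤ)
    where eq : minimum (suc n) e ≡ e (suc n)
          eq = ℕ.m≥n⇒m⊓n≡n (ℕ.<⇒≤ lt)
  ... | tri≈ _ q _ with minimum-attained n e
  ...   | i , le , q′ = ⊥-elim (ℕ.<-irrefl (inj i (suc n) (ℕ.m≤n⇒m≤1+n le) ℕ.≤-refl (sym (trans q q′))) (s≤s le))
  count-minimum (suc n) e inj | tri> _ _ gt = trans (cong₂ _+_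
          (trans (∑-cong (suc n) (λ i _ → cong (λ t → indicator (e i ℕ.≟ t)) eq))
                 (count-minimum n e (λ i j p q → inj i j (ℕ.m≤n⇒m≤1+n p) (ℕ.m≤n⇒m≤1+n q))))
          (indicator-no (e (suc n) ℕ.≟ _) (λ q → ℕ.<-irrefl (trans (sym eq) (sym q)) gt))) (+-identityʳ 1ℤ)
    where eq : minimum (suc n) e ≡ minimum n e
          eq = ℕ.m≤n⇒m⊓n≡m (ℕ.<⇒≤ gt)

  iter : ∀ {B : Set} → (B → B) → ℕ → B → B
  iter g zero    x = x
  iter g (suc i) x = g (iter g i x)

  module _ {B : Set} (g : B → B) where

    iter-suc : ∀ i x → iter g (suc i) x ≡ iter g i (g x)
    iter-suc zero    x = refl
    iter-suc (suc i) x = cong g (iter-suc i x)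

    iter-+ : ∀ i j x → iter g (i ℕ.+ j) x ≡ iter g i (iter g j x)
    iter-+ zero    j x = refl
    iter-+ (suc i) j x = cong g (iter-+ i j x)

    iter-fix : ∀ {x} → g x ≡ x → ∀ i → iter g i x ≡ x
    iter-fix h zero    = refl
    iter-fix h (suc i) = trans (cong g (iter-fix h i)) h

    iter-* : ∀ i {x} → iter g i x ≡ x → ∀ k → iter g (k ℕ.* i) x ≡ x
    iter-* i h zero    = refl
    iter-* i h (suc k) = trans (iter-+ i (k ℕ.* i) _) (trans (cong (iter g i) (iter-* i h k)) h)

    iter-injective : (∀ {x y} → g x ≡ g y → x ≡ y) → ∀ i {x y} → iter g i x ≡ iter g i y → x ≡ y
    iter-injective inj zero    e = e
    iter-injective inj (suc i) e = iter-injective inj i (inj e)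

    periodic⇒injective : ∀ n → (∀ x → iter g (suc n) x ≡ x) → ∀ {x y} → g x ≡ g y → x ≡ y
    periodic⇒injective n per {x} {y} e = trans (sym (trans (sym (iter-suc n x)) (per x)))
      (trans (cong (iter g n) e) (trans (sym (iter-suc n y)) (per y)))

    -- Bézout: some multiple of `i` and some multiple of `p` differ by one, and both iterates fix
    -- `x`.
    prime-period : ∀ {p} → Prime p → ∀ {x} → iter g p x ≡ x → ∀ i → 0 < i → i < p → iter g i x ≡ x → g x ≡ x
    prime-period {p} pp {x} per i 0<i i<p h with coprime-Bézout (prime⇒coprime pp {{ℕ.>-nonZero 0<i}} i<p)
    ... | Bézout.+- a b eq = trans (cong g (sym (iter-* i h b))) (trans (cong (λ t → iter g t x) eq) (iter-* p per a))
    ... | Bézout.-+ a b eq = trans (cong g (sym (iter-* p per a))) (trans (cong (λ t → iter g t x) eq) (iter-* i h b))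

  -- The indicator of one representative, the one with the least code, in each free orbit of a map of prime period.
  module Representative {B : Set} (code : B → ℕ) (code-inj : ∀ {x y} → code x ≡ code y → x ≡ y)
    (g : B → B) (n : ℕ) (pp : Prime (suc n)) (per : ∀ x → iter g (suc n) x ≡ x) where

    least : B → ℕ
    least x = minimum n (λ i → code (iter g i x))

    least-g : ∀ x → least (g x) ≡ least x
    least-g x = trans (minimum-cong n (λ i → cong code (sym (iter-suc g i x))))
      (minimum-cycle n (λ i → code (iter g i x)) (cong code (per x)))

    least-iter : ∀ i x → least (iter g i x) ≡ least x
    least-iter zero    x = refl
    least-iter (suc i) x = trans (least-g (iter g i x)) (least-iter i x)

    weight : B → ℤ
    weight x = indicator (code x ℕ.≟ least x)

    private
      inj : ∀ {x y} → g x ≡ g y → x ≡ y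
      inj = periodic⇒injective g n per

      distinct : ∀ {x} → g x ≢ x → ∀ i j → i < j → j ≤ n → iter g i x ≢ iter g j x
      distinct {x} h i j i<j j≤n e = h (prime-period g pp (per x) (j ℕ.∸ i) (ℕ.m<n⇒0<n∸m i<j)
        (s≤s (ℕ.≤-trans (ℕ.m∸n≤m j i) j≤n))
        (sym (iter-injective g inj i (trans e (trans (cong (λ t → iter g t x) (sym (ℕ.m+[n∸m]≡n (ℕ.<⇒≤ i<j)))) (iter-+ g i (j ℕ.∸ i) x))))))

    weight-sum : ∀ {x} → g x ≢ x → ∑ (suc n) (λ i → weight (iter g i x)) ≡ 1ℤ
    weight-sum {x} h = trans (∑-cong (suc n) (λ i _ → cong (λ t → indicator (code (iter g i x) ℕ.≟ t)) (least-iter i x)))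
      (count-minimum n (λ i → code (iter g i x)) injective)
      where
      injective : ∀ i j → i ≤ n → j ≤ n → code (iter g i x) ≡ code (iter g j x) → i ≡ j
      injective i j i≤ j≤ e with ℕ.<-cmp i j
      ... | tri< lt _ _ = ⊥-elim (distinct h i j lt j≤ (code-inj e))
      ... | tri≈ _ q _  = q
      ... | tri> _ _ gt = ⊥-elim (distinct h j i gt i≤ (sym (code-inj e)))

-- Smith theory for a map of prime order.

module Smith where

  open import Data.Nat as ℕ using (ℕ; zero; suc; s≤s; _≤_; _<_)
  import Data.Nat.Properties as ℕ
  open import Data.Nat.Primality using (Prime)
  open import Data.Integer using (ℤ; +_; 0ℤ; 1ℤ; _+_; _-_; _*_; -_)
  open import Data.Integer.Properties using (+-identityˡ; +-identityʳ; *-zeroʳ; *-identityʳ; i≡j⇒i-j≡0)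
  open import Data.Integer.Tactic.RingSolver using (solve-∀)
  open import Data.List using (List; []; _∷_; map; length)
  open import Data.List.Properties using (length-map; ≡-dec)
  open import Data.List.Relation.Unary.All using ([]; _∷_)
  open import Data.List.Relation.Binary.Sublist.Propositional using (_⊆_; []; _∷_; _∷ʳ_; ⊆-refl)
  open import Data.Product using (Σ; _,_; _×_; proj₁; proj₂)
  open import Data.Sum using (_⊎_; inj₁; inj₂)
  open import Data.Empty using (⊥-elim)
  open import Function using (_∘_)
  open import Relation.Nullary using (¬_; Dec; yes; no)
  open import Relation.Binary.Definitions using (DecidableEquality)
  open import Relation.Binary.PropositionalEquality
  open Congruence
  open Cochain
  open FiniteSum
  open Orbit

  module ListWeight {A : Set} (_≟_ : DecidableEquality A) (code : A → ℕ) (code-inj : ∀ {x y} → code x ≡ code y → x ≡ y)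
    (g : A → A) (n : ℕ) (pp : Prime (suc n)) (per : ∀ x → iter g (suc n) x ≡ x) where

    open Representative code code-inj g n pp per

    γ : List A → List A
    γ = map g

    iter-γ-∷ : ∀ i x c → iter γ i (x ∷ c) ≡ iter g i x ∷ iter γ i c
    iter-γ-∷ zero    x c = refl
    iter-γ-∷ (suc i) x c = cong γ (iter-γ-∷ i x c)

    γ-period : ∀ c → iter γ (suc n) c ≡ c
    γ-period [] = iter-fix γ refl (suc n)
    γ-period (x ∷ c) = trans (iter-γ-∷ (suc n) x c) (cong₂ _∷_ (per x) (γ-period c))

    fixed? : ∀ c → Dec (γ c ≡ c)
    fixed? c = ≡-dec _≟_ (γ c) c

    g-injective : ∀ {x y} → g x ≡ g y → x ≡ y
    g-injective = periodic⇒injective g n per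

    γ-injective : ∀ {c d} → γ c ≡ γ d → c ≡ d
    γ-injective = periodic⇒injective γ n γ-period

    -- A list is fixed exactly when all its entries are, so a free list has a first entry that
    -- moves. The orbit of this entry runs in step with that of the list, whose representative it
    -- can therefore select.
    listWeight : List A → ℤ
    listWeight [] = 0ℤ
    listWeight (x ∷ c) with g x ≟ x
    ... | yes _ = listWeight c
    ... | no _  = weight x

    listWeight-cons-fixed : ∀ {x} c → g x ≡ x → listWeight (x ∷ c) ≡ listWeight c
    listWeight-cons-fixed {x} c h with g x ≟ x
    ... | yes _ = refl
    ... | no ne = ⊥-elim (ne h)

    listWeight-cons-free : ∀ {x} c → g x ≢ x → listWeight (x ∷ c) ≡ weight x
    listWeight-cons-free {x} c h with g x ≟ x
    ... | yes e = ⊥-elim (h e)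
    ... | no _  = refl

    iter-free : ∀ {x} i → g x ≢ x → g (iter g i x) ≢ iter g i x
    iter-free {x} i h e = h (iter-injective g g-injective i (trans (sym (iter-suc g i x)) e))

    iter-γ-free : ∀ {c} i → γ c ≢ c → γ (iter γ i c) ≢ iter γ i c
    iter-γ-free {c} i h e = h (iter-injective γ γ-injective i (trans (sym (iter-suc γ i c)) e))

    tail-fixed : ∀ {x c} → γ (x ∷ c) ≡ x ∷ c → (g x ≡ x) × (γ c ≡ c)
    tail-fixed {x} {c} e = cong (hd x) e , cong tl e
      where
      hd : A → List A → A
      hd d []      = d
      hd d (y ∷ _) = y
      tl : List A → List A
      tl []      = []
      tl (_ ∷ c) = c

    listWeight-fixed : ∀ {c} → γ c ≡ c → listWeight c ≡ 0ℤ
    listWeight-fixed {[]} h = refl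
    listWeight-fixed {x ∷ c} h with tail-fixed {x} {c} h
    ... | hx , hc = trans (listWeight-cons-fixed c hx) (listWeight-fixed hc)

    listWeight-sum : ∀ c → γ c ≢ c → ∑ (suc n) (λ i → listWeight (iter γ i c)) ≡ 1ℤ
    listWeight-sum [] h = ⊥-elim (h refl)
    listWeight-sum (x ∷ c) h with g x ≟ x
    ... | yes e = trans (∑-cong (suc n) (λ i _ → trans (cong listWeight (iter-γ-∷ i x c))
            (listWeight-cons-fixed (iter γ i c) (trans (iter-suc g i x) (cong (iter g i) e)))))
          (listWeight-sum c (λ q → h (cong₂ _∷_ e q)))
    ... | no ne = trans (∑-cong (suc n) (λ i _ → trans (cong listWeight (iter-γ-∷ i x c))
            (listWeight-cons-free (iter γ i c) (iter-free i ne))))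
          (weight-sum ne)

  module SmithTheory (A : Set) (_≟_ : DecidableEquality A) (_⊑_ : A → A → Set)
    (⊑-refl : ∀ {x} → x ⊑ x) (⊑-trans : ∀ {x y z} → x ⊑ y → y ⊑ z → x ⊑ z)
    (code : A → ℕ) (code-inj : ∀ {x y} → code x ≡ code y → x ≡ y)
    (rank : A → ℕ) (height : ℕ) (rank-< : ∀ {x y} → x ⊑ y → x ≢ y → rank x < rank y) (rank-≤ : ∀ x → rank x ≤ height)
    (n : ℕ) (pp : Prime (suc n)) where

    open Acyclicity A _≟_ _⊑_ ⊑-refl ⊑-trans (+ suc n) public

    long-degenerate : ∀ {X x c} → Chain X (x ∷ c) → Deg (x ∷ c) ⊎ (length c ℕ.+ rank x ≤ height)
    long-degenerate {x = x} {[]} ch = inj₂ (rank-≤ x)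
    long-degenerate {x = x} {y ∷ c} ((_ , a ∷ _) ∷ ch) with x ≟ y
    ... | yes refl = inj₁ here
    ... | no ne with long-degenerate ch
    ...   | inj₁ d = inj₁ (there d)
    ...   | inj₂ le = inj₂ (ℕ.≤-trans (ℕ.≤-trans (ℕ.≤-reflexive (sym (ℕ.+-suc (length c) (rank x)))) (ℕ.+-monoʳ-≤ (length c) (rank-< a ne))) le)

    long-Normal : ∀ {X f} → Normal X f → ∀ c → Chain X c → suc height < length c → f c ≈ 0ℤ
    long-Normal nf (x ∷ c) ch lt with long-degenerate ch
    ... | inj₁ d = nf _ ch d
    ... | inj₂ le = ⊥-elim (ℕ.<-irrefl refl (ℕ.≤-trans (ℕ.≤-pred lt) (ℕ.≤-trans (ℕ.m≤m+n (length c) (rank x)) le)))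

    module _ (g : A → A) (per : ∀ x → iter g (suc n) x ≡ x)
      (X : Pred) (g-X : ∀ {x} → X x → X (g x)) (g-mono : ∀ {x y} → x ⊑ y → g x ⊑ g y) where

      open ListWeight _≟_ code code-inj g n pp per

      private

        p : ℕ
        p = suc n

        Fixed : List A → Set
        Fixed c = γ c ≡ c

        γ-Chain : ∀ {c} → Chain X c → Chain X (γ c)
        γ-Chain = Chain-map g g-X (λ _ _ → g-mono)

        iter-Chain : ∀ i {c} → Chain X c → Chain X (iter γ i c)
        iter-Chain zero    ch = ch
        iter-Chain (suc i) ch = γ-Chain (iter-Chain i ch)

        iter-Deg : ∀ i {c} → Deg c → Deg (iter γ i c)
        iter-Deg zero    d = d
        iter-Deg (suc i) d = Deg-map g (iter-Deg i d)

        iter-length : ∀ i c → length (iter γ i c) ≡ length c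
        iter-length zero    c = refl
        iter-length (suc i) c = trans (length-map g (iter γ i c)) (iter-length i c)

        -- Smith's operators 1 + g + ... + g^n, where n + 1 is the prime, and 1 - g. They form one
        -- type because the exact sequence exchanges them from one degree to the next.
        data Op : Set where
          norm diff : Op

        dual : Op → Op
        dual norm = diff
        dual diff = norm

        op : Op → Cochain → Cochain
        op norm f c = ∑ p (λ i → f (iter γ i c))
        op diff f c = f c - f (γ c)

        op-≈ : ∀ o {f h} c → (∀ i → f (iter γ i c) ≈ h (iter γ i c)) → op o f c ≈ op o h c
        op-≈ norm c e = ∑-≈ (+ p) p (λ i _ → e i)
        op-≈ diff c e = minus-≈ (e 0) (e 1)

        op-zero : ∀ o c → op o (λ _ → 0ℤ) c ≡ 0ℤ
        op-zero norm c = ∑-zero p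
        op-zero diff c = refl

        op-≈0 : ∀ o {f} c → (∀ i → f (iter γ i c) ≈ 0ℤ) → op o f c ≈ 0ℤ
        op-≈0 o c e = ≈-trans (op-≈ o c e) (≈-reflexive (op-zero o c))

        op-≈X : ∀ o {f h} → (∀ c → Chain X c → f c ≈ h c) → ∀ c → Chain X c → op o f c ≈ op o h c
        op-≈X o e c ch = op-≈ o c (λ i → e _ (iter-Chain i ch))

        op-minus : ∀ o f h c → op o (λ d → f d - h d) c ≡ op o f c - op o h c
        op-minus norm f h c = trans (∑-+ p (λ i → f (iter γ i c)) (λ i → - h (iter γ i c))) (cong (λ t → op norm f c + t) (neg p))
          where
          lem : ∀ a b → - a + - b ≡ - (a + b)
          lem = solve-∀
          neg : ∀ k → ∑ k (λ i → - h (iter γ i c)) ≡ - ∑ k (λ i → h (iter γ i c))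
          neg zero    = refl
          neg (suc k) = trans (cong (_+ - h (iter γ k c)) (neg k)) (lem (∑ k (λ i → h (iter γ i c))) (h (iter γ k c)))
        op-minus diff f h c = lem (f c) (h c) (f (γ c)) (h (γ c))
          where lem : ∀ a b c d → a - b - (c - d) ≡ a - c - (b - d)
                lem = solve-∀

        -- On a fixed chain the norm is multiplication by p, and the difference is zero outright.
        op-fixed : ∀ o f {c} → Fixed c → op o f c ≈ 0ℤ
        op-fixed norm f {c} h = ≈-trans (≈-reflexive (trans (∑-cong p (λ i _ → cong f (iter-fix γ h i))) (∑-const p (f c))))
          (congruent (f c) (lem (+ p) (f c)))
          where lem : ∀ P a → P * a ≡ 0ℤ + a * P
                lem = solve-∀
        op-fixed diff f {c} h = ≈-reflexive (i≡j⇒i-j≡0 (cong f (sym h)))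

        δ-iter : ∀ i f c → δ (f ∘ iter γ i) c ≡ δ f (iter γ i c)
        δ-iter zero    f c = refl
        δ-iter (suc i) f c = trans (δ-iter i (f ∘ γ) c) (δ-map g f (iter γ i c))

        op-δ : ∀ o f c → op o (δ f) c ≡ δ (op o f) c
        op-δ norm f c = go p
          where
          go : ∀ k → ∑ k (λ i → δ f (iter γ i c)) ≡ δ (λ d → ∑ k (λ i → f (iter γ i d))) c
          go zero    = sym (zeroes c)
            where zeroes : ∀ c → δ (λ _ → 0ℤ) c ≡ 0ℤ
                  zeroes []      = refl
                  zeroes (x ∷ c) = cong (λ t → 0ℤ - t) (zeroes c)
          go (suc k) = trans (cong₂ _+_ (go k) (sym (δ-iter k f c))) (sym (δ-+ _ (f ∘ iter γ k) c))
        op-δ diff f c = sym (trans (δ-minus f (f ∘ γ) c) (cong (λ t → δ f c - t) (δ-map g f c)))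

        op-op : ∀ o f c → op (dual o) (op o f) c ≡ 0ℤ
        op-op norm f c = i≡j⇒i-j≡0 (sym (trans (∑-cong p (λ i _ → cong f (sym (iter-suc γ i c)))) cyc))
          where
          cyc : ∑ p (λ i → f (iter γ (suc i) c)) ≡ ∑ p (λ i → f (iter γ i c))
          cyc = trans (cong (λ t → ∑ n (λ i → f (iter γ (suc i) c)) + f t) (γ-period c))
                (trans (lem (∑ n (λ i → f (iter γ (suc i) c))) (f c)) (sym (∑-shift n (λ i → f (iter γ i c)))))
            where lem : ∀ a b → a + b ≡ b + a
                  lem = solve-∀
        op-op diff f c = trans (∑-telescope p (λ i → f (iter γ i c))) (i≡j⇒i-j≡0 (cong f (sym (γ-period c))))

        -- Preimages under the operators. For the norm the value is concentrated at the
        -- representative of each free orbit; for the difference it is the sum of `f` along the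
        -- orbit from `c` up to the representative.
        kern : Op → Cochain → Cochain
        kern norm f c = listWeight c * f c
        kern diff f c = ∑ p (λ i → listWeight (iter γ i c) * ∑ i (λ j → f (iter γ j c)))

        kern-≈0 : ∀ o {f} c → (∀ i → f (iter γ i c) ≈ 0ℤ) → kern o f c ≈ 0ℤ
        kern-≈0 norm {f} c e = ≈-trans (*-≈ˡ (listWeight c) (e 0)) (≈-reflexive (*-zeroʳ (listWeight c)))
        kern-≈0 diff {f} c e = ∑-≈0 (+ p) p (λ i _ → ≈-trans (*-≈ˡ (listWeight (iter γ i c)) (∑-≈0 (+ p) i (λ j _ → e j)))
          (≈-reflexive (*-zeroʳ (listWeight (iter γ i c)))))

        -- On free orbits the kernel of each operator is the image of the other one.
        kernel : ∀ o f → Zero X (op (dual o) f) → (∀ c → Chain X c → Fixed c → f c ≈ 0ℤ) →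
          ∀ c → Chain X c → op o (kern o f) c ≈ f c
        kernel o f z zf c ch with fixed? c
        kernel o f z zf c ch | yes fx = ≈-trans (op-fixed o (kern o f) fx) (≈-sym (zf c ch fx))
        kernel norm f z zf c ch | no nf =
          ≈-trans (∑-≈ (+ p) p (λ i _ → *-≈ˡ (listWeight (iter γ i c)) (const i)))
          (≈-reflexive (trans (∑-cong p (λ i _ → comm (listWeight (iter γ i c)) (f c)))
            (trans (∑-* p (f c) (λ i → listWeight (iter γ i c))) (trans (cong (λ t → f c * t) (listWeight-sum c nf)) (*-identityʳ (f c))))))
          where
          comm : ∀ a b → a * b ≡ b * a
          comm = solve-∀
          const : ∀ i → f (iter γ i c) ≈ f c
          const zero    = ≈-refl
          const (suc i) = ≈-trans (≈-sym (≈0⇒≈ (z (iter γ i c) (iter-Chain i ch)))) (const i)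
        kernel diff f z zf c ch | no nf =
          ≈-trans (minus-≈ expand₀ expand₁)
          (≈-reflexive (trans (collect (f c) W₁ _ (listWeight c)) (trans (cong (λ t → f c * t) (trans (sym (∑-shift n w)) (listWeight-sum c nf))) (*-identityʳ (f c)))))
          where
          w : ℕ → ℤ
          w i = listWeight (iter γ i c)
          e : ℕ → ℤ
          e i = f (iter γ i c)
          S : ℕ → ℤ
          S i = ∑ i (λ j → e (suc j))
          W₁ = ∑ n (λ i → w (suc i))
          T = ∑ n (λ i → w (suc i) * S i)
          collect : ∀ a W T w → (a * W + T) - (T + w * (- a)) ≡ a * (w + W)
          collect = solve-∀
          -- The telescoping breaks where the orbit closes up; the vanishing norm of `f` supplies
          -- the missing term.
          total : S n ≈ - e 0
          total = ≈-trans (≈-reflexive (lem (e 0) (S n))) (≈-trans (+-≈ (≈-trans (≈-reflexive (sym (∑-shift n e))) (z c ch)) (≈-refl { - e 0})) (≈-reflexive (+-identityˡ (- e 0))))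
            where lem : ∀ a s → s ≡ (a + s) + - a
                  lem = solve-∀
          expand₀ : kern diff f c ≈ e 0 * W₁ + T
          expand₀ = ≈-reflexive (trans (∑-shift n (λ i → w i * ∑ i e))
            (trans (cong₂ _+_ (*-zeroʳ (w 0)) (trans (∑-cong n (λ i _ → trans (cong (λ t → w (suc i) * t) (∑-shift i e)) (lem (w (suc i)) (e 0) (S i))))
               (trans (∑-+ n (λ i → e 0 * w (suc i)) (λ i → w (suc i) * S i)) (cong (_+ T) (∑-* n (e 0) (λ i → w (suc i)))))))
               (+-identityˡ _)))
            where lem : ∀ w a s → w * (a + s) ≡ a * w + w * s
                  lem = solve-∀
          expand₁ : kern diff f (γ c) ≈ T + listWeight c * (- f c)
          expand₁ = ≈-trans (≈-reflexive (∑-cong p (λ i _ → cong₂ (λ a b → listWeight a * b) (sym (iter-suc γ i c)) (∑-cong i (λ j _ → cong f (sym (iter-suc γ j c)))))))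
            (+-≈ (≈-refl {T}) (≈-trans (≈-reflexive (cong (λ t → listWeight t * S n) (γ-period c))) (*-≈ˡ (listWeight c) total)))

      Support : ℕ → Cochain → Set
      Support k f = ∀ c → Chain X c → length c < k → f c ≈ 0ℤ

      private

        mask unmask : Cochain → Cochain
        mask f c with fixed? c
        ... | yes _ = 0ℤ
        ... | no _  = f c
        unmask f c with fixed? c
        ... | yes _ = f c
        ... | no _  = 0ℤ

        mask-fixed : ∀ f {c} → Fixed c → mask f c ≡ 0ℤ
        mask-fixed f {c} h with fixed? c
        ... | yes _ = refl
        ... | no ne = ⊥-elim (ne h)

        mask-free : ∀ f {c} → ¬ Fixed c → mask f c ≡ f c
        mask-free f {c} h with fixed? c
        ... | yes e = ⊥-elim (h e)
        ... | no _  = refl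

        unmask-fixed : ∀ f {c} → Fixed c → unmask f c ≡ f c
        unmask-fixed f {c} h with fixed? c
        ... | yes _ = refl
        ... | no ne = ⊥-elim (ne h)

        unmask-free : ∀ f {c} → ¬ Fixed c → unmask f c ≡ 0ℤ
        unmask-free f {c} h with fixed? c
        ... | yes e = ⊥-elim (h e)
        ... | no _  = refl

        mask-≈0 : ∀ f {c} → f c ≈ 0ℤ → mask f c ≈ 0ℤ
        mask-≈0 f {c} h with fixed? c
        ... | yes _ = ≈-refl
        ... | no _  = h

        op-mask : ∀ o f c → op o (mask f) c ≈ op o f c
        op-mask o f c with fixed? c
        ... | yes fx = ≈-trans (op-fixed o (mask f) fx) (≈-sym (op-fixed o f fx))
        ... | no nf  = op-≈ o c (λ i → ≈-reflexive (mask-free f (iter-γ-free i nf)))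

        op-unmask : ∀ o f c → op o (unmask f) c ≈ 0ℤ
        op-unmask o f c with fixed? c
        ... | yes fx = op-fixed o (unmask f) fx
        ... | no nf  = op-≈0 o c (λ i → ≈-reflexive (unmask-free f (iter-γ-free i nf)))

        Fixed-⊆ : ∀ {c d} → d ⊆ c → Fixed c → Fixed d
        Fixed-⊆ [] h = refl
        Fixed-⊆ (y ∷ʳ i) h = Fixed-⊆ i (proj₂ (tail-fixed h))
        Fixed-⊆ {x ∷ c} (refl ∷ i) h with tail-fixed {x} {c} h
        ... | hx , hc = cong₂ _∷_ hx (Fixed-⊆ i hc)

        δ-support : ∀ k {f} → Support k f → Support (suc k) (δ f)
        δ-support k s [] ch lt = ≈-refl
        δ-support k {f} s (x ∷ c) ch (s≤s lt) = shorter f (x ∷ c) (λ d i le → s d (Chain-⊆ i ch) (ℕ.≤-trans le lt))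
          where
          shorter : ∀ f c → (∀ d → d ⊆ c → length d < length c → f d ≈ 0ℤ) → δ f c ≈ 0ℤ
          shorter f []      h = ≈-refl
          shorter f (x ∷ c) h = 0-≈ (h c (x ∷ʳ ⊆-refl) ℕ.≤-refl) (shorter (slice x f) c (λ d i le → h (x ∷ d) (refl ∷ i) (s≤s le)))

        Solution : Op → Cochain → Set
        Solution o f = Σ Cochain λ u → Normal X u × (∀ c → Chain X c → op o f c ≈ op o (δ u) c) × (∀ c → Chain X c → Fixed c → f c ≈ δ u c)

        -- Exactness of 0 → o C → C → (dual o) C ⊕ C(X^g) → 0, by downward induction on the degree.
        solve : Acyclic X → ∀ j k → suc height < k ℕ.+ j → ∀ o f → Normal X f → Support k f →
          Zero X (op (dual o) (δ f)) → (∀ c → Chain X c → Fixed c → δ f c ≈ 0ℤ) → Solution (dual o) f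
        solve ac zero k lt o f nf sf z zf = (λ _ → 0ℤ) , (λ _ _ _ → ≈-refl) ,
            (λ c ch → ≈-trans (op-≈0 (dual o) c (λ i → small _ (iter-Chain i ch))) (≈-sym (op-≈0 (dual o) c (λ i → zeroes (iter γ i c))))) ,
            (λ c ch _ → ≈-trans (small c ch) (≈-sym (zeroes c)))
          where
          zeroes : ∀ c → δ (λ _ → 0ℤ) c ≈ 0ℤ
          zeroes c = δ-≈0 {f = λ _ → 0ℤ} c (λ _ _ → ≈-refl)
          small : ∀ c → Chain X c → f c ≈ 0ℤ
          small c ch with length c ℕ.<? k
          ... | yes l = sf c ch l
          ... | no nl = long-Normal nf c ch (ℕ.≤-trans (subst (suc height <_) (ℕ.+-identityʳ k) lt) (ℕ.≮⇒≥ nl))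
        solve ac (suc j) k lt o f nf sf z zf = w , nw , okOp , okFix
          where
          h = kern o (δ f)
          hker : ∀ c → Chain X c → op o h c ≈ δ f c
          hker = kernel o (δ f) z zf
          nh : Normal X h
          nh c ch d = kern-≈0 o c (λ i → δ-Normal nf _ (iter-Chain i ch) (iter-Deg i d))
          sh : Support (suc k) h
          sh c ch l = kern-≈0 o c (λ i → δ-support k sf _ (iter-Chain i ch) (subst (_< suc k) (sym (iter-length i c)) l))
          -- Both operators vanish modulo p on fixed chains, so discarding the values there changes
          -- nothing, and it makes the condition on fixed chains in the recursive call trivial.
          h′ = mask h
          dd : ∀ o′ → dual (dual o′) ≡ o′
          dd norm = refl
          dd diff = refl
          zh′ : ∀ c → Chain X c → op o (δ h′) c ≈ 0ℤ
          zh′ c ch = ≈-trans (≈-reflexive (op-δ o h′ c)) (≈-trans (δ-≈ c (λ d i → ≈-trans (op-mask o h d) (hker d (Chain-⊆ i ch)))) (≈-reflexive (δδ f c)))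
          zfh′ : ∀ c → Chain X c → Fixed c → δ h′ c ≈ 0ℤ
          zfh′ c ch fx = δ-≈0 c (λ d i → ≈-reflexive (mask-fixed h (Fixed-⊆ i fx)))
          rec : Solution o h′
          rec = subst (λ q → Solution q h′) (dd o) (solve ac j (suc k) (subst (suc height <_) (ℕ.+-suc k j) lt) (dual o) h′
            (λ c ch d → mask-≈0 h (nh c ch d)) (λ c ch l → mask-≈0 h (sh c ch l))
            (subst (λ q → Zero X (op q (δ h′))) (sym (dd o)) zh′) zfh′)
          v = proj₁ rec
          -- Subtracting `op o v` turns `f` into a cocycle on all of `X`; neither the dual operator
          -- nor the restriction to fixed chains sees the difference.
          f₂ : Cochain
          f₂ c = f c - op o v c
          fin = ac f₂
            (λ c ch d → 0-≈ (nf c ch d) (op-≈0 o c (λ i → proj₁ (proj₂ rec) _ (iter-Chain i ch) (iter-Deg i d))))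
            (λ c ch → ≈-trans (≈-reflexive (δ-minus f (op o v) c)) (≈⇒≈0 (≈-trans (≈-sym (hker c ch))
               (≈-trans (≈-sym (op-mask o h c)) (≈-trans (proj₁ (proj₂ (proj₂ rec)) c ch) (≈-reflexive (op-δ o v c)))))))
          w = proj₁ fin
          nw = proj₁ (proj₂ fin)
          split : ∀ c → f c ≡ f₂ c + op o v c
          split c = lem (f c) (op o v c)
            where lem : ∀ a b → a ≡ (a - b) + b
                  lem = solve-∀
          okOp : ∀ c → Chain X c → op (dual o) f c ≈ op (dual o) (δ w) c
          okOp c ch = ≈-trans (≈-trans (≈-reflexive (lem (op (dual o) f c) (op (dual o) (op o v) c)))
              (≈-trans (+-≈ (≈-reflexive (sym (op-minus (dual o) f (op o v) c))) (≈-reflexive (op-op o v c))) (≈-reflexive (+-identityʳ _))))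
            (op-≈X (dual o) (proj₂ (proj₂ fin)) c ch)
            where lem : ∀ a b → a ≡ (a - b) + b
                  lem = solve-∀
          okFix : ∀ c → Chain X c → Fixed c → f c ≈ δ w c
          okFix c ch fx = ≈-trans (≈-reflexive (split c)) (≈-trans (+-≈ (proj₂ (proj₂ fin) c ch) (op-fixed o v fx)) (≈-reflexive (+-identityʳ _)))

      FixedPart : Pred
      FixedPart x = X x × g x ≡ x

      private
        chain-fixed : ∀ {c} → Chain FixedPart c → Fixed c
        chain-fixed [] = refl
        chain-fixed (((_ , e) , _) ∷ ch) = cong₂ _∷_ e (chain-fixed ch)

      -- Extended by zero, a cocycle on the fixed part is supported on fixed chains, where 1 - g
      -- vanishes, so 1 - g kills its coboundary as well. The primitive that `solve` returns is then
      -- correct on fixed chains.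
      smith : Acyclic X → Acyclic FixedPart
      smith ac f nf zf = u , (λ c ch → proj₁ (proj₂ sol) c (Chain-sub proj₁ ch)) ,
          (λ c ch → ≈-trans (≈-reflexive (sym (unmask-fixed f (chain-fixed ch)))) (proj₂ (proj₂ (proj₂ sol)) c (Chain-sub proj₁ ch) (chain-fixed ch)))
        where
        f′ = unmask f
        toFixed : ∀ {c} → Chain X c → Fixed c → Chain FixedPart c
        toFixed [] h = []
        toFixed {x ∷ c} ((Xx , a) ∷ ch) h with tail-fixed {x} {c} h
        ... | hx , hc = ((Xx , hx) , a) ∷ toFixed ch hc
        nf′ : Normal X f′
        nf′ c ch d with fixed? c
        ... | yes fx = nf c (toFixed ch fx) d
        ... | no _   = ≈-refl
        sol = solve ac (suc (suc height)) 0 ℕ.≤-refl norm f′ nf′ (λ _ _ ())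
          (λ c ch → ≈-trans (≈-reflexive (op-δ diff f′ c)) (δ-≈0 c (λ d _ → op-unmask diff f d)))
          (λ c ch fx → ≈-trans (≈-reflexive (δ-ext c (λ d i → unmask-fixed f (Fixed-⊆ i fx)))) (zf c (toFixed ch fx)))
        u = proj₁ sol

-- Supertraces and contractions modulo p.

module Lefschetz where

  open import Data.Nat as ℕ using (ℕ; zero; suc; s≤s; z≤n; _<_)
  import Data.Nat.Properties as ℕ
  import Data.Nat.Divisibility as ℕ
  open import Data.Nat.Primality using (Prime; prime⇒nonTrivial)
  open import Data.Integer as ℤ using (ℤ; +_; 0ℤ; _+_; _-_; _*_; -_; ∣_∣)
  open import Data.Integer.Properties using (+-identityˡ; +-identityʳ; *-zeroˡ; *-zeroʳ; *-identityʳ; *-identityˡ; *-assoc; *-comm; *-cancelʳ-≡; *-distribˡ-+; *-distribʳ-+; +-assoc; abs-*; ∣i∣≡0⇒i≡0; pos-*)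
  open import Data.Integer.Tactic.RingSolver using (solve-∀)
  open import Data.List using (List; []; _∷_; map; _++_; concatMap; filter)
  open import Data.List.Relation.Unary.All using ([]; _∷_)
  open import Data.List.Relation.Unary.Any using (here; there)
  open import Data.List.Membership.Propositional using (_∈_)
  open import Data.List.Relation.Binary.Sublist.Propositional using ([]; _∷_)
  open import Data.Product using (Σ; _,_)
  open import Data.Empty using (⊥-elim)
  open import Function using (_∘_)
  open import Relation.Nullary using (Dec; yes; no)
  open import Relation.Binary.Definitions using (DecidableEquality)
  open import Relation.Binary.PropositionalEquality
  open Cochain
  open FiniteSum
  open Orbit
  open Smith

  ∑L : ∀ {T : Set} → List T → (T → ℤ) → ℤ
  ∑L []      f = 0ℤ
  ∑L (t ∷ l) f = f t + ∑L l f

  module _ {T : Set} where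

    ∑L-cong : ∀ (l : List T) {f g} → (∀ t → t ∈ l → f t ≡ g t) → ∑L l f ≡ ∑L l g
    ∑L-cong []      h = refl
    ∑L-cong (t ∷ l) h = cong₂ _+_ (h t (here refl)) (∑L-cong l (λ s i → h s (there i)))

    ∑L-zero : ∀ (l : List T) → ∑L l (λ _ → 0ℤ) ≡ 0ℤ
    ∑L-zero []      = refl
    ∑L-zero (t ∷ l) = trans (+-identityˡ _) (∑L-zero l)

    ∑L-+ : ∀ (l : List T) f g → ∑L l (λ t → f t + g t) ≡ ∑L l f + ∑L l g
    ∑L-+ []      f g = refl
    ∑L-+ (t ∷ l) f g = trans (cong (λ s → f t + g t + s) (∑L-+ l f g)) (lem (f t) (g t) (∑L l f) (∑L l g))
      where lem : ∀ a b c d → a + b + (c + d) ≡ (a + c) + (b + d)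
            lem = solve-∀

    ∑L-* : ∀ (l : List T) a f → ∑L l (λ t → a * f t) ≡ a * ∑L l f
    ∑L-* []      a f = sym (*-zeroʳ a)
    ∑L-* (t ∷ l) a f = trans (cong (λ s → a * f t + s) (∑L-* l a f)) (sym (*-distribˡ-+ a (f t) (∑L l f)))

    ∑L-*ʳ : ∀ (l : List T) a f → ∑L l (λ t → f t * a) ≡ ∑L l f * a
    ∑L-*ʳ l a f = trans (∑L-cong l (λ t _ → *-comm (f t) a)) (trans (∑L-* l a f) (*-comm a _))

    ∑L-neg : ∀ (l : List T) f → ∑L l (λ t → - f t) ≡ - ∑L l f
    ∑L-neg []      f = refl
    ∑L-neg (t ∷ l) f = trans (cong (λ s → - f t + s) (∑L-neg l f)) (lem (f t) (∑L l f))
      where lem : ∀ a b → - a + - b ≡ - (a + b)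
            lem = solve-∀

    ∑L-swap : ∀ {S : Set} (l : List T) (k : List S) (f : T → S → ℤ) → ∑L l (λ t → ∑L k (f t)) ≡ ∑L k (λ s → ∑L l (λ t → f t s))
    ∑L-swap []      k f = sym (go k)
      where go : ∀ k → ∑L k (λ s → 0ℤ) ≡ 0ℤ
            go []      = refl
            go (s ∷ k) = trans (+-identityˡ _) (go k)
    ∑L-swap {S} (t ∷ l) k f = trans (cong (λ s → ∑L k (f t) + s) (∑L-swap l k f)) (sym (go k))
      where
      lem : ∀ a b c d → a + b + (c + d) ≡ (a + c) + (b + d)
      lem = solve-∀
      go : ∀ k → ∑L k (λ s → f t s + ∑L l (λ t′ → f t′ s)) ≡ ∑L k (f t) + ∑L k (λ s → ∑L l (λ t′ → f t′ s))
      go []      = refl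
      go (s ∷ k) = trans (cong (λ z → f t s + ∑L l (λ t′ → f t′ s) + z) (go k)) (lem (f t s) _ _ _)

    ∑L-++ : ∀ (l k : List T) f → ∑L (l ++ k) f ≡ ∑L l f + ∑L k f
    ∑L-++ []      k f = sym (+-identityˡ _)
    ∑L-++ (t ∷ l) k f = trans (cong (λ s → f t + s) (∑L-++ l k f)) (sym (+-assoc (f t) _ _))

    ∑L-map : ∀ {S : Set} (h : S → T) l f → ∑L (map h l) f ≡ ∑L l (f ∘ h)
    ∑L-map h []      f = refl
    ∑L-map h (s ∷ l) f = cong (λ z → f (h s) + z) (∑L-map h l f)

    ∑L-concatMap : ∀ {S : Set} (h : S → List T) l f → ∑L (concatMap h l) f ≡ ∑L l (λ s → ∑L (h s) f)
    ∑L-concatMap h []      f = refl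
    ∑L-concatMap h (s ∷ l) f = trans (∑L-++ (h s) (concatMap h l) f) (cong (λ z → ∑L (h s) f + z) (∑L-concatMap h l f))

    ∑L-filter : ∀ {Q : T → Set} (Q? : ∀ t → Dec (Q t)) l f → ∑L (filter Q? l) f ≡ ∑L l (λ t → indicator (Q? t) * f t)
    ∑L-filter Q? []      f = refl
    ∑L-filter Q? (t ∷ l) f with Q? t
    ... | yes _ = cong₂ _+_ (sym (*-identityˡ (f t))) (∑L-filter Q? l f)
    ... | no _  = trans (∑L-filter Q? l f) (sym (trans (cong (_+ ∑L l (λ t → indicator (Q? t) * f t)) (*-zeroˡ (f t))) (+-identityˡ _)))

  ∑L-∑ : ∀ {T : Set} (l : List T) n (f : T → ℕ → ℤ) → ∑L l (λ t → ∑ n (f t)) ≡ ∑ n (λ i → ∑L l (λ t → f t i))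
  ∑L-∑ l zero    f = ∑L-zero l
  ∑L-∑ l (suc n) f = trans (∑L-+ l (λ t → ∑ n (f t)) (λ t → f t n)) (cong (_+ ∑L l (λ t → f t n)) (∑L-∑ l n f))

  -- If `a` were nonzero, the exponent |a| would give a divisor larger than |a|.
  infinitely-divisible : ∀ {p} → Prime p → ∀ a → (∀ j → Σ ℤ λ b → a ≡ b * + (p ℕ.^ j)) → a ≡ 0ℤ
  infinitely-divisible {p} pp a h with ∣ a ∣ in e
  ... | zero = ∣i∣≡0⇒i≡0 e
  ... | suc m with h (suc m)
  ...   | b , q = ⊥-elim (ℕ.<-irrefl refl (ℕ.≤-trans (s≤s (ℕ.∣⇒≤ dvd)) (big (suc m))))
    where
    dvd : p ℕ.^ suc m ℕ.∣ suc m
    dvd = ℕ.divides ∣ b ∣ (trans (sym e) (trans (cong ∣_∣ q) (abs-* b _)))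
    big : ∀ j → j < p ℕ.^ j
    big zero    = s≤s z≤n
    big (suc j) = ℕ.≤-trans (s≤s (big j)) (ℕ.≤-trans (ℕ.+-monoˡ-≤ (p ℕ.^ j) (ℕ.≤-trans (s≤s z≤n) (big j)))
      (ℕ.≤-trans (ℕ.≤-reflexive (cong (p ℕ.^ j ℕ.+_) (sym (ℕ.+-identityʳ _)))) (ℕ.*-monoˡ-≤ (p ℕ.^ j) (ℕ.nonTrivial⇒n>1 p {{prime⇒nonTrivial pp}}))))

  -- If D contracts modulo p, say D h + h D = 1 + p E, then L(Φ) = - p L(Φ E) for the supertrace L of every Φ
  -- commuting with D, and Φ E commutes with D again; so L(Φ) is divisible by every power of p.
  module Supertrace {T : Set} (_≟_ : DecidableEquality T) (I : List T)
    -- Every member of `I` occurs exactly once, in the form in which this is used: the matrix of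
    -- indicators is a unit.
    (delta : ∀ t (f : T → ℤ) → t ∈ I → ∑L I (λ s → indicator (t ≟ s) * f s) ≡ f t)
    {p : ℕ} (pp : Prime p) (D h : T → T → ℤ) (ε : T → ℤ) where

    private
      Matrix : Set
      Matrix = T → T → ℤ

      infixl 7 _·_
      _·_ : Matrix → Matrix → Matrix
      (K · L) a b = ∑L I (λ c → K a c * L c b)

      _≅_ : Matrix → Matrix → Set
      K ≅ L = ∀ a b → a ∈ I → b ∈ I → K a b ≡ L a b

      ·-cong : ∀ {K K′ L L′} → K ≅ K′ → L ≅ L′ → (K · L) ≅ (K′ · L′)
      ·-cong e e′ a b i j = ∑L-cong I (λ c k → cong₂ _*_ (e a c i k) (e′ c b k j))

      ·-assoc : ∀ K L M → ((K · L) · M) ≅ (K · (L · M))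
      ·-assoc K L M a b i j =
        trans (∑L-cong I (λ c _ → sym (∑L-*ʳ I (M c b) (λ d → K a d * L d c))))
        (trans (∑L-swap I I (λ c d → K a d * L d c * M c b))
        (∑L-cong I (λ d _ → trans (∑L-cong I (λ c _ → *-assoc (K a d) (L d c) (M c b))) (∑L-* I (K a d) (λ c → L d c * M c b)))))

      supertrace : Matrix → ℤ
      supertrace K = ∑L I (λ a → ε a * K a a)

    module _
      (DD : ∀ a b → a ∈ I → b ∈ I → ∑L I (λ c → D a c * D c b) ≡ 0ℤ)
      (odd : ∀ a b → a ∈ I → b ∈ I → ε a * D a b ≡ - (D a b * ε b))
      (E : T → T → ℤ)
      (contraction : ∀ a b → a ∈ I → b ∈ I →
        ∑L I (λ c → D a c * h c b) + ∑L I (λ c → h a c * D c b) ≡ indicator (a ≟ b) + E a b * + p) where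

      private
        U : Matrix
        U a b = (D · h) a b + (h · D) a b

        I·ʳ : ∀ (K : Matrix) → (λ a b → ∑L I (λ c → K a c * indicator (c ≟ b))) ≅ K
        I·ʳ K a b i j = trans (∑L-cong I (λ c _ → trans (*-comm (K a c) _) (cong (_* K a c) (flip c)))) (delta b (K a) j)
          where
          flip : ∀ c → indicator (c ≟ b) ≡ indicator (b ≟ c)
          flip c with c ≟ b | b ≟ c
          ... | yes _ | yes _ = refl
          ... | no _  | no _  = refl
          ... | yes e | no n  = ⊥-elim (n (sym e))
          ... | no n  | yes e = ⊥-elim (n (sym e))

        I·ˡ : ∀ (K : Matrix) → (λ a b → ∑L I (λ c → indicator (a ≟ c) * K c b)) ≅ K
        I·ˡ K a b i j = delta a (λ c → K c b) i

        ·-+ˡ : ∀ (K L M : Matrix) a b → ∑L I (λ c → (K a c + L a c) * M c b) ≡ (K · M) a b + (L · M) a b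
        ·-+ˡ K L M a b = trans (∑L-cong I (λ c _ → *-distribʳ-+ (M c b) (K a c) (L a c))) (∑L-+ I _ _)

        ·-+ʳ : ∀ (K L M : Matrix) a b → ∑L I (λ c → K a c * (L c b + M c b)) ≡ (K · L) a b + (K · M) a b
        ·-+ʳ K L M a b = trans (∑L-cong I (λ c _ → *-distribˡ-+ (K a c) (L c b) (M c b))) (∑L-+ I _ _)

        zeroʳ : ∀ (K : Matrix) → (λ a b → ∑L I (λ c → K a c * 0ℤ)) ≅ (λ _ _ → 0ℤ)
        zeroʳ K a b i j = trans (∑L-cong I (λ c _ → *-zeroʳ (K a c))) (∑L-zero I)

        UD : (U · D) ≅ (D · (h · D))
        UD a b i j = trans (·-+ˡ (D · h) (h · D) D a b) (trans (cong₂ _+_ (·-assoc D h D a b i j)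
          (trans (·-assoc h D D a b i j) (trans (·-cong {h} {h} (λ _ _ _ _ → refl) DD a b i j) (zeroʳ h a b i j)))) (+-identityʳ _))

        DU : (D · U) ≅ (D · (h · D))
        DU a b i j = trans (·-+ʳ D (D · h) (h · D) a b) (trans (cong (_+ (D · (h · D)) a b)
          (trans (sym (·-assoc D D h a b i j)) (trans (·-cong {L = h} {h} DD (λ _ _ _ _ → refl) a b i j)
            (trans (∑L-cong I (λ c _ → *-zeroˡ (h c b))) (∑L-zero I))))) (+-identityˡ _))

        pE : Matrix
        pE a b = E a b * + p

        U-split : U ≅ (λ a b → indicator (a ≟ b) + pE a b)
        U-split = contraction

        cancel : ∀ a x y → a + x ≡ a + y → x ≡ y
        cancel a x y e = trans (lem a x) (trans (cong (λ t → - a + t) e) (sym (lem a y)))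
          where lem : ∀ a x → x ≡ - a + (a + x)
                lem = solve-∀

        instance
          p≢0 : ℤ.NonZero (+ p)
          p≢0 = ℕ.>-nonZero (ℕ.<-trans (s≤s z≤n) (ℕ.nonTrivial⇒n>1 p {{prime⇒nonTrivial pp}}))

        -- D h + h D commutes with `D` because `D` squares to zero. Removing the identity leaves p
        -- E, and over ℤ the factor p can be cancelled; this is the reason for integral cochains.
        ED : (E · D) ≅ (D · E)
        ED a b i j = *-cancelʳ-≡ _ _ (+ p) (cancel (D a b) _ _ (trans (sym left) (trans (UD a b i j) (trans (sym (DU a b i j)) right))))
          where
          left : (U · D) a b ≡ D a b + (E · D) a b * + p
          left = trans (·-cong {U} {L = D} U-split (λ _ _ _ _ → refl) a b i j) (trans (·-+ˡ (λ x y → indicator (x ≟ y)) pE D a b)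
            (cong₂ _+_ (I·ˡ D a b i j) (trans (∑L-cong I (λ c _ → swap (E a c) (+ p) (D c b))) (∑L-*ʳ I (+ p) (λ c → E a c * D c b)))))
            where swap : ∀ e p d → e * p * d ≡ e * d * p
                  swap = solve-∀
          right : (D · U) a b ≡ D a b + (D · E) a b * + p
          right = trans (·-cong {D} {L = U} (λ _ _ _ _ → refl) U-split a b i j) (trans (·-+ʳ D (λ x y → indicator (x ≟ y)) pE a b)
            (cong₂ _+_ (I·ʳ D a b i j) (trans (∑L-cong I (λ c _ → sym (*-assoc (D a c) (E c b) (+ p)))) (∑L-*ʳ I (+ p) (λ c → D a c * E c b)))))

        Commutes : Matrix → Set
        Commutes Φ = (Φ · D) ≅ (D · Φ)

        commutes-E : ∀ Φ → Commutes Φ → Commutes (Φ · E)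
        commutes-E Φ c a b i j = trans (·-assoc Φ E D a b i j) (trans (·-cong {Φ} {Φ} (λ _ _ _ _ → refl) ED a b i j)
          (trans (sym (·-assoc Φ D E a b i j)) (trans (·-cong {L = E} {E} c (λ _ _ _ _ → refl) a b i j) (·-assoc D Φ E a b i j))))

        supertrace-cong : ∀ {K L} → K ≅ L → supertrace K ≡ supertrace L
        supertrace-cong e = ∑L-cong I (λ a i → cong (λ t → ε a * t) (e a a i i))

        supertrace-+ : ∀ K L → supertrace (λ a b → K a b + L a b) ≡ supertrace K + supertrace L
        supertrace-+ K L = trans (∑L-cong I (λ a _ → *-distribˡ-+ (ε a) (K a a) (L a a))) (∑L-+ I _ _)

        supertrace-anticommutes : ∀ K → supertrace (K · D) ≡ - supertrace (D · K)
        supertrace-anticommutes K = trans (∑L-cong I (λ a _ → sym (∑L-* I (ε a) (λ b → K a b * D b a))))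
          (trans (∑L-swap I I (λ a b → ε a * (K a b * D b a)))
          (trans (∑L-cong I (λ b j → trans (∑L-cong I (λ a i → trans (shuffle (ε a) (K a b) (D b a)) (trans (cong (_* K a b) (flip a b i j)) (shuffle₂ (ε b) (D b a) (K a b)))))
            (trans (∑L-neg I (λ a → ε b * (D b a * K a b))) (cong -_ (∑L-* I (ε b) (λ a → D b a * K a b))))))
          (∑L-neg I (λ b → ε b * (D · K) b b))))
          where
          shuffle : ∀ e k d → e * (k * d) ≡ (d * e) * k
          shuffle = solve-∀
          shuffle₂ : ∀ e d k → - (e * d) * k ≡ - (e * (d * k))
          shuffle₂ = solve-∀
          flip : ∀ a b → a ∈ I → b ∈ I → D b a * ε a ≡ - (ε b * D b a)
          flip a b i j = trans (lem (D b a * ε a)) (cong -_ (sym (odd b a j i)))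
            where lem : ∀ x → x ≡ - (- x)
                  lem = solve-∀

        -- Commuting `Φ` past `D` turns the two halves into the supertraces of D (Φ h) and (Φ h) D,
        -- which cancel because `D` is odd.
        supertrace-U : ∀ Φ → Commutes Φ → supertrace (Φ · U) ≡ 0ℤ
        supertrace-U Φ c = trans (supertrace-cong (λ a b _ _ → ·-+ʳ Φ (D · h) (h · D) a b)) (trans (supertrace-+ (Φ · (D · h)) (Φ · (h · D)))
          (trans (cong₂ _+_ (supertrace-cong (λ a b i j → trans (sym (·-assoc Φ D h a b i j)) (trans (·-cong {L = h} {h} c (λ _ _ _ _ → refl) a b i j) (·-assoc D Φ h a b i j))))
              (trans (supertrace-cong (λ a b i j → sym (·-assoc Φ h D a b i j))) (supertrace-anticommutes (Φ · h))))
            (lem (supertrace (D · (Φ · h))))))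
          where lem : ∀ x → x + - x ≡ 0ℤ
                lem = solve-∀

        descend : ∀ Φ → Commutes Φ → supertrace Φ ≡ - supertrace (Φ · E) * + p
        descend Φ c = trans (lem (supertrace Φ) (supertrace (Φ · E) * + p)) (trans (cong (_- supertrace (Φ · E) * + p)
          (trans (sym expand) (supertrace-U Φ c))) (lem₂ (supertrace (Φ · E)) (+ p)))
          where
          lem : ∀ a b → a ≡ (a + b) - b
          lem = solve-∀
          lem₂ : ∀ a b → 0ℤ - a * b ≡ - a * b
          lem₂ = solve-∀
          expand : supertrace (Φ · U) ≡ supertrace Φ + supertrace (Φ · E) * + p
          expand = trans (supertrace-cong (λ a b i j → trans (·-cong {Φ} {L = U} (λ _ _ _ _ → refl) U-split a b i j)
              (trans (·-+ʳ Φ (λ x y → indicator (x ≟ y)) pE a b) (cong₂ _+_ (I·ʳ Φ a b i j)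
                (trans (∑L-cong I (λ c _ → sym (*-assoc (Φ a c) (E c b) (+ p)))) (∑L-*ʳ I (+ p) (λ c → Φ a c * E c b)))))))
            (trans (supertrace-+ Φ (λ a b → (Φ · E) a b * + p)) (cong (λ t → supertrace Φ + t)
              (trans (∑L-cong I (λ a _ → sym (*-assoc (ε a) _ (+ p)))) (∑L-*ʳ I (+ p) (λ a → ε a * (Φ · E) a a)))))

        divisible : ∀ j Φ → Commutes Φ → Σ ℤ λ b → supertrace Φ ≡ b * + (p ℕ.^ j)
        divisible zero    Φ c = supertrace Φ , sym (*-identityʳ _)
        divisible (suc j) Φ c with divisible j (Φ · E) (commutes-E Φ c)
        ... | b , e = - b , trans (descend Φ c) (trans (cong (λ t → - t * + p) e)
                (trans (lem b (+ (p ℕ.^ j)) (+ p)) (cong (λ t → - b * t) (sym (pos-* p (p ℕ.^ j))))))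
          where lem : ∀ b x p → - (b * x) * p ≡ - b * (p * x)
                lem = solve-∀

      supertrace-zero : ∀ Φ → (∀ a b → a ∈ I → b ∈ I → ∑L I (λ c → Φ a c * D c b) ≡ ∑L I (λ c → D a c * Φ c b)) →
        ∑L I (λ a → ε a * Φ a a) ≡ 0ℤ
      supertrace-zero Φ c = infinitely-divisible pp _ (λ j → divisible j Φ c)

-- The Lefschetz number of an acyclic poset, and common fixed points.

module FixedPoint where

  open import Data.Nat as ℕ using (ℕ; zero; suc; s≤s; z≤n; _≤_; _<_)
  import Data.Nat.Properties as ℕ
  open import Data.Nat.Primality using (Prime; prime⇒nonTrivial)
  open import Data.Integer using (ℤ; +_; 0ℤ; 1ℤ; _+_; _-_; _*_; -_; ∣_∣)
  open import Data.Integer.Properties using (+-identityˡ; +-identityʳ; *-zeroˡ; *-zeroʳ; *-identityʳ; *-identityˡ; *-assoc; *-comm; abs-*)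
  open import Data.Integer.Tactic.RingSolver using (solve-∀)
  open import Data.List using (List; []; _∷_; map; length; concatMap; filter)
  open import Data.List.Properties using (≡-dec; ∷-injective)
  open import Data.List.Relation.Unary.All as All using (All; []; _∷_)
  open import Data.List.Relation.Unary.Any using (here; there)
  open import Data.List.Membership.Propositional using (_∈_)
  open import Data.List.Membership.Propositional.Properties using (∈-filter⁻)
  open import Data.List.Relation.Binary.Sublist.Propositional using (_⊆_; []; _∷_; _∷ʳ_)
  open import Data.Product using (Σ; _,_; _×_; proj₁; proj₂)
  open import Data.Sum using (_⊎_; inj₁; inj₂)
  open import Data.Empty using (⊥; ⊥-elim)
  open import Function using (_∘_)
  open import Relation.Nullary using (¬_; Dec; yes; no; _×-dec_; ¬?)
  open import Relation.Nullary.Decidable using (map′)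
  open import Relation.Binary.Definitions using (DecidableEquality)
  open import Relation.Binary.PropositionalEquality
  open Congruence
  open Cochain
  open FiniteSum
  open Orbit
  open Smith
  open Lefschetz

  indicator-⇔ : ∀ {X Y : Set} (d : Dec X) (e : Dec Y) → (X → Y) → (Y → X) → indicator d ≡ indicator e
  indicator-⇔ (yes x) e f g = sym (indicator-yes e (f x))
  indicator-⇔ (no nx) e f g = sym (indicator-no e (nx ∘ g))

  module FixedPoints (A : Set) (_≟_ : DecidableEquality A) (_⊑_ : A → A → Set)
    (⊑-refl : ∀ {x} → x ⊑ x) (⊑-trans : ∀ {x y z} → x ⊑ y → y ⊑ z → x ⊑ z) (_⊑?_ : ∀ x y → Dec (x ⊑ y))
    (code : A → ℕ) (code-inj : ∀ {x y} → code x ≡ code y → x ≡ y)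
    (rank : A → ℕ) (height : ℕ) (rank-< : ∀ {x y} → x ⊑ y → x ≢ y → rank x < rank y) (rank-≤ : ∀ x → rank x ≤ height)
    (els : List A) (els-delta : ∀ x (f : A → ℤ) → ∑L els (λ y → indicator (x ≟ y) * f y) ≡ f x)
    (n : ℕ) (pp : Prime (suc n)) where

    open SmithTheory A _≟_ _⊑_ ⊑-refl ⊑-trans code code-inj rank height rank-< rank-≤ n pp public

    _≟ₗ_ : DecidableEquality (List A)
    _≟ₗ_ = ≡-dec _≟_

    lists : ℕ → List (List A)
    lists zero    = [] ∷ []
    lists (suc k) = [] ∷ concatMap (λ x → map (x ∷_) (lists k)) els

    lists-delta : ∀ k c (f : List A → ℤ) → length c ≤ k → ∑L (lists k) (λ d → indicator (c ≟ₗ d) * f d) ≡ f c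
    lists-delta zero [] f le = trans (+-identityʳ _) (*-identityˡ (f []))
    lists-delta (suc k) [] f le = trans (cong₂ _+_ (*-identityˡ (f []))
        (trans (∑L-concatMap (λ x → map (x ∷_) (lists k)) els _) (trans (∑L-cong els (λ x _ →
          trans (∑L-map (x ∷_) (lists k) _) (trans (∑L-cong (lists k) (λ d _ → *-zeroˡ (f (x ∷ d)))) (∑L-zero (lists k))))) (∑L-zero els))))
      (+-identityʳ (f []))
    lists-delta (suc k) (y ∷ c) f (s≤s le) = trans (cong (_+ rest) (*-zeroˡ (f []))) (trans (+-identityˡ rest)
        (trans (∑L-concatMap (λ x → map (x ∷_) (lists k)) els _) (trans (∑L-cong els (λ x _ →
          trans (∑L-map (x ∷_) (lists k) _) (trans (∑L-cong (lists k) (λ d _ → trans (cong (_* f (x ∷ d)) (split x d)) (*-assoc (indicator (y ≟ x)) _ _)))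
            (trans (∑L-* (lists k) (indicator (y ≟ x)) _) (cong (λ t → indicator (y ≟ x) * t) (lists-delta k c (λ d → f (x ∷ d)) le))))))
          (els-delta y (λ x → f (x ∷ c))))))
      where
      rest = ∑L (concatMap (λ x → map (x ∷_) (lists k)) els) (λ d → indicator ((y ∷ c) ≟ₗ d) * f d)
      split : ∀ x d → indicator ((y ∷ c) ≟ₗ (x ∷ d)) ≡ indicator (y ≟ x) * indicator (c ≟ₗ d)
      split x d with y ≟ x | c ≟ₗ d
      ... | yes _ | yes _ = refl
      ... | yes _ | no _  = refl
      ... | no _  | yes _ = refl
      ... | no _  | no _  = refl

    deg? : ∀ c → Dec (Deg c)
    deg? [] = no λ ()
    deg? (x ∷ []) = no λ { (there ()) }
    deg? (x ∷ y ∷ c) with x ≟ y | deg? (y ∷ c)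
    ... | yes refl | _     = yes here
    ... | no _     | yes d = yes (there d)
    ... | no ne    | no nd = no λ { here → ne refl ; (there d) → nd d }

    module _ (X : Pred) (X? : ∀ x → Dec (X x)) where

      chain? : ∀ c → Dec (Chain X c)
      chain? [] = yes []
      chain? (x ∷ c) = map′ (λ { (a , ch) → a ∷ ch }) (λ { (a ∷ ch) → a , ch }) ((X? x ×-dec All.all? (x ⊑?_) c) ×-dec chain? c)

      Strict : List A → Set
      Strict c = Chain X c × ¬ Deg c

      strict? : ∀ c → Dec (Strict c)
      strict? c = chain? c ×-dec ¬? (deg? c)

      strict-length : ∀ {c} → Strict c → length c ≤ suc height
      strict-length {[]} _ = z≤n
      strict-length {x ∷ c} (ch , nd) with long-degenerate ch
      ... | inj₁ d  = ⊥-elim (nd d)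
      ... | inj₂ le = s≤s (ℕ.≤-trans (ℕ.m≤m+n (length c) (rank x)) le)

      -- In a chain, equal entries enclose only equal ones: x ⊑ y ⊑ x with y different from x would
      -- contradict the rank.
      Deg-⊆ : ∀ {c d} → d ⊆ c → Chain X c → Deg d → Deg c
      Deg-⊆ (y ∷ʳ i) (_ ∷ ch) dg = there (Deg-⊆ i ch dg)
      Deg-⊆ (refl ∷ i) (_ ∷ ch) (there dg) = there (Deg-⊆ i ch dg)
      Deg-⊆ {x ∷ c} (refl ∷ i) ((_ , a) ∷ ch) here = repeat c a ch i
        where
        repeat : ∀ c → All (x ⊑_) c → Chain X c → ∀ {d} → (x ∷ d) ⊆ c → Deg (x ∷ c)
        repeat (.x ∷ c) _ _ (refl ∷ i) = here
        repeat (y ∷ c) (x⊑y ∷ a) ((_ , b) ∷ ch) (.y ∷ʳ i) with x ≟ y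
        ... | yes refl = here
        ... | no ne = ⊥-elim (ℕ.<-asym (rank-< x⊑y ne) (rank-< (All.lookup b (first i)) (ne ∘ sym)))
          where
          first : ∀ {d c} → (x ∷ d) ⊆ c → x ∈ c
          first (y ∷ʳ i)   = there (first i)
          first (refl ∷ i) = here refl

      Strict-⊆ : ∀ {c d} → d ⊆ c → Strict c → Strict d
      Strict-⊆ i (ch , nd) = Chain-⊆ i ch , nd ∘ Deg-⊆ i ch

      abstract
        simplices : List (List A)
        simplices = filter strict? (lists (suc height))

        simplices-strict : ∀ {c} → c ∈ simplices → Strict c
        simplices-strict {c} i = proj₂ (∈-filter⁻ strict? {xs = lists (suc height)} i)

        delta : ∀ c (f : List A → ℤ) → Strict c → ∑L simplices (λ d → indicator (c ≟ₗ d) * f d) ≡ f c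
        delta c f sc = trans (∑L-filter strict? (lists (suc height)) (λ d → indicator (c ≟ₗ d) * f d))
          (trans (∑L-cong (lists (suc height)) (λ d _ → move (indicator (strict? d)) (indicator (c ≟ₗ d)) (f d)))
          (trans (lists-delta (suc height) c (λ d → indicator (strict? d) * f d) (strict-length sc))
                 (trans (cong (_* f c) (indicator-yes (strict? c) sc)) (*-identityˡ (f c)))))
          where move : ∀ a b c → a * (b * c) ≡ b * (a * c)
                move = solve-∀

      basis : List A → Cochain
      basis b c = indicator (c ≟ₗ b)

      D : List A → List A → ℤ
      D a b = δ (basis b) a

      δ-∑ : ∀ {T : Set} (l : List T) (a : T → ℤ) (F : T → Cochain) c → δ (λ d → ∑L l (λ t → a t * F t d)) c ≡ ∑L l (λ t → a t * δ (F t) c)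
      δ-∑ [] a F c = zeroes c
        where zeroes : ∀ c → δ (λ _ → 0ℤ) c ≡ 0ℤ
              zeroes []      = refl
              zeroes (x ∷ c) = cong (λ t → 0ℤ - t) (zeroes c)
      δ-∑ (t ∷ l) a F c = trans (δ-+ (λ d → a t * F t d) _ c) (cong₂ _+_ (δ-* (a t) (F t) c) (δ-∑ l a F c))

      δ-matrix : ∀ f c → Strict c → ∑L simplices (λ b → D c b * f b) ≡ δ f c
      δ-matrix f c sc = sym (trans (δ-ext c (λ d i → trans (sym (delta d f (Strict-⊆ i sc))) (∑L-cong simplices (λ b _ → *-comm _ (f b)))))
        (trans (δ-∑ simplices f basis c) (∑L-cong simplices (λ b _ → *-comm (f b) _))))

      sign : List A → ℤ
      sign []      = 1ℤ
      sign (_ ∷ c) = - sign c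

      δ-sign : ∀ f c → δ (λ d → sign d * f d) c ≡ - (sign c * δ f c)
      δ-sign f [] = refl
      δ-sign f (x ∷ c) = trans (cong (λ t → sign c * f c - t) (trans (δ-ext c (λ d _ → lem (sign d) (f (x ∷ d)))) (δ-neg _ c)))
        (trans (cong (λ t → sign c * f c - - t) (δ-sign (slice x f) c)) (lem₂ (sign c) (f c) (δ (slice x f) c)))
        where
        lem : ∀ s y → - s * y ≡ - (s * y)
        lem = solve-∀
        lem₂ : ∀ s y z → s * y - - - (s * z) ≡ - (- s * (y - z))
        lem₂ = solve-∀

      D-odd : ∀ a b → sign a * D a b ≡ - (D a b * sign b)
      D-odd a b = trans (lem (sign a * D a b)) (cong -_ (trans (sym (δ-sign (basis b) a))
        (trans (δ-ext a (λ d _ → swap d)) (trans (δ-* (sign b) (basis b) a) (*-comm (sign b) _)))))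
        where
        lem : ∀ x → x ≡ - - x
        lem = solve-∀
        swap : ∀ d → sign d * basis b d ≡ sign b * basis b d
        swap d with d ≟ₗ b
        ... | yes refl = refl
        ... | no _ = trans (*-zeroʳ (sign d)) (sym (*-zeroʳ (sign b)))

      D-length : ∀ a b → length a ≢ suc (length b) → D a b ≡ 0ℤ
      D-length a b ne = go (basis b) a (λ d q → indicator-no (d ≟ₗ b) λ { refl → ne (sym q) })
        where
        go : ∀ f a → (∀ d → suc (length d) ≡ length a → f d ≡ 0ℤ) → δ f a ≡ 0ℤ
        go f []      h = refl
        go f (x ∷ a) h = cong₂ _-_ (h a refl) (go (slice x f) a (λ d q → h (x ∷ d) (cong suc q)))

      combine : (List A → Cochain) → Cochain → Cochain
      combine H f a = ∑L simplices (λ b → H b a * f b)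

      -- The column of index `c` in the equation D h + h D ≡ 1, for the matrix `h` whose columns are
      -- the cochains `H c`.
      Solves : (List A → Cochain) → List A → Set
      Solves H c = ∀ a → Chain X a → δ (H c) a ≈ basis c a - combine H (δ (basis c)) a

      basis-normal : ∀ {c a} → ¬ Deg c → Deg a → basis c a ≡ 0ℤ
      basis-normal {c} {a} nd d = indicator-no (a ≟ₗ c) λ { refl → nd d }

      combine-normal : ∀ H f → (∀ c → Normal X (H c)) → Normal X (combine H f)
      combine-normal H f nH a ch d = go simplices
        where
        go : ∀ l → ∑L l (λ b → H b a * f b) ≈ 0ℤ
        go []      = ≈-refl
        go (b ∷ l) = +-≈ (≈-trans (≈-reflexive (*-comm (H b a) (f b))) (≈-trans (*-≈ˡ (f b) (nH b a ch d)) (≈-reflexive (*-zeroʳ (f b))))) (go l)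

      combine-cong : ∀ {H H′ f} a → (∀ b → f b ≡ 0ℤ ⊎ H b a ≡ H′ b a) → combine H f a ≡ combine H′ f a
      combine-cong {H} {H′} {f} a h = ∑L-cong simplices (λ b _ → go b (h b))
        where
        go : ∀ b → f b ≡ 0ℤ ⊎ H b a ≡ H′ b a → H b a * f b ≡ H′ b a * f b
        go b (inj₁ z) = trans (cong (λ t → H b a * t) z) (trans (*-zeroʳ (H b a)) (sym (trans (cong (λ t → H′ b a * t) z) (*-zeroʳ (H′ b a)))))
        go b (inj₂ e) = cong (_* f b) e

      δ-basis-length : ∀ c b → δ (basis c) b ≡ 0ℤ ⊎ length b ≡ suc (length c)
      δ-basis-length c b with length b ℕ.≟ suc (length c)
      ... | yes e = inj₂ e
      ... | no ne = inj₁ (D-length b c ne)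

      -- The usual step in building a contraction: once the equations for the chains one vertex
      -- longer are inserted, what remains of the coboundary of the defect contains `δδ` of a basis
      -- cochain.
      defect-cocycle : ∀ H c → Strict c → (∀ b → Strict b → length b ≡ suc (length c) → Solves H b) →
        Zero X (δ (λ a → basis c a - combine H (δ (basis c)) a))
      defect-cocycle H c sc sol a ch =
        ≈-trans (≈-reflexive (trans (δ-minus (basis c) (combine H (δ (basis c))) a) (cong (λ t → δ (basis c) a - t) expand)))
        (≈-trans (minus-≈ (≈-refl {δ (basis c) a}) (substitute simplices (λ b i → simplices-strict i)))
        (≈-trans (≈-reflexive (cong (λ t → δ (basis c) a - t) collect)) (≈⇒≈0 (reproduce (deg? a)))))
        where
        e = δ (basis c)
        expand : δ (combine H e) a ≡ ∑L simplices (λ b → e b * δ (H b) a)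
        expand = trans (δ-ext a (λ d _ → ∑L-cong simplices (λ b _ → *-comm (H b d) (e b)))) (δ-∑ simplices e H a)
        substitute : ∀ l → (∀ b → b ∈ l → Strict b) → ∑L l (λ b → e b * δ (H b) a) ≈ ∑L l (λ b → e b * (basis b a - combine H (δ (basis b)) a))
        substitute [] h = ≈-refl
        substitute (b ∷ l) h = +-≈ (term (δ-basis-length c b)) (substitute l (λ b i → h b (there i)))
          where
          term : e b ≡ 0ℤ ⊎ length b ≡ suc (length c) → e b * δ (H b) a ≈ e b * (basis b a - combine H (δ (basis b)) a)
          term (inj₁ z) = ≈-reflexive (trans (cong (_* δ (H b) a) z) (sym (cong (_* (basis b a - combine H (δ (basis b)) a)) z)))
          term (inj₂ q) = *-≈ˡ (e b) (sol b (h b (here refl)) q a ch)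
        double : ∑L simplices (λ b → e b * combine H (δ (basis b)) a) ≡ 0ℤ
        double = trans (∑L-cong simplices (λ b _ → sym (∑L-* simplices (e b) (λ d → H d a * D d b))))
          (trans (∑L-swap simplices simplices (λ b d → e b * (H d a * D d b)))
          (trans (∑L-cong simplices (λ d i → trans (∑L-cong simplices (λ b _ → lem (e b) (H d a) (D d b)))
            (trans (∑L-* simplices (H d a) (λ b → D d b * e b)) (trans (cong (λ t → H d a * t) (trans (δ-matrix e d (simplices-strict i)) (δδ (basis c) d))) (*-zeroʳ (H d a))))))
          (∑L-zero simplices)))
          where lem : ∀ x y z → x * (y * z) ≡ y * (z * x)
                lem = solve-∀
        collect : ∑L simplices (λ b → e b * (basis b a - combine H (δ (basis b)) a)) ≡ ∑L simplices (λ b → e b * basis b a)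
        collect = trans (∑L-cong simplices (λ b _ → lem (e b) (basis b a) (combine H (δ (basis b)) a)))
          (trans (∑L-+ simplices (λ b → e b * basis b a) (λ b → - (e b * combine H (δ (basis b)) a)))
          (trans (cong (λ t → ∑L simplices (λ b → e b * basis b a) + t) (trans (∑L-neg simplices _) (cong -_ double))) (+-identityʳ _)))
          where lem : ∀ x y z → x * (y - z) ≡ x * y + - (x * z)
                lem = solve-∀
        reproduce : Dec (Deg a) → e a ≈ ∑L simplices (λ b → e b * basis b a)
        reproduce (no nd) = ≈-reflexive (sym (trans (∑L-cong simplices (λ b _ → *-comm (e b) _)) (delta a e (ch , nd))))
        reproduce (yes d) = ≈-trans (δ-degenerate a (λ d _ dg → ≈-reflexive (basis-normal (proj₂ sc) dg)) d)
          (≈-reflexive (sym (trans (∑L-cong simplices (λ b i → trans (cong (λ t → e b * t) (basis-normal (proj₂ (simplices-strict i)) d)) (*-zeroʳ (e b)))) (∑L-zero simplices))))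

      module _ (ac : Acyclic X) where

        private
          -- Columns are found in order of decreasing length, as the equation for `c` involves the
          -- columns of chains one longer. A column once found is kept, so that equations already
          -- solved remain valid.
          Level : ℕ → Set
          Level j = Σ (List A → Cochain) λ H → (∀ c → Normal X (H c)) × (∀ c → Strict c → suc (suc height) ≤ length c ℕ.+ j → Solves H c)

          raise : ∀ j → Level j → Level (suc j)
          raise j (H , nH , sH) = (λ c → new c (old? c) (strict? c)) , (λ c → normal c (old? c) (strict? c)) , solves
            where
            K = suc (suc height)
            old? : ∀ c → Dec (K ≤ length c ℕ.+ j)
            old? c = K ℕ.≤? (length c ℕ.+ j)
            longer : ∀ {b c} → length b ≡ suc (length c) → K ≤ length c ℕ.+ suc j → K ≤ length b ℕ.+ j
            longer {b} {c} q le = ℕ.≤-trans le (ℕ.≤-reflexive (trans (ℕ.+-suc (length c) j) (cong (ℕ._+ j) (sym q))))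
            defect : List A → Cochain
            defect c a = basis c a - combine H (δ (basis c)) a
            sol : ∀ c → Strict c → K ≤ length c ℕ.+ suc j → Σ Cochain λ u → Normal X u × (∀ a → Chain X a → defect c a ≈ δ u a)
            sol c sc le = ac (defect c) (λ a ch d → 0-≈ (≈-reflexive (basis-normal (proj₂ sc) d)) (combine-normal H (δ (basis c)) nH a ch d))
              (defect-cocycle H c sc (λ b sb q → sH b sb (longer {b} {c} q le)))
            try : ∀ c → Strict c → Dec (K ≤ length c ℕ.+ suc j) → Cochain
            try c sc (yes le) = proj₁ (sol c sc le)
            try c sc (no _)   = H c
            new : ∀ c → Dec (K ≤ length c ℕ.+ j) → Dec (Strict c) → Cochain
            new c (yes _) _        = H c
            new c (no _)  (yes sc) = try c sc (K ℕ.≤? (length c ℕ.+ suc j))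
            new c (no _)  (no _)   = H c
            normal : ∀ c o s → Normal X (new c o s)
            normal c (yes _) _ = nH c
            normal c (no _) (yes sc) with K ℕ.≤? (length c ℕ.+ suc j)
            ... | yes le = proj₁ (proj₂ (sol c sc le))
            ... | no _   = nH c
            normal c (no _) (no _) = nH c
            H′ : List A → Cochain
            H′ c = new c (old? c) (strict? c)
            agree : ∀ b → K ≤ length b ℕ.+ j → ∀ a → H b a ≡ H′ b a
            agree b le a with old? b
            ... | yes _ = refl
            ... | no n  = ⊥-elim (n le)
            same : ∀ c a → K ≤ length c ℕ.+ suc j → combine H (δ (basis c)) a ≡ combine H′ (δ (basis c)) a
            same c a le = combine-cong {H} {H′} {δ (basis c)} a (λ b → pick b (δ-basis-length c b))
              where
              pick : ∀ b → δ (basis c) b ≡ 0ℤ ⊎ length b ≡ suc (length c) → δ (basis c) b ≡ 0ℤ ⊎ H b a ≡ H′ b a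
              pick b (inj₁ z) = inj₁ z
              pick b (inj₂ q) = inj₂ (agree b (longer {b} {c} q le) a)
            solves′ : ∀ c o s → Strict c → K ≤ length c ℕ.+ suc j → ∀ a → Chain X a → δ (new c o s) a ≈ basis c a - combine H (δ (basis c)) a
            solves′ c (yes le) s sc _ a ch = sH c sc le a ch
            solves′ c (no _) (no ns) sc _ a ch = ⊥-elim (ns sc)
            solves′ c (no _) (yes sc) _ le a ch with K ℕ.≤? (length c ℕ.+ suc j)
            ... | yes le′ = ≈-sym (proj₂ (proj₂ (sol c sc le′)) a ch)
            ... | no n    = ⊥-elim (n le)
            solves : ∀ c → Strict c → K ≤ length c ℕ.+ suc j → Solves H′ c
            solves c sc le a ch = ≈-trans (solves′ c (old? c) (strict? c) sc le a ch) (≈-reflexive (cong (λ t → basis c a - t) (same c a le)))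

          level : ∀ j → Level j
          level zero = (λ _ _ → 0ℤ) , (λ _ _ _ _ → ≈-refl) , λ c sc le →
            ⊥-elim (ℕ.<-irrefl refl (ℕ.≤-trans le (subst (_≤ suc height) (sym (ℕ.+-identityʳ (length c))) (strict-length sc))))
          level (suc j) = raise j (level j)

          top : Level (suc (suc height))
          top = level (suc (suc height))

          H = proj₁ top

        module _ (g : A → A) (N : ℕ) (per : ∀ x → iter g (suc N) x ≡ x)
          (g-X : ∀ {x} → X x → X (g x)) (g-mono : ∀ {x y} → x ⊑ y → g x ⊑ g y) where

          private
            γ = map g

            iter-γ : ∀ i c → iter γ i c ≡ map (iter g i) c
            iter-γ i [] = iter-fix γ refl i
            iter-γ i (x ∷ c) = trans (cons i) (cong (iter g i x ∷_) (iter-γ i c))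
              where cons : ∀ i → iter γ i (x ∷ c) ≡ iter g i x ∷ iter γ i c
                    cons zero    = refl
                    cons (suc i) = cong γ (cons i)

            map-period : ∀ c → map (iter g (suc N)) c ≡ c
            map-period []      = refl
            map-period (x ∷ c) = cong₂ _∷_ (per x) (map-period c)

            γ-period : ∀ c → iter γ (suc N) c ≡ c
            γ-period c = trans (iter-γ (suc N) c) (map-period c)

          strict-map : ∀ {c} → Strict c → Strict (map g c)
          strict-map {c} (ch , nd) = Chain-map g g-X (λ _ _ → g-mono) ch ,
            λ d → nd (subst Deg (trans (sym (iter-γ N (γ c))) (trans (sym (iter-suc γ N c)) (γ-period c))) (Deg-map (iter g N) d))

          -- The permutation matrix of `g` commutes with `D`, and this is its supertrace: up to sign
          -- the reduced Lefschetz number, with the empty chain contributing 1.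
          lefschetz : ∑L simplices (λ c → sign c * indicator (map g c ≟ₗ c)) ≡ 0ℤ
          lefschetz = Supertrace.supertrace-zero _≟ₗ_ simplices (λ c f i → delta c f (simplices-strict i)) pp D (λ a b → H b a) sign
            (λ a b i j → trans (δ-matrix (δ (basis b)) a (simplices-strict i)) (δδ (basis b) a))
            (λ a b _ _ → D-odd a b)
            E contr
            (λ a b → indicator (map g a ≟ₗ b))
            (λ a b i j → trans (delta (γ a) (λ c → D c b) (strict-map (simplices-strict i)))
              (sym (trans (δ-matrix (basis b ∘ γ) a (simplices-strict i)) (δ-map g (basis b) a))))
            where
            inside : ∀ a b → Dec (Strict a) → Dec (Strict b) → ℤ
            E : List A → List A → ℤ
            E a b = inside a b (strict? a) (strict? b)
            contraction′ : ∀ a b → Strict a → Strict b →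
              ∑L simplices (λ c → D a c * H b c) + ∑L simplices (λ c → H c a * D c b) ≈ indicator (a ≟ₗ b)
            contraction′ a b sa sb = ≈-trans (≈-reflexive (cong (_+ combine H (δ (basis b)) a) (δ-matrix (H b) a sa)))
              (≈-trans (+-≈ (proj₂ (proj₂ top) b sb (ℕ.m≤n+m _ (length b)) a (proj₁ sa)) (≈-refl {combine H (δ (basis b)) a}))
                (≈-reflexive (lem (basis b a) (combine H (δ (basis b)) a))))
              where lem : ∀ x y → (x - y) + y ≡ x
                    lem = solve-∀
            inside a b (yes sa) (yes sb) = _≈_.quotient (contraction′ a b sa sb)
            inside a b _        _        = 0ℤ
            contr : ∀ a b → a ∈ simplices → b ∈ simplices →
              ∑L simplices (λ c → D a c * H b c) + ∑L simplices (λ c → H c a * D c b) ≡ indicator (a ≟ₗ b) + E a b * + suc n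
            contr a b i j = go (strict? a) (strict? b)
              where
              go : ∀ (x : Dec (Strict a)) (y : Dec (Strict b)) →
                ∑L simplices (λ c → D a c * H b c) + ∑L simplices (λ c → H c a * D c b) ≡ indicator (a ≟ₗ b) + inside a b x y * + suc n
              go (yes sa) (yes sb) = _≈_.equality (contraction′ a b sa sb)
              go (no n)   _        = ⊥-elim (n (simplices-strict i))
              go (yes _)  (no n)   = ⊥-elim (n (simplices-strict j))

          module _ (s : A → A) (m : ℕ) (qq : Prime (suc m)) (s-per : ∀ x → iter s (suc m) x ≡ x)
            (s-X : ∀ {x} → X x → X (s x)) (s-mono : ∀ {x y} → x ⊑ y → s x ⊑ s y)
            (s-fix : ∀ {x} → X x → g x ≡ x → g (s x) ≡ s x) where

            open ListWeight _≟_ code code-inj s m qq s-per using (listWeight; listWeight-fixed; listWeight-sum; tail-fixed)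
              renaming (γ to ς; γ-period to ς-period; fixed? to ς-fixed?)

            private
              strict-s : ∀ {c} → Strict c → Strict (ς c)
              strict-s {c} (ch , nd) = Chain-map s s-X (λ _ _ → s-mono) ch , λ d → nd (subst Deg (trans (sym (iter-suc ς m c)) (ς-period c)) (deg m d))
                where deg : ∀ i {c} → Deg c → Deg (iter ς i c)
                      deg zero    d = d
                      deg (suc i) d = Deg-map s (deg i d)

              strict-iter : ∀ i {c} → Strict c → Strict (iter ς i c)
              strict-iter zero    sc = sc
              strict-iter (suc i) sc = strict-s (strict-iter i sc)

              ς-fix : ∀ {c} → Chain X c → γ c ≡ c → γ (ς c) ≡ ς c
              ς-fix [] e = refl
              ς-fix {x ∷ c} ((Xx , _) ∷ ch) e with ∷-injective e
              ... | hx , hc = cong₂ _∷_ (s-fix Xx hx) (ς-fix ch hc)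

              iter-fixes : ∀ i {c} → Strict c → γ c ≡ c → γ (iter ς i c) ≡ iter ς i c
              iter-fixes zero    sc e = e
              iter-fixes (suc i) sc e = ς-fix (proj₁ (strict-iter i sc)) (iter-fixes i sc e)

              φ : List A → ℤ
              φ c = sign c * indicator (γ c ≟ₗ c)

              sign-map : ∀ c → sign (ς c) ≡ sign c
              sign-map []      = refl
              sign-map (x ∷ c) = cong -_ (sign-map c)

              φ-s : ∀ {c} → Strict c → φ (ς c) ≡ φ c
              φ-s {c} sc = cong₂ _*_ (sign-map c) (indicator-⇔ (γ (ς c) ≟ₗ ς c) (γ c ≟ₗ c)
                (λ e → subst (λ d → γ d ≡ d) (trans (sym (iter-suc ς m c)) (ς-period c)) (iter-fixes m (strict-s sc) e))
                (λ e → ς-fix (proj₁ sc) e))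

              φ-iter : ∀ i {c} → Strict c → φ (iter ς i c) ≡ φ c
              φ-iter zero    sc = refl
              φ-iter (suc i) sc = trans (φ-s (strict-iter i sc)) (φ-iter i sc)

              reindex : ∀ (f : List A → ℤ) → ∑L simplices (f ∘ ς) ≡ ∑L simplices f
              reindex f = trans (∑L-cong simplices (λ c i → sym (delta (ς c) f (strict-s (simplices-strict i)))))
                (trans (∑L-swap simplices simplices (λ c d → indicator (ς c ≟ₗ d) * f d))
                (∑L-cong simplices (λ d j → trans (∑L-cong simplices (λ c _ → cong (_* f d)
                    (indicator-⇔ (ς c ≟ₗ d) (iter ς m d ≟ₗ c)
                      (λ e → trans (cong (iter ς m) (sym e)) (trans (sym (iter-suc ς m c)) (ς-period c)))
                      (λ e → trans (cong ς (sym e)) (ς-period d)))))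
                  (delta (iter ς m d) (λ _ → f d) (strict-iter m (simplices-strict j))))))

              reindex-iter : ∀ i (f : List A → ℤ) → ∑L simplices (f ∘ iter ς i) ≡ ∑L simplices f
              reindex-iter zero    f = refl
              reindex-iter (suc i) f = trans (reindex-iter i (f ∘ ς)) (reindex f)

              split : ∀ c → indicator (ς-fixed? c) + ∑ (suc m) (λ i → listWeight (iter ς i c)) ≡ 1ℤ
              split c with ς-fixed? c
              ... | yes e = trans (cong (λ t → 1ℤ + t) (trans (∑-cong (suc m) (λ i _ → trans (cong listWeight (iter-fix ς e i)) (listWeight-fixed e))) (∑-zero (suc m)))) refl
              ... | no ne = trans (+-identityˡ _) (listWeight-sum c ne)

              -- Chains moved by `s` form orbits of prime length on which `φ` is constant, and
              -- `listWeight` picks one chain of each. The prime is the order of `s`, which may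
              -- differ from the modulus of the cochains.
              mod-count : ∑L simplices φ ≡ ∑L simplices (λ c → φ c * indicator (ς-fixed? c)) + + suc m * ∑L simplices (λ c → φ c * listWeight c)
              mod-count = trans (∑L-cong simplices (λ c _ → trans (sym (*-identityʳ (φ c))) (trans (cong (λ t → φ c * t) (sym (split c))) (dist (φ c) _ _))))
                (trans (∑L-+ simplices (λ c → φ c * indicator (ς-fixed? c)) (λ c → φ c * ∑ (suc m) (λ i → listWeight (iter ς i c)))) (cong (λ t → ∑L simplices (λ c → φ c * indicator (ς-fixed? c)) + t)
                  (trans (∑L-cong simplices (λ c _ → sym (∑-* (suc m) (φ c) (λ i → listWeight (iter ς i c)))))
                  (trans (∑L-∑ simplices (suc m) (λ c i → φ c * listWeight (iter ς i c)))
                  (trans (∑-cong (suc m) (λ i _ → trans (∑L-cong simplices (λ c j → cong (_* listWeight (iter ς i c)) (sym (φ-iter i (simplices-strict j)))))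
                     (reindex-iter i (λ c → φ c * listWeight c))))
                  (∑-const (suc m) _))))))
                where dist : ∀ x y z → x * (y + z) ≡ x * y + x * z
                      dist = solve-∀

            -- Without a common fixed element only the empty chain survives the count, and 0 ≡ 1
            -- modulo the order of `s`.
            no-fixed-free-action : ¬ (∀ x → X x → g x ≡ x → s x ≡ x → ⊥)
            no-fixed-free-action none = contra (trans (sym lefschetz) (trans mod-count (cong (_+ + suc m * Z) only-empty)))
              where
              Z = ∑L simplices (λ c → φ c * listWeight c)
              term : ∀ c → Strict c → φ c * indicator (ς-fixed? c) ≡ indicator ([] ≟ₗ c) * 1ℤ
              term [] _ = refl
              term (x ∷ c) ((Xx , _) ∷ _ , _) = both (γ (x ∷ c) ≟ₗ (x ∷ c)) (ς-fixed? (x ∷ c))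
                where
                both : ∀ (d : Dec (γ (x ∷ c) ≡ x ∷ c)) (e : Dec (ς (x ∷ c) ≡ x ∷ c)) → sign (x ∷ c) * indicator d * indicator e ≡ 0ℤ
                both (yes d) (yes e) = ⊥-elim (none x Xx (proj₁ (∷-injective d)) (proj₁ (∷-injective e)))
                both (no _)  e       = trans (cong (_* indicator e) (*-zeroʳ (sign (x ∷ c)))) (*-zeroˡ (indicator e))
                both d       (no _)  = *-zeroʳ (sign (x ∷ c) * indicator d)
              only-empty : ∑L simplices (λ c → φ c * indicator (ς-fixed? c)) ≡ 1ℤ
              only-empty = trans (∑L-cong simplices (λ c i → term c (simplices-strict i))) (delta [] (λ _ → 1ℤ) ([] , λ ()))
              contra : 0ℤ ≡ 1ℤ + + suc m * Z → ⊥
              contra e = ℕ.<-irrefl (sym (ℕ.m*n≡1⇒m≡1 (suc m) ∣ Z ∣ (trans (sym (abs-* (+ suc m) Z)) (cong ∣_∣ mZ)))) (ℕ.nonTrivial⇒n>1 (suc m) {{prime⇒nonTrivial qq}})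
                where
                mZ : + suc m * Z ≡ - 1ℤ
                mZ = trans (lem (+ suc m * Z)) (cong (λ t → t - 1ℤ) (sym e))
                  where lem : ∀ x → x ≡ (1ℤ + x) - 1ℤ
                        lem = solve-∀

-- Oliver's theorem for the complex of a monotone Boolean function.

module Oliver where

  open import Defs using (DecisionTree; eval; depth; bit)
  open import Data.Nat as ℕ using (ℕ; zero; suc; _+_; _*_; _<_)
  import Data.Nat.Properties as ℕ
  open import Data.Nat.Primality using (Prime)
  open import Data.Integer as ℤ using (ℤ; +_; 0ℤ)
  import Data.Integer.Properties as ℤ
  open import Data.Bool using (Bool; true; false)
  import Data.Bool.Properties as Bool
  open import Data.Fin using (Fin; zero; suc)
  import Data.Fin.Properties as Fin
  open import Data.Vec using ([]; _∷_; lookup; replicate)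
  open import Data.Vec.Properties using (lookup-replicate; ∷-injective)
  open import Data.List using (List; []; _∷_; map; _++_)
  open import Data.List.Relation.Unary.Any using (here; there)
  open import Data.List.Membership.Propositional using (_∈_)
  open import Data.Product using (_,_; _×_; proj₁; proj₂)
  open import Data.Empty using (⊥; ⊥-elim)
  open import Function using (_∘_)
  open import Relation.Nullary using (¬_; Dec; _×-dec_; ¬?)
  open import Relation.Nullary.Decidable using (map′; _→-dec_)
  open import Relation.Binary.PropositionalEquality
  open Orbit
  open Lefschetz using (∑L; ∑L-++; ∑L-map; ∑L-cong; ∑L-zero)
  open Nonevasive
  open FixedPoint

  code : ∀ {m} → Face m → ℕ
  code []      = 0
  code (b ∷ F) = bit b + 2 * code F

  code-injective : ∀ {m} {F G : Face m} → code F ≡ code G → F ≡ G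
  code-injective {F = []} {[]} e = refl
  code-injective {F = true ∷ F} {true ∷ G} e = cong (true ∷_) (code-injective (ℕ.*-cancelˡ-≡ _ _ 2 (ℕ.suc-injective e)))
  code-injective {F = false ∷ F} {false ∷ G} e = cong (false ∷_) (code-injective (ℕ.*-cancelˡ-≡ _ _ 2 e))
  code-injective {F = true ∷ F} {false ∷ G} e = ⊥-elim (ℕ.even≢odd (code G) (code F) (sym e))
  code-injective {F = false ∷ F} {true ∷ G} e = ⊥-elim (ℕ.even≢odd (code F) (code G) e)

  faces : ∀ m → List (Face m)
  faces zero    = [] ∷ []
  faces (suc m) = map (true ∷_) (faces m) ++ map (false ∷_) (faces m)

  faces-delta : ∀ {m} (F : Face m) (f : Face m → ℤ) → ∑L (faces m) (λ G → indicator (F ≟ᶠ G) ℤ.* f G) ≡ f F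
  faces-delta [] f = trans (ℤ.+-identityʳ _) (ℤ.*-identityˡ (f []))
  faces-delta {suc m} (b ∷ F) f = trans (∑L-++ (map (true ∷_) (faces m)) (map (false ∷_) (faces m)) _)
      (trans (cong₂ ℤ._+_ (∑L-map (true ∷_) (faces m) _) (∑L-map (false ∷_) (faces m) _)) (halves b))
    where
    same : ∀ b G → indicator ((b ∷ F) ≟ᶠ (b ∷ G)) ≡ indicator (F ≟ᶠ G)
    same b G = indicator-⇔ ((b ∷ F) ≟ᶠ (b ∷ G)) (F ≟ᶠ G) (proj₂ ∘ ∷-injective) (cong (b ∷_))
    half : ∀ b → ∑L (faces m) (λ G → indicator ((b ∷ F) ≟ᶠ (b ∷ G)) ℤ.* f (b ∷ G)) ≡ f (b ∷ F)
    half b = trans (∑L-cong (faces m) (λ G _ → cong (ℤ._* f (b ∷ G)) (same b G))) (faces-delta F (f ∘ (b ∷_)))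
    other : ∀ b b′ → b ≢ b′ → ∑L (faces m) (λ G → indicator ((b ∷ F) ≟ᶠ (b′ ∷ G)) ℤ.* f (b′ ∷ G)) ≡ 0ℤ
    other b b′ ne = trans (∑L-cong (faces m) (λ G _ → trans (cong (ℤ._* f (b′ ∷ G)) (indicator-no ((b ∷ F) ≟ᶠ (b′ ∷ G)) (ne ∘ proj₁ ∘ ∷-injective))) (ℤ.*-zeroˡ (f (b′ ∷ G))))) (∑L-zero (faces m))
    halves : ∀ b → ∑L (faces m) (λ G → indicator ((b ∷ F) ≟ᶠ (true ∷ G)) ℤ.* f (true ∷ G)) ℤ.+
                   ∑L (faces m) (λ G → indicator ((b ∷ F) ≟ᶠ (false ∷ G)) ℤ.* f (false ∷ G)) ≡ f (b ∷ F)
    halves true  = trans (cong₂ ℤ._+_ (half true) (other true false λ ())) (ℤ.+-identityʳ _)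
    halves false = trans (cong₂ ℤ._+_ (other false true λ ()) (half false)) (ℤ.+-identityˡ _)

  _⊑ᶠ?_ : ∀ {m} (F G : Face m) → Dec (F ⊑ᶠ G)
  F ⊑ᶠ? G = map′ sub _⊑ᶠ_.at (Fin.all? (λ i → (lookup F i Bool.≟ true) →-dec (lookup G i Bool.≟ true)))

  size-< : ∀ {m} {F G : Face m} → F ⊑ᶠ G → F ≢ G → size F < size G
  size-< h ne = ℕ.≰⇒> (λ le → ne (size-≡ h le))

  ∅ full : ∀ {m} → Face m
  ∅ = replicate _ false
  full = replicate _ true

  ∅-⊑ : ∀ {m} {F : Face m} → ∅ ⊑ᶠ F
  _⊑ᶠ_.at (∅-⊑ {m}) i e with trans (sym (lookup-replicate i false)) e
  ... | ()

  ⊑-full : ∀ {m} {F : Face m} → F ⊑ᶠ full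
  _⊑ᶠ_.at (⊑-full {m}) i e = lookup-replicate i true

  size-∅ : ∀ m → size (∅ {m}) ≡ 0
  size-∅ zero    = refl
  size-∅ (suc m) = size-∅ m

  size-full : ∀ m → size (full {m}) ≡ m
  size-full zero    = refl
  size-full (suc m) = cong suc (size-full m)

  record Automorphism {m} (P : Face m → Bool) : Set where
    field
      act      : Face m → Face m
      order    : ℕ
      periodic : ∀ F → iter act (suc order) F ≡ F
      monotone : ∀ {F G} → F ⊑ᶠ G → act F ⊑ᶠ act G
      invariant : ∀ {F} → P F ≡ true → P (act F) ≡ true

  module _ {m : ℕ} (P : Face m → Bool) (P-mono : ∀ {F G} → F ⊑ᶠ G → P G ≡ true → P F ≡ true) where

    open Automorphism

    private
      X₀ : Face m → Set
      -- The interval is the same for every modulus; 0 is a placeholder.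
      X₀ = Interval P P-mono 0ℤ ∅ full

      X₀? : ∀ F → Dec (X₀ F)
      X₀? F = (∅ ⊑ᶠ? F) ×-dec (F ⊑ᶠ? full) ×-dec ¬? (F ≟ᶠ ∅) ×-dec (P F Bool.≟ true)

      preserves : (α : Automorphism P) → ∀ {F} → X₀ F → X₀ (act α F)
      preserves α {F} (_ , _ , ne , PF) = ∅-⊑ , ⊑-full , (λ e → ne (periodic⇒injective (act α) (order α) (periodic α) (trans e (sym fix∅)))) , invariant α PF
        where
        fix∅ : act α ∅ ≡ ∅
        fix∅ = ⊑ᶠ-antisym (subst (act α ∅ ⊑ᶠ_) (periodic α ∅) (monotone α ∅-⊑)) ∅-⊑

      Fixed : List (Automorphism P) → Face m → Set
      Fixed []       F = X₀ F
      Fixed (τ ∷ ts) F = Fixed ts F × act τ F ≡ F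

      Fixed? : ∀ ts F → Dec (Fixed ts F)
      Fixed? []       F = X₀? F
      Fixed? (τ ∷ ts) F = Fixed? ts F ×-dec (act τ F ≟ᶠ F)

      Fixed-X₀ : ∀ ts {F} → Fixed ts F → X₀ F
      Fixed-X₀ []       h = h
      Fixed-X₀ (τ ∷ ts) h = Fixed-X₀ ts (proj₁ h)

      Fixed-at : ∀ ts {F} → Fixed ts F → ∀ {τ} → τ ∈ ts → act τ F ≡ F
      Fixed-at (τ ∷ ts) h (here refl) = proj₂ h
      Fixed-at (τ ∷ ts) h (there i)   = Fixed-at ts (proj₁ h) i

      Fixed-intro : ∀ ts {F} → X₀ F → (∀ {τ} → τ ∈ ts → act τ F ≡ F) → Fixed ts F
      Fixed-intro []       x h = x
      Fixed-intro (τ ∷ ts) x h = Fixed-intro ts x (h ∘ there) , h (here refl)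

    -- Oliver's fixed point theorem for a p-group generated by the commuting elements ts, extended by the
    -- cyclic group of g and then by the group of s, of prime order.
    oliver : ∀ (t : DecisionTree (Fin m)) → (∀ F → eval t (lookup F) ≡ P F) → depth t < m → P ∅ ≡ true →
      ∀ n → Prime (suc n) → (ts : List (Automorphism P)) → (∀ {τ} → τ ∈ ts → order τ ≡ n) →
      (∀ {σ τ} → σ ∈ ts → τ ∈ ts → ∀ F → act σ (act τ F) ≡ act τ (act σ F)) →
      (g : Automorphism P) → (∀ F → (∀ {τ} → τ ∈ ts → act τ F ≡ F) → ∀ {τ} → τ ∈ ts → act τ (act g F) ≡ act g F) →
      (s : Automorphism P) → Prime (suc (order s)) →
      (∀ F → (∀ {τ} → τ ∈ ts → act τ F ≡ F) → ∀ {τ} → τ ∈ ts → act τ (act s F) ≡ act s F) →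
      (∀ F → (∀ {τ} → τ ∈ ts → act τ F ≡ F) → act g F ≡ F → act g (act s F) ≡ act s F) →
      ¬ (∀ F → F ≢ ∅ → P F ≡ true → (∀ {τ} → τ ∈ ts → act τ F ≡ F) → act g F ≡ F → act s F ≡ F → ⊥)
    oliver t ct dt P∅ n pp ts ord comm g g-ts s qq s-ts s-g none =
      no-fixed-free-action (Fixed ts) (Fixed? ts) (acyclic ts (λ i → i))
        (act g) (order g) (periodic g) (λ h → Fixed-intro ts (preserves g (Fixed-X₀ ts h)) (g-ts _ (Fixed-at ts h))) (monotone g)
        (act s) (order s) qq (periodic s) (λ h → Fixed-intro ts (preserves s (Fixed-X₀ ts h)) (s-ts _ (Fixed-at ts h))) (monotone s)
        (λ h e → s-g _ (Fixed-at ts h) e)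
        (λ F h e e′ → none F (proj₁ (proj₂ (proj₂ (Fixed-X₀ ts h)))) (proj₂ (proj₂ (proj₂ (Fixed-X₀ ts h)))) (Fixed-at ts h) e e′)
      where
      open FixedPoints (Face m) _≟ᶠ_ _⊑ᶠ_ ⊑ᶠ-refl ⊑ᶠ-trans _⊑ᶠ?_ code code-injective size m size-< size-≤ (faces m) faces-delta n pp
      -- Smith's theorem is applied to one generator at a time; each acts on the common fixed part
      -- of those already treated because they commute.
      acyclic : ∀ ts′ → (∀ {τ} → τ ∈ ts′ → τ ∈ ts) → Acyclic (Fixed ts′)
      acyclic [] inc = Acyclic-tree P P-mono (+ suc n) t ∅ full ⊑-full (λ F _ _ → ct F)
        (subst₂ _<_ (sym (trans (cong (λ z → depth t + z) (size-∅ m)) (ℕ.+-identityʳ _))) (sym (size-full m)) dt) P∅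
      acyclic (τ ∷ ts′) inc = smith (act τ) (λ F → trans (cong (λ k → iter (act τ) (suc k) F) (sym (ord (inc (here refl))))) (periodic τ F))
        (Fixed ts′)
        (λ h → Fixed-intro ts′ (preserves τ (Fixed-X₀ ts′ h)) (λ i → trans (comm (inc (there i)) (inc (here refl)) _) (cong (act τ) (Fixed-at ts′ h i))))
        (monotone τ) (acyclic ts′ (inc ∘ there))

-- Graphs as faces, and vertex symmetries acting on them.

module GraphAction where

  open import Defs
  open import Data.Nat as ℕ using (ℕ; zero; suc; _+_; _*_; _∸_; s≤s; z≤n)
  import Data.Nat.Properties as ℕ
  import Data.Nat.DivMod as ℕ
  open import Data.Nat.Primality using (Prime)
  open import Data.Bool using (Bool; true; false)
  open import Data.Fin as Fin using (Fin; zero; suc; _<_; _<?_; splitAt; join)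
  import Data.Fin.Properties as Fin
  open import Data.Fin.Permutation using (Permutation′; permutation)
  open import Data.Vec using (lookup; tabulate)
  open import Data.Vec.Properties using (lookup∘tabulate; lookup-replicate)
  open import Data.List using (List; map)
  open import Data.List.Membership.Propositional using (_∈_)
  open import Data.List.Membership.Propositional.Properties using (∈-map⁻)
  open import Data.Product using (_,_)
  open import Data.Sum using (_⊎_; inj₁; inj₂)
  open import Data.Empty using (⊥; ⊥-elim)
  open import Function using (_∘_)
  open import Relation.Nullary using (yes; no)
  open import Relation.Binary.Definitions using (tri<; tri≈; tri>)
  open import Relation.Binary.PropositionalEquality
  open Orbit
  open Nonevasive
  open Oliver

  edges : ℕ → ℕ
  edges zero    = 0
  edges (suc n) = n + edges n

  private
    shift : ∀ {n} → Edge n → Edge (suc n)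
    shift ((i , j) , p) = (suc i , suc j) , s≤s p

  mutual
    edgeAt : ∀ n → Fin (edges n) → Edge n
    edgeAt (suc n) k = edgeAt-split n (splitAt n k)

    edgeAt-split : ∀ n → Fin n ⊎ Fin (edges n) → Edge (suc n)
    edgeAt-split n (inj₁ j) = (zero , suc j) , s≤s z≤n
    edgeAt-split n (inj₂ k) = shift (edgeAt n k)

  indexOf : ∀ n → Edge n → Fin (edges n)
  indexOf (suc n) ((zero  , suc j) , p)     = join n (edges n) (inj₁ j)
  indexOf (suc n) ((suc i , suc j) , s≤s p) = join n (edges n) (inj₂ (indexOf n ((i , j) , p)))

  edge-≡ : ∀ {n} {i j : Fin n} (p q : i < j) → _≡_ {A = Edge n} ((i , j) , p) ((i , j) , q)
  edge-≡ p q = cong (_ ,_) (ℕ.≤-irrelevant p q)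

  edgeAt-indexOf : ∀ n e → edgeAt n (indexOf n e) ≡ e
  edgeAt-indexOf (suc n) ((zero , suc j) , p) rewrite Fin.splitAt-↑ˡ n j (edges n) = edge-≡ _ _
  edgeAt-indexOf (suc n) ((suc i , suc j) , s≤s p) rewrite Fin.splitAt-↑ʳ n (edges n) (indexOf n ((i , j) , p)) =
    cong shift (edgeAt-indexOf n ((i , j) , p))

  indexOf-shift : ∀ n e → indexOf (suc n) (shift e) ≡ join n (edges n) (inj₂ (indexOf n e))
  indexOf-shift n e = refl

  indexOf-edgeAt : ∀ n k → indexOf n (edgeAt n k) ≡ k
  indexOf-edgeAt (suc n) k with splitAt n k in e
  ... | inj₁ j = trans (cong (join n (edges n)) (sym e)) (Fin.join-splitAt n (edges n) k)
  ... | inj₂ l = trans (indexOf-shift n (edgeAt n l)) (trans (cong (join n (edges n) ∘ inj₂) (indexOf-edgeAt n l))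
                   (trans (cong (join n (edges n)) (sym e)) (Fin.join-splitAt n (edges n) k)))

  double-edges : ∀ n → edges n * 2 ≡ n * (n ∸ 1)
  double-edges zero = refl
  double-edges (suc zero) = refl
  double-edges (suc (suc n)) = trans (ℕ.*-distribʳ-+ 2 (suc n) (edges (suc n))) (trans (cong (λ t → suc n * 2 + t) (double-edges (suc n))) (lem n))
    where
    open import Data.Nat.Tactic.RingSolver using (solve-∀)
    lem : ∀ n → suc n * 2 + suc n * n ≡ suc (suc n) * suc n
    lem = solve-∀

  edges-formula : ∀ n → n * (n ∸ 1) ℕ./ 2 ≡ edges n
  edges-formula n = trans (cong (ℕ._/ 2) (sym (double-edges n))) (ℕ.m*n/n≡m (edges n) 2)

  module _ {n : ℕ} where

    adj-< : ∀ (G : Graph n) {i j} (p : i < j) → adj G i j ≡ G ((i , j) , p)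
    adj-< G {i} {j} p with i <? j
    ... | yes q = cong G (edge-≡ q p)
    ... | no nq = ⊥-elim (nq p)

    adj-sym : ∀ (G : Graph n) i j → adj G i j ≡ adj G j i
    adj-sym G i j with i <? j | j <? i
    ... | yes p | yes q = ⊥-elim (ℕ.<-asym p q)
    ... | yes _ | no _  = refl
    ... | no _  | yes _ = refl
    ... | no _  | no _  = refl

    adj-irrefl : ∀ (G : Graph n) i → adj G i i ≡ false
    adj-irrefl G i with i <? i
    ... | yes p = ⊥-elim (ℕ.<-irrefl refl p)
    ... | no _  = refl

    adj-mono : ∀ {G H : Graph n} → G ⊑ H → ∀ i j → adj G i j ≡ true → adj H i j ≡ true
    adj-mono h i j e with i <? j | j <? i
    ... | yes p | _     = h _ e
    ... | no _  | yes _ = h _ e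
    ... | no _  | no _  = e

    adj-ext : ∀ {a b : Fin n → Fin n → Bool} → (∀ i j → a i j ≡ a j i) → (∀ i j → b i j ≡ b j i) →
      (∀ i → a i i ≡ b i i) → (∀ {i j} → i < j → a i j ≡ b i j) → ∀ i j → a i j ≡ b i j
    adj-ext sa sb d h i j with Fin.<-cmp i j
    ... | tri< p _ _    = h p
    ... | tri≈ _ refl _ = d i
    ... | tri> _ _ p    = trans (sa i j) (trans (h p) (sb j i))

    graph : Face (edges n) → Graph n
    graph F e = lookup F (indexOf n e)

    neighbours : Face (edges n) → Fin n → Fin n → Bool
    neighbours F = adj (graph F)

    neighbours-injective : ∀ {F G} → (∀ i j → neighbours F i j ≡ neighbours G i j) → F ≡ G
    neighbours-injective {F} {G} h = vec-ext λ k → trans (cong (lookup F) (sym (indexOf-edgeAt n k)))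
      (trans (step (edgeAt n k)) (cong (lookup G) (indexOf-edgeAt n k)))
      where
      step : ∀ e → graph F e ≡ graph G e
      step ((i , j) , p) = trans (sym (adj-< (graph F) p)) (trans (h i j) (adj-< (graph G) p))

    -- A permutation together with a period, so that its inverse is one of its powers.
    record Symmetry : Set where
      field
        move     : Fin n → Fin n
        order    : ℕ
        periodic : ∀ v → iter move (suc order) v ≡ v

    open Symmetry public

    toPermutation : Symmetry → Permutation′ n
    toPermutation σ = permutation (move σ) (iter (move σ) (order σ)) (periodic σ)
      (λ v → trans (sym (iter-suc (move σ) (order σ) v)) (periodic σ v))

    -- Graphs are pulled back along `move`, which reverses composition; the fixed graphs are the
    -- invariant ones all the same.
    actOn : Symmetry → Face (edges n) → Face (edges n)
    actOn σ F = tabulate (relabel (toPermutation σ) (graph F) ∘ edgeAt n)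

    graph-actOn : ∀ σ F e → graph (actOn σ F) e ≡ relabel (toPermutation σ) (graph F) e
    graph-actOn σ F e = trans (lookup∘tabulate _ (indexOf n e)) (cong (relabel (toPermutation σ) (graph F)) (edgeAt-indexOf n e))

    neighbours-actOn : ∀ σ F i j → neighbours (actOn σ F) i j ≡ neighbours F (move σ i) (move σ j)
    neighbours-actOn σ F = adj-ext (adj-sym (graph (actOn σ F))) (λ i j → adj-sym (graph F) (move σ i) (move σ j))
      (λ i → trans (adj-irrefl (graph (actOn σ F)) i) (sym (adj-irrefl (graph F) (move σ i))))
      (λ {i} {j} p → trans (adj-< (graph (actOn σ F)) p) (graph-actOn σ F ((i , j) , p)))

    neighbours-iter : ∀ σ k F i j → neighbours (iter (actOn σ) k F) i j ≡ neighbours F (iter (move σ) k i) (iter (move σ) k j)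
    neighbours-iter σ zero    F i j = refl
    neighbours-iter σ (suc k) F i j = trans (neighbours-actOn σ (iter (actOn σ) k F) i j) (trans (neighbours-iter σ k F (move σ i) (move σ j))
      (sym (cong₂ (neighbours F) (iter-suc (move σ) k i) (iter-suc (move σ) k j))))

    Invariant : (Fin n → Fin n) → (Fin n → Fin n → Bool) → Set
    Invariant σ a = ∀ i j → a (σ i) (σ j) ≡ a i j

    fixed⇒invariant : ∀ σ {F} → actOn σ F ≡ F → Invariant (move σ) (neighbours F)
    fixed⇒invariant σ {F} e i j = trans (sym (neighbours-actOn σ F i j)) (cong (λ H → neighbours H i j) e)

    mapTree : DecisionTree (Edge n) → DecisionTree (Fin (edges n))
    mapTree (leaf b)        = leaf b
    mapTree (query e t₀ t₁) = query (indexOf n e) (mapTree t₀) (mapTree t₁)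

    eval-mapTree : ∀ t F → eval (mapTree t) (lookup F) ≡ eval t (graph F)
    eval-mapTree (leaf b) F = refl
    eval-mapTree (query e t₀ t₁) F with lookup F (indexOf n e)
    ... | true  = eval-mapTree t₁ F
    ... | false = eval-mapTree t₀ F

    depth-mapTree : ∀ t → depth (mapTree t) ≡ depth t
    depth-mapTree (leaf b)        = refl
    depth-mapTree (query e t₀ t₁) = cong₂ (λ a b → suc (a ℕ.⊔ b)) (depth-mapTree t₀) (depth-mapTree t₁)

    module _ (P : Graph n → Bool) (isP : IsGraphProperty P) (mono : Monotone P) where

      private
        P-ext : ∀ {G H : Graph n} → (∀ e → G e ≡ H e) → P G ≡ P H
        P-ext {G} {H} h = iff-bool (mono G H (λ e x → trans (h e) x)) (mono H G (λ e x → trans (sym (h e)) x))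

        Q : Face (edges n) → Bool
        Q F = P (graph F)

        graph-mono : ∀ {F G : Face (edges n)} → F ⊑ᶠ G → graph F ⊑ graph G
        graph-mono h e x = _⊑ᶠ_.at h (indexOf n e) x

        automorphism : Symmetry → Automorphism Q
        automorphism σ = record
          { act = actOn σ ; order = order σ
          ; periodic = λ F → neighbours-injective λ i j → trans (neighbours-iter σ (suc (order σ)) F i j) (cong₂ (neighbours F) (periodic σ i) (periodic σ j))
          ; monotone = λ {F} {G} h → sub λ k x → trans (lookup∘tabulate _ k)
              (go (graph-mono h) (edgeAt n k) (trans (sym (lookup∘tabulate (relabel (toPermutation σ) (graph F) ∘ edgeAt n) k)) x))
          ; invariant = λ {F} x → trans (P-ext (graph-actOn σ F)) (trans (isP (toPermutation σ) (graph F)) x) }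
          where
          go : ∀ {G H : Graph n} → G ⊑ H → ∀ e → relabel (toPermutation σ) G e ≡ true → relabel (toPermutation σ) H e ≡ true
          go h ((i , j) , _) x = adj-mono h (move σ i) (move σ j) x

      -- Oliver's theorem expressed on vertices. Normality is asked for through its effect: `g` and
      -- `s` carry adjacency functions invariant under the earlier generators to such functions
      -- again. The last hypothesis leaves no nonempty invariant member, which contradicts the
      -- theorem if a tree is too shallow.
      evasive-by-symmetry : Nontrivial P →
        ∀ p → Prime (suc p) → (ts : List Symmetry) → (∀ {τ} → τ ∈ ts → order τ ≡ p) →
        (∀ {σ τ} → σ ∈ ts → τ ∈ ts → ∀ v → move σ (move τ v) ≡ move τ (move σ v)) →
        (g s : Symmetry) → Prime (suc (order s)) →
        (∀ a → (∀ {τ} → τ ∈ ts → Invariant (move τ) a) → ∀ {τ} → τ ∈ ts → Invariant (move τ) (λ i j → a (move g i) (move g j))) →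
        (∀ a → (∀ {τ} → τ ∈ ts → Invariant (move τ) a) → ∀ {τ} → τ ∈ ts → Invariant (move τ) (λ i j → a (move s i) (move s j))) →
        (∀ a → Invariant (move g) a → Invariant (move g) (λ i j → a (move s i) (move s j))) →
        (∀ G → P G ≡ true → (∀ {τ} → τ ∈ ts → Invariant (move τ) (adj G)) → Invariant (move g) (adj G) → Invariant (move s) (adj G) →
          ∀ e → G e ≡ false) →
        EvasiveProperty n P
      evasive-by-symmetry ((G₀ , PG₀) , _) p pp ts ord comm g s qq g-ts s-ts s-g empty t ct =
        ℕ.≮⇒≥ λ lt → oliver Q (λ {F} {G} h → mono (graph G) (graph F) (graph-mono h)) (mapTree t)
          (λ F → trans (eval-mapTree t F) (ct (graph F)))
          (subst₂ ℕ._<_ (sym (depth-mapTree t)) (edges-formula n) lt)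
          (mono G₀ (graph ∅) (λ e x → ⊥-elim (absurd e x)) PG₀)
          p pp (map automorphism ts)
          (λ i → ordered i)
          (λ i j F → commute i j F)
          (automorphism g) (λ F h i → conj g g-ts F h i)
          (automorphism s) qq (λ F h i → conj s s-ts F h i)
          (λ F h e → neighbours-injective λ i j → trans (neighbours-actOn g (actOn s F) i j) (trans (neighbours-actOn s F (move g i) (move g j))
            (trans (s-g (neighbours F) (fixed⇒invariant g e) i j) (sym (neighbours-actOn s F i j)))))
          (λ F ne PF h eg es → ne (vec-ext λ k → trans (cong (lookup F) (sym (indexOf-edgeAt n k)))
            (trans (empty (graph F) PF (λ {τ} i → fixed⇒invariant τ (h (∈-map i))) (fixed⇒invariant g eg) (fixed⇒invariant s es) (edgeAt n k)) (sym (lookup-replicate k false)))))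
        where
        open import Data.List.Membership.Propositional.Properties using (∈-map⁺)
        absurd : ∀ e → graph ∅ e ≡ true → ⊥
        absurd e x with trans (sym (lookup-replicate (indexOf n e) false)) x
        ... | ()
        ∈-map : ∀ {τ} → τ ∈ ts → automorphism τ ∈ map automorphism ts
        ∈-map = ∈-map⁺ automorphism
        ordered : ∀ {α} → α ∈ map automorphism ts → Automorphism.order α ≡ p
        ordered i with ∈-map⁻ automorphism i
        ... | τ , k , refl = ord k
        commute : ∀ {α β} → α ∈ map automorphism ts → β ∈ map automorphism ts → ∀ F →
          Automorphism.act α (Automorphism.act β F) ≡ Automorphism.act β (Automorphism.act α F)
        commute i j F with ∈-map⁻ automorphism i | ∈-map⁻ automorphism j
        ... | σ , k , refl | τ , l , refl = neighbours-injective λ u v →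
          trans (neighbours-actOn σ (actOn τ F) u v) (trans (neighbours-actOn τ F (move σ u) (move σ v))
          (trans (cong₂ (neighbours F) (comm l k u) (comm l k v))
          (sym (trans (neighbours-actOn τ (actOn σ F) u v) (neighbours-actOn σ F (move τ u) (move τ v))))))
        conj : ∀ h → (∀ a → (∀ {τ} → τ ∈ ts → Invariant (move τ) a) → ∀ {τ} → τ ∈ ts → Invariant (move τ) (λ i j → a (move h i) (move h j))) →
          ∀ F → (∀ {α} → α ∈ map automorphism ts → Automorphism.act α F ≡ F) → ∀ {α} → α ∈ map automorphism ts → Automorphism.act α (actOn h F) ≡ actOn h F
        conj h h-ts F fx i with ∈-map⁻ automorphism i
        ... | τ , k , refl = neighbours-injective λ u v → trans (neighbours-actOn τ (actOn h F) u v) (trans (neighbours-actOn h F (move τ u) (move τ v))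
          (trans (h-ts (neighbours F) (λ {σ} l → fixed⇒invariant σ (fx (∈-map l))) k u v) (sym (neighbours-actOn h F u v))))

-- Counting sums and integer logarithms.

module Sums where

  open import Data.Nat
  open import Data.Nat.Properties
  open import Data.Nat.Tactic.RingSolver using (solve-∀)
  open import Data.Product using (_,_)
  open import Data.Empty using (⊥-elim)
  open import Relation.Nullary using (¬_; Dec; yes; no)
  open import Relation.Binary.PropositionalEquality

  ♯ : ∀ {X : Set} → Dec X → ℕ
  ♯ (yes _) = 1
  ♯ (no _)  = 0

  ♯-yes : ∀ {X : Set} (d : Dec X) → X → ♯ d ≡ 1
  ♯-yes (yes _) x = refl
  ♯-yes (no n)  x = ⊥-elim (n x)

  ♯-no : ∀ {X : Set} (d : Dec X) → ¬ X → ♯ d ≡ 0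
  ♯-no (yes x) n = ⊥-elim (n x)
  ♯-no (no _)  n = refl

  ♯-mono : ∀ {X Y : Set} (d : Dec X) (e : Dec Y) → (X → Y) → ♯ d ≤ ♯ e
  ♯-mono (yes x) e f = ≤-reflexive (sym (♯-yes e (f x)))
  ♯-mono (no _)  e f = z≤n

  ♯-≤1 : ∀ {X : Set} (d : Dec X) → ♯ d ≤ 1
  ♯-≤1 (yes _) = s≤s z≤n
  ♯-≤1 (no _)  = z≤n

  ∑₁ : ℕ → (ℕ → ℕ) → ℕ
  ∑₁ zero    f = 0
  ∑₁ (suc n) f = ∑₁ n f + f (suc n)

  ∑₁-cong : ∀ n {f g} → (∀ m → 1 ≤ m → m ≤ n → f m ≡ g m) → ∑₁ n f ≡ ∑₁ n g
  ∑₁-cong zero    h = refl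
  ∑₁-cong (suc n) h = cong₂ _+_ (∑₁-cong n (λ m l u → h m l (m≤n⇒m≤1+n u))) (h (suc n) (s≤s z≤n) ≤-refl)

  ∑₁-mono : ∀ n {f g} → (∀ m → 1 ≤ m → m ≤ n → f m ≤ g m) → ∑₁ n f ≤ ∑₁ n g
  ∑₁-mono zero    h = z≤n
  ∑₁-mono (suc n) h = +-mono-≤ (∑₁-mono n (λ m l u → h m l (m≤n⇒m≤1+n u))) (h (suc n) (s≤s z≤n) ≤-refl)

  ∑₁-+ : ∀ n f g → ∑₁ n (λ m → f m + g m) ≡ ∑₁ n f + ∑₁ n g
  ∑₁-+ zero    f g = refl
  ∑₁-+ (suc n) f g = trans (cong (_+ (f (suc n) + g (suc n))) (∑₁-+ n f g)) (lem (∑₁ n f) (∑₁ n g) _ _)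
    where lem : ∀ a b c d → a + b + (c + d) ≡ (a + c) + (b + d)
          lem = solve-∀

  ∑₁-* : ∀ n a f → ∑₁ n (λ m → a * f m) ≡ a * ∑₁ n f
  ∑₁-* zero    a f = sym (*-zeroʳ a)
  ∑₁-* (suc n) a f = trans (cong (_+ a * f (suc n)) (∑₁-* n a f)) (sym (*-distribˡ-+ a (∑₁ n f) (f (suc n))))

  ∑₁-*ʳ : ∀ n a f → ∑₁ n (λ m → f m * a) ≡ ∑₁ n f * a
  ∑₁-*ʳ n a f = trans (∑₁-cong n (λ m _ _ → *-comm (f m) a)) (trans (∑₁-* n a f) (*-comm a _))

  ∑₁-zero : ∀ n → ∑₁ n (λ _ → 0) ≡ 0
  ∑₁-zero zero    = refl
  ∑₁-zero (suc n) = trans (+-identityʳ _) (∑₁-zero n)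

  ∑₁-const : ∀ n a → ∑₁ n (λ _ → a) ≡ n * a
  ∑₁-const zero    a = refl
  ∑₁-const (suc n) a = trans (cong (_+ a) (∑₁-const n a)) (+-comm (n * a) a)

  ∑₁-swap : ∀ n k (f : ℕ → ℕ → ℕ) → ∑₁ n (λ a → ∑₁ k (f a)) ≡ ∑₁ k (λ b → ∑₁ n (λ a → f a b))
  ∑₁-swap zero    k f = sym (∑₁-zero k)
  ∑₁-swap (suc n) k f = trans (cong (_+ ∑₁ k (f (suc n))) (∑₁-swap n k f)) (sym (∑₁-+ k (λ b → ∑₁ n (λ a → f a b)) (f (suc n))))

  ∑₁-≤ : ∀ n {f c} → (∀ m → 1 ≤ m → m ≤ n → f m ≤ c) → ∑₁ n f ≤ n * c
  ∑₁-≤ n h = ≤-trans (∑₁-mono n h) (≤-reflexive (∑₁-const n _))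

  ∑₁-extend : ∀ {n k} f → n ≤ k → ∑₁ n f ≤ ∑₁ k f
  ∑₁-extend {n} {k} f le with m≤n⇒∃[o]m+o≡n le
  ... | o , refl = go o
    where
    go : ∀ o → ∑₁ n f ≤ ∑₁ (n + o) f
    go zero    = ≤-reflexive (cong (λ t → ∑₁ t f) (sym (+-identityʳ n)))
    go (suc o) = ≤-trans (≤-trans (go o) (m≤m+n _ _)) (≤-reflexive (cong (λ t → ∑₁ t f) (sym (+-suc n o))))

  ∑₁-split : ∀ a b f → ∑₁ (a + b) f ≡ ∑₁ a f + ∑₁ b (λ m → f (a + m))
  ∑₁-split a zero    f = trans (cong (λ t → ∑₁ t f) (+-identityʳ a)) (sym (+-identityʳ _))
  ∑₁-split a (suc b) f = trans (cong (λ t → ∑₁ t f) (+-suc a b)) (trans (cong₂ _+_ (∑₁-split a b f) (cong f (sym (+-suc a b)))) (+-assoc (∑₁ a f) _ _))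

  ∑₁-term : ∀ n f m → 1 ≤ m → m ≤ n → f m ≤ ∑₁ n f
  ∑₁-term zero f .0 () z≤n
  ∑₁-term (suc n) f m l u with m ≟ suc n
  ... | yes refl = m≤n+m _ _
  ... | no ne = ≤-trans (∑₁-term n f m l (≤-pred (≤∧≢⇒< u ne))) (m≤m+n _ _)

  ∑₁-unique : ∀ n f → (∀ m → f m ≤ 1) → (∀ m k → 1 ≤ f m → 1 ≤ f k → m ≡ k) → ∑₁ n f ≤ 1
  ∑₁-unique zero    f b u = z≤n
  ∑₁-unique (suc n) f b u with f (suc n) in e
  ... | zero  = ≤-trans (≤-reflexive (+-identityʳ _)) (∑₁-unique n f b u)
  ... | suc k = ≤-trans (≤-reflexive (cong (_+ suc k) (trans (∑₁-cong n zeros) (∑₁-zero n)))) (subst (_≤ 1) e (b (suc n)))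
    where
    zeros : ∀ m → 1 ≤ m → m ≤ n → f m ≡ 0
    zeros m l le with f m in e′
    ... | zero  = refl
    ... | suc j = ⊥-elim (<-irrefl (u m (suc n) (subst (1 ≤_) (sym e′) (s≤s z≤n)) (subst (1 ≤_) (sym e) (s≤s z≤n))) (s≤s le))

  -- The largest exponent e with b ^ e ≤ n, for b ≥ 2 and n ≥ 1.
  expo′ : ℕ → ℕ → ℕ → ℕ
  expo′ zero    b n = 0
  expo′ (suc k) b n with b ^ suc k ≤? n
  ... | yes _ = suc k
  ... | no _  = expo′ k b n

  expo : ℕ → ℕ → ℕ
  expo b n = expo′ n b n

  expo′-≤ : ∀ k b n → 1 ≤ n → b ^ expo′ k b n ≤ n
  expo′-≤ zero    b n le = le
  expo′-≤ (suc k) b n le with b ^ suc k ≤? n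
  ... | yes h = h
  ... | no _  = expo′-≤ k b n le

  expo-≤ : ∀ b {n} → 1 ≤ n → b ^ expo b n ≤ n
  expo-≤ b {n} = expo′-≤ n b n

  expo′-max : ∀ k b n e → e ≤ k → b ^ e ≤ n → e ≤ expo′ k b n
  expo′-max zero b n e le h = le
  expo′-max (suc k) b n e le h with b ^ suc k ≤? n
  ... | yes _ = le
  ... | no nh = expo′-max k b n e (≤-pred (≤∧≢⇒< le λ { refl → nh h })) h

  n<b^n : ∀ {b} → 2 ≤ b → ∀ n → n < b ^ n
  n<b^n h zero = s≤s z≤n
  n<b^n {b} h (suc n) = ≤-trans (+-mono-≤ (≤-trans (s≤s z≤n) (n<b^n h n)) (n<b^n h n))
    (≤-trans (≤-reflexive (cong (b ^ n +_) (sym (+-identityʳ _)))) (*-monoˡ-≤ (b ^ n) h))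

  expo-max : ∀ {b n} → 2 ≤ b → ∀ e → b ^ e ≤ n → e ≤ expo b n
  expo-max {b} {n} h e le = expo′-max n b n e (<⇒≤ (<-≤-trans (n<b^n h e) le)) le

  <-expo : ∀ {b n} → 2 ≤ b → n < b ^ suc (expo b n)
  <-expo {b} {n} h = ≰⇒> λ le → <-irrefl refl (expo-max h (suc (expo b n)) le)

  expo-mono : ∀ {b m n} → 2 ≤ b → 1 ≤ m → m ≤ n → expo b m ≤ expo b n
  expo-mono {b} {m} h l le = expo-max h (expo b m) (≤-trans (expo-≤ b l) le)

  lg : ℕ → ℕ
  lg = expo 2

  2≤2 : 2 ≤ 2
  2≤2 = ≤-refl

  2^lg≤ : ∀ {n} → 1 ≤ n → 2 ^ lg n ≤ n
  2^lg≤ = expo-≤ 2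

  <2^lg : ∀ n → n < 2 ^ suc (lg n)
  <2^lg n = <-expo {2} {n} 2≤2

  lg-max : ∀ {n} e → 2 ^ e ≤ n → e ≤ lg n
  lg-max = expo-max 2≤2

  lg-mono : ∀ {m n} → 1 ≤ m → m ≤ n → lg m ≤ lg n
  lg-mono = expo-mono 2≤2

  2^-cancel-≤ : ∀ {a b} → 2 ^ a ≤ 2 ^ b → a ≤ b
  2^-cancel-≤ {a} {b} h = ≮⇒≥ λ lt → <-irrefl refl (≤-trans (s≤s h) (^-monoʳ-< 2 ≤-refl lt))

  ^-distribʳ-* : ∀ k a b → (a * b) ^ k ≡ a ^ k * b ^ k
  ^-distribʳ-* zero    a b = refl
  ^-distribʳ-* (suc k) a b = trans (cong (a * b *_) (^-distribʳ-* k a b)) (lem a b (a ^ k) (b ^ k))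
    where lem : ∀ a b x y → a * b * (x * y) ≡ a * x * (b * y)
          lem = solve-∀

-- Divisibility by primes and prime powers.

module PrimeBasics where

  open import Data.Nat
  open import Data.Nat.Properties
  open import Data.Nat.Divisibility
  open import Data.Nat.Primality
  open import Data.Nat.Primality.Factorisation using (factorise)
  open import Data.Nat.Coprimality using (Coprime; coprime-divisor; sym)
  open import Data.Nat.Induction using (<-rec)
  open import Data.List using ([]; _∷_)
  open import Data.Nat.ListAction using (product)
  open import Data.List.Relation.Unary.All using ([]; _∷_)
  open import Data.Product using (_,_; _×_; ∃)
  open import Data.Sum using (inj₁; inj₂)
  open import Data.Empty using (⊥-elim)
  open import Relation.Nullary using (¬_; yes; no)
  import Relation.Binary.PropositionalEquality as ≡
  open ≡ using (_≡_; _≢_; refl; cong; subst; trans)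

  prime>1 : ∀ {p} → Prime p → 2 ≤ p
  prime>1 {p} pp = nonTrivial⇒n>1 p {{prime⇒nonTrivial pp}}

  prime>0 : ∀ {p} → Prime p → 1 ≤ p
  prime>0 pp = <⇒≤ (prime>1 pp)

  ∣⇒≤′ : ∀ {m n} → 1 ≤ n → m ∣ n → m ≤ n
  ∣⇒≤′ {n = suc _} _ d = ∣⇒≤ d

  ∣⇒>0 : ∀ {m n} → 1 ≤ n → m ∣ n → 1 ≤ m
  ∣⇒>0 {zero} {n} le d = ⊥-elim (<-irrefl refl (≤-trans le (≤-reflexive (0∣⇒≡0 d))))
  ∣⇒>0 {suc m} le d = s≤s z≤n

  prime-divisor : ∀ {m} → 2 ≤ m → ∃ λ p → Prime p × p ∣ m
  prime-divisor {m} le with factorise m {{>-nonZero (<⇒≤ le)}}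
  ... | record { factors = [] ; isFactorisation = refl } = ⊥-elim (<-irrefl refl le)
  ... | record { factors = p ∷ ps ; isFactorisation = refl ; factorsPrime = pp ∷ _ } = p , pp , m∣m*n (product ps)

  prime-∣-prime : ∀ {p q} → Prime p → Prime q → p ∣ q → p ≡ q
  prime-∣-prime pp pq d with prime⇒irreducible pq d
  ... | inj₁ refl = ⊥-elim (<-irrefl refl (prime>1 pp))
  ... | inj₂ e    = e

  prime-∤⇒coprime : ∀ {p m} → Prime p → ¬ p ∣ m → Coprime p m
  prime-∤⇒coprime pp nd (d₁ , d₂) with prime⇒irreducible pp d₁
  ... | inj₁ e    = e
  ... | inj₂ refl = ⊥-elim (nd d₂)

  prime-∣-^ : ∀ {p} q u → Prime p → p ∣ q ^ u → p ∣ q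
  prime-∣-^ q zero pp d = ⊥-elim (<-irrefl refl (≤-trans (prime>1 pp) (∣⇒≤ d)))
  prime-∣-^ q (suc u) pp d with euclidsLemma q (q ^ u) pp d
  ... | inj₁ h = h
  ... | inj₂ h = prime-∣-^ q u pp h

  cancel-prime-power : ∀ {p q} → Prime p → Prime q → p ≢ q → ∀ u v {x} → q ^ u ∣ p ^ v * x → q ^ u ∣ x
  cancel-prime-power pp pq ne u zero d = subst (_ ∣_) (*-identityˡ _) d
  cancel-prime-power {p} {q} pp pq ne u (suc v) {x} d = cancel-prime-power pp pq ne u v
    (coprime-divisor (sym (prime-∤⇒coprime pp (λ h → ne (prime-∣-prime pp pq (prime-∣-^ q u pp h))))) (subst (q ^ u ∣_) (*-assoc p (p ^ v) x) d))

  extract : ∀ {p} → Prime p → ∀ k → 1 ≤ k → ∃ λ v → ∃ λ m → k ≡ p ^ v * m × ¬ p ∣ m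
  extract {p} pp = <-rec _ go
    where
    go : ∀ k → (∀ {j} → j < k → 1 ≤ j → ∃ λ v → ∃ λ m → j ≡ p ^ v * m × ¬ p ∣ m) → 1 ≤ k → ∃ λ v → ∃ λ m → k ≡ p ^ v * m × ¬ p ∣ m
    go k rec le with p ∣? k
    ... | no nd = 0 , k , ≡.sym (*-identityˡ k) , nd
    ... | yes (divides zero refl) = ⊥-elim (n≮0 le)
    ... | yes (divides q@(suc _) refl) with rec (subst (q <_) (*-comm p q) (subst (_< p * q) (*-identityˡ q) (*-monoˡ-< q (prime>1 pp)))) (s≤s z≤n)
    ...   | v , m , e , nd = suc v , m , trans (*-comm q p) (trans (cong (p *_) e) (≡.sym (*-assoc p (p ^ v) m))) , nd

  -- The full power of one prime divisor is split off, and the cofactor is treated by induction with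
  -- the corresponding quotient of `D`.
  ∣-by-prime-powers : ∀ k → 1 ≤ k → ∀ D → (∀ p v → Prime p → p ^ v ∣ k → p ^ v ∣ D) → k ∣ D
  ∣-by-prime-powers = <-rec _ go
    where
    go : ∀ k → (∀ {j} → j < k → 1 ≤ j → ∀ D → (∀ p v → Prime p → p ^ v ∣ j → p ^ v ∣ D) → j ∣ D) →
      1 ≤ k → ∀ D → (∀ p v → Prime p → p ^ v ∣ k → p ^ v ∣ D) → k ∣ D
    go k rec le D h with k ≤? 1
    ... | yes le1 = subst (_∣ D) (≤-antisym le le1) (1∣ D)
    ... | no nle with prime-divisor (≰⇒> nle)
    ...   | p , pp , p∣k with extract pp k le
    ...     | v , m , refl , nd with h p v pp (m∣m*n m)
    ...       | divides D′ eD = subst (p ^ v * m ∣_) (trans (*-comm (p ^ v) D′) (≡.sym eD)) (*-monoʳ-∣ (p ^ v) (rec m<k 1≤m D′ h′))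
      where
      1≤m : 1 ≤ m
      1≤m = ∣⇒>0 le (n∣m*n (p ^ v))
      0<v : 1 ≤ v
      0<v = n≢0⇒n>0 λ { refl → nd (subst (p ∣_) (*-identityˡ m) p∣k) }
      m<k : m < p ^ v * m
      m<k = subst (_< p ^ v * m) (*-identityˡ m) (*-monoˡ-< m {{>-nonZero 1≤m}} (≤-trans (prime>1 pp) (≤-trans (≤-reflexive (≡.sym (*-identityʳ p))) (^-monoʳ-≤ p {{>-nonZero (prime>0 pp)}} 0<v))))
      h′ : ∀ q u → Prime q → q ^ u ∣ m → q ^ u ∣ D′
      h′ q zero pq d = 1∣ D′
      h′ q (suc u) pq d = cancel-prime-power pp pq ne (suc u) v (subst (q ^ suc u ∣_) (trans eD (*-comm D′ (p ^ v))) (h q (suc u) pq (∣n⇒∣m*n (p ^ v) d)))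
        where
        ne : p ≢ q
        ne refl = nd (∣-trans (m∣m*n (q ^ u)) d)

-- Chebyshev's lower bound for the number of primes.

module Chebyshev where

  open import Data.Nat
  open import Data.Nat.Properties
  open import Data.Nat.Divisibility
  open import Data.Nat.Primality
  open import Data.Nat.Tactic.RingSolver using (solve-∀)
  open import Data.Product using (_,_)
  open import Data.Empty using (⊥-elim)
  open import Relation.Nullary using (yes; no)
  open import Relation.Binary.PropositionalEquality
  open Sums
  open PrimeBasics

  binom : ℕ → ℕ → ℕ
  binom n       zero    = 1
  binom zero    (suc k) = 0
  binom (suc n) (suc k) = binom n k + binom n (suc k)

  absorption : ∀ n k → suc k * binom (suc n) (suc k) ≡ suc n * binom n k
  absorption zero    zero    = refl
  absorption zero    (suc k) = *-zeroʳ (suc (suc k))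
  absorption (suc n) zero    = cong suc (trans (+-identityʳ _) (trans (+-suc 0 _) (lem n (absorption n 0))))
    where
    lem : ∀ n → 1 * binom (suc n) 1 ≡ suc n * 1 → suc (binom n 1) ≡ suc (n * 1)
    lem n e = trans (sym (+-identityʳ _)) e
  absorption (suc n) (suc k) = trans (lem₁ k (binom (suc n) (suc k)) (binom (suc n) (suc (suc k))))
    (trans (cong₂ (λ a b → binom (suc n) (suc k) + a + b) (absorption n k) (absorption n (suc k)))
           (lem₂ n (binom n k) (binom n (suc k))))
    where
    lem₁ : ∀ k x y → suc (suc k) * (x + y) ≡ x + suc k * x + suc (suc k) * y
    lem₁ = solve-∀
    lem₂ : ∀ n a b → a + b + suc n * a + suc n * b ≡ suc (suc n) * (a + b)
    lem₂ = solve-∀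

  binom-positive : ∀ n k → k ≤ n → 1 ≤ binom n k
  binom-positive n zero le = s≤s z≤n
  binom-positive (suc n) (suc k) (s≤s le) = ≤-trans (binom-positive n k le) (m≤m+n _ _)

  binom-sum : ∀ n → binom n 0 + ∑₁ n (binom n) ≡ 2 ^ n
  binom-sum n = go n
    where
    beyond : ∀ n k → n < k → binom n k ≡ 0
    beyond zero (suc k) lt = refl
    beyond (suc n) (suc k) (s≤s lt) = cong₂ _+_ (beyond n k lt) (beyond n (suc k) (m<n⇒m<1+n lt))
    pascal : ∀ m n → ∑₁ (suc m) (binom (suc n)) ≡ 1 + ∑₁ m (binom n) + ∑₁ (suc m) (binom n)
    pascal zero n = refl
    pascal (suc m) n = trans (cong (_+ (binom n (suc m) + binom n (suc (suc m)))) (pascal m n))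
      (lem (∑₁ m (binom n)) (∑₁ (suc m) (binom n)) (binom n (suc m)) (binom n (suc (suc m))))
      where lem : ∀ a b c d → 1 + a + b + (c + d) ≡ 1 + (a + c) + (b + d)
            lem = solve-∀
    go : ∀ n → 1 + ∑₁ n (binom n) ≡ 2 ^ n
    go zero = refl
    go (suc n) = trans (cong suc (trans (pascal n n) (cong (1 + ∑₁ n (binom n) +_) (trans (cong (∑₁ n (binom n) +_) (beyond n (suc n) ≤-refl)) (+-identityʳ _)))))
      (trans (lem (∑₁ n (binom n))) (cong (2 *_) (go n)))
      where lem : ∀ s → suc (1 + s + s) ≡ 2 * (1 + s)
            lem = solve-∀

  -- The Leibniz harmonic triangle: 1/L(n+1,j+1) = 1/L(n,j) - 1/L(n+1,j) for L(n,j) = (n+1) C(n,j).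
  leibniz : ∀ D n j → j ≤ n → (∀ k → 1 ≤ k → k ≤ suc n → k ∣ D) → suc n * binom n j ∣ D
  leibniz D n zero le h = subst (_∣ D) (sym (*-identityʳ (suc n))) (h (suc n) (s≤s z≤n) ≤-refl)
  leibniz D (suc n) (suc j) (s≤s le) h
    with leibniz D n j le (λ k l u → h k l (m≤n⇒m≤1+n u)) | leibniz D (suc n) j (m≤n⇒m≤1+n le) h
  ... | divides x ex | divides y ey = ∣m+n∣m⇒∣n {m = L * y} (divides x eq) (divides y (*-comm L y))
    where
    a = binom n j
    b = binom (suc n) j
    C = binom (suc n) (suc j)
    A = suc n * a
    B = suc (suc n) * b
    L = suc (suc n) * C
    instance
      B≢0 : NonZero B
      B≢0 = >-nonZero (*-mono-≤ {1} {suc (suc n)} (s≤s z≤n) (binom-positive (suc n) j (m≤n⇒m≤1+n le)))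
    ab : ∀ j → suc n * binom n j + j * binom (suc n) j ≡ suc n * binom (suc n) j
    ab zero    = +-identityʳ _
    ab (suc j) = trans (cong (suc n * binom n (suc j) +_) (absorption n j))
      (lem (suc n) (binom n (suc j)) (binom n j))
      where lem : ∀ N x y → N * x + N * y ≡ N * (y + x)
            lem = solve-∀
    -- Divided by A B L this reads 1/L + 1/B = 1/A.
    key : A * B + L * A ≡ L * B
    key = trans (lem (suc n) a (suc (suc n)) b C)
      (trans (cong (λ t → suc (suc n) * (t * b + C * A)) (sym (absorption n j)))
      (trans (lem₂ (suc (suc n)) j C b A) (cong (λ t → suc (suc n) * C * (b + t)) (trans (+-comm (j * b) A) (ab j)))))
      where
      lem : ∀ N a N′ b C → N * a * (N′ * b) + N′ * C * (N * a) ≡ N′ * (N * a * b + C * (N * a))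
      lem = solve-∀
      lem₂ : ∀ N′ j C b A → N′ * (suc j * C * b + C * A) ≡ N′ * C * (b + (j * b + A))
      lem₂ = solve-∀
    eq : L * y + D ≡ x * L
    eq = *-cancelˡ-≡ _ _ B (trans (*-distribˡ-+ B (L * y) D) (trans (cong₂ (λ s t → s + B * t) (trans (lem₁ B L y) (cong (L *_) (sym ey))) ex)
      (trans (cong (λ t → L * t + B * (x * A)) ex) (trans (lem₂ L x A B) (trans (cong (x *_) key) (lem₃ x L B))))))
      where
      lem₁ : ∀ B L y → B * (L * y) ≡ L * (y * B)
      lem₁ = solve-∀
      lem₂ : ∀ L x A B → L * (x * A) + B * (x * A) ≡ x * (A * B + L * A)
      lem₂ = solve-∀
      lem₃ : ∀ x L B → x * (L * B) ≡ B * (x * L)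
      lem₃ = solve-∀

  primeCount : ℕ → ℕ
  primeCount n = ∑₁ n (λ m → ♯ (prime? m))

  -- For j = n this is the least common multiple of 1, ..., n.
  primePowers : ℕ → ℕ → ℕ
  primePowers n zero    = 1
  primePowers n (suc j) with prime? (suc j)
  ... | yes _ = suc j ^ expo (suc j) n * primePowers n j
  ... | no _  = primePowers n j

  primePowers-≤ : ∀ n j → 1 ≤ n → primePowers n j ≤ n ^ primeCount j
  primePowers-≤ n zero le = ≤-refl
  primePowers-≤ n (suc j) le with prime? (suc j)
  ... | no _  = ≤-trans (primePowers-≤ n j le) (≤-reflexive (cong (n ^_) (sym (+-identityʳ (primeCount j)))))
  ... | yes _ = ≤-trans (*-mono-≤ (expo-≤ (suc j) le) (primePowers-≤ n j le)) (≤-reflexive (cong (n ^_) (+-comm 1 (primeCount j))))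

  ^-∣ : ∀ p {v e} → v ≤ e → p ^ v ∣ p ^ e
  ^-∣ p {v} {e} le with m≤n⇒∃[o]m+o≡n le
  ... | o , refl = subst (p ^ v ∣_) (sym (^-distribˡ-+-* p v o)) (m∣m*n (p ^ o))

  primePowers-∣ : ∀ n j p v → Prime p → p ≤ j → p ^ v ≤ n → p ^ v ∣ primePowers n j
  primePowers-∣ n zero p v pp le h = ⊥-elim (n≮0 (≤-trans (prime>0 pp) le))
  primePowers-∣ n (suc j) p v pp le h with prime? (suc j) | p ≟ suc j
  ... | yes _ | yes refl = ∣m⇒∣m*n (primePowers n j) (^-∣ p (expo-max (prime>1 pp) v h))
  ... | yes _ | no ne = ∣n⇒∣m*n (suc j ^ expo (suc j) n) (primePowers-∣ n j p v pp (≤-pred (≤∧≢⇒< le ne)) h)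
  ... | no np | yes refl = ⊥-elim (np pp)
  ... | no _  | no ne = primePowers-∣ n j p v pp (≤-pred (≤∧≢⇒< le ne)) h

  primePowers-multiple : ∀ n k → 1 ≤ k → k ≤ n → k ∣ primePowers n n
  primePowers-multiple n k l u = ∣-by-prime-powers k l (primePowers n n) h
    where
    h : ∀ p v → Prime p → p ^ v ∣ k → p ^ v ∣ primePowers n n
    h p zero    pp d = 1∣ _
    h p (suc v) pp d = primePowers-∣ n n p (suc v) pp (≤-trans (∣⇒≤′ l (∣-trans (m∣m*n (p ^ v)) d)) u) (≤-trans (∣⇒≤′ l d) u)

  primePowers-positive : ∀ n j → 1 ≤ n → 1 ≤ primePowers n j
  primePowers-positive n zero le = ≤-refl
  primePowers-positive n (suc j) le with prime? (suc j)
  ... | yes _ = *-mono-≤ {1} (m^n>0 (suc j) (expo (suc j) n)) (primePowers-positive n j le)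
  ... | no _  = primePowers-positive n j le

  -- Every (n + 1) C(n, j) divides the least common multiple `D` of 1, ..., n + 1. Adding these n +
  -- 1 inequalities gives (n + 1) 2^n ≤ (n + 1) D, while `D` has one factor of at most n + 1 for
  -- each prime.
  chebyshev : ∀ n → 2 ^ n ≤ suc n ^ primeCount (suc n)
  chebyshev n = ≤-trans (*-cancelˡ-≤ (suc n) bound) (primePowers-≤ (suc n) (suc n) (s≤s z≤n))
    where
    D = primePowers (suc n) (suc n)
    each : ∀ j → j ≤ n → suc n * binom n j ≤ D
    each j le = ∣⇒≤′ (primePowers-positive (suc n) (suc n) (s≤s z≤n)) (leibniz D n j le (primePowers-multiple (suc n)))
    bound : suc n * 2 ^ n ≤ suc n * D
    bound = ≤-trans (≤-reflexive (trans (cong (suc n *_) (sym (binom-sum n))) (trans (*-distribˡ-+ (suc n) 1 (∑₁ n (binom n))) (cong (suc n * 1 +_) (sym (∑₁-* n (suc n) (binom n)))))))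
      (+-mono-≤ (each 0 z≤n) (∑₁-≤ n (λ j _ u → each j u)))

  primeCount-lower : ∀ n → n ≤ suc (lg (suc n)) * primeCount (suc n)
  primeCount-lower n = 2^-cancel-≤ (≤-trans (chebyshev n) (≤-trans (^-monoˡ-≤ (primeCount (suc n)) (<⇒≤ (<2^lg (suc n))))
    (≤-reflexive (^-*-assoc 2 (suc (lg (suc n))) (primeCount (suc n))))))

-- Multiples in intervals and in arithmetic progressions.

module Multiples where

  open import Data.Nat
  open import Data.Nat.Properties
  open import Data.Nat.Divisibility
  open import Data.Nat.DivMod
  open import Data.Nat.Coprimality using (Coprime; coprime-divisor; coprime-Bézout)
  import Data.Nat.Coprimality as Cop
  open import Data.Nat.GCD using (module Bézout)
  open import Data.Nat.Tactic.RingSolver using (solve-∀)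
  open import Data.Product using (_,_; _×_; ∃; proj₁; proj₂)
  open import Relation.Nullary using (yes; no)
  open import Relation.Binary.PropositionalEquality
  open Sums

  -- The rounded quotient of `N` by `l`, written as a count so that sums over `l` and over its
  -- multiples can be interchanged.
  mult : ℕ → ℕ → ℕ
  mult N l = ∑₁ N (λ m → ♯ (l ∣? m))

  mult-spec : ∀ N {l} → 1 ≤ l → mult N l * l ≤ N × N < suc (mult N l) * l
  mult-spec zero {l} le = z≤n , ≤-trans le (≤-reflexive (sym (*-identityˡ l)))
  mult-spec (suc N) {l} le with mult-spec N le | l ∣? suc N
  ... | lo , hi | no nd = ≤-trans (≤-reflexive (cong (_* l) (+-identityʳ (mult N l)))) (m≤n⇒m≤1+n lo) ,
          subst (λ t → suc N < suc t * l) (sym (+-identityʳ (mult N l))) (≤∧≢⇒< hi λ e → nd (divides (suc (mult N l)) e))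
  ... | lo , hi | yes (divides q e) = ≤-reflexive (trans (cong (_* l) (trans (+-comm (mult N l) 1) (sym q≡))) (sym e)) ,
          subst (λ t → suc N < suc t * l) (trans q≡ (+-comm 1 (mult N l))) (subst (_< suc q * l) (sym e) (m<n+m (q * l) le))
    where
    q≡ : q ≡ suc (mult N l)
    q≡ = ≤-antisym (*-cancelʳ-≤ q (suc (mult N l)) l {{>-nonZero le}} (subst (_≤ suc (mult N l) * l) e hi))
                   (*-cancelʳ-< l (mult N l) q (subst (mult N l * l <_) e (s≤s lo)))

  mult≡/ : ∀ N l .{{_ : NonZero l}} → N / l ≡ mult N l
  mult≡/ N l with mult-spec N {l} (>-nonZero⁻¹ l)
  ... | lo , hi = ≤-antisym (≤-pred (m<n*o⇒m/o<n {N} {suc (mult N l)} {l} hi)) (subst (_≤ N / l) (m*n/n≡m (mult N l) l) (/-monoˡ-≤ l lo))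

  ∑₁-multiples : ∀ z p .{{_ : NonZero p}} (f : ℕ → ℕ) → ∑₁ z (λ e → ♯ (p ∣? e) * f e) ≡ ∑₁ (z / p) (λ e → f (p * e))
  ∑₁-multiples z p f = trans (go z) (cong (λ t → ∑₁ t (λ e → f (p * e))) (sym (mult≡/ z p)))
    where
    go : ∀ z → ∑₁ z (λ e → ♯ (p ∣? e) * f e) ≡ ∑₁ (mult z p) (λ e → f (p * e))
    go zero = refl
    go (suc z) with p ∣? suc z in eq
    ... | no _ = trans (+-identityʳ _) (trans (go z) (cong (λ t → ∑₁ t (λ e → f (p * e))) (sym (+-identityʳ (mult z p)))))
    ... | yes (divides q e) = trans (cong₂ _+_ (go z) (trans (+-identityʳ _) (cong f (trans e (trans (*-comm q p) (cong (p *_) q≡))))))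
            (cong (λ t → ∑₁ t (λ e → f (p * e))) (+-comm 1 (mult z p)))
      where
      q≡ : q ≡ suc (mult z p)
      q≡ with mult-spec z {p} (>-nonZero⁻¹ p)
      ... | lo , hi = ≤-antisym (*-cancelʳ-≤ q (suc (mult z p)) p (subst (_≤ suc (mult z p) * p) e hi))
                       (*-cancelʳ-< p (mult z p) q (subst (mult z p * p <_) e (s≤s lo)))

  -- In the progression a + d k the multiples of e, coprime to d, form a single residue class of k.
  residue : ∀ a d e → Coprime d e → ∃ λ c → ∀ k → (e ∣ a + d * k → e ∣ c + k) × (e ∣ c + k → e ∣ a + d * k)
  residue a d e cop with coprime-Bézout cop
  ... | Bézout.+- x y eq = a * x , λ k →
          (λ h → coprime-divisor (Cop.sym cop) (subst (e ∣_) (id₁ k) (∣m∣n⇒∣m+n h (n∣m*n (a * y))))) ,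
          (λ h → ∣m+n∣m⇒∣n (subst (e ∣_) (trans (sym (id₁ k)) (+-comm (a + d * k) (a * y * e))) (∣n⇒∣m*n d h)) (n∣m*n (a * y)))
    where
    id₁ : ∀ k → a + d * k + a * y * e ≡ d * (a * x + k)
    id₁ k = trans (lem a d k y e) (trans (cong (λ t → a * t + d * k) eq) (lem₂ a d k x))
      where
      lem : ∀ a d k y e → a + d * k + a * y * e ≡ a * (1 + y * e) + d * k
      lem = solve-∀
      lem₂ : ∀ a d k x → a * (x * d) + d * k ≡ d * (a * x + k)
      lem₂ = solve-∀
  ... | Bézout.-+ x y eq = a * x * (d * x) , λ k →
          (λ h → coprime-divisor (Cop.sym cop) (∣m+n∣m⇒∣n (subst (e ∣_) (id₁ k) (∣m∣n⇒∣m+n h (n∣m*n (a * y * (y * e))))) (n∣m*n (a * y + a * y)))) ,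
          (λ h → ∣m+n∣m⇒∣n (subst (e ∣_) (trans (sym (id₁ k)) (+-comm (a + d * k) (a * y * (y * e) * e))) (∣m∣n⇒∣m+n (n∣m*n (a * y + a * y)) (∣n⇒∣m*n d h))) (n∣m*n (a * y * (y * e))))
    where
    -- d x ≡ -1, so d (a x (d x)) ≡ a.
    id₁ : ∀ k → a + d * k + a * y * (y * e) * e ≡ (a * y + a * y) * e + d * (a * x * (d * x) + k)
    id₁ k = trans (lem a d k (y * e) y e) (trans (cong (λ t → a + d * k + a * (t * t)) (sym eq))
      (trans (lem₂ a d k (x * d)) (trans (cong (λ t → a * (t + t) + (d * k + a * (x * d * (x * d)))) eq) (lem₃ a d k x y e))))
      where
      lem : ∀ a d k t y e → a + d * k + a * y * t * e ≡ a + d * k + a * (y * e * t)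
      lem = solve-∀
      lem₂ : ∀ a d k t → a + d * k + a * ((1 + t) * (1 + t)) ≡ a * ((1 + t) + (1 + t)) + (d * k + a * (t * t))
      lem₂ = solve-∀
      lem₃ : ∀ a d k x y e → a * (y * e + y * e) + (d * k + a * (x * d * (x * d))) ≡ (a * y + a * y) * e + d * (a * x * (d * x) + k)
      lem₃ = solve-∀

  count-progression : ∀ a d e → 1 ≤ e → Coprime d e → ∀ K →
    let cnt = ∑₁ K (λ k → ♯ (e ∣? (a + d * k))) in (cnt * e ≤ K + e) × (K ≤ cnt * e + e)
  count-progression a d e le cop K with residue a d e cop
  ... | c , h = upper , lower
    where
    cnt = ∑₁ K (λ k → ♯ (e ∣? (a + d * k)))
    eq : mult (c + K) e ≡ mult c e + cnt
    eq = trans (∑₁-split c K _) (cong (mult c e +_) (∑₁-cong K (λ k _ _ → ≤-antisym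
      (♯-mono (e ∣? (c + k)) (e ∣? (a + d * k)) (proj₂ (h k))) (♯-mono (e ∣? (a + d * k)) (e ∣? (c + k)) (proj₁ (h k))))))
    s₁ = mult-spec (c + K) le
    s₀ = mult-spec c le
    upper : cnt * e ≤ K + e
    upper = +-cancelˡ-≤ (mult c e * e) _ _ (begin
      mult c e * e + cnt * e ≡⟨ sym (*-distribʳ-+ e (mult c e) cnt) ⟩
      (mult c e + cnt) * e   ≡⟨ cong (_* e) (sym eq) ⟩
      mult (c + K) e * e     ≤⟨ proj₁ s₁ ⟩
      c + K                  ≤⟨ +-monoˡ-≤ K (<⇒≤ (proj₂ s₀)) ⟩
      e + mult c e * e + K   ≡⟨ lem e (mult c e * e) K ⟩
      mult c e * e + (K + e) ∎)
      where open ≤-Reasoning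
            lem : ∀ a b c → a + b + c ≡ b + (c + a)
            lem = solve-∀
    lower : K ≤ cnt * e + e
    lower = +-cancelˡ-≤ c _ _ (begin
      c + K                          ≤⟨ <⇒≤ (proj₂ s₁) ⟩
      e + mult (c + K) e * e         ≡⟨ cong (λ t → e + t * e) eq ⟩
      e + (mult c e + cnt) * e       ≡⟨ lem e (mult c e) cnt ⟩
      mult c e * e + (cnt * e + e)   ≤⟨ +-monoˡ-≤ _ (proj₁ s₀) ⟩
      c + (cnt * e + e)              ∎)
      where open ≤-Reasoning
            lem : ∀ e m c → e + (m + c) * e ≡ m * e + (c * e + e)
            lem = solve-∀

-- Selberg's sieve.

module Selberg where

  open import Data.Nat as ℕ using (ℕ; zero; suc; _≤_; s≤s; z≤n; _∸_)
  import Data.Nat.Properties as ℕ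
  import Data.Nat.DivMod as ℕ
  open import Data.Nat.Divisibility using (_∣_; _∣?_; ∣-trans; m∣m*n; n∣m*n; *-pres-∣; divides)
  open import Data.Nat.Coprimality using (Coprime; coprime-divisor)
  import Data.Nat.Coprimality as Cop
  open import Data.Nat.Primality using (Prime; euclidsLemma)
  open import Data.Integer as ℤ using (ℤ; +_; 0ℤ; 1ℤ; _+_; _-_; _*_; -_; ∣_∣; +≤+)
  import Data.Integer.Properties as ℤ
  open import Data.Integer.Tactic.RingSolver using (solve-∀)
  open import Data.List using (List; []; _∷_)
  open import Data.List.Relation.Unary.All using (All; []; _∷_)
  open import Data.List.Relation.Unary.AllPairs using (AllPairs; []; _∷_)
  open import Data.Product using (_,_; _×_; proj₁; proj₂)
  open import Data.Sum using (inj₁; inj₂)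
  open import Data.Empty using (⊥)
  open import Relation.Nullary using (¬_; Dec; yes; no)
  open import Relation.Binary.PropositionalEquality
  open FiniteSum
  open Orbit using (indicator; indicator-yes; indicator-no)
  open Sums
  open PrimeBasics
  open Multiples

  -- Multilinear polynomials in the indicators of divisibility by the primes of a list.
  Poly : List ℕ → Set
  Poly []       = ℤ
  Poly (p ∷ ps) = Poly ps × Poly ps

  ev : ∀ ps → Poly ps → ℕ → ℤ
  ev []       a       m = a
  ev (p ∷ ps) (A , B) m = ev ps A m + indicator (p ∣? m) * ev ps B m

  lin : ∀ ps → ℤ → Poly ps → ℤ → Poly ps → Poly ps
  lin []       a A b B = a * A + b * B
  lin (p ∷ ps) a (A , A′) b (B , B′) = lin ps a A b B , lin ps a A′ b B′

  -- The mean value of a product, times the product of the primes.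
  mean : ∀ ps → Poly ps → Poly ps → ℤ
  mean []       a b = a * b
  mean (p ∷ ps) (A , B) (A′ , B′) = + p * mean ps A A′ + mean ps A B′ + mean ps B A′ + mean ps B B′

  norm : ∀ ps → Poly ps → ℕ
  norm []       a       = ∣ a ∣
  norm (p ∷ ps) (A , B) = norm ps A ℕ.+ norm ps B

  Π Φ : List ℕ → ℕ
  Π []       = 1
  Π (p ∷ ps) = p ℕ.* Π ps
  Φ []       = 1
  Φ (p ∷ ps) = (p ∸ 1) ℕ.* Φ ps

  ev-lin : ∀ ps a A b B m → ev ps (lin ps a A b B) m ≡ a * ev ps A m + b * ev ps B m
  ev-lin []       a A b B m = refl
  ev-lin (p ∷ ps) a (A , A′) b (B , B′) m = trans (cong₂ (λ s t → s + indicator (p ∣? m) * t) (ev-lin ps a A b B m) (ev-lin ps a A′ b B′ m))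
    (lem a b (indicator (p ∣? m)) (ev ps A m) (ev ps B m) (ev ps A′ m) (ev ps B′ m))
    where lem : ∀ a b i x y x′ y′ → a * x + b * y + i * (a * x′ + b * y′) ≡ a * (x + i * x′) + b * (y + i * y′)
          lem = solve-∀

  mean-lin : ∀ ps a A b B C → mean ps (lin ps a A b B) C ≡ a * mean ps A C + b * mean ps B C
  mean-lin [] a A b B C = lem a A b B C
    where lem : ∀ a A b B C → (a * A + b * B) * C ≡ a * (A * C) + b * (B * C)
          lem = solve-∀
  mean-lin (p ∷ ps) a (A , A′) b (B , B′) (C , C′)
    rewrite mean-lin ps a A b B C | mean-lin ps a A b B C′ | mean-lin ps a A′ b B′ C | mean-lin ps a A′ b B′ C′ =
    lem a b (+ p) (mean ps A C) (mean ps B C) (mean ps A C′) (mean ps B C′) (mean ps A′ C) (mean ps B′ C) (mean ps A′ C′) (mean ps B′ C′)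
    where lem : ∀ a b p x y x₁ y₁ x₂ y₂ x₃ y₃ → p * (a * x + b * y) + (a * x₁ + b * y₁) + (a * x₂ + b * y₂) + (a * x₃ + b * y₃) ≡
                a * (p * x + x₁ + x₂ + x₃) + b * (p * y + y₁ + y₂ + y₃)
          lem = solve-∀

  mean-sym : ∀ ps A B → mean ps A B ≡ mean ps B A
  mean-sym [] a b = ℤ.*-comm a b
  mean-sym (p ∷ ps) (A , A′) (B , B′) rewrite mean-sym ps A B | mean-sym ps A B′ | mean-sym ps A′ B | mean-sym ps A′ B′ =
    lem (+ p * mean ps B A) (mean ps B′ A) (mean ps B A′) (mean ps B′ A′)
    where lem : ∀ a b c d → a + b + c + d ≡ a + c + b + d
          lem = solve-∀

  norm-lin : ∀ ps a A b B → norm ps (lin ps a A b B) ≤ ∣ a ∣ ℕ.* norm ps A ℕ.+ ∣ b ∣ ℕ.* norm ps B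
  norm-lin [] a A b B = ℕ.≤-trans (ℤ.∣i+j∣≤∣i∣+∣j∣ (a * A) (b * B)) (ℕ.≤-reflexive (cong₂ ℕ._+_ (ℤ.abs-* a A) (ℤ.abs-* b B)))
  norm-lin (p ∷ ps) a (A , A′) b (B , B′) = ℕ.≤-trans (ℕ.+-mono-≤ (norm-lin ps a A b B) (norm-lin ps a A′ b B′))
    (ℕ.≤-reflexive (lem ∣ a ∣ ∣ b ∣ (norm ps A) (norm ps B) (norm ps A′) (norm ps B′)))
    where
    open import Data.Nat.Tactic.RingSolver using () renaming (solve-∀ to ℕ-solve-∀)
    lem : ∀ a b x y x′ y′ → a ℕ.* x ℕ.+ b ℕ.* y ℕ.+ (a ℕ.* x′ ℕ.+ b ℕ.* y′) ≡ a ℕ.* (x ℕ.+ x′) ℕ.+ b ℕ.* (y ℕ.+ y′)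
    lem = ℕ-solve-∀

  -- Selberg's weights: F = Σ μ(e) ψ_e over squarefree e ≤ z, scaled by Φ, where ψ_p = p 1_p - 1, and G is its value at
  -- numbers free of the primes of the list.
  F : ∀ ps → ℕ → Poly ps
  F []             zero    = 0ℤ
  F []             (suc z) = 1ℤ
  F (zero ∷ ps)    z = lin ps 0ℤ (F ps z) 0ℤ (F ps z) , lin ps 0ℤ (F ps z) 0ℤ (F ps z)
  F (p@(suc p′) ∷ ps) z = lin ps (+ p′) (F ps z) 1ℤ (F ps (z ℕ./ p)) , lin ps 0ℤ (F ps z) (- + p) (F ps (z ℕ./ p))

  -- Relative to `Φ`, `G` is the sum of 1/φ(e) and `T` that of σ(e)/φ(e) over the squarefree e ≤ z
  -- composed of primes of the list. `T` bounds the absolute coefficients of `F`, since ψ_p has the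
  -- coefficients p and -1.
  G T : List ℕ → ℕ → ℕ
  G []             zero    = 0
  G []             (suc z) = 1
  G (zero ∷ ps)    z = 0
  G (p@(suc p′) ∷ ps) z = p′ ℕ.* G ps z ℕ.+ G ps (z ℕ./ p)
  T []             zero    = 0
  T []             (suc z) = 1
  T (zero ∷ ps)    z = 0
  T (p@(suc p′) ∷ ps) z = p′ ℕ.* T ps z ℕ.+ suc p ℕ.* T ps (z ℕ./ p)

  Free : List ℕ → ℕ → Set
  Free ps m = All (λ p → ¬ p ∣ m) ps

  F-free : ∀ ps → All (1 ≤_) ps → ∀ z m → Free ps m → ev ps (F ps z) m ≡ + G ps z
  F-free [] _ zero    m fr = refl
  F-free [] _ (suc z) m fr = refl
  F-free (p@(suc p′) ∷ ps) (_ ∷ pos) z m (np ∷ fr)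
    rewrite indicator-no (p ∣? m) np | ev-lin ps (+ p′) (F ps z) 1ℤ (F ps (z ℕ./ p)) m | F-free ps pos z m fr | F-free ps pos (z ℕ./ p) m fr =
    trans (lem (+ p′) (+ G ps z) (+ G ps (z ℕ./ p))  (ev ps (lin ps 0ℤ (F ps z) (- + p) (F ps (z ℕ./ p))) m))
          (trans (cong (_+ + G ps (z ℕ./ p)) (sym (ℤ.pos-* p′ (G ps z)))) (sym (ℤ.pos-+ (p′ ℕ.* G ps z) _)))
    where lem : ∀ a x y w → a * x + 1ℤ * y + 0ℤ * w ≡ a * x + y
          lem = solve-∀

  norm-F : ∀ ps → All (1 ≤_) ps → ∀ z → norm ps (F ps z) ≤ T ps z
  norm-F [] _ zero    = z≤n
  norm-F [] _ (suc z) = ℕ.≤-refl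
  norm-F (p@(suc p′) ∷ ps) (_ ∷ pos) z = ℕ.≤-trans (ℕ.+-mono-≤ (norm-lin ps (+ p′) (F ps z) 1ℤ (F ps (z ℕ./ p))) (norm-lin ps 0ℤ (F ps z) (- + p) (F ps (z ℕ./ p))))
    (ℕ.≤-trans (ℕ.≤-reflexive (lem p′ (norm ps (F ps z)) (norm ps (F ps (z ℕ./ p)))))
      (ℕ.+-mono-≤ (ℕ.*-monoʳ-≤ p′ (norm-F ps pos z)) (ℕ.*-monoʳ-≤ (suc p) (norm-F ps pos (z ℕ./ p)))))
    where
    open import Data.Nat.Tactic.RingSolver using () renaming (solve-∀ to ℕ-solve-∀)
    lem : ∀ q x y → q ℕ.* x ℕ.+ 1 ℕ.* y ℕ.+ (0 ℕ.* x ℕ.+ suc q ℕ.* y) ≡ q ℕ.* x ℕ.+ suc (suc q) ℕ.* y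
    lem = ℕ-solve-∀

  -- The functions ψ_e are orthogonal, and ψ_e² has mean φ(e).
  mean-F : ∀ ps → All (1 ≤_) ps → ∀ z → mean ps (F ps z) (F ps z) ≡ + (Π ps ℕ.* (Φ ps ℕ.* G ps z))
  mean-F [] _ zero    = refl
  mean-F [] _ (suc z) = refl
  mean-F (p@(suc p′) ∷ ps) (_ ∷ pos) z = trans step (trans (cong₂ (λ s t → + p * (+ p′ * + p′) * s + + p * + p′ * t) (mean-F ps pos z) (mean-F ps pos (z ℕ./ p))) final)
    where
    A  = F ps z
    A′ = F ps (z ℕ./ p)
    U  = lin ps (+ p′) A 1ℤ A′
    V  = lin ps 0ℤ A (- + p) A′
    x  = mean ps A A
    y  = mean ps A A′
    w  = mean ps A′ A′
    UU : mean ps U U ≡ + p′ * (+ p′ * x + 1ℤ * y) + 1ℤ * (+ p′ * y + 1ℤ * w)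
    UU = trans (mean-lin ps (+ p′) A 1ℤ A′ U) (cong₂ (λ s t → + p′ * s + 1ℤ * t)
      (trans (mean-sym ps A U) (trans (mean-lin ps (+ p′) A 1ℤ A′ A) (cong (λ t → + p′ * x + 1ℤ * t) (mean-sym ps A′ A))))
      (trans (mean-sym ps A′ U) (mean-lin ps (+ p′) A 1ℤ A′ A′)))
    UV : mean ps U V ≡ + p′ * (0ℤ * x + - + p * y) + 1ℤ * (0ℤ * y + - + p * w)
    UV = trans (mean-lin ps (+ p′) A 1ℤ A′ V) (cong₂ (λ s t → + p′ * s + 1ℤ * t)
      (trans (mean-sym ps A V) (trans (mean-lin ps 0ℤ A (- + p) A′ A) (cong (λ t → 0ℤ * x + - + p * t) (mean-sym ps A′ A))))
      (trans (mean-sym ps A′ V) (mean-lin ps 0ℤ A (- + p) A′ A′)))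
    VV : mean ps V V ≡ 0ℤ * (mean ps A V) + - + p * (0ℤ * y + - + p * w)
    VV = trans (mean-lin ps 0ℤ A (- + p) A′ V) (cong (λ t → 0ℤ * mean ps A V + - + p * t) (trans (mean-sym ps A′ V) (mean-lin ps 0ℤ A (- + p) A′ A′)))
    step : + p * mean ps U U + mean ps U V + mean ps V U + mean ps V V ≡ + p * (+ p′ * + p′) * x + + p * + p′ * w
    step = trans (cong₂ _+_ (cong₂ _+_ (cong₂ _+_ (cong (+ p *_) UU) UV) (trans (mean-sym ps V U) UV)) VV)
                 (lem (+ p′) x y w (mean ps A V))
      where
      lem : ∀ q x y w v → (1ℤ + q) * (q * (q * x + 1ℤ * y) + 1ℤ * (q * y + 1ℤ * w)) + (q * (0ℤ * x + - (1ℤ + q) * y) + 1ℤ * (0ℤ * y + - (1ℤ + q) * w))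
          + (q * (0ℤ * x + - (1ℤ + q) * y) + 1ℤ * (0ℤ * y + - (1ℤ + q) * w)) + (0ℤ * v + - (1ℤ + q) * (0ℤ * y + - (1ℤ + q) * w)) ≡ (1ℤ + q) * (q * q) * x + (1ℤ + q) * q * w
      lem = solve-∀
    final : + p * (+ p′ * + p′) * + (Π ps ℕ.* (Φ ps ℕ.* G ps z)) + + p * + p′ * + (Π ps ℕ.* (Φ ps ℕ.* G ps (z ℕ./ p))) ≡
            + (p ℕ.* Π ps ℕ.* (p′ ℕ.* Φ ps ℕ.* (p′ ℕ.* G ps z ℕ.+ G ps (z ℕ./ p))))
    final = trans (cong₂ _+_ (cong₂ _*_ (trans (cong (+ p *_) (sym (ℤ.pos-* p′ p′))) (sym (ℤ.pos-* p (p′ ℕ.* p′)))) refl) (cong (_* + (Π ps ℕ.* (Φ ps ℕ.* G ps (z ℕ./ p)))) (sym (ℤ.pos-* p p′))))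
      (trans (cong₂ _+_ (sym (ℤ.pos-* (p ℕ.* (p′ ℕ.* p′)) _)) (sym (ℤ.pos-* (p ℕ.* p′) _))) (trans refl (cong +_ (lem p p′ (Π ps) (Φ ps) (G ps z) (G ps (z ℕ./ p))))))
      where
      open import Data.Nat.Tactic.RingSolver using () renaming (solve-∀ to ℕ-solve-∀)
      lem : ∀ p q a b g h → p ℕ.* (q ℕ.* q) ℕ.* (a ℕ.* (b ℕ.* g)) ℕ.+ p ℕ.* q ℕ.* (a ℕ.* (b ℕ.* h)) ≡ p ℕ.* a ℕ.* (q ℕ.* b ℕ.* (q ℕ.* g ℕ.+ h))
      lem = ℕ-solve-∀

  module Progression (a d K : ℕ) where

    private
      m : ℕ → ℕ
      m i = a ℕ.+ d ℕ.* suc i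

    -- Expanding by one prime after another meets the multiples of every product `e` of some of
    -- them; each `e` has to be coprime to the next prime and to the difference `d`.
    Good : ℕ → List ℕ → Set
    Good e []       = 1 ≤ e × Coprime d e
    Good e (p ∷ ps) = Coprime e p × Good e ps × Good (e ℕ.* p) ps

    private
      count : ∀ e → ∑ K (λ i → indicator (e ∣? m i)) ≡ + ∑₁ K (λ k → ♯ (e ∣? (a ℕ.+ d ℕ.* k)))
      count e = go K
        where
        same : ∀ {X : Set} (x : Dec X) → indicator x ≡ + ♯ x
        same (yes _) = refl
        same (no _)  = refl
        go : ∀ K → ∑ K (λ i → indicator (e ∣? m i)) ≡ + ∑₁ K (λ k → ♯ (e ∣? (a ℕ.+ d ℕ.* k)))
        go zero    = refl
        go (suc K) = trans (cong₂ _+_ (go K) (same (e ∣? m K))) refl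

      indicator-* : ∀ e p i → Coprime e p → indicator (e ∣? i) * indicator (p ∣? i) ≡ indicator ((e ℕ.* p) ∣? i)
      indicator-* e p i cop with e ∣? i | p ∣? i
      ... | yes d₁ | yes d₂ = sym (indicator-yes ((e ℕ.* p) ∣? i) (both d₁ d₂))
        where
        both : e ∣ i → p ∣ i → e ℕ.* p ∣ i
        both (divides q refl) d₂ = subst (e ℕ.* p ∣_) (ℕ.*-comm e q) (*-pres-∣ (divides 1 (sym (ℕ.*-identityˡ e))) (coprime-divisor (Cop.sym cop) (subst (p ∣_) (ℕ.*-comm q e) d₂)))
      ... | yes _  | no n₂  = sym (indicator-no ((e ℕ.* p) ∣? i) (λ h → n₂ (∣-trans (n∣m*n e) h)))
      ... | no n₁  | yes _  = sym (indicator-no ((e ℕ.* p) ∣? i) (λ h → n₁ (∣-trans (m∣m*n p) h)))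
      ... | no n₁  | no _   = sym (indicator-no ((e ℕ.* p) ∣? i) (λ h → n₁ (∣-trans (m∣m*n p) h)))

      bound : ∀ e K c x → c ℕ.* e ≤ K ℕ.+ e → K ≤ c ℕ.* e ℕ.+ e → + (e ℕ.* c) * x ℤ.≤ + K * x + + (e ℕ.* ∣ x ∣)
      bound e K c x up lo = ℤ.≤-trans (ℤ.≤-reflexive (lem (+ (e ℕ.* c)) (+ K) x)) (ℤ.+-monoʳ-≤ (+ K * x) (ℤ.≤-trans (i≤∣i∣ _)
        (+≤+ (ℕ.≤-trans (ℕ.≤-reflexive (ℤ.abs-* (+ (e ℕ.* c) - + K) x)) (ℕ.*-monoˡ-≤ ∣ x ∣ close)))))
        where
        lem : ∀ u k x → u * x ≡ k * x + (u - k) * x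
        lem = solve-∀
        i≤∣i∣ : ∀ i → i ℤ.≤ + ∣ i ∣
        i≤∣i∣ (+ n)      = ℤ.≤-refl
        i≤∣i∣ ℤ.-[1+ n ] = ℤ.-≤+
        close : ∣ + (e ℕ.* c) - + K ∣ ≤ e
        close with ℕ.≤-total K (e ℕ.* c)
        ... | inj₁ le = subst (_≤ e) (sym (trans (cong ∣_∣ (ℤ.m-n≡m⊖n (e ℕ.* c) K)) (trans (cong ∣_∣ (ℤ.⊖-≥ le)) refl)))
                (ℕ.m≤n+o⇒m∸n≤o (e ℕ.* c) K (ℕ.≤-trans (ℕ.≤-reflexive (ℕ.*-comm e c)) up))
        ... | inj₂ le = subst (_≤ e) (sym (trans (ℤ.∣i-j∣≡∣j-i∣ (+ (e ℕ.* c)) (+ K)) (trans (cong ∣_∣ (ℤ.m-n≡m⊖n K (e ℕ.* c))) (cong ∣_∣ (ℤ.⊖-≥ le)))))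
                (ℕ.m≤n+o⇒m∸n≤o K (e ℕ.* c) (ℕ.≤-trans lo (ℕ.≤-reflexive (cong (ℕ._+ e) (ℕ.*-comm c e)))))

    -- Expanding both polynomials leaves counts of the multiples of one modulus in the progression,
    -- each within one of its expected value; these errors add up to at most the product of the
    -- norms.
    mean-value : ∀ e ps → Good e ps → All (1 ≤_) ps → ∀ A B →
      + (e ℕ.* Π ps) * ∑ K (λ i → indicator (e ∣? m i) * (ev ps A (m i) * ev ps B (m i))) ℤ.≤ + K * mean ps A B + + (e ℕ.* Π ps ℕ.* (norm ps A ℕ.* norm ps B))
    mean-value e [] (le , cop) _ A B = ℤ.≤-trans (ℤ.≤-reflexive eq)
        (ℤ.≤-trans (bound e K cnt (A * B) (proj₁ cp) (proj₂ cp)) (ℤ.≤-reflexive (cong (λ t → + K * (A * B) + + t) (trans (cong (e ℕ.*_) (ℤ.abs-* A B)) (cong (ℕ._* (∣ A ∣ ℕ.* ∣ B ∣)) (sym (ℕ.*-identityʳ e)))))))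
      where
      cnt = ∑₁ K (λ k → ♯ (e ∣? (a ℕ.+ d ℕ.* k)))
      cp = count-progression a d e le cop K
      eq : + (e ℕ.* 1) * ∑ K (λ i → indicator (e ∣? m i) * (A * B)) ≡ + (e ℕ.* cnt) * (A * B)
      eq = trans (cong₂ (λ s t → + s * t) (ℕ.*-identityʳ e) (trans (∑-cong K (λ i _ → ℤ.*-comm (indicator (e ∣? m i)) (A * B)))
             (trans (∑-* K (A * B) (λ i → indicator (e ∣? m i))) (cong ((A * B) *_) (count e)))))
           (trans (lem (+ e) (A * B) (+ cnt)) (cong (_* (A * B)) (sym (ℤ.pos-* e cnt))))
        where lem : ∀ e x c → e * (x * c) ≡ e * c * x
              lem = solve-∀
    mean-value e (p ∷ ps) (cop , g₀ , g₁) (_ ∷ pos) (A , B) (A′ , B′) =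
      ℤ.≤-trans (ℤ.≤-reflexive expand) (ℤ.≤-trans
        (ℤ.+-mono-≤ (ℤ.+-mono-≤ (ℤ.+-mono-≤ (ℤ.*-monoˡ-≤-nonNeg (+ p) (mean-value e ps g₀ pos A A′)) (mean-value (e ℕ.* p) ps g₁ pos A B′))
          (mean-value (e ℕ.* p) ps g₁ pos B A′)) (mean-value (e ℕ.* p) ps g₁ pos B B′))
        (ℤ.≤-reflexive collect))
      where
      Sum : ℕ → Poly ps → Poly ps → ℤ
      Sum e A B = ∑ K (λ i → indicator (e ∣? m i) * (ev ps A (m i) * ev ps B (m i)))
      expand : + (e ℕ.* (p ℕ.* Π ps)) * ∑ K (λ i → indicator (e ∣? m i) * (ev (p ∷ ps) (A , B) (m i) * ev (p ∷ ps) (A′ , B′) (m i))) ≡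
        + p * (+ (e ℕ.* Π ps) * Sum e A A′) + + (e ℕ.* p ℕ.* Π ps) * Sum (e ℕ.* p) A B′ + + (e ℕ.* p ℕ.* Π ps) * Sum (e ℕ.* p) B A′ + + (e ℕ.* p ℕ.* Π ps) * Sum (e ℕ.* p) B B′
      expand = trans (cong (+ (e ℕ.* (p ℕ.* Π ps)) *_) inner) (trans (cong (_* (Sum e A A′ + Sum (e ℕ.* p) A B′ + Sum (e ℕ.* p) B A′ + Sum (e ℕ.* p) B B′)) coeff)
        (trans (lem (+ p) (+ (e ℕ.* Π ps)) (Sum e A A′) (Sum (e ℕ.* p) A B′) (Sum (e ℕ.* p) B A′) (Sum (e ℕ.* p) B B′))
          (cong (λ c → + p * (+ (e ℕ.* Π ps) * Sum e A A′) + c * Sum (e ℕ.* p) A B′ + c * Sum (e ℕ.* p) B A′ + c * Sum (e ℕ.* p) B B′) (sym coeff₂))))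
        where
        open import Data.Nat.Tactic.RingSolver using () renaming (solve-∀ to ℕ-solve-∀)
        nlem : ∀ e p q → e ℕ.* (p ℕ.* q) ≡ p ℕ.* (e ℕ.* q)
        nlem = ℕ-solve-∀
        nlem₂ : ∀ e p q → e ℕ.* p ℕ.* q ≡ p ℕ.* (e ℕ.* q)
        nlem₂ = ℕ-solve-∀
        coeff : + (e ℕ.* (p ℕ.* Π ps)) ≡ + p * + (e ℕ.* Π ps)
        coeff = trans (cong +_ (nlem e p (Π ps))) (ℤ.pos-* p (e ℕ.* Π ps))
        coeff₂ : + (e ℕ.* p ℕ.* Π ps) ≡ + p * + (e ℕ.* Π ps)
        coeff₂ = trans (cong +_ (nlem₂ e p (Π ps))) (ℤ.pos-* p (e ℕ.* Π ps))
        lem : ∀ p c s t u v → p * c * (s + t + u + v) ≡ p * (c * s) + p * c * t + p * c * u + p * c * v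
        lem = solve-∀
        inner : ∑ K (λ i → indicator (e ∣? m i) * (ev (p ∷ ps) (A , B) (m i) * ev (p ∷ ps) (A′ , B′) (m i))) ≡
          Sum e A A′ + Sum (e ℕ.* p) A B′ + Sum (e ℕ.* p) B A′ + Sum (e ℕ.* p) B B′
        inner = trans (∑-cong K (λ i _ → trans (term (indicator (e ∣? m i)) (indicator (p ∣? m i)) (ev ps A (m i)) (ev ps B (m i)) (ev ps A′ (m i)) (ev ps B′ (m i)) (idem (p ∣? m i)))
            (cong (λ j → indicator (e ∣? m i) * (ev ps A (m i) * ev ps A′ (m i)) + j * (ev ps A (m i) * ev ps B′ (m i)) + j * (ev ps B (m i) * ev ps A′ (m i)) + j * (ev ps B (m i) * ev ps B′ (m i))) (indicator-* e p (m i) cop))))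
          (trans (∑-+ K _ _) (cong (_+ Sum (e ℕ.* p) B B′) (trans (∑-+ K _ _) (cong (_+ Sum (e ℕ.* p) B A′) (∑-+ K _ _)))))
          where
          idem : ∀ {X : Set} (x : Dec X) → indicator x * indicator x ≡ indicator x
          idem (yes _) = refl
          idem (no _)  = refl
          term : ∀ i j x y x′ y′ → j * j ≡ j → i * ((x + j * y) * (x′ + j * y′)) ≡ i * (x * x′) + i * j * (x * y′) + i * j * (y * x′) + i * j * (y * y′)
          term i j x y x′ y′ e = trans (tlem i j x y x′ y′) (cong (λ t → i * (x * x′) + i * j * (x * y′) + i * j * (y * x′) + i * t * (y * y′)) e)
            where tlem : ∀ i j x y x′ y′ → i * ((x + j * y) * (x′ + j * y′)) ≡ i * (x * x′) + i * j * (x * y′) + i * j * (y * x′) + i * (j * j) * (y * y′)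
                  tlem = solve-∀
      n₀ = norm ps A
      n₁ = norm ps B
      n₂ = norm ps A′
      n₃ = norm ps B′
      collect : + p * (+ K * mean ps A A′ + + (e ℕ.* Π ps ℕ.* (n₀ ℕ.* n₂))) + (+ K * mean ps A B′ + + (e ℕ.* p ℕ.* Π ps ℕ.* (n₀ ℕ.* n₃)))
        + (+ K * mean ps B A′ + + (e ℕ.* p ℕ.* Π ps ℕ.* (n₁ ℕ.* n₂))) + (+ K * mean ps B B′ + + (e ℕ.* p ℕ.* Π ps ℕ.* (n₁ ℕ.* n₃)))
        ≡ + K * mean (p ∷ ps) (A , B) (A′ , B′) + + (e ℕ.* (p ℕ.* Π ps) ℕ.* ((n₀ ℕ.+ n₁) ℕ.* (n₂ ℕ.+ n₃)))
      collect = trans (lem (+ p) (+ K) (mean ps A A′) (mean ps A B′) (mean ps B A′) (mean ps B B′) (+ (e ℕ.* Π ps ℕ.* (n₀ ℕ.* n₂))) (+ (e ℕ.* p ℕ.* Π ps ℕ.* (n₀ ℕ.* n₃))) (+ (e ℕ.* p ℕ.* Π ps ℕ.* (n₁ ℕ.* n₂))) (+ (e ℕ.* p ℕ.* Π ps ℕ.* (n₁ ℕ.* n₃))))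
        (cong (λ t → + K * mean (p ∷ ps) (A , B) (A′ , B′) + t)
          (trans (cong (λ t → t + + (e ℕ.* p ℕ.* Π ps ℕ.* (n₀ ℕ.* n₃)) + + (e ℕ.* p ℕ.* Π ps ℕ.* (n₁ ℕ.* n₂)) + + (e ℕ.* p ℕ.* Π ps ℕ.* (n₁ ℕ.* n₃))) (sym (ℤ.pos-* p _)))
            (cong +_ (nlem p e (Π ps) n₀ n₁ n₂ n₃))))
        where
        open import Data.Nat.Tactic.RingSolver using () renaming (solve-∀ to ℕ-solve-∀)
        lem : ∀ p k a b c d x y z w → p * (k * a + x) + (k * b + y) + (k * c + z) + (k * d + w) ≡ k * (p * a + b + c + d) + (p * x + y + z + w)
        lem = solve-∀
        nlem : ∀ p e q a b c d → p ℕ.* (e ℕ.* q ℕ.* (a ℕ.* c)) ℕ.+ e ℕ.* p ℕ.* q ℕ.* (a ℕ.* d) ℕ.+ e ℕ.* p ℕ.* q ℕ.* (b ℕ.* c) ℕ.+ e ℕ.* p ℕ.* q ℕ.* (b ℕ.* d) ≡ e ℕ.* (p ℕ.* q) ℕ.* ((a ℕ.+ b) ℕ.* (c ℕ.+ d))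
        nlem = ℕ-solve-∀

    private
      nonneg-∑ : ∀ K {f g : ℕ → ℤ} → (∀ i → f i ℤ.≤ g i) → ∑ K f ℤ.≤ ∑ K g
      nonneg-∑ zero    h = ℤ.≤-refl
      nonneg-∑ (suc K) h = ℤ.+-mono-≤ (nonneg-∑ K h) (h K)

      square≥0 : ∀ x → 0ℤ ℤ.≤ x * x
      square≥0 (+ n)      = subst (0ℤ ℤ.≤_) (ℤ.pos-* n n) (+≤+ z≤n)
      square≥0 ℤ.-[1+ n ] = +≤+ z≤n

    -- `F` equals `G` at the numbers free of the primes, so G² times their indicator is at most F².
    -- The average of F² is known from `mean-F`, with an error controlled by `norm-F`.
    sieve : ∀ ps → Good 1 ps → All (1 ≤_) ps → (free? : ∀ m → Dec (Free ps m)) → ∀ z →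
      ∑₁ K (λ k → ♯ (free? (a ℕ.+ d ℕ.* k))) ℕ.* (G ps z ℕ.* G ps z) ≤ K ℕ.* (Φ ps ℕ.* G ps z) ℕ.+ T ps z ℕ.* T ps z
    sieve ps good pos free? z = ℕ.*-cancelˡ-≤ (Π ps) {{ℕ.>-nonZero (Π>0 ps pos)}} (ℤ.drop‿+≤+ (ℤ.≤-trans (ℤ.≤-reflexive lhs) (ℤ.≤-trans
        (ℤ.*-monoˡ-≤-nonNeg (+ Π ps) (nonneg-∑ K term))
        (ℤ.≤-trans (ℤ.≤-reflexive eq₁) (ℤ.≤-trans (mean-value 1 ps good pos (F ps z) (F ps z)) (ℤ.≤-trans (ℤ.+-monoʳ-≤ (+ K * mean ps (F ps z) (F ps z))
          (+≤+ (ℕ.*-monoʳ-≤ (1 ℕ.* Π ps) (ℕ.*-mono-≤ (norm-F ps pos z) (norm-F ps pos z))))) (ℤ.≤-reflexive rhs)))))))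
      where
      g = G ps z
      t = T ps z
      Π>0 : ∀ ps → All (1 ≤_) ps → 1 ≤ Π ps
      Π>0 [] [] = s≤s z≤n
      Π>0 (p ∷ ps) (h ∷ hs) = ℕ.*-mono-≤ h (Π>0 ps hs)
      cnt = ∑₁ K (λ k → ♯ (free? (a ℕ.+ d ℕ.* k)))
      f : ℕ → ℤ
      f i = ev ps (F ps z) (m i)
      term : ∀ i → indicator (free? (m i)) * (+ g * + g) ℤ.≤ f i * f i
      term i with free? (m i)
      ... | no _   = ℤ.≤-trans (ℤ.≤-reflexive (ℤ.*-zeroˡ (+ g * + g))) (square≥0 (f i))
      ... | yes fr = ℤ.≤-reflexive (trans (ℤ.*-identityˡ (+ g * + g)) (sym (cong₂ _*_ (F-free ps pos z (m i) fr) (F-free ps pos z (m i) fr))))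
      countFree : ∀ K → ∑ K (λ i → indicator (free? (m i))) ≡ + ∑₁ K (λ k → ♯ (free? (a ℕ.+ d ℕ.* k)))
      countFree zero    = refl
      countFree (suc K) = cong₂ _+_ (countFree K) (same (free? (m K)))
        where
        same : ∀ {X : Set} (x : Dec X) → indicator x ≡ + ♯ x
        same (yes _) = refl
        same (no _)  = refl
      lhs : + (Π ps ℕ.* (cnt ℕ.* (g ℕ.* g))) ≡ + Π ps * ∑ K (λ i → indicator (free? (m i)) * (+ g * + g))
      lhs = trans (ℤ.pos-* (Π ps) _) (cong (+ Π ps *_) (trans (ℤ.pos-* cnt (g ℕ.* g)) (trans (cong₂ _*_ (sym (countFree K)) (ℤ.pos-* g g))
        (trans (ℤ.*-comm _ (+ g * + g)) (trans (sym (∑-* K (+ g * + g) (λ i → indicator (free? (m i))))) (∑-cong K (λ i _ → ℤ.*-comm (+ g * + g) _)))))))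
      eq₁ : + Π ps * ∑ K (λ i → f i * f i) ≡ + (1 ℕ.* Π ps) * ∑ K (λ i → indicator (1 ∣? m i) * (f i * f i))
      eq₁ = cong₂ _*_ (cong +_ (sym (ℕ.*-identityˡ (Π ps)))) (∑-cong K (λ i _ → sym (trans (cong (_* (f i * f i)) (indicator-yes (1 ∣? m i) (divides (m i) (sym (ℕ.*-identityʳ (m i)))))) (ℤ.*-identityˡ (f i * f i)))))
      rhs : + K * mean ps (F ps z) (F ps z) + + (1 ℕ.* Π ps ℕ.* (t ℕ.* t)) ≡ + (Π ps ℕ.* (K ℕ.* (Φ ps ℕ.* g) ℕ.+ t ℕ.* t))
      rhs = trans (cong (λ x → + K * x + + (1 ℕ.* Π ps ℕ.* (t ℕ.* t))) (mean-F ps pos z)) (trans (cong (_+ + (1 ℕ.* Π ps ℕ.* (t ℕ.* t))) (sym (ℤ.pos-* K _)))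
        (cong +_ (lem K (Π ps) (Φ ps ℕ.* g) (t ℕ.* t))))
        where
        open import Data.Nat.Tactic.RingSolver using () renaming (solve-∀ to ℕ-solve-∀)
        lem : ∀ k p x y → k ℕ.* (p ℕ.* x) ℕ.+ 1 ℕ.* p ℕ.* y ≡ p ℕ.* (k ℕ.* x ℕ.+ y)
        lem = ℕ-solve-∀

    good-primes : ∀ e ps → 1 ≤ e → Coprime d e → All (λ p → Prime p × (¬ (p ∣ d)) × (¬ (p ∣ e))) ps → AllPairs _≢_ ps → Good e ps
    good-primes e [] le cop _ _ = le , cop
    good-primes e (p ∷ ps) le cop ((pp , nd , ne) ∷ hs) (np ∷ uniq) =
      Cop.sym (prime-∤⇒coprime pp ne) , good-primes e ps le cop hs uniq ,
      good-primes (e ℕ.* p) ps (ℕ.*-mono-≤ le (prime>0 pp)) (coprime-* cop (Cop.sym (prime-∤⇒coprime pp nd))) (extend hs np) uniq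
      where
      coprime-* : ∀ {x y} → Coprime d x → Coprime d y → Coprime d (x ℕ.* y)
      coprime-* {x} {y} c₁ c₂ {f} (f∣d , f∣xy) = c₂ (f∣d , coprime-divisor (λ { (g∣f , g∣x) → c₁ (∣-trans g∣f f∣d , g∣x) }) f∣xy)
      extend : ∀ {ps} → All (λ p → Prime p × (¬ (p ∣ d)) × (¬ (p ∣ e))) ps → All (p ≢_) ps → All (λ q → Prime q × (¬ (q ∣ d)) × (¬ (q ∣ e ℕ.* p))) ps
      extend [] [] = []
      extend ((pq , nd′ , ne′) ∷ hs) (n ∷ ns) = (pq , nd′ , λ h → split pq ne′ n (euclidsLemma e p pq h)) ∷ extend hs ns
        where
        open import Data.Sum using (_⊎_)
        split : ∀ {q} → Prime q → ¬ (q ∣ e) → p ≢ q → (q ∣ e) ⊎ (q ∣ p) → ⊥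
        split pq ne′ n (inj₁ h) = ne′ h
        split pq ne′ n (inj₂ h) = n (sym (prime-∣-prime pq pp h))

-- Estimates for the sums that occur in the sieve.

module SieveBounds where

  open import Data.Nat
  open import Data.Nat.Properties
  open import Data.Nat.DivMod
  open import Data.Nat.Divisibility
  open import Data.Nat.Primality using (Prime; euclidsLemma)
  open import Data.Nat.Tactic.RingSolver using (solve-∀)
  open import Data.List using (List; []; _∷_)
  open import Data.List.Relation.Unary.All as All using (All; []; _∷_)
  open import Data.List.Relation.Unary.Any using (here; there)
  open import Data.List.Relation.Unary.AllPairs using (AllPairs; []; _∷_)
  open import Data.List.Membership.Propositional using (_∈_)
  open import Data.Product using (_,_; _×_)
  open import Data.Sum using (_⊎_; inj₁; inj₂)
  open import Data.Empty using (⊥-elim)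
  open import Relation.Nullary using (¬_; Dec; yes; no; ¬?)
  open import Relation.Binary.PropositionalEquality
  open Sums
  open PrimeBasics
  open Multiples
  open Selberg

  abstract
    free? : ∀ ps m → Dec (Free ps m)
    free? ps m = All.all? (λ p → ¬? (p ∣? m)) ps

  -- `Φ` times the product of (p + 1)/(p - 1) over the primes of the list that divide e, arranged
  -- without division.
  W : List ℕ → ℕ → ℕ
  W []       e = 1
  W (p ∷ ps) e = (p ∸ 1 + 2 * ♯ (p ∣? e)) * W ps e

  W-prime : ∀ {p} ps → Prime p → All (λ q → Prime q × p ≢ q) ps → ∀ e → W ps (p * e) ≡ W ps e
  W-prime [] pp [] e = refl
  W-prime {p} (q ∷ qs) pp ((pq , ne) ∷ hs) e = cong₂ (λ s t → (q ∸ 1 + 2 * s) * t)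
    (≤-antisym (♯-mono (q ∣? (p * e)) (q ∣? e) forth) (♯-mono (q ∣? e) (q ∣? (p * e)) (∣n⇒∣m*n p))) (W-prime qs pp hs e)
    where
    forth : q ∣ p * e → q ∣ e
    forth h with euclidsLemma p e pq h
    ... | inj₁ d = ⊥-elim (ne (sym (prime-∣-prime pq pp d)))
    ... | inj₂ d = d

  Free-prime : ∀ {p} done → Prime p → All (λ q → Prime q × p ≢ q) done → ∀ {e} → Free done e → Free done (p * e)
  Free-prime [] pp [] [] = []
  Free-prime {p} (q ∷ qs) pp ((pq , ne) ∷ hs) {e} (n ∷ fr) = no-div ∷ Free-prime qs pp hs fr
    where
    no-div : ¬ q ∣ p * e
    no-div h with euclidsLemma p e pq h
    ... | inj₁ d = ne (sym (prime-∣-prime pq pp d))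
    ... | inj₂ d = n d

  Free-one : ∀ done → All Prime done → Free done 1
  Free-one [] [] = []
  Free-one (p ∷ ps) (pp ∷ hs) = (λ d → <-irrefl refl (≤-trans (prime>1 pp) (∣⇒≤ d))) ∷ Free-one ps hs

  Separated : List ℕ → List ℕ → Set
  Separated done ps = All (λ p → Prime p × All (λ q → Prime q × p ≢ q) done) ps

  private
    separated-cons : ∀ {p done ps} → Prime p → All (p ≢_) ps → Separated done ps → Separated (p ∷ done) ps
    separated-cons pp [] [] = []
    separated-cons pp (n ∷ ns) ((pq , h) ∷ hs) = (pq , (pp , λ e → n (sym e)) ∷ h) ∷ separated-cons pp ns hs

    others : ∀ {p ps done} → All (p ≢_) ps → Separated done ps → All (λ q → Prime q × p ≢ q) ps
    others [] [] = []
    others (n ∷ ns) ((pq , _) ∷ hs) = (pq , n) ∷ others ns hs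

  -- The recursion of `T` is unfolded into a sum over all e ≤ z, squarefree or not: p - 1 weighs the
  -- e prime to p, and p + 1 the multiples of p. The primes in `done` are used up and may not divide
  -- e.
  T-sum : ∀ done ps → All Prime done → AllPairs _≢_ ps → Separated done ps → ∀ z →
    T ps z ≤ ∑₁ z (λ e → ♯ (free? done e) * W ps e)
  T-sum done [] pd _ _ zero = z≤n
  T-sum done [] pd _ _ (suc z) = ≤-trans (≤-reflexive (sym (cong (_* 1) (♯-yes (free? done 1) (Free-one done pd)))))
    (∑₁-term (suc z) (λ e → ♯ (free? done e) * 1) 1 ≤-refl (s≤s z≤n))
  T-sum done (zero ∷ ps) pd _ ((pp , _) ∷ _) z = ⊥-elim (n≮0 (prime>0 pp))
  T-sum done (p@(suc p′) ∷ ps) pd (np ∷ uniq) ((pp , sp) ∷ sep) z = begin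
    p′ * T ps z + suc p * T ps (z / p)
      ≤⟨ +-mono-≤ (*-monoʳ-≤ p′ (T-sum (p ∷ done) ps (pp ∷ pd) uniq (separated-cons pp np sep) z))
                  (*-monoʳ-≤ (suc p) (T-sum (p ∷ done) ps (pp ∷ pd) uniq (separated-cons pp np sep) (z / p))) ⟩
    p′ * ∑₁ z f₁ + suc p * ∑₁ (z / p) f₁
      ≡⟨ cong₂ _+_ (sym (∑₁-* z p′ f₁)) (sym (∑₁-* (z / p) (suc p) f₁)) ⟩
    ∑₁ z (λ e → p′ * f₁ e) + ∑₁ (z / p) (λ e → suc p * f₁ e)
      ≤⟨ +-monoʳ-≤ (∑₁ z (λ e → p′ * f₁ e)) (∑₁-mono (z / p) (λ e _ _ → *-monoʳ-≤ (suc p)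
           (*-mono-≤ (♯-mono (free? (p ∷ done) e) (free? done (p * e)) (λ { (_ ∷ fr) → Free-prime done pp sp fr }))
                     (≤-reflexive (sym (W-prime ps pp (others np sep) e)))))) ⟩
    ∑₁ z (λ e → p′ * f₁ e) + ∑₁ (z / p) (λ e → f₂ (p * e))
      ≡⟨ cong (∑₁ z (λ e → p′ * f₁ e) +_) (sym (∑₁-multiples z p f₂)) ⟩
    ∑₁ z (λ e → p′ * f₁ e) + ∑₁ z (λ e → ♯ (p ∣? e) * f₂ e)
      ≡⟨ sym (∑₁-+ z _ _) ⟩
    ∑₁ z (λ e → p′ * f₁ e + ♯ (p ∣? e) * f₂ e)
      ≤⟨ ∑₁-mono z (λ e _ _ → pointwise e) ⟩
    ∑₁ z (λ e → ♯ (free? done e) * ((p′ + 2 * ♯ (p ∣? e)) * W ps e)) ∎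
    where
    open ≤-Reasoning
    f₁ f₂ : ℕ → ℕ
    f₁ e = ♯ (free? (p ∷ done) e) * W ps e
    f₂ e = suc p * (♯ (free? done e) * W ps e)
    pointwise : ∀ e → p′ * f₁ e + ♯ (p ∣? e) * f₂ e ≤ ♯ (free? done e) * ((p′ + 2 * ♯ (p ∣? e)) * W ps e)
    pointwise e with p ∣? e
    ... | yes d = ≤-reflexive (trans (cong (λ t → p′ * t + 1 * f₂ e) (cong (_* W ps e) (♯-no (free? (p ∷ done) e) (λ { (n ∷ _) → n d }))))
            (lem p′ (♯ (free? done e)) (W ps e)))
      where lem : ∀ q x w → q * 0 + 1 * (suc (suc q) * (x * w)) ≡ x * ((q + 2 * 1) * w)
            lem = solve-∀
    ... | no _ = ≤-trans (+-monoˡ-≤ 0 (*-monoʳ-≤ p′ (*-monoˡ-≤ (W ps e) (♯-mono (free? (p ∷ done) e) (free? done e) (λ { (_ ∷ fr) → fr })))))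
            (≤-reflexive (lem p′ (♯ (free? done e)) (W ps e)))
      where lem : ∀ q x w → q * (x * w) + 0 ≡ x * ((q + 2 * 0) * w)
            lem = solve-∀

  -- The list is generated from a position `b` below all its members, and `W-sum` is an induction in
  -- which this position moves.
  module Ascending {Ok : ℕ → Set} (ok? : ∀ m → Dec (Ok m)) (ok-prime : ∀ {m} → Ok m → Prime m) where

    asc : ℕ → ℕ → List ℕ
    asc b zero    = []
    asc b (suc k) with ok? (suc b)
    ... | yes _ = suc b ∷ asc (suc b) k
    ... | no _  = asc (suc b) k

    asc-All : ∀ b k → All (λ p → b < p × Ok p) (asc b k)
    asc-All b zero = []
    asc-All b (suc k) with ok? (suc b)
    ... | yes h = (≤-refl , h) ∷ All.map (λ { (l , o) → <⇒≤ l , o }) (asc-All (suc b) k)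
    ... | no _  = All.map (λ { (l , o) → <⇒≤ l , o }) (asc-All (suc b) k)

    asc-unique : ∀ b k → AllPairs _≢_ (asc b k)
    asc-unique b zero = []
    asc-unique b (suc k) with ok? (suc b)
    ... | yes _ = All.map (λ { (l , _) refl → <-irrefl refl l }) (asc-All (suc b) k) ∷ asc-unique (suc b) k
    ... | no _  = asc-unique (suc b) k

    asc-complete : ∀ b k m → b < m → m ≤ b + k → Ok m → m ∈ asc b k
    asc-complete b zero m lt le o = ⊥-elim (<-irrefl refl (≤-trans lt (≤-trans le (≤-reflexive (+-identityʳ b)))))
    asc-complete b (suc k) m lt le o with ok? (suc b) | m ≟ suc b
    ... | yes _ | yes refl = here refl
    ... | no n  | yes refl = ⊥-elim (n o)
    ... | yes _ | no ne = there (asc-complete (suc b) k m (≤∧≢⇒< lt (λ e → ne (sym e))) (≤-trans le (≤-reflexive (+-suc b k))) o)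
    ... | no _  | no ne = asc-complete (suc b) k m (≤∧≢⇒< lt (λ e → ne (sym e))) (≤-trans le (≤-reflexive (+-suc b k))) o

    private
      head-others : ∀ b k → All (λ q → Prime q × suc b ≢ q) (asc (suc b) k)
      head-others b k = All.map (λ { (l , o) → ok-prime o , λ { refl → <-irrefl refl l } }) (asc-All (suc b) k)

    -- The factor (b+1)³/b³ bounds the tail product of 1 + 2/(p(p-1)) over p > b.
    W-sum : ∀ b k → 1 ≤ b → ∀ z → b * b * b * ∑₁ z (W (asc b k)) ≤ suc b * suc b * suc b * (Φ (asc b k) * z)
    W-sum b zero le z = *-mono-≤ (*-mono-≤ (*-mono-≤ (n≤1+n b) (n≤1+n b)) (n≤1+n b)) (≤-reflexive (trans (∑₁-const z 1) (trans (*-identityʳ z) (sym (+-identityʳ z)))))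
    W-sum b (suc k) le z with ok? (suc b)
    ... | no _ = *-cancelˡ-≤ (j * j * j) (begin
        j * j * j * (b * b * b * S)                          ≡⟨ lem₁ j b S ⟩
        b * b * b * (j * j * j * S)                          ≤⟨ *-monoʳ-≤ (b * b * b) (W-sum j k (s≤s z≤n) z) ⟩
        b * b * b * (suc j * suc j * suc j * (Φ ps * z))      ≡⟨ lem₂ b (Φ ps * z) ⟩
        (b * suc j) * (b * suc j) * (b * suc j) * (Φ ps * z)  ≤⟨ *-monoˡ-≤ (Φ ps * z) (*-mono-≤ (*-mono-≤ (q b) (q b)) (q b)) ⟩
        (j * j) * (j * j) * (j * j) * (Φ ps * z)              ≡⟨ lem₃ j (Φ ps * z) ⟩
        j * j * j * (j * j * j * (Φ ps * z))                  ∎)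
      where
      open ≤-Reasoning
      j = suc b
      ps = asc j k
      S = ∑₁ z (W ps)
      lem₁ : ∀ j b s → j * j * j * (b * b * b * s) ≡ b * b * b * (j * j * j * s)
      lem₁ = solve-∀
      lem₂ : ∀ b x → b * b * b * (suc (suc b) * suc (suc b) * suc (suc b) * x) ≡ (b * suc (suc b)) * (b * suc (suc b)) * (b * suc (suc b)) * x
      lem₂ = solve-∀
      lem₃ : ∀ j x → (j * j) * (j * j) * (j * j) * x ≡ j * j * j * (j * j * j * x)
      lem₃ = solve-∀
      q : ∀ b → b * suc (suc b) ≤ suc b * suc b
      q b = ≤-trans (n≤1+n _) (≤-reflexive (q′ b))
        where q′ : ∀ b → suc (b * suc (suc b)) ≡ suc b * suc b
              q′ = solve-∀
    ... | yes o = *-cancelˡ-≤ (j * j * j * j) (begin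
        j * j * j * j * (b * b * b * ∑₁ z (W (j ∷ ps)))                                  ≡⟨ cong (λ t → j * j * j * j * (b * b * b * t)) split ⟩
        j * j * j * j * (b * b * b * (b * S + 2 * S′))                                    ≡⟨ lem₁ j b S S′ ⟩
        b * b * b * (b * j * (j * j * j * S) + 2 * j * (j * j * j * S′))                  ≤⟨ *-monoʳ-≤ (b * b * b) (+-mono-≤ (*-monoʳ-≤ (b * j) (W-sum j k (s≤s z≤n) z)) (*-monoʳ-≤ (2 * j) (W-sum j k (s≤s z≤n) (z / j)))) ⟩
        b * b * b * (b * j * (J₃ * (Φ ps * z)) + 2 * j * (J₃ * (Φ ps * (z / j))))           ≡⟨ lem₂ b j J₃ (Φ ps) z (z / j) ⟩
        b * b * b * (J₃ * Φ ps * (b * j * z + 2 * (z / j * j)))                            ≤⟨ *-monoʳ-≤ (b * b * b) (*-monoʳ-≤ (J₃ * Φ ps) (+-monoʳ-≤ (b * j * z) (*-monoʳ-≤ 2 (m/n*n≤m z j)))) ⟩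
        b * b * b * (J₃ * Φ ps * (b * j * z + 2 * z))                                      ≡⟨ lem₃ b (Φ ps) z ⟩
        (b * b * (suc j * suc j * suc j) * (b * j + 2)) * (b * (Φ ps * z))                ≤⟨ *-monoˡ-≤ (b * (Φ ps * z)) (poly b) ⟩
        (j * j * j * j * (j * j * j)) * (b * (Φ ps * z))                                  ≡⟨ lem₄ j b (Φ ps) z ⟩
        j * j * j * j * (j * j * j * (b * Φ ps * z))                                      ∎)
      where
      open ≤-Reasoning
      j = suc b
      J₃ = suc j * suc j * suc j
      ps = asc j k
      S = ∑₁ z (W ps)
      S′ = ∑₁ (z / j) (W ps)
      split : ∑₁ z (W (j ∷ ps)) ≡ b * S + 2 * S′
      split = trans (∑₁-cong z (λ e _ _ → slem b (♯ (j ∣? e)) (W ps e)))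
        (trans (∑₁-+ z (λ e → b * W ps e) (λ e → 2 * (♯ (j ∣? e) * W ps e))) (cong₂ _+_ (∑₁-* z b (W ps)) (trans (∑₁-* z 2 (λ e → ♯ (j ∣? e) * W ps e))
          (cong (2 *_) (trans (∑₁-multiples z j (W ps)) (∑₁-cong (z / j) (λ e _ _ → W-prime ps (ok-prime o) (head-others b k) e)))))))
        where slem : ∀ b i w → (b + 2 * i) * w ≡ b * w + 2 * (i * w)
              slem = solve-∀
      lem₁ : ∀ j b s t → j * j * j * j * (b * b * b * (b * s + 2 * t)) ≡ b * b * b * (b * j * (j * j * j * s) + 2 * j * (j * j * j * t))
      lem₁ = solve-∀
      lem₂ : ∀ b j J₃ f z y → b * b * b * (b * j * (J₃ * (f * z)) + 2 * j * (J₃ * (f * y))) ≡ b * b * b * (J₃ * f * (b * j * z + 2 * (y * j)))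
      lem₂ = solve-∀
      lem₃ : ∀ b f z → b * b * b * (suc (suc b) * suc (suc b) * suc (suc b) * f * (b * suc b * z + 2 * z)) ≡ (b * b * (suc (suc b) * suc (suc b) * suc (suc b)) * (b * suc b + 2)) * (b * (f * z))
      lem₃ = solve-∀
      lem₄ : ∀ j b f z → (j * j * j * j * (j * j * j)) * (b * (f * z)) ≡ j * j * j * j * (j * j * j * (b * f * z))
      lem₄ = solve-∀
      -- Divided by b³ (b+1)⁴ this is (1 + 2/(b(b+1))) ((b+2)/(b+1))³ ≤ ((b+1)/b)³, the passage from
      -- the tail beyond b + 1 to the tail beyond b. The polynomial added below is the difference of
      -- the two sides.
      poly : ∀ b → b * b * (suc (suc b) * suc (suc b) * suc (suc b)) * (b * suc b + 2) ≤ suc b * suc b * suc b * suc b * (suc b * suc b * suc b)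
      poly b = ≤-trans (m≤m+n _ (b * b * b * b * b + 3 * (b * b * b * b) + 3 * (b * b * b) + 5 * (b * b) + 7 * b + 1)) (≤-reflexive (plem b))
        where plem : ∀ b → b * b * (suc (suc b) * suc (suc b) * suc (suc b)) * (b * suc b + 2) + (b * b * b * b * b + 3 * (b * b * b * b) + 3 * (b * b * b) + 5 * (b * b) + 7 * b + 1) ≡ suc b * suc b * suc b * suc b * (suc b * suc b * suc b)
              plem = solve-∀

  G-mono : ∀ ps {z z′} → z ≤ z′ → G ps z ≤ G ps z′
  G-mono [] {zero} le = z≤n
  G-mono [] {suc z} {suc z′} le = ≤-refl
  G-mono (zero ∷ ps) le = z≤n
  G-mono (p@(suc p′) ∷ ps) le = +-mono-≤ (*-monoʳ-≤ p′ (G-mono ps le)) (G-mono ps (/-monoˡ-≤ p le))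

  Φ≤G : ∀ ps → All (1 ≤_) ps → ∀ z → Φ ps ≤ G ps (suc z)
  Φ≤G [] _ z = ≤-refl
  Φ≤G (suc p′ ∷ ps) (_ ∷ pos) z = ≤-trans (*-monoʳ-≤ p′ (Φ≤G ps pos z)) (m≤m+n _ _)

  -- `h` stands for a constant multiple of the reciprocal, and `h-div` expresses this without
  -- division.
  module Harmonic (Z : ℕ) (h : ℕ → ℕ) (h-div : ∀ x p → 1 ≤ x * p → x * p ≤ Z → p * h (x * p) ≡ h x) where

    -- The classical comparison of the sum of 1/m over m ≤ z with that of 1/φ(e). The m are split by
    -- the first listed prime p into those prime to p and the p m′ with m′ ≤ z / p. The second part
    -- keeps the list but lowers `z`, hence the fuel; `e` collects the factors taken out.
    G-lower : ∀ ps fuel done z e → z ≤ fuel → 1 ≤ e → e * z ≤ Z → All Prime ps →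
      (∀ q → Prime q → q ≤ z → q ∈ done ⊎ q ∈ ps) → Φ ps * ∑₁ z (λ m → ♯ (free? done m) * h (e * m)) ≤ h e * G ps z
    G-lower [] fuel done zero e le 1≤e ez _ cover = z≤n
    -- With the list exhausted, every prime up to z lies in `done`, so that only m = 1 contributes.
    G-lower [] fuel done (suc z) e le 1≤e ez _ cover = ≤-trans (≤-reflexive (+-identityʳ _)) (≤-trans (go z ≤-refl) (≤-reflexive (sym (*-identityʳ (h e)))))
      where
      f : ℕ → ℕ
      f m = ♯ (free? done m) * h (e * m)
      go : ∀ y → y ≤ z → ∑₁ (suc y) f ≤ h e
      go zero    _ = ≤-trans (*-monoˡ-≤ (h (e * 1)) (♯-≤1 (free? done 1))) (≤-reflexive (trans (*-identityˡ _) (cong h (*-identityʳ e))))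
      go (suc y) u = ≤-trans (≤-reflexive (trans (cong (∑₁ (suc y) f +_) (cong (_* h (e * suc (suc y))) (♯-no (free? done (suc (suc y))) nf))) (+-identityʳ _))) (go y (<⇒≤ u))
        where
        nf : ¬ Free done (suc (suc y))
        nf fr with prime-divisor {suc (suc y)} (s≤s (s≤s z≤n))
        ... | q , pq , d with cover q pq (≤-trans (∣⇒≤ d) (s≤s u))
        ...   | inj₁ i = All.lookup fr i d
    G-lower (zero ∷ ps) fuel done z e le 1≤e ez (pp ∷ _) cover = ⊥-elim (n≮0 (prime>0 pp))
    G-lower (p@(suc p′) ∷ ps) fuel done zero e le 1≤e ez _ cover = ≤-trans (≤-reflexive (*-zeroʳ (p′ * Φ ps))) z≤n
    G-lower L@(p@(suc p′) ∷ ps) (suc fuel) done z@(suc z₀) e le 1≤e ez (pp ∷ pps) cover = begin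
      p′ * Φ ps * ∑₁ z f ≤⟨ *-monoʳ-≤ (p′ * Φ ps) (∑₁-mono z (λ m _ _ → pointwise m)) ⟩
      p′ * Φ ps * ∑₁ z (λ m → f₁ m + ♯ (p ∣? m) * f m) ≡⟨ cong (p′ * Φ ps *_) (trans (∑₁-+ z f₁ _) (cong (∑₁ z f₁ +_) (∑₁-multiples z p f))) ⟩
      p′ * Φ ps * (∑₁ z f₁ + ∑₁ (z / p) (λ m → f (p * m))) ≤⟨ *-monoʳ-≤ (p′ * Φ ps) (+-monoʳ-≤ (∑₁ z f₁) (∑₁-mono (z / p) (λ m _ _ →
          *-mono-≤ (♯-mono (free? done (p * m)) (free? done m) (All.map (λ n d → n (∣n⇒∣m*n p d)))) (≤-reflexive (cong h (sym (*-assoc e p m))))))) ⟩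
      p′ * Φ ps * (∑₁ z f₁ + S₂) ≡⟨ lem p′ (Φ ps) (∑₁ z f₁) S₂ ⟩
      p′ * (Φ ps * ∑₁ z f₁) + p′ * Φ ps * S₂ ≤⟨ +-mono-≤ (*-monoʳ-≤ p′ (G-lower ps z (p ∷ done) z e ≤-refl 1≤e ez pps cover₁)) (second (G-lower L fuel done (z / p) (e * p) (≤-pred (≤-trans (m/n<m z p (prime>1 pp)) le)) (*-mono-≤ 1≤e (prime>0 pp))
          (≤-trans (≤-reflexive (*-assoc e p (z / p))) (≤-trans (*-monoʳ-≤ e (≤-trans (≤-reflexive (*-comm p (z / p))) (m/n*n≤m z p))) ez)) (pp ∷ pps)
          (λ q pq u → cover q pq (≤-trans u (m/n≤m z p))))) ⟩
      p′ * (h e * G ps z) + h e * G ps (z / p) ≡⟨ lem₂ p′ (h e) (G ps z) (G ps (z / p)) ⟩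
      h e * (p′ * G ps z + G ps (z / p)) ∎
      where
      open ≤-Reasoning
      f f₁ : ℕ → ℕ
      f m = ♯ (free? done m) * h (e * m)
      f₁ m = ♯ (free? (p ∷ done) m) * h (e * m)
      S₂ = ∑₁ (z / p) (λ m → ♯ (free? done m) * h (e * p * m))
      lem : ∀ q f a b → q * f * (a + b) ≡ q * (f * a) + q * f * b
      lem = solve-∀
      lem₂ : ∀ q h g g′ → q * (h * g) + h * g′ ≡ h * (q * g + g′)
      lem₂ = solve-∀
      pointwise : ∀ m → f m ≤ f₁ m + ♯ (p ∣? m) * f m
      pointwise m with p ∣? m
      ... | yes _ = ≤-trans (≤-reflexive (sym (*-identityˡ (f m)))) (m≤n+m (1 * f m) (f₁ m))
      ... | no n  = ≤-trans (*-monoˡ-≤ (h (e * m)) (♯-mono (free? done m) (free? (p ∷ done) m) (n ∷_))) (m≤m+n (f₁ m) (0 * f m))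
      cover₁ : ∀ q → Prime q → q ≤ z → q ∈ (p ∷ done) ⊎ q ∈ ps
      cover₁ q pq u with cover q pq u
      ... | inj₁ i           = inj₁ (there i)
      ... | inj₂ (here refl) = inj₁ (here refl)
      ... | inj₂ (there i)   = inj₂ i
      -- At z / p the list with p contributes at most p′ G + G = p G, and this p is what `h` gains
      -- between e p and e: the geometric series of 1/p in closed form.
      second : p′ * Φ ps * S₂ ≤ h (e * p) * (p′ * G ps (z / p) + G ps (z / p / p)) → p′ * Φ ps * S₂ ≤ h e * G ps (z / p)
      second ih with p ≤? z
      ... | no nle = ≤-trans (≤-reflexive (trans (cong (λ y → p′ * Φ ps * ∑₁ y (λ m → ♯ (free? done m) * h (e * p * m))) (m<n⇒m/n≡0 (≰⇒> nle))) (*-zeroʳ (p′ * Φ ps)))) z≤n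
      ... | yes p≤z = begin
        p′ * Φ ps * S₂ ≤⟨ ih ⟩
        h (e * p) * (p′ * G ps (z / p) + G ps (z / p / p)) ≤⟨ *-monoʳ-≤ (h (e * p)) (+-monoʳ-≤ (p′ * G ps (z / p)) (G-mono ps (m/n≤m (z / p) p))) ⟩
        h (e * p) * (p′ * G ps (z / p) + G ps (z / p)) ≡⟨ lem₃ (h (e * p)) p′ (G ps (z / p)) ⟩
        p * h (e * p) * G ps (z / p) ≡⟨ cong (_* G ps (z / p)) (h-div e p (*-mono-≤ 1≤e (prime>0 pp)) (≤-trans (*-monoʳ-≤ e p≤z) ez)) ⟩
        h e * G ps (z / p) ∎
        where lem₃ : ∀ h q g → h * (q * g + g) ≡ suc q * h * g
              lem₃ = solve-∀

-- The Brun-Titchmarsh inequality for a product of two primes.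

module BrunTitchmarsh where

  open import Data.Nat
  open import Data.Nat.Properties
  open import Data.Nat.DivMod
  open import Data.Nat.Divisibility
  open import Data.Nat.Primality using (Prime; prime?; euclidsLemma)
  open import Data.Nat.Coprimality using (1-coprimeTo)
  import Data.Nat.Coprimality as Cop
  open import Data.Nat.Tactic.RingSolver using (solve-∀)
  open import Data.List using ([]; _∷_)
  open import Data.List.Relation.Unary.All as All using (All; []; _∷_)
  open import Data.List.Relation.Unary.Any using (here; there)
  open import Data.List.Membership.Propositional using (_∈_)
  open import Data.Product using (_,_; _×_; proj₁; proj₂)
  open import Data.Sum using (_⊎_; inj₁; inj₂)
  open import Data.Empty using (⊥; ⊥-elim)
  open import Relation.Nullary using (¬_; Dec; yes; no; ¬?; _×-dec_)
  open import Relation.Nullary.Decidable using (from-yes)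
  open import Relation.Binary.PropositionalEquality
  open Sums
  open PrimeBasics
  open Multiples
  open Selberg
  open SieveBounds

  module Reciprocal (Z : ℕ) where

    X : ℕ
    X = Z !

    -- X / x, an integer for 1 ≤ x ≤ Z.
    recip : ℕ → ℕ
    recip zero    = 0
    recip (suc x) = X / suc x

    recip-spec : ∀ x → 1 ≤ x → x ≤ Z → x * recip x ≡ X
    recip-spec (suc x) l u = trans (*-comm (suc x) _) (m/n*n≡m (∣-trans (m∣m*n (x !)) (m≤n⇒m!∣n! u)))

    recip-div : ∀ x p → 1 ≤ x * p → x * p ≤ Z → p * recip (x * p) ≡ recip x
    recip-div zero p () u
    recip-div x@(suc _) zero l u = ⊥-elim (n≮0 (≤-trans l (≤-reflexive (*-zeroʳ x))))
    recip-div x@(suc _) p@(suc _) l u = *-cancelˡ-≡ _ _ x (trans (sym (*-assoc x p _)) (trans (recip-spec (x * p) l u)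
      (sym (recip-spec x (s≤s z≤n) (≤-trans (m≤m*n x p) u)))))

    private
      -- The sum of 1/m over 32 u < m ≤ 64 u, in 32 groups of u terms of which the i-th contributes
      -- at least 1/(32 + i). The rounded quotients `c i` of `Q` certify 1/33 + ... + 1/64 ≥ 0.68.
      -- Treating the range as one group would give only 1/2, too far from log 2.
      module Blocks (Q : ℕ) (1≤Q : 1 ≤ Q) (c : ℕ → ℕ) (c-≤ : ∀ i → c i * (32 + i) ≤ Q) (c-sum : 68 * Q ≤ 100 * ∑₁ 32 c) where

        groups : ∀ u → 1 ≤ u → 64 * u ≤ Z → ∀ i → i ≤ 32 → ∑₁ i c * X ≤ Q * ∑₁ (i * u) (λ m → recip (32 * u + m))
        groups u l le zero _ = z≤n
        groups u l le (suc i) i≤ = begin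
          (∑₁ i c + c (suc i)) * X ≡⟨ *-distribʳ-+ X (∑₁ i c) (c (suc i)) ⟩
          ∑₁ i c * X + c (suc i) * X ≤⟨ +-mono-≤ (groups u l le i (<⇒≤ i≤)) (*-monoʳ-≤ (c (suc i)) one) ⟩
          Q * ∑₁ (i * u) f + c (suc i) * ((32 + suc i) * g) ≤⟨ +-monoʳ-≤ _ (≤-trans (≤-reflexive (sym (*-assoc (c (suc i)) (32 + suc i) g)))
                (*-monoˡ-≤ g (c-≤ (suc i)))) ⟩
          Q * ∑₁ (i * u) f + Q * g ≡⟨ sym (*-distribˡ-+ Q (∑₁ (i * u) f) g) ⟩
          Q * (∑₁ (i * u) f + g) ≡⟨ cong (Q *_) (trans (sym (∑₁-split (i * u) u f)) (cong (λ t → ∑₁ t f) (+-comm (i * u) u))) ⟩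
          Q * ∑₁ (suc i * u) f ∎
          where
          open ≤-Reasoning
          f : ℕ → ℕ
          f m = recip (32 * u + m)
          g = ∑₁ u (λ m → f (i * u + m))
          each : ∀ m → 1 ≤ m → m ≤ u → X ≤ (32 + suc i) * u * f (i * u + m)
          each m l₁ u₁ = ≤-trans (≤-reflexive (sym (recip-spec (32 * u + (i * u + m)) (≤-trans l₁ (≤-trans (m≤n+m m (i * u)) (m≤n+m _ (32 * u)))) (≤-trans small (≤-trans (*-monoˡ-≤ u (+-monoʳ-≤ 32 i≤)) le)))))
            (*-monoˡ-≤ (f (i * u + m)) small)
            where
            lem : ∀ a u i → a * u + (i * u + u) ≡ (a + suc i) * u
            lem = solve-∀
            small : 32 * u + (i * u + m) ≤ (32 + suc i) * u
            small = ≤-trans (+-monoʳ-≤ (32 * u) (+-monoʳ-≤ (i * u) u₁)) (≤-reflexive (lem 32 u i))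
          one : X ≤ (32 + suc i) * g
          one = *-cancelˡ-≤ u {{>-nonZero l}} (≤-trans (≤-reflexive (sym (∑₁-const u X))) (≤-trans (∑₁-mono u each)
            (≤-reflexive (trans (∑₁-* u ((32 + suc i) * u) (λ m → f (i * u + m))) (lem (32 + suc i) u g)))))
            where lem : ∀ a u g → a * u * g ≡ u * (a * g)
                  lem = solve-∀

        block : ∀ u → 1 ≤ u → 64 * u ≤ Z → 68 * X ≤ 100 * ∑₁ (32 * u) (λ m → recip (32 * u + m))
        block u l le = *-cancelˡ-≤ Q {{>-nonZero 1≤Q}} (≤-trans (≤-reflexive (lem Q 68 X)) (≤-trans (*-monoˡ-≤ X c-sum)
          (≤-trans (≤-reflexive (*-assoc 100 (∑₁ 32 c) X)) (≤-trans (*-monoʳ-≤ 100 (groups u l le 32 ≤-refl)) (≤-reflexive (lem₂ 100 Q (∑₁ (32 * u) (λ m → recip (32 * u + m)))))))))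
          where
          lem : ∀ q a x → q * (a * x) ≡ a * q * x
          lem = solve-∀
          lem₂ : ∀ a q s → a * (q * s) ≡ q * (a * s)
          lem₂ = solve-∀

      open Blocks 1000000 (s≤s z≤n) (λ i → 1000000 / (32 + i)) (λ i → m/n*n≤m 1000000 (32 + i)) (from-yes (68000000 ≤? (100 * ∑₁ 32 (λ i → 1000000 / (32 + i))))) using (block)

      dyadic : ∀ i → 32 * 2 ^ i ≤ Z → 68 * i * X ≤ 100 * ∑₁ (32 * 2 ^ i) recip
      dyadic zero le = z≤n
      dyadic (suc i) le = begin
        68 * suc i * X ≡⟨ lem 68 i X ⟩
        68 * i * X + 68 * X ≤⟨ +-mono-≤ (dyadic i (≤-trans (*-monoʳ-≤ 32 (m≤m+n u (u + 0))) le)) (block u (m^n>0 2 i) (≤-trans (≤-reflexive (trans (*-distribʳ-+ u 32 32) (lem₃ 32 u))) le)) ⟩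
        100 * ∑₁ (32 * u) recip + 100 * ∑₁ (32 * u) (λ m → recip (32 * u + m)) ≡⟨ sym (*-distribˡ-+ 100 (∑₁ (32 * u) recip) _) ⟩
        100 * (∑₁ (32 * u) recip + ∑₁ (32 * u) (λ m → recip (32 * u + m))) ≡⟨ cong (100 *_) (trans (sym (∑₁-split (32 * u) (32 * u) recip)) (cong (λ t → ∑₁ t recip) (lem₃ 32 u))) ⟩
        100 * ∑₁ (32 * 2 ^ suc i) recip ∎
        where
        open ≤-Reasoning
        u = 2 ^ i
        lem : ∀ a i x → a * suc i * x ≡ a * i * x + a * x
        lem = solve-∀
        lem₃ : ∀ a u → a * u + a * u ≡ a * (u + (u + 0))
        lem₃ = solve-∀

    harmonic : ∀ z → 1 ≤ z → z ≤ Z → 68 * (lg z ∸ 5) * X ≤ 100 * ∑₁ z recip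
    harmonic z l u with 5 ≤? lg z
    ... | no n = ≤-trans (≤-reflexive (cong (λ t → 68 * t * X) (m≤n⇒m∸n≡0 (<⇒≤ (≰⇒> n))))) z≤n
    ... | yes 5≤ = ≤-trans (dyadic (lg z ∸ 5) (≤-trans pow u)) (*-monoʳ-≤ 100 (∑₁-extend recip pow))
      where
      pow : 32 * 2 ^ (lg z ∸ 5) ≤ z
      pow = ≤-trans (≤-reflexive (trans (sym (^-distribˡ-+-* 2 5 (lg z ∸ 5))) (cong (2 ^_) (m+[n∸m]≡n 5≤)))) (2^lg≤ l)

  -- The primes that divide the modulus cannot be used for sieving. Leaving them out takes at most
  -- the proportion 2/B from the harmonic sum, as both are at least `B`. The numerical constants are
  -- variables throughout the estimate.
  module Bounding (B B′ num den : ℕ) (B≡ : B′ + 2 ≡ B)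
    (harm : ∀ z → 1 ≤ z → num * (lg z ∸ 5) * Reciprocal.X z ≤ den * ∑₁ z (Reciprocal.recip z))
    (l₁ l₂ : ℕ) (pl₁ : Prime l₁) (pl₂ : Prime l₂) (big₁ : B ≤ l₁) (big₂ : B ≤ l₂) where

    private
      d = l₁ * l₂

      Ok : ℕ → Set
      Ok m = Prime m × m ≢ l₁ × m ≢ l₂

      ok? : ∀ m → Dec (Ok m)
      ok? m = prime? m ×-dec ¬? (m ≟ l₁) ×-dec ¬? (m ≟ l₂)

      open Ascending ok? proj₁

    bound : ∀ a K z → 1 ≤ z →
      ∑₁ K (λ k → ♯ (prime? (a + d * k) ×-dec (suc z <? (a + d * k)))) * (B′ * (num * (lg z ∸ 5))) ≤ den * B * (K + 64 * (z * z))
    bound a K z@(suc z₀) 1≤z = *-cancelˡ-≤ (X * Φ ps) {{>-nonZero (*-mono-≤ (n!>0 z) Φ>0)}} (begin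
      X * Φ ps * (cnt * (B′ * (num * (lg z ∸ 5)))) ≡⟨ lem₁ X (Φ ps) cnt B′ num (lg z ∸ 5) ⟩
      cnt * Φ ps * (B′ * (num * (lg z ∸ 5) * X)) ≤⟨ *-mono-≤ (*-monoˡ-≤ (Φ ps) cnt≤C) (*-monoʳ-≤ B′ (harm z 1≤z)) ⟩
      C * Φ ps * (B′ * (den * H)) ≡⟨ lem₂ C (Φ ps) B′ den H ⟩
      C * Φ ps * (den * (B′ * H)) ≤⟨ *-monoʳ-≤ (C * Φ ps) (*-monoʳ-≤ den sums) ⟩
      C * Φ ps * (den * (B * S)) ≡⟨ lem₃ C (Φ ps) den B S ⟩
      (den * B) * (C * (Φ ps * S)) ≤⟨ *-monoʳ-≤ (den * B) (*-monoʳ-≤ C (Harm.G-lower ps z (l₁ ∷ l₂ ∷ []) z 1 ≤-refl ≤-refl (≤-reflexive (*-identityˡ z)) primes cover)) ⟩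
      (den * B) * (C * (recip 1 * g)) ≡⟨ cong (λ t → (den * B) * (C * (t * g))) (trans (sym (*-identityˡ (recip 1))) (recip-spec 1 ≤-refl 1≤z)) ⟩
      (den * B) * (C * (X * g)) ≡⟨ lem₄ (den * B) C X g ⟩
      (den * B) * (X * (C * g)) ≤⟨ *-monoʳ-≤ (den * B) (*-monoʳ-≤ X Cg) ⟩
      (den * B) * (X * (Φ ps * (K + 64 * (z * z)))) ≡⟨ lem₅ (den * B) X (Φ ps) (K + 64 * (z * z)) ⟩
      X * Φ ps * ((den * B) * (K + 64 * (z * z))) ∎)
      where
      open ≤-Reasoning
      open Reciprocal z
      module Harm = Harmonic z recip recip-div
      open Progression a d K using (sieve; good-primes)
      ps = asc 1 z
      g = G ps z
      t = T ps z
      C = ∑₁ K (λ k → ♯ (free? ps (a + d * k)))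
      cnt = ∑₁ K (λ k → ♯ (prime? (a + d * k) ×-dec (suc z <? (a + d * k))))
      H = ∑₁ z recip
      S = ∑₁ z (λ m → ♯ (free? (l₁ ∷ l₂ ∷ []) m) * recip (1 * m))
      lem₁ : ∀ x f c b n u → x * f * (c * (b * (n * u))) ≡ c * f * (b * (n * u * x))
      lem₁ = solve-∀
      lem₂ : ∀ c f b n h → c * f * (b * (n * h)) ≡ c * f * (n * (b * h))
      lem₂ = solve-∀
      lem₃ : ∀ c f n b s → c * f * (n * (b * s)) ≡ n * b * (c * (f * s))
      lem₃ = solve-∀
      lem₄ : ∀ n c x g → n * (c * (x * g)) ≡ n * (x * (c * g))
      lem₄ = solve-∀
      lem₅ : ∀ n x f y → n * (x * (f * y)) ≡ x * f * (n * y)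
      lem₅ = solve-∀
      n!>0 : ∀ n → 1 ≤ n !
      n!>0 zero    = ≤-refl
      n!>0 (suc n) = *-mono-≤ {1} {suc n} (s≤s z≤n) (n!>0 n)
      all : All (λ p → 1 < p × Ok p) ps
      all = asc-All 1 z
      primes : All Prime ps
      primes = All.map (λ h → proj₁ (proj₂ h)) all
      pos : All (1 ≤_) ps
      pos = All.map prime>0 primes
      Φ>0 : 1 ≤ Φ ps
      Φ>0 = go ps (All.map proj₁ all)
        where
        go : ∀ ps → All (1 <_) ps → 1 ≤ Φ ps
        go [] [] = ≤-refl
        go (suc p ∷ ps) (s≤s h ∷ hs) = *-mono-≤ h (go ps hs)
      cnt≤C : cnt ≤ C
      cnt≤C = ∑₁-mono K (λ k _ _ → ♯-mono (prime? (a + d * k) ×-dec (suc z <? (a + d * k))) (free? ps (a + d * k)) (λ { (pc , lt) →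
        All.map (λ { (le , pp , _) dv → <-irrefl refl (≤-trans lt (subst (_≤ suc z) (prime-∣-prime pp pc dv) le)) }) (below 1 z) }))
        where
          below : ∀ b k → All (λ p → p ≤ b + k × Ok p) (asc b k)
          below b zero = []
          below b (suc k) with ok? (suc b)
          ... | yes o = (≤-trans (s≤s (m≤m+n b k)) (≤-reflexive (sym (+-suc b k))) , o) ∷ All.map (λ { (l , o) → ≤-trans l (≤-reflexive (sym (+-suc b k))) , o }) (below (suc b) k)
          ... | no _  = All.map (λ { (l , o) → ≤-trans l (≤-reflexive (sym (+-suc b k))) , o }) (below (suc b) k)
      cover : ∀ q → Prime q → q ≤ z → q ∈ (l₁ ∷ l₂ ∷ []) ⊎ q ∈ ps
      cover q pq u with q ≟ l₁ | q ≟ l₂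
      ... | yes e | _     = inj₁ (here e)
      ... | no _  | yes e = inj₁ (there (here e))
      ... | no n₁ | no n₂ = inj₂ (asc-complete 1 z q (prime>1 pq) (m≤n⇒m≤1+n u) (pq , n₁ , n₂))
      multiples : ∀ l → 1 ≤ l → B ≤ l → B * ∑₁ z (λ m → ♯ (l ∣? m) * recip m) ≤ H
      multiples l@(suc _) _ big = begin
        B * ∑₁ z (λ m → ♯ (l ∣? m) * recip m) ≤⟨ *-monoˡ-≤ _ big ⟩
        l * ∑₁ z (λ m → ♯ (l ∣? m) * recip m) ≡⟨ cong (l *_) (∑₁-multiples z l recip) ⟩
        l * ∑₁ (z / l) (λ m → recip (l * m)) ≡⟨ sym (∑₁-* (z / l) l _) ⟩
        ∑₁ (z / l) (λ m → l * recip (l * m)) ≡⟨ ∑₁-cong (z / l) (λ m 1≤m m≤ → trans (cong (λ t → l * recip t) (*-comm l m)) (recip-div m l (*-mono-≤ 1≤m (s≤s z≤n)) (≤-trans (*-monoˡ-≤ l m≤) (m/n*n≤m z l)))) ⟩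
        ∑₁ (z / l) recip ≤⟨ ∑₁-extend recip (m/n≤m z l) ⟩
        H ∎
      sums : B′ * H ≤ B * S
      sums = +-cancelʳ-≤ (2 * H) _ _ (begin
        B′ * H + 2 * H ≡⟨ trans (sym (*-distribʳ-+ H B′ 2)) (cong (_* H) B≡) ⟩
        B * H ≤⟨ *-monoʳ-≤ B (∑₁-mono z (λ m _ _ → pointwise m)) ⟩
        B * ∑₁ z (λ m → s m + (♯ (l₁ ∣? m) * recip m + ♯ (l₂ ∣? m) * recip m)) ≡⟨ cong (B *_) (trans (∑₁-+ z s _) (cong (S +_) (∑₁-+ z _ _))) ⟩
        B * (S + (M₁ + M₂)) ≡⟨ slem B S M₁ M₂ ⟩
        B * S + (B * M₁ + B * M₂) ≤⟨ +-monoʳ-≤ (B * S) (+-mono-≤ (multiples l₁ (prime>0 pl₁) big₁) (multiples l₂ (prime>0 pl₂) big₂)) ⟩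
        B * S + (H + H) ≡⟨ cong (λ t → B * S + (H + t)) (sym (+-identityʳ H)) ⟩
        B * S + 2 * H ∎)
        where
        s : ℕ → ℕ
        s m = ♯ (free? (l₁ ∷ l₂ ∷ []) m) * recip (1 * m)
        M₁ = ∑₁ z (λ m → ♯ (l₁ ∣? m) * recip m)
        M₂ = ∑₁ z (λ m → ♯ (l₂ ∣? m) * recip m)
        slem : ∀ n s a b → n * (s + (a + b)) ≡ n * s + (n * a + n * b)
        slem = solve-∀
        pointwise : ∀ m → recip m ≤ s m + (♯ (l₁ ∣? m) * recip m + ♯ (l₂ ∣? m) * recip m)
        pointwise m with l₁ ∣? m | l₂ ∣? m
        ... | yes _ | _ = ≤-trans (≤-trans (≤-reflexive (sym (*-identityˡ (recip m)))) (m≤m+n (1 * recip m) _)) (m≤n+m _ (s m))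
        ... | no _ | yes _ = ≤-trans (≤-reflexive (sym (*-identityˡ (recip m)))) (m≤n+m (1 * recip m) (s m))
        ... | no n₁ | no n₂ = ≤-trans (≤-reflexive (sym (trans (cong₂ _*_ (♯-yes (free? (l₁ ∷ l₂ ∷ []) m) (n₁ ∷ n₂ ∷ [])) (cong recip (*-identityˡ m))) (*-identityˡ (recip m))))) (m≤m+n (s m) 0)
      -- `W-sum` at b = 1, where the factor (b + 1)³/b³ is 8.
      t≤ : t ≤ 8 * (Φ ps * z)
      t≤ = ≤-trans (T-sum [] ps [] (asc-unique 1 z) (All.map (λ pp → pp , []) primes) z)
        (≤-trans (∑₁-mono z (λ e _ _ → ≤-trans (*-monoˡ-≤ (W ps e) (♯-≤1 (free? [] e))) (≤-reflexive (*-identityˡ (W ps e)))))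
          (≤-trans (≤-reflexive (sym (*-identityˡ _))) (W-sum 1 z ≤-refl z)))
      -- One factor `G` cancels: the error T² ≤ 64 Φ² z² is at most 64 Φ z² G because Φ ≤ G.
      Cg : C * g ≤ Φ ps * (K + 64 * (z * z))
      Cg = *-cancelʳ-≤ (C * g) _ g {{>-nonZero (≤-trans Φ>0 (Φ≤G ps pos z₀))}} (begin
        C * g * g ≡⟨ *-assoc C g g ⟩
        C * (g * g) ≤⟨ sieve ps good pos (free? ps) z ⟩
        K * (Φ ps * g) + t * t ≤⟨ +-monoʳ-≤ (K * (Φ ps * g)) (*-mono-≤ t≤ t≤) ⟩
        K * (Φ ps * g) + 8 * (Φ ps * z) * (8 * (Φ ps * z)) ≡⟨ cong (K * (Φ ps * g) +_) (clem 8 (Φ ps) z) ⟩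
        K * (Φ ps * g) + Φ ps * (64 * (z * z)) * Φ ps ≤⟨ +-monoʳ-≤ (K * (Φ ps * g)) (*-monoʳ-≤ (Φ ps * (64 * (z * z))) (Φ≤G ps pos z₀)) ⟩
        K * (Φ ps * g) + Φ ps * (64 * (z * z)) * g ≡⟨ clem₂ K (Φ ps) g (64 * (z * z)) ⟩
        Φ ps * (K + 64 * (z * z)) * g ∎)
        where
        clem : ∀ a f z → a * (f * z) * (a * (f * z)) ≡ f * (a * a * (z * z)) * f
        clem = solve-∀
        clem₂ : ∀ k f g y → k * (f * g) + f * y * g ≡ f * (k + y) * g
        clem₂ = solve-∀
        good = good-primes 1 ps ≤-refl (Cop.sym (1-coprimeTo d)) (All.map cond (All.map proj₂ all)) (asc-unique 1 z)
          where
          cond : ∀ {p} → Ok p → Prime p × (¬ (p ∣ d)) × (¬ (p ∣ 1))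
          cond {p} (pp , n₁ , n₂) = pp , (λ h → split (euclidsLemma l₁ l₂ pp h)) , λ h → <-irrefl refl (≤-trans (prime>1 pp) (∣⇒≤ h))
            where
            split : (p ∣ l₁) ⊎ (p ∣ l₂) → ⊥
            split (inj₁ h) = n₁ (prime-∣-prime pp pl₁ h)
            split (inj₂ h) = n₂ (prime-∣-prime pp pl₂ h)

  -- Brun–Titchmarsh for the modulus l₁ l₂: at most K / G + O(z²) primes above z + 1 among the first K terms, G ≥ 0.678 log₂ z.
  brun-titchmarsh : ∀ l₁ l₂ → Prime l₁ → Prime l₂ → 1000 ≤ l₁ → 1000 ≤ l₂ → ∀ a K z → 1 ≤ z →
    ∑₁ K (λ k → ♯ (prime? (a + l₁ * l₂ * k) ×-dec (suc z <? (a + l₁ * l₂ * k)))) * (998 * (68 * (lg z ∸ 5))) ≤ 100 * 1000 * (K + 64 * (z * z))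
  brun-titchmarsh l₁ l₂ pl₁ pl₂ b₁ b₂ = Bounding.bound 1000 998 68 100 refl (λ z l → Reciprocal.harmonic z z l ≤-refl) l₁ l₂ pl₁ pl₂ b₁ b₂

-- Integer logarithmic weights of prime divisors.

module Weights where

  open import Data.Nat
  open import Data.Nat.Properties
  open import Data.Nat.DivMod
  open import Data.Nat.Divisibility
  open import Data.Nat.Primality using (Prime; prime?; euclidsLemma)
  open import Data.Nat.Coprimality using (coprime-divisor)
  open import Data.Nat.Induction using (<-rec)
  open import Data.Nat.Tactic.RingSolver using (solve-∀)
  open import Data.Product using (_,_; _×_; ∃)
  open import Data.Sum using (inj₁; inj₂)
  open import Data.Empty using (⊥-elim)
  open import Relation.Nullary using (¬_; Dec; yes; no; ¬?; _×-dec_)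
  open import Relation.Binary.PropositionalEquality
  open Sums
  open PrimeBasics
  open Multiples

  Squarefree : ℕ → Set
  Squarefree m = ∀ p → Prime p → ¬ p * p ∣ m

  squarefree-part : ∀ m → 1 ≤ m → ∃ λ s → ∃ λ m′ → m ≡ s * s * m′ × Squarefree m′
  squarefree-part = <-rec _ go
    where
    go : ∀ m → (∀ {j} → j < m → 1 ≤ j → ∃ λ s → ∃ λ m′ → j ≡ s * s * m′ × Squarefree m′) → 1 ≤ m → ∃ λ s → ∃ λ m′ → m ≡ s * s * m′ × Squarefree m′
    go m rec le with anyUpTo? (λ p → prime? p ×-dec (p * p) ∣? m) (suc m)
    ... | no none = 1 , m , sym (*-identityˡ m) , λ p pp d → none (p , s≤s (≤-trans (m≤m*n p p {{>-nonZero (prime>0 pp)}}) (∣⇒≤′ le d)) , pp , d)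
    ... | yes (p , _ , pp , divides zero refl) = ⊥-elim (n≮0 le)
    ... | yes (p , _ , pp , divides q@(suc _) refl) with rec q<m (s≤s z≤n)
      where
      q<m : q < q * (p * p)
      q<m = subst (_< q * (p * p)) (*-identityʳ q) (*-monoʳ-< q (≤-trans (prime>1 pp) (m≤m*n p p {{>-nonZero (prime>0 pp)}})))
    ...   | s , m′ , e , sf = p * s , m′ , trans (cong (_* (p * p)) e) (lem s m′ p) , sf
      where lem : ∀ s m p → s * s * m * (p * p) ≡ p * s * (p * s) * m
            lem = solve-∀

  dividing? : ∀ l m → Dec (Prime l × l ∣ m)
  dividing? l m = prime? l ×-dec (l ∣? m)

  prodDiv : ℕ → ℕ → ℕ
  prodDiv zero    m = 1
  prodDiv (suc j) m with dividing? (suc j) m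
  ... | yes _ = suc j * prodDiv j m
  ... | no _  = prodDiv j m

  prodDiv-primes : ∀ j m {p} → Prime p → p ∣ prodDiv j m → p ≤ j
  prodDiv-primes zero m pp d = ⊥-elim (<-irrefl refl (≤-trans (prime>1 pp) (∣⇒≤ d)))
  prodDiv-primes (suc j) m pp d with dividing? (suc j) m
  ... | no _ = m≤n⇒m≤1+n (prodDiv-primes j m pp d)
  ... | yes (pj , _) with euclidsLemma (suc j) (prodDiv j m) pp d
  ...   | inj₁ h = ∣⇒≤ h
  ...   | inj₂ h = m≤n⇒m≤1+n (prodDiv-primes j m pp h)

  prodDiv-∣ : ∀ j m → prodDiv j m ∣ m
  prodDiv-∣ zero m = 1∣ m
  prodDiv-∣ (suc j) m with dividing? (suc j) m
  ... | no _ = prodDiv-∣ j m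
  ... | yes (pj , dj) with prodDiv-∣ j m
  ...   | divides q e = subst (suc j * prodDiv j m ∣_) (sym e) (*-monoˡ-∣ (prodDiv j m) (coprime-divisor (prime-∤⇒coprime pj (λ h → <-irrefl refl (prodDiv-primes j m pj h))) (subst (suc j ∣_) (trans e (*-comm q _)) dj)))

  prime-∣-prodDiv : ∀ j m {p} → Prime p → p ∣ m → p ≤ j → p ∣ prodDiv j m
  prime-∣-prodDiv zero m pp d le = ⊥-elim (n≮0 (≤-trans (prime>0 pp) le))
  prime-∣-prodDiv (suc j) m {p} pp d le with dividing? (suc j) m | p ≟ suc j
  ... | yes _ | yes refl = m∣m*n (prodDiv j m)
  ... | no n  | yes refl = ⊥-elim (n (pp , d))
  ... | yes _ | no ne = ∣n⇒∣m*n (suc j) (prime-∣-prodDiv j m pp d (≤-pred (≤∧≢⇒< le ne)))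
  ... | no _  | no ne = prime-∣-prodDiv j m pp d (≤-pred (≤∧≢⇒< le ne))

  squarefree-∣-prodDiv : ∀ j m m′ → 1 ≤ m′ → Squarefree m′ → m′ ∣ m → (∀ p → Prime p → p ∣ m′ → p ≤ j) → m′ ∣ prodDiv j m
  squarefree-∣-prodDiv j m m′ le sf d smooth = ∣-by-prime-powers m′ le (prodDiv j m) h
    where
    h : ∀ p v → Prime p → p ^ v ∣ m′ → p ^ v ∣ prodDiv j m
    h p zero pp d′ = 1∣ _
    h p (suc zero) pp d′ = subst (_∣ prodDiv j m) (sym (*-identityʳ p)) (prime-∣-prodDiv j m pp (∣-trans p∣ d) (smooth p pp p∣))
      where
      p∣ : p ∣ m′
      p∣ = subst (_∣ m′) (*-identityʳ p) d′
    h p (suc (suc v)) pp d′ = ⊥-elim (sf p pp (∣-trans (subst (p * p ∣_) (*-assoc p p (p ^ v)) (m∣m*n (p ^ v))) d′))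

  module Weight (M : ℕ) (1≤M : 1 ≤ M) where

    -- M log₂ l rounded down, an integer substitute for the logarithm. For l ≥ 2 the rounding loses
    -- less than 1 and the weight is at least M, so the relative loss is at most 1/M.
    w : ℕ → ℕ
    w l = lg (l ^ M)

    ^-pos : ∀ {l} → 1 ≤ l → 1 ≤ l ^ M
    ^-pos {l} h = m^n>0 l {{>-nonZero h}} M

    2^w≤ : ∀ {l} → 1 ≤ l → 2 ^ w l ≤ l ^ M
    2^w≤ h = 2^lg≤ (^-pos h)

    w-mono : ∀ {l l′} → 1 ≤ l → l ≤ l′ → w l ≤ w l′
    w-mono {l} {l′} h le = lg-mono (^-pos h) (^-monoˡ-≤ M le)

    M≤w : ∀ {l} → 2 ≤ l → M ≤ w l
    M≤w {l} h = lg-max M (^-monoˡ-≤ M h)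

    w≤ : ∀ {l e} → 1 ≤ l → l ≤ 2 ^ e → w l ≤ M * e
    w≤ {l} {e} h le = 2^-cancel-≤ (≤-trans (2^w≤ h) (≤-trans (^-monoˡ-≤ M le) (≤-reflexive (trans (^-*-assoc 2 e M) (cong (2 ^_) (*-comm e M))))))

    wsum : ℕ → ℕ → ℕ
    wsum j m = ∑₁ j (λ l → ♯ (dividing? l m) * w l)

    private
      2^wsum≤ : ∀ j m → 2 ^ wsum j m ≤ prodDiv j m ^ M
      2^wsum≤ zero m = ≤-reflexive (sym (^-zeroˡ M))
      2^wsum≤ (suc j) m with dividing? (suc j) m
      ... | no _ = ≤-trans (≤-reflexive (cong (2 ^_) (+-identityʳ (wsum j m)))) (2^wsum≤ j m)
      ... | yes _ = ≤-trans (≤-reflexive (^-distribˡ-+-* 2 (wsum j m) (1 * w (suc j))))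
            (≤-trans (*-mono-≤ (2^wsum≤ j m) (≤-trans (≤-reflexive (cong (2 ^_) (*-identityˡ (w (suc j))))) (2^w≤ {suc j} (s≤s z≤n))))
              (≤-reflexive (trans (*-comm (prodDiv j m ^ M) (suc j ^ M)) (sym (^-distribʳ-* M (suc j) (prodDiv j m))))))

      vsum : ℕ → ℕ → ℕ
      vsum j m = ∑₁ j (λ l → ♯ (dividing? l m) * suc (w l))

      ≤2^vsum : ∀ j m → prodDiv j m ^ M ≤ 2 ^ vsum j m
      ≤2^vsum zero m = ≤-reflexive (^-zeroˡ M)
      ≤2^vsum (suc j) m with dividing? (suc j) m
      ... | no _ = ≤-trans (≤2^vsum j m) (≤-reflexive (cong (2 ^_) (sym (+-identityʳ (vsum j m)))))
      ... | yes _ = ≤-trans (≤-reflexive (trans (^-distribʳ-* M (suc j) (prodDiv j m)) (*-comm (suc j ^ M) (prodDiv j m ^ M))))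
            (≤-trans (*-mono-≤ (≤2^vsum j m) (≤-trans (<⇒≤ (<2^lg (suc j ^ M))) (≤-reflexive (cong (2 ^_) (sym (*-identityˡ (suc (w (suc j)))))))))
              (≤-reflexive (sym (^-distribˡ-+-* 2 (vsum j m) (1 * suc (w (suc j)))))))

      M*vsum≤ : ∀ j m → M * vsum j m ≤ suc M * wsum j m
      M*vsum≤ j m = ≤-trans (≤-reflexive (sym (∑₁-* j M _))) (≤-trans (∑₁-mono j (λ l _ _ → term l)) (≤-reflexive (∑₁-* j (suc M) _)))
        where
        lem : ∀ M w → M * (1 * suc w) ≡ M + M * w
        lem = solve-∀
        lem₂ : ∀ M w → w + M * w ≡ suc M * (1 * w)
        lem₂ = solve-∀
        term : ∀ l → M * (♯ (dividing? l m) * suc (w l)) ≤ suc M * (♯ (dividing? l m) * w l)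
        term l with dividing? l m
        ... | no _ = ≤-trans (≤-reflexive (*-zeroʳ M)) z≤n
        ... | yes (pl , _) = ≤-trans (≤-reflexive (lem M (w l))) (≤-trans (+-monoˡ-≤ (M * w l) (M≤w (prime>1 pl))) (≤-reflexive (lem₂ M (w l))))

    wsum-≤ : ∀ j m → 1 ≤ m → wsum j m ≤ w m
    wsum-≤ j m le = lg-max (wsum j m) (≤-trans (2^wsum≤ j m) (^-monoˡ-≤ M (∣⇒≤′ le (prodDiv-∣ j m))))

    -- A squarefree m′ with all primes at most j divides the product of the primes ≤ j that divide
    -- m, and rounding costs each of these primes at most the proportion 1/M of its weight.
    wsum-≥ : ∀ j m m′ → 1 ≤ m → 1 ≤ m′ → Squarefree m′ → m′ ∣ m → (∀ p → Prime p → p ∣ m′ → p ≤ j) → M * (M * lg m′) ≤ suc M * wsum j m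
    wsum-≥ j m m′ 1≤m 1≤m′ sf d smooth = ≤-trans (*-monoʳ-≤ M (2^-cancel-≤ (≤-trans (≤-reflexive (trans (cong (2 ^_) (*-comm M (lg m′))) (sym (^-*-assoc 2 (lg m′) M))))
        (≤-trans (^-monoˡ-≤ M (≤-trans (2^lg≤ 1≤m′) (∣⇒≤′ (∣⇒>0 1≤m (prodDiv-∣ j m)) (squarefree-∣-prodDiv j m m′ 1≤m′ sf d smooth)))) (≤2^vsum j m))))) (M*vsum≤ j m)

    -- Half of Mertens' estimate, by interchanging a double sum: each l counts once for every
    -- multiple m ≤ N, and the primes dividing m together weigh at most w m.
    mertens : ∀ j N → 1 ≤ N → ∑₁ j (λ l → ♯ (prime? l) * w l * mult N l) ≤ N * w N
    mertens j N le = ≤-trans (≤-reflexive (trans (∑₁-cong j (λ l _ _ → trans (sym (∑₁-* N (♯ (prime? l) * w l) (λ m → ♯ (l ∣? m)))) (∑₁-cong N (λ m _ _ → term l m))))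
        (∑₁-swap j N (λ l m → ♯ (dividing? l m) * w l))))
      (∑₁-≤ N (λ m l u → ≤-trans (wsum-≤ j m l) (w-mono l u)))
      where
      lem : ∀ a b c → a * c * b ≡ a * b * c
      lem = solve-∀
      both : ∀ l m → ♯ (prime? l) * ♯ (l ∣? m) ≡ ♯ (dividing? l m)
      both l m with prime? l | l ∣? m
      ... | yes _ | yes _ = refl
      ... | yes _ | no _  = refl
      ... | no _  | yes _ = refl
      ... | no _  | no _  = refl
      term : ∀ l m → ♯ (prime? l) * w l * ♯ (l ∣? m) ≡ ♯ (dividing? l m) * w l
      term l m = trans (lem (♯ (prime? l)) (♯ (l ∣? m)) (w l)) (cong (_* w l) (both l m))

    module Pairs (B r : ℕ) where

      large? : ∀ l → Dec (Prime l × B ≤ l)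
      large? l = prime? l ×-dec (B ≤? l)

      v : ℕ → ℕ → ℕ
      v l m = ♯ (large? l) * ♯ (l ∣? m) * w l

      single pairs : ℕ → ℕ
      single m = ∑₁ r (λ l → v l m)
      pairs m = ∑₁ r (λ l₁ → ∑₁ r (λ l₂ → ♯ (¬? (l₁ ≟ l₂)) * (v l₁ m * v l₂ m)))

      -- The sieve needs primes of at least `B`; those below it weigh a bounded amount together.
      wsum≤single : ∀ m → 1 ≤ B → wsum r m ≤ single m + B * w B
      wsum≤single m 1≤B = ≤-trans (∑₁-mono r (λ l 1≤l _ → term l 1≤l)) (≤-trans (≤-reflexive (∑₁-+ r (λ l → v l m) (λ l → ♯ (l <? B) * w B)))
          (+-monoʳ-≤ (single m) (≤-trans (≤-reflexive (∑₁-*ʳ r (w B) (λ l → ♯ (l <? B)))) (*-monoˡ-≤ (w B) (few r)))))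
        where
        term : ∀ l → 1 ≤ l → ♯ (dividing? l m) * w l ≤ v l m + ♯ (l <? B) * w B
        term l 1≤l with prime? l | l ∣? m | B ≤? l | l <? B
        ... | yes _ | yes _ | yes _ | _     = m≤m+n (1 * w l) _
        ... | yes _ | yes _ | no _  | yes lt = *-monoʳ-≤ 1 (w-mono 1≤l (<⇒≤ lt))
        ... | yes _ | yes _ | no n  | no n′ = ⊥-elim (n (≮⇒≥ n′))
        ... | yes _ | no _  | _     | _     = z≤n
        ... | no _  | _     | _     | _     = z≤n
        few : ∀ r → ∑₁ r (λ l → ♯ (l <? B)) ≤ B
        few zero = z≤n
        few (suc r) with suc r <? B
        ... | no _ = ≤-trans (≤-reflexive (+-identityʳ _)) (few r)
        ... | yes lt = ≤-trans (≤-trans (+-monoˡ-≤ 1 (∑₁-≤ r (λ l _ _ → ♯-≤1 (l <? B)))) (≤-reflexive (trans (cong (_+ 1) (*-identityʳ r)) (+-comm r 1)))) (<⇒≤ lt)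

      -- Only the diagonal l₁ = l₂ separates the square from `pairs`, and there one weight is at
      -- most w r. For smooth m near n, with r near the fourth root of n, this leaves about three
      -- quarters of the square.
      single²≤ : ∀ m → single m * single m ≤ pairs m + w r * single m
      single²≤ m = ≤-trans (≤-reflexive (trans (sym (∑₁-*ʳ r (single m) (λ l → v l m))) (∑₁-cong r (λ l₁ _ _ → sym (∑₁-* r (v l₁ m) (λ l → v l m))))))
        (≤-trans (∑₁-mono r (λ l₁ a b → ≤-trans (∑₁-mono r (λ l₂ _ _ → term l₁ l₂ a b)) (≤-reflexive (∑₁-+ r _ _))))
        (≤-trans (≤-reflexive (∑₁-+ r _ _)) (+-monoʳ-≤ (pairs m) (≤-trans (∑₁-mono r (λ l₁ _ _ → diagonal l₁)) (≤-reflexive (∑₁-* r (w r) (λ l → v l m)))))))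
        where
        v≤w : ∀ l → v l m ≤ w l
        v≤w l = ≤-trans (*-monoˡ-≤ (w l) (*-mono-≤ (♯-≤1 (large? l)) (♯-≤1 (l ∣? m)))) (≤-reflexive (*-identityˡ (w l)))
        term : ∀ l₁ l₂ → 1 ≤ l₁ → l₁ ≤ r → v l₁ m * v l₂ m ≤ ♯ (¬? (l₁ ≟ l₂)) * (v l₁ m * v l₂ m) + ♯ (l₁ ≟ l₂) * (w r * v l₁ m)
        term l₁ l₂ a b with l₁ ≟ l₂
        ... | yes refl = ≤-trans (*-monoˡ-≤ (v l₁ m) (≤-trans (v≤w l₁) (w-mono a b))) (≤-reflexive (sym (+-identityʳ (w r * v l₁ m))))
        ... | no _ = ≤-trans (≤-reflexive (sym (*-identityˡ _))) (m≤m+n (1 * (v l₁ m * v l₂ m)) 0)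
        diagonal : ∀ l₁ → ∑₁ r (λ l₂ → ♯ (l₁ ≟ l₂) * (w r * v l₁ m)) ≤ w r * v l₁ m
        diagonal l₁ = ≤-trans (≤-reflexive (∑₁-*ʳ r (w r * v l₁ m) (λ l₂ → ♯ (l₁ ≟ l₂)))) (≤-trans (*-monoˡ-≤ (w r * v l₁ m) (∑₁-unique r (λ l₂ → ♯ (l₁ ≟ l₂)) (λ l → ♯-≤1 (l₁ ≟ l)) uniq)) (≤-reflexive (*-identityˡ _)))
          where
          uniq : ∀ a b → 1 ≤ ♯ (l₁ ≟ a) → 1 ≤ ♯ (l₁ ≟ b) → a ≡ b
          uniq a b p q with l₁ ≟ a | l₁ ≟ b
          ... | yes refl | yes refl = refl

-- Pairs of prime divisors of c - 1 or n - c, summed over primes c.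

module PairCount where

  open import Data.Nat
  open import Data.Nat.Properties
  open import Data.Nat.DivMod
  open import Data.Nat.Divisibility
  open import Data.Nat.Primality using (Prime; prime?)
  open import Data.Nat.Coprimality using (coprime-divisor)
  open import Data.Nat.Tactic.RingSolver using (solve-∀)
  open import Data.Product using (_,_; ∃; proj₁; proj₂)
  open import Relation.Nullary using (Dec; yes; no; ¬?; _×-dec_)
  open import Relation.Binary.PropositionalEquality
  open Sums
  open PrimeBasics
  open Multiples
  open Weights

  ≟-unique : ∀ {x} → (f : ℕ → ℕ) → (∀ {a b} → f a ≡ f b → a ≡ b) → ∀ n → ∑₁ n (λ c → ♯ (f c ≟ x)) ≤ 1
  ≟-unique {x} f inj n = ∑₁-unique n _ (λ m → ♯-≤1 (f m ≟ x)) uniq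
    where
    uniq : ∀ a b → 1 ≤ ♯ (f a ≟ x) → 1 ≤ ♯ (f b ≟ x) → a ≡ b
    uniq a b p q with f a ≟ x | f b ≟ x
    ... | yes e | yes e′ = inj (trans e (sym e′))

  -- The members of the class are ρ + d k, and d ≤ c rules out k = 0, as the sum begins at k = 1.
  count-class : ∀ {Q : ℕ → Set} (Q? : ∀ c → Dec (Q c)) n d ρ .{{_ : NonZero d}} →
    ∑₁ n (λ c → ♯ (Q? c ×-dec (d ≤? c) ×-dec (c % d ≟ ρ))) ≤ ∑₁ (mult n d) (λ k → ♯ (Q? (ρ + d * k)))
  count-class {Q} Q? n d ρ = begin
    ∑₁ n (λ c → ♯ (Q? c ×-dec (d ≤? c) ×-dec (c % d ≟ ρ))) ≤⟨ ∑₁-mono n (λ c _ c≤n → term c c≤n) ⟩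
    ∑₁ n (λ c → ∑₁ K (λ k → ♯ (c ≟ ρ + d * k) * ♯ (Q? (ρ + d * k)))) ≡⟨ ∑₁-swap n K _ ⟩
    ∑₁ K (λ k → ∑₁ n (λ c → ♯ (c ≟ ρ + d * k) * ♯ (Q? (ρ + d * k)))) ≡⟨ ∑₁-cong K (λ k _ _ → ∑₁-*ʳ n (♯ (Q? (ρ + d * k))) (λ c → ♯ (c ≟ ρ + d * k))) ⟩
    ∑₁ K (λ k → ∑₁ n (λ c → ♯ (c ≟ ρ + d * k)) * ♯ (Q? (ρ + d * k))) ≤⟨ ∑₁-mono K (λ k _ _ → ≤-trans (*-monoˡ-≤ _ (≟-unique (λ c → c) (λ e → e) n)) (≤-reflexive (*-identityˡ _))) ⟩
    ∑₁ K (λ k → ♯ (Q? (ρ + d * k))) ∎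
    where
    open ≤-Reasoning
    K = mult n d
    term : ∀ c → c ≤ n → ♯ (Q? c ×-dec (d ≤? c) ×-dec (c % d ≟ ρ)) ≤ ∑₁ K (λ k → ♯ (c ≟ ρ + d * k) * ♯ (Q? (ρ + d * k)))
    term c c≤n with Q? c ×-dec (d ≤? c) ×-dec (c % d ≟ ρ)
    ... | no _ = z≤n
    ... | yes (q , d≤c , e) = ≤-trans (≤-reflexive (sym (cong₂ _*_ (♯-yes (c ≟ ρ + d * (c / d)) eq) (♯-yes (Q? (ρ + d * (c / d))) (subst Q eq q)))))
        (∑₁-term K (λ k → ♯ (c ≟ ρ + d * k) * ♯ (Q? (ρ + d * k))) (c / d) (m≥n⇒m/n>0 d≤c) (≤-trans (/-monoˡ-≤ d c≤n) (≤-reflexive (mult≡/ n d))))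
      where
      eq : c ≡ ρ + d * (c / d)
      eq = trans (m≡m%n+[m/n]*n c d) (cong₂ _+_ e (*-comm (c / d) d))

  -- For m c = c - 1 and for m c = n - c alike, the c with d dividing m c lie in one residue class
  -- modulo d. The hypothesis `class` isolates this, so that one argument serves both.
  module Count (M : ℕ) (1≤M : 1 ≤ M) (B n r L Y θ C Q : ℕ) (1≤r : 1 ≤ r) (1≤L : 1 ≤ L) (r²≤Y : r * r ≤ Y)
    (P : ℕ → Set) (P? : ∀ c → Dec (P c)) (P-large : ∀ {c} → P c → Y < c)
    (bt : ∀ l₁ l₂ → Prime l₁ → Prime l₂ → B ≤ l₁ → B ≤ l₂ → ∀ a K → ∑₁ K (λ k → ♯ (P? (a + l₁ * l₂ * k))) * θ ≤ C * (K + Q))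
    (m : ℕ → ℕ) (class : ∀ d .{{_ : NonZero d}} → ∃ λ ρ → ∀ c → 1 ≤ c → c ≤ n → d ∣ m c → c % d ≡ ρ) where

    open Weight M 1≤M
    open Pairs B r

    private
      ω : ℕ → ℕ
      ω l = ♯ (prime? l) * w l

      -- Mertens' estimate is applied at r L instead of r: for every l ≤ r the rounded quotient of r
      -- L by l is then within a factor 1 + 1/L of the true one.
      N = r * L

      1≤N : 1 ≤ N
      1≤N = *-mono-≤ 1≤r 1≤L

      hits : ℕ → ℕ → ℕ
      hits l₁ l₂ = ∑₁ n (λ c → ♯ (P? c) * (♯ (l₁ ∣? m c) * ♯ (l₂ ∣? m c)))

      weight : ℕ → ℕ → ℕ
      weight l₁ l₂ = ♯ (¬? (l₁ ≟ l₂)) * (♯ (large? l₁) * w l₁ * (♯ (large? l₂) * w l₂))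

      exchange : ∑₁ n (λ c → ♯ (P? c) * pairs (m c)) ≡ ∑₁ r (λ l₁ → ∑₁ r (λ l₂ → weight l₁ l₂ * hits l₁ l₂))
      exchange = trans (∑₁-cong n (λ c _ _ → trans (sym (∑₁-* r (♯ (P? c)) _)) (∑₁-cong r (λ l₁ _ _ → sym (∑₁-* r (♯ (P? c)) _)))))
        (trans (∑₁-swap n r _) (∑₁-cong r (λ l₁ _ _ → trans (∑₁-swap n r _) (∑₁-cong r (λ l₂ _ _ →
          trans (∑₁-cong n (λ c _ _ → lem (♯ (P? c)) (♯ (¬? (l₁ ≟ l₂))) (♯ (large? l₁)) (♯ (l₁ ∣? m c)) (w l₁) (♯ (large? l₂)) (♯ (l₂ ∣? m c)) (w l₂)))
            (∑₁-* n (weight l₁ l₂) _))))))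
        where lem : ∀ p i a d x b e y → p * (i * (a * d * x * (b * e * y))) ≡ i * (a * x * (b * y)) * (p * (d * e))
              lem = solve-∀

      hits-bound : ∀ l₁ l₂ → Prime l₁ → Prime l₂ → B ≤ l₁ → B ≤ l₂ → l₁ ≢ l₂ → l₁ ≤ r → l₂ ≤ r → hits l₁ l₂ * θ ≤ C * (mult n (l₁ * l₂) + Q)
      hits-bound l₁ l₂ p₁ p₂ b₁ b₂ ne le₁ le₂ = ≤-trans (*-monoˡ-≤ θ (≤-trans (∑₁-mono n term) (count-class P? n d ρ))) (bt l₁ l₂ p₁ p₂ b₁ b₂ ρ (mult n d))
        where
        d = l₁ * l₂
        instance
          d≢0 : NonZero d
          d≢0 = >-nonZero (*-mono-≤ (prime>0 p₁) (prime>0 p₂))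
        ρ = proj₁ (class d)
        both : ∀ {x} → l₁ ∣ x → l₂ ∣ x → d ∣ x
        both (divides q refl) h = subst (d ∣_) (*-comm l₁ q) (*-monoʳ-∣ l₁ (coprime-divisor (prime-∤⇒coprime p₂ (λ h → ne (sym (prime-∣-prime p₂ p₁ h)))) (subst (l₂ ∣_) (*-comm q l₁) h)))
        term : ∀ c → 1 ≤ c → c ≤ n → ♯ (P? c) * (♯ (l₁ ∣? m c) * ♯ (l₂ ∣? m c)) ≤ ♯ (P? c ×-dec (d ≤? c) ×-dec (c % d ≟ ρ))
        term c l u with P? c | l₁ ∣? m c | l₂ ∣? m c
        ... | no _  | _ | _ = z≤n
        ... | yes _ | no _ | _ = z≤n
        ... | yes _ | yes _ | no _ = z≤n
        ... | yes q | yes h₁ | yes h₂ = ≤-reflexive (sym (♯-yes (yes q ×-dec (d ≤? c) ×-dec (c % d ≟ ρ))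
                (q , ≤-trans (*-mono-≤ le₁ le₂) (≤-trans r²≤Y (<⇒≤ (P-large q))) , proj₂ (class d) c l u (both h₁ h₂))))

      pair-bound : ∀ l₁ l₂ → l₁ ≤ r → l₂ ≤ r → weight l₁ l₂ * hits l₁ l₂ * θ ≤ C * (ω l₁ * ω l₂ * (mult n (l₁ * l₂) + Q))
      pair-bound l₁ l₂ u₁ u₂ with l₁ ≟ l₂ | prime? l₁ | B ≤? l₁ | prime? l₂ | B ≤? l₂
      ... | yes _ | _ | _ | _ | _ = z≤n
      ... | no _ | no _ | _ | _ | _ = z≤n
      ... | no _ | yes _ | no _ | _ | _ = z≤n
      ... | no _ | yes _ | yes _ | no _ | _ = ≤-trans (≤-reflexive (lem (w l₁) (hits l₁ l₂) θ (w l₂))) z≤n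
        where lem : ∀ a h t b → 1 * (1 * a * (0 * b)) * h * t ≡ 0
              lem = solve-∀
      ... | no _ | yes _ | yes _ | yes _ | no _ = ≤-trans (≤-reflexive (lem (w l₁) (hits l₁ l₂) θ (w l₂))) z≤n
        where lem : ∀ a h t b → 1 * (1 * a * (0 * b)) * h * t ≡ 0
              lem = solve-∀
      ... | no ne | yes p₁ | yes b₁ | yes p₂ | yes b₂ = ≤-trans (≤-reflexive (lem (w l₁) (w l₂) (hits l₁ l₂) θ))
            (≤-trans (*-monoʳ-≤ (w l₁ * w l₂) (hits-bound l₁ l₂ p₁ p₂ b₁ b₂ ne u₁ u₂)) (≤-reflexive (lem₂ (w l₁) (w l₂) C (mult n (l₁ * l₂) + Q))))
        where
        lem : ∀ a b h t → 1 * (1 * a * (1 * b)) * h * t ≡ a * b * (h * t)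
        lem = solve-∀
        lem₂ : ∀ a b c x → a * b * (c * x) ≡ c * (1 * a * (1 * b) * x)
        lem₂ = solve-∀

      u : ℕ → ℕ
      u l = mult N l

      floor-bound : ∀ l → 1 ≤ l → l ≤ r → N * L ≤ l * u l * suc L
      floor-bound l 1≤l l≤r = begin
        N * L ≤⟨ *-monoˡ-≤ L (<⇒≤ (proj₂ (mult-spec N 1≤l))) ⟩
        suc (u l) * l * L ≡⟨ lem (u l) l L ⟩
        l * (L + u l * L) ≤⟨ *-monoʳ-≤ l (+-monoˡ-≤ (u l * L) L≤u) ⟩
        l * (u l + u l * L) ≡⟨ lem₂ l (u l) L ⟩
        l * u l * suc L ∎
        where
        open ≤-Reasoning
        lem : ∀ u l L → suc u * l * L ≡ l * (L + u * L)
        lem = solve-∀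
        lem₂ : ∀ l u L → l * (u + u * L) ≡ l * u * suc L
        lem₂ = solve-∀
        L≤u : L ≤ u l
        L≤u = ≤-pred (*-cancelʳ-< l L (suc (u l)) (≤-<-trans (≤-trans (*-monoʳ-≤ L l≤r) (≤-reflexive (*-comm L r))) (proj₂ (mult-spec N 1≤l))))

      -- Up to factors near 1, the quotient of n by l₁ l₂ is at most n / N² times the product of the
      -- quotients of N by l₁ and by l₂. The double sum over l₁ and l₂ then factors into two sums of
      -- Mertens type.
      mult-bound : ∀ l₁ l₂ → 1 ≤ l₁ → l₁ ≤ r → 1 ≤ l₂ → l₂ ≤ r → N * N * (L * L * mult n (l₁ * l₂)) ≤ n * (suc L * suc L) * (u l₁ * u l₂)
      mult-bound l₁ l₂ a₁ b₁ a₂ b₂ = begin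
        N * N * (L * L * mult n (l₁ * l₂)) ≡⟨ lem N L (mult n (l₁ * l₂)) ⟩
        N * L * (N * L) * mult n (l₁ * l₂) ≤⟨ *-monoˡ-≤ (mult n (l₁ * l₂)) (*-mono-≤ (floor-bound l₁ a₁ b₁) (floor-bound l₂ a₂ b₂)) ⟩
        l₁ * u l₁ * suc L * (l₂ * u l₂ * suc L) * mult n (l₁ * l₂) ≡⟨ lem₂ l₁ (u l₁) (suc L) l₂ (u l₂) (mult n (l₁ * l₂)) ⟩
        mult n (l₁ * l₂) * (l₁ * l₂) * (suc L * suc L) * (u l₁ * u l₂) ≤⟨ *-monoˡ-≤ (u l₁ * u l₂) (*-monoˡ-≤ (suc L * suc L) (proj₁ (mult-spec n (*-mono-≤ a₁ a₂)))) ⟩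
        n * (suc L * suc L) * (u l₁ * u l₂) ∎
        where
        open ≤-Reasoning
        lem : ∀ N L x → N * N * (L * L * x) ≡ N * L * (N * L) * x
        lem = solve-∀
        lem₂ : ∀ a u s b v x → a * u * s * (b * v * s) * x ≡ x * (a * b) * (s * s) * (u * v)
        lem₂ = solve-∀

      A D₂ : ℕ
      A = ∑₁ r (λ l₁ → ∑₁ r (λ l₂ → ω l₁ * ω l₂ * mult n (l₁ * l₂)))
      D₂ = ∑₁ r (λ l₁ → ∑₁ r (λ l₂ → ω l₁ * ω l₂ * Q))

      square : ∀ (f : ℕ → ℕ) → ∑₁ r (λ l₁ → ∑₁ r (λ l₂ → f l₁ * f l₂)) ≡ ∑₁ r f * ∑₁ r f
      square f = trans (∑₁-cong r (λ l₁ _ _ → ∑₁-* r (f l₁) f)) (∑₁-*ʳ r (∑₁ r f) f)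

      A-bound : L * L * A ≤ n * (suc L * suc L) * (w N * w N)
      A-bound = *-cancelˡ-≤ (N * N) {{>-nonZero (*-mono-≤ 1≤N 1≤N)}} (begin
        N * N * (L * L * A) ≡⟨ trans (sym (*-assoc (N * N) (L * L) A)) (trans (sym (∑₁-* r k _)) (∑₁-cong r (λ l₁ _ _ → sym (∑₁-* r k _)))) ⟩
        ∑₁ r (λ l₁ → ∑₁ r (λ l₂ → k * (ω l₁ * ω l₂ * mult n (l₁ * l₂)))) ≤⟨ ∑₁-mono r (λ l₁ a₁ b₁ → ∑₁-mono r (λ l₂ a₂ b₂ →
            ≤-trans (≤-reflexive (lem N L (ω l₁ * ω l₂) (mult n (l₁ * l₂)))) (≤-trans (*-monoʳ-≤ (ω l₁ * ω l₂) (mult-bound l₁ l₂ a₁ b₁ a₂ b₂))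
              (≤-reflexive (lem₂ (ω l₁) (ω l₂) (n * (suc L * suc L)) (u l₁) (u l₂)))))) ⟩
        ∑₁ r (λ l₁ → ∑₁ r (λ l₂ → h * (ω l₁ * u l₁ * (ω l₂ * u l₂)))) ≡⟨ trans (∑₁-cong r (λ l₁ _ _ → ∑₁-* r h _)) (∑₁-* r h _) ⟩
        h * ∑₁ r (λ l₁ → ∑₁ r (λ l₂ → ω l₁ * u l₁ * (ω l₂ * u l₂))) ≡⟨ cong (h *_) (square (λ l → ω l * u l)) ⟩
        h * (∑₁ r (λ l → ω l * u l) * ∑₁ r (λ l → ω l * u l)) ≤⟨ *-monoʳ-≤ h (*-mono-≤ (mertens r N 1≤N) (mertens r N 1≤N)) ⟩
        h * (N * w N * (N * w N)) ≡⟨ lem₃ h N (w N) ⟩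
        N * N * (h * (w N * w N)) ∎)
        where
        open ≤-Reasoning
        h = n * (suc L * suc L)
        k = N * N * (L * L)
        lem : ∀ N L x y → N * N * (L * L) * (x * y) ≡ x * (N * N * (L * L * y))
        lem = solve-∀
        lem₂ : ∀ a b h u v → a * b * (h * (u * v)) ≡ h * (a * u * (b * v))
        lem₂ = solve-∀
        lem₃ : ∀ h N w → h * (N * w * (N * w)) ≡ N * N * (h * (w * w))
        lem₃ = solve-∀

      ω-bound : ∑₁ r ω ≤ r * w r
      ω-bound = ∑₁-≤ r (λ l a b → ≤-trans (*-monoˡ-≤ (w l) (♯-≤1 (prime? l))) (≤-trans (≤-reflexive (*-identityˡ (w l))) (w-mono a b)))

      D₂-bound : D₂ ≤ r * w r * (r * w r) * Q
      D₂-bound = ≤-trans (≤-reflexive (trans (∑₁-cong r (λ l₁ _ _ → ∑₁-*ʳ r Q (λ l₂ → ω l₁ * ω l₂))) (trans (∑₁-*ʳ r Q _) (cong (_* Q) (square ω)))))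
        (*-monoˡ-≤ Q (*-mono-≤ ω-bound ω-bound))

    total-bound : L * L * (∑₁ n (λ c → ♯ (P? c) * pairs (m c)) * θ) ≤ C * (n * (suc L * suc L) * (w (r * L) * w (r * L)) + L * L * (r * w r * (r * w r) * Q))
    total-bound = begin
      L * L * (∑₁ n (λ c → ♯ (P? c) * pairs (m c)) * θ) ≤⟨ *-monoʳ-≤ (L * L) first ⟩
      L * L * (C * (A + D₂)) ≡⟨ lem (L * L) C A D₂ ⟩
      C * (L * L * A + L * L * D₂) ≤⟨ *-monoʳ-≤ C (+-mono-≤ A-bound (*-monoʳ-≤ (L * L) D₂-bound)) ⟩
      C * (n * (suc L * suc L) * (w N * w N) + L * L * (r * w r * (r * w r) * Q)) ∎
      where
      open ≤-Reasoning
      lem : ∀ l c a d → l * (c * (a + d)) ≡ c * (l * a + l * d)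
      lem = solve-∀
      first : ∑₁ n (λ c → ♯ (P? c) * pairs (m c)) * θ ≤ C * (A + D₂)
      first = begin
        ∑₁ n (λ c → ♯ (P? c) * pairs (m c)) * θ ≡⟨ cong (_* θ) exchange ⟩
        ∑₁ r (λ l₁ → ∑₁ r (λ l₂ → weight l₁ l₂ * hits l₁ l₂)) * θ ≡⟨ trans (sym (∑₁-*ʳ r θ _)) (∑₁-cong r (λ l₁ _ _ → sym (∑₁-*ʳ r θ _))) ⟩
        ∑₁ r (λ l₁ → ∑₁ r (λ l₂ → weight l₁ l₂ * hits l₁ l₂ * θ)) ≤⟨ ∑₁-mono r (λ l₁ _ b₁ → ∑₁-mono r (λ l₂ _ b₂ → pair-bound l₁ l₂ b₁ b₂)) ⟩
        ∑₁ r (λ l₁ → ∑₁ r (λ l₂ → C * (ω l₁ * ω l₂ * (mult n (l₁ * l₂) + Q)))) ≡⟨ trans (∑₁-cong r (λ l₁ _ _ → ∑₁-* r C _)) (∑₁-* r C _) ⟩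
        C * ∑₁ r (λ l₁ → ∑₁ r (λ l₂ → ω l₁ * ω l₂ * (mult n (l₁ * l₂) + Q))) ≡⟨ cong (C *_) (trans (∑₁-cong r (λ l₁ _ _ → trans (∑₁-cong r (λ l₂ _ _ → *-distribˡ-+ (ω l₁ * ω l₂) _ Q)) (∑₁-+ r _ _))) (∑₁-+ r _ _)) ⟩
        C * (A + D₂) ∎

-- A union bound over the primes up to n.

module GoodPrime where

  open import Data.Nat
  open import Data.Nat.Properties
  open import Data.Nat.DivMod
  open import Data.Nat.Divisibility
  open import Data.Nat.Primality using (Prime; prime?; euclidsLemma)
  open import Data.Nat.Tactic.RingSolver using (solve-∀)
  open import Data.Product using (_,_; _×_; ∃; proj₁)
  open import Data.Sum using (_⊎_; inj₁; inj₂)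
  open import Data.Empty using (⊥-elim)
  open import Relation.Nullary using (¬_; Dec; yes; no; _×-dec_)
  open import Relation.Binary.PropositionalEquality
  open Sums
  open PrimeBasics
  open Multiples
  open Weights
  open PairCount
  open Chebyshev using (primeCount)

  ∑₁-shift : ∀ n f → ∑₁ (suc n) f ≡ f 1 + ∑₁ n (λ i → f (suc i))
  ∑₁-shift n f = ∑₁-split 1 n f

  -- An induction with `V` varying, which encodes the telescoping bound 1/s² ≤ 1/(s - 1) - 1/s for s
  -- > V.
  square-tail : ∀ n k V → V * ∑₁ k (λ i → mult n ((V + i) * (V + i))) ≤ n
  square-tail n zero V = ≤-trans (≤-reflexive (*-zeroʳ V)) z≤n
  square-tail n (suc k) V = *-cancelˡ-≤ (s * s) (begin
    s * s * (V * ∑₁ (suc k) f) ≡⟨ cong (λ t → s * s * (V * t)) (trans (∑₁-shift k f) (cong₂ _+_ (cong (λ t → mult n (t * t)) (+-comm V 1)) (∑₁-cong k (λ i _ _ → cong (λ t → mult n (t * t)) (+-suc V i))))) ⟩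
    s * s * (V * (a + b)) ≡⟨ lem s V a b ⟩
    V * (a * (s * s)) + V * s * (s * b) ≤⟨ +-mono-≤ (*-monoʳ-≤ V (proj₁ (mult-spec n {s * s} (s≤s z≤n)))) (*-monoʳ-≤ (V * s) (square-tail n k s)) ⟩
    V * n + V * s * n ≤⟨ ≤-trans (m≤m+n _ n) (≤-reflexive (lem₂ V n)) ⟩
    s * s * n ∎)
    where
    open ≤-Reasoning
    s = suc V
    f : ℕ → ℕ
    f i = mult n ((V + i) * (V + i))
    a = mult n (s * s)
    b = ∑₁ k (λ i → mult n ((s + i) * (s + i)))
    lem : ∀ s V a b → s * s * (V * (a + b)) ≡ V * (a * (s * s)) + V * s * (s * b)
    lem = solve-∀
    lem₂ : ∀ V n → V * n + V * suc V * n + n ≡ suc V * suc V * n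
    lem₂ = solve-∀

  module Search (M : ℕ) (1≤M : 1 ≤ M) (B n r V Y λ′ σ τ : ℕ) (1≤B : 1 ≤ B) (1≤n : 1 ≤ n) (1≤V : 1 ≤ V) (Y≤n : Y ≤ n) (1≤Y : 1 ≤ Y) (V≤r : V ≤ r)
    (n<VY : n < V * suc Y)
    (lg-hyp : ∀ m → 1 ≤ m → Y ≤ V * V * m → λ′ ≤ lg m)
    (σ-hyp : ∀ S → M * (M * λ′) ≤ suc M * (S + B * Weight.w M 1≤M B) → σ ≤ S)
    (τ-hyp : τ + Weight.w M 1≤M r ≤ σ) where

    open Weight M 1≤M
    open Pairs B r

    Smooth : ℕ → Set
    Smooth m = ∀ p → Prime p → p ∣ m → p ≤ r

    -- Removing the square part, at most V², leaves a squarefree smooth number of at least Y / V².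
    -- Its logarithm bounds `single` below by σ; the diagonal takes at most w r, so that τ remains
    -- as the second factor.
    smooth-pairs : ∀ m → 1 ≤ m → Y ≤ m → Smooth m → (∀ s → s * s ∣ m → s ≤ V) → σ * τ ≤ pairs m
    smooth-pairs m 1≤m Y≤m sm sq with squarefree-part m 1≤m
    ... | s , m′ , refl , sf = ≤-trans (*-monoˡ-≤ τ σ≤S) (+-cancelʳ-≤ (w r * S) (S * τ) (pairs m) (≤-trans (≤-trans (≤-reflexive (lem S τ (w r))) (*-monoʳ-≤ S (≤-trans τ-hyp σ≤S))) (single²≤ m)))
      where
      S = single m
      lem : ∀ S t w → S * t + w * S ≡ S * (t + w)
      lem = solve-∀
      1≤m′ : 1 ≤ m′
      1≤m′ = ∣⇒>0 1≤m (n∣m*n (s * s))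
      s≤V : s ≤ V
      s≤V = sq s (m∣m*n m′)
      σ≤S : σ ≤ S
      σ≤S = σ-hyp S (≤-trans (*-monoʳ-≤ M (*-monoʳ-≤ M (lg-hyp m′ 1≤m′ (≤-trans Y≤m (*-monoˡ-≤ m′ (*-mono-≤ s≤V s≤V))))))
        (≤-trans (wsum-≥ r m m′ 1≤m 1≤m′ sf (n∣m*n (s * s)) (λ p pp d → sm p pp (∣-trans d (n∣m*n (s * s))))) (*-monoʳ-≤ (suc M) (wsum≤single m 1≤B))))

    record Good : Set where
      field
        c p q k : ℕ
        prime-c : Prime c
        prime-p : Prime p
        prime-q : Prime q
        r<p : r < p
        r<q : r < q
        q∣ : q ∣ c ∸ 1
        n≡ : n ≡ c + k * p
        Y<c : Y < c
        Y≤kp : Y ≤ k * p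
        c∤ : ¬ c ∣ k * (p ∸ 1)

    P : ℕ → Set
    P c = Prime c × Y < c

    P? : ∀ c → Dec (P c)
    P? c = prime? c ×-dec (Y <? c)

    m₁ m₂ : ℕ → ℕ
    m₁ c = c ∸ 1
    m₂ c = n ∸ c

    private
      bad : (ℕ → ℕ) → ℕ → ℕ
      bad m c = ♯ (P? c ×-dec (σ * τ ≤? pairs (m c)))

      squares : (ℕ → ℕ) → ℕ → ℕ
      squares m c = ∑₁ n (λ i → ♯ ((1 ≤? m c) ×-dec ((V + i) * (V + i)) ∣? m c))

      -- If c divides p - 1, say p - 1 = j c, then n = c (1 + j k) + k with j k ≤ V, and the pair j,
      -- k determines c.
      rare : ℕ → ℕ
      rare c = ∑₁ V (λ j → ∑₁ V (λ k → ♯ (c * (1 + j * k) + k ≟ n)))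

      e₁ e₂ : ℕ → ℕ
      e₁ c = ♯ (c ≤? Y)
      e₂ c = ♯ ((n ∸ c) <? Y)

      -- At least 1 at every prime c that fails: c or n - c is too small, the square of some s > V
      -- divides c - 1 or n - c, c divides p - 1, or one of c - 1 and n - c has too many pairs.
      exceptional : ℕ → ℕ
      exceptional c = e₁ c + e₂ c + squares m₁ c + squares m₂ c + rare c + bad m₁ c + bad m₂ c

      large-prime? : ∀ m → 1 ≤ m → (∃ λ q → Prime q × r < q × q ∣ m) ⊎ Smooth m
      large-prime? m 1≤m with anyUpTo? (λ q → prime? q ×-dec (r <? q) ×-dec (q ∣? m)) (suc m)
      ... | yes (q , _ , h) = inj₁ (q , h)
      ... | no none = inj₂ (λ p pp d → ≮⇒≥ λ lt → none (p , s≤s (∣⇒≤′ 1≤m d) , pp , lt , d))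

      smooth-case : ∀ m c → Prime c → Y < c → 1 ≤ m c → Y ≤ m c → m c ≤ n → Smooth (m c) → 1 ≤ squares m c + bad m c
      smooth-case m c pc Y<c 1≤m Y≤m m≤n sm with anyUpTo? (λ s → (V <? s) ×-dec (s * s) ∣? m c) (suc n)
      ... | yes (s , s≤n , V<s , d) = ≤-trans (≤-trans (≤-reflexive (sym (♯-yes ((1 ≤? m c) ×-dec ((V + i) * (V + i)) ∣? m c) (1≤m , subst (λ t → t * t ∣ m c) (sym s≡) d))))
              (∑₁-term n (λ i → ♯ ((1 ≤? m c) ×-dec ((V + i) * (V + i)) ∣? m c)) i (m<n⇒0<n∸m V<s) (≤-trans (m∸n≤m s V) (≤-pred s≤n)))) (m≤m+n (squares m c) (bad m c))
        where
        i = s ∸ V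
        s≡ : V + i ≡ s
        s≡ = m+[n∸m]≡n (<⇒≤ V<s)
      ... | no none = ≤-trans (≤-reflexive (sym (♯-yes (P? c ×-dec (σ * τ ≤? pairs (m c))) ((pc , Y<c) , smooth-pairs (m c) 1≤m Y≤m sm small)))) (m≤n+m (bad m c) (squares m c))
        where
        small : ∀ s → s * s ∣ m c → s ≤ V
        small s d = ≮⇒≥ λ lt → none (s , s≤s (≤-trans (m≤m*n s s {{>-nonZero (≤-trans (s≤s z≤n) lt)}}) (≤-trans (∣⇒≤′ 1≤m d) m≤n)) , lt , d)

      examine-prime : ∀ c → 1 ≤ c → c ≤ n → Prime c → Good ⊎ (1 ≤ exceptional c)
      examine-prime c 1≤c c≤n pc with c ≤? Y | (n ∸ c) <? Y
      ... | yes le | _ = inj₂ (s≤s z≤n)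
      ... | no _ | yes lt = inj₂ (s≤s z≤n)
      ... | no nle | no nlt with large-prime? (c ∸ 1) (≤-trans 1≤Y (≤-pred-c)) | large-prime? (n ∸ c) (≤-trans 1≤Y (≮⇒≥ nlt))
        where
        ≤-pred-c : Y ≤ c ∸ 1
        ≤-pred-c = ∸-monoˡ-≤ 1 (≰⇒> nle)
      ...   | inj₂ sm | _ = inj₂ (≤-trans (smooth-case m₁ c pc (≰⇒> nle) (≤-trans 1≤Y (∸-monoˡ-≤ 1 (≰⇒> nle))) (∸-monoˡ-≤ 1 (≰⇒> nle)) (≤-trans (m∸n≤m c 1) c≤n) sm)
                (≤-trans (m≤m+n (squares m₁ c + bad m₁ c) (squares m₂ c + rare c + bad m₂ c)) (≤-reflexive (lem (squares m₁ c) (bad m₁ c) (squares m₂ c) (rare c) (bad m₂ c)))))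
        where lem : ∀ a b d e f → a + b + (d + e + f) ≡ a + d + e + b + f
              lem = solve-∀
      ...   | inj₁ _ | inj₂ sm = inj₂ (≤-trans (smooth-case m₂ c pc (≰⇒> nle) (≤-trans 1≤Y (≮⇒≥ nlt)) (≮⇒≥ nlt) (m∸n≤m n c) sm)
                (≤-trans (m≤m+n (squares m₂ c + bad m₂ c) (squares m₁ c + rare c + bad m₁ c)) (≤-reflexive (lem (squares m₁ c) (bad m₁ c) (squares m₂ c) (rare c) (bad m₂ c)))))
        where lem : ∀ a b d e f → d + f + (a + e + b) ≡ a + d + e + b + f
              lem = solve-∀
      ...   | inj₁ (q , pq , r<q , q∣) | inj₁ (p , pp , r<p , divides k e) with c ∣? (k * (p ∸ 1))
      ...     | no nd = inj₁ (record { k = k ; prime-c = pc ; prime-p = pp ; prime-q = pq ; r<p = r<p ; r<q = r<q ; q∣ = q∣ ; n≡ = trans (sym (m+[n∸m]≡n c≤n)) (cong (c +_) e)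
                ; Y<c = ≰⇒> nle ; Y≤kp = ≤-trans (≮⇒≥ nlt) (≤-reflexive e) ; c∤ = nd })
      ...     | yes d = inj₂ (≤-trans (rare-case (euclidsLemma k (p ∸ 1) pc d)) (≤-trans (m≤m+n (rare c) (squares m₁ c + squares m₂ c + bad m₁ c + bad m₂ c)) (≤-reflexive (lem (squares m₁ c) (bad m₁ c) (squares m₂ c) (rare c) (bad m₂ c)))))
        where
        lem : ∀ a b d e f → e + (a + d + b + f) ≡ a + d + e + b + f
        lem = solve-∀
        n≡ : n ≡ c + k * p
        n≡ = trans (sym (m+[n∸m]≡n c≤n)) (cong (c +_) e)
        1≤k : 1 ≤ k
        1≤k = n≢0⇒n>0 λ { refl → <-irrefl refl (≤-trans 1≤Y (≤-trans (≮⇒≥ nlt) (≤-reflexive e))) }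
        n<Vc : n < V * c
        n<Vc = <-≤-trans n<VY (*-monoʳ-≤ V (≰⇒> nle))
        -- From n < V c and V ≤ r < p: a k of at least c would make k p exceed n. Hence c can divide
        -- k (p - 1) only through p - 1.
        k<c : k < c
        k<c = ≰⇒> λ c≤k → <-irrefl refl (<-≤-trans n<Vc (≤-trans (*-mono-≤ (≤-trans V≤r (<⇒≤ r<p)) c≤k) (≤-trans (≤-reflexive (*-comm p k)) (≤-trans (m≤n+m (k * p) c) (≤-reflexive (sym n≡))))))
        rare-case : (c ∣ k) ⊎ (c ∣ p ∸ 1) → 1 ≤ rare c
        rare-case (inj₁ h) = ⊥-elim (<-irrefl refl (≤-trans k<c (∣⇒≤′ 1≤k h)))
        rare-case (inj₂ (divides j ej)) = ≤-trans (≤-reflexive (sym (♯-yes (c * (1 + j * k) + k ≟ n) (sym eq))))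
            (≤-trans (∑₁-term V (λ k → ♯ (c * (1 + j * k) + k ≟ n)) k 1≤k (≤-trans (m≤n*m k j {{>-nonZero 1≤j}}) jk≤V))
                     (∑₁-term V (λ j → ∑₁ V (λ k → ♯ (c * (1 + j * k) + k ≟ n))) j 1≤j (≤-trans (m≤m*n j k {{>-nonZero 1≤k}}) jk≤V)))
          where
          1≤j : 1 ≤ j
          1≤j = n≢0⇒n>0 λ { refl → <-irrefl refl (≤-trans (m<n⇒0<n∸m (prime>1 pp)) (≤-reflexive ej)) }
          p≡ : p ≡ 1 + j * c
          p≡ = trans (sym (m+[n∸m]≡n (prime>0 pp))) (cong suc ej)
          eq : n ≡ c * (1 + j * k) + k
          eq = trans n≡ (trans (cong (λ t → c + k * t) p≡) (elem c j k))
            where elem : ∀ c j k → c + k * (1 + j * c) ≡ c * (1 + j * k) + k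
                  elem = solve-∀
          jk≤V : j * k ≤ V
          jk≤V = <⇒≤ (*-cancelʳ-< c (j * k) V (≤-<-trans (≤-trans (≤-trans (≤-reflexive (*-comm (j * k) c)) (*-monoʳ-≤ c (n≤1+n (j * k)))) (≤-trans (m≤m+n _ k) (≤-reflexive (sym eq)))) n<Vc))

      examine : ∀ c → 1 ≤ c → c ≤ n → Good ⊎ (♯ (prime? c) ≤ exceptional c)
      examine c l u = go (prime? c)
        where
        go : (d : Dec (Prime c)) → Good ⊎ (♯ d ≤ exceptional c)
        go (yes pc) = examine-prime c l u pc
        go (no _)   = inj₂ z≤n

      scan : ∀ N → N ≤ n → Good ⊎ (∑₁ N (λ c → ♯ (prime? c)) ≤ ∑₁ N exceptional)
      scan zero le = inj₂ z≤n
      scan (suc N) le with scan N (<⇒≤ le) | examine (suc N) (s≤s z≤n) le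
      ... | inj₁ g | _      = inj₁ g
      ... | inj₂ _ | inj₁ g = inj₁ g
      ... | inj₂ a | inj₂ b = inj₂ (+-mono-≤ a b)

      sum-e₁ : ∀ N → ∑₁ N e₁ ≤ Y
      sum-e₁ zero = z≤n
      sum-e₁ (suc N) with suc N ≤? Y
      ... | no _ = ≤-trans (≤-reflexive (+-identityʳ _)) (sum-e₁ N)
      ... | yes le = ≤-trans (+-monoˡ-≤ 1 (∑₁-≤ N (λ l _ _ → ♯-≤1 (l ≤? Y)))) (≤-trans (≤-reflexive (trans (cong (_+ 1) (*-identityʳ N)) (+-comm N 1))) le)

      sum-e₂ : ∑₁ n e₂ ≤ Y
      sum-e₂ = ≤-trans (≤-reflexive (trans (cong (λ t → ∑₁ t e₂) (sym (m∸n+n≡m Y≤n))) (trans (∑₁-split (n ∸ Y) Y e₂)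
          (cong (_+ ∑₁ Y (λ m → e₂ (n ∸ Y + m))) (trans (∑₁-cong (n ∸ Y) (λ c _ u → ♯-no ((n ∸ c) <? Y) (λ lt → <-irrefl refl (<-≤-trans lt
            (≤-trans (≤-reflexive (sym (m∸[m∸n]≡n Y≤n))) (∸-monoʳ-≤ n u)))))) (∑₁-zero (n ∸ Y)))))))
        (≤-trans (∑₁-≤ Y (λ m _ _ → ♯-≤1 ((n ∸ (n ∸ Y + m)) <? Y))) (≤-reflexive (*-identityʳ Y)))

      sum-rare : ∑₁ n rare ≤ V * V
      sum-rare = ≤-trans (≤-reflexive (∑₁-swap n V _)) (∑₁-≤ V (λ j _ _ → ≤-trans (≤-reflexive (∑₁-swap n V _)) (≤-trans (∑₁-≤ V (λ k _ _ →
          ≟-unique (λ c → c * (1 + j * k) + k) (λ {a} {b} e → *-cancelʳ-≡ a b (1 + j * k) (+-cancelʳ-≡ k _ _ e)) n)) (≤-reflexive (*-identityʳ V)))))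

      -- Injectivity of `m` bounds the c with s² dividing m c by the multiples of s² up to n, for
      -- each s > V.
      sum-squares : ∀ m → (∀ a b → 1 ≤ a → a ≤ n → 1 ≤ b → b ≤ n → m a ≡ m b → a ≡ b) → (∀ c → 1 ≤ c → c ≤ n → m c ≤ n) → V * ∑₁ n (squares m) ≤ n
      sum-squares m inj m≤n = ≤-trans (*-monoʳ-≤ V (≤-trans (≤-reflexive (∑₁-swap n n _)) (∑₁-mono n (λ i _ _ → multiples ((V + i) * (V + i)))))) (square-tail n n V)
        where
        multiples : ∀ x → ∑₁ n (λ c → ♯ ((1 ≤? m c) ×-dec x ∣? m c)) ≤ mult n x
        multiples x = begin
          ∑₁ n (λ c → ♯ ((1 ≤? m c) ×-dec x ∣? m c)) ≤⟨ ∑₁-mono n (λ c l u → term c l u) ⟩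
          ∑₁ n (λ c → ∑₁ n (λ y → ♯ (at? y c) * ♯ (x ∣? y))) ≡⟨ ∑₁-swap n n _ ⟩
          ∑₁ n (λ y → ∑₁ n (λ c → ♯ (at? y c) * ♯ (x ∣? y))) ≡⟨ ∑₁-cong n (λ y _ _ → ∑₁-*ʳ n (♯ (x ∣? y)) (λ c → ♯ (at? y c))) ⟩
          ∑₁ n (λ y → ∑₁ n (λ c → ♯ (at? y c)) * ♯ (x ∣? y)) ≤⟨ ∑₁-mono n (λ y _ _ → ≤-trans (*-monoˡ-≤ (♯ (x ∣? y)) (∑₁-unique n _ (λ c → ♯-≤1 (at? y c)) (uniq y))) (≤-reflexive (*-identityˡ _))) ⟩
          mult n x ∎
          where
          open ≤-Reasoning
          at? : ∀ y c → Dec ((1 ≤ c × c ≤ n) × m c ≡ y)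
          at? y c = ((1 ≤? c) ×-dec (c ≤? n)) ×-dec (m c ≟ y)
          uniq : ∀ y a b → 1 ≤ ♯ (at? y a) → 1 ≤ ♯ (at? y b) → a ≡ b
          uniq y a b h h′ with at? y a | at? y b
          ... | yes ((l , u) , e) | yes ((l′ , u′) , e′) = inj a b l u l′ u′ (trans e (sym e′))
          term : ∀ c → 1 ≤ c → c ≤ n → ♯ ((1 ≤? m c) ×-dec x ∣? m c) ≤ ∑₁ n (λ y → ♯ (at? y c) * ♯ (x ∣? y))
          term c l u with (1 ≤? m c) ×-dec x ∣? m c
          ... | no _ = z≤n
          ... | yes (1≤m , d) = ≤-trans (≤-reflexive (sym (cong₂ _*_ (♯-yes (at? (m c) c) ((l , u) , refl)) (♯-yes (x ∣? m c) d))))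
                (∑₁-term n (λ y → ♯ (at? y c) * ♯ (x ∣? y)) (m c) 1≤m (m≤n c l u))

      sum-bad : ∀ m → σ * τ * ∑₁ n (bad m) ≤ ∑₁ n (λ c → ♯ (P? c) * pairs (m c))
      sum-bad m = ≤-trans (≤-reflexive (sym (∑₁-* n (σ * τ) (bad m)))) (∑₁-mono n (λ c _ _ → term c))
        where
        term : ∀ c → σ * τ * bad m c ≤ ♯ (P? c) * pairs (m c)
        term c with P? c | σ * τ ≤? pairs (m c)
        ... | no _  | yes _ = ≤-reflexive (*-zeroʳ (σ * τ))
        ... | no _  | no _  = ≤-reflexive (*-zeroʳ (σ * τ))
        ... | yes _ | no _  = ≤-trans (≤-reflexive (*-zeroʳ (σ * τ))) z≤n
        ... | yes _ | yes h = ≤-trans (≤-reflexive (*-identityʳ (σ * τ))) (≤-trans h (≤-reflexive (sym (*-identityˡ _))))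

    -- The outcome when no prime works: `E` counts the exceptions that will be of size O(n / V),
    -- `b₁` and `b₂` the primes for which c - 1 and n - c have many pairs.
    record Few : Set where
      field
        E b₁ b₂ : ℕ
        count : primeCount n ≤ E + b₁ + b₂
        E-bound : V * E ≤ V * (Y + Y) + (n + n) + V * (V * V)
        b₁-bound : σ * τ * b₁ ≤ ∑₁ n (λ c → ♯ (P? c) * pairs (m₁ c))
        b₂-bound : σ * τ * b₂ ≤ ∑₁ n (λ c → ♯ (P? c) * pairs (m₂ c))

    dichotomy : Good ⊎ Few
    dichotomy with scan n ≤-refl
    ... | inj₁ g = inj₁ g
    ... | inj₂ h = inj₂ (record
        { E = E ; b₁ = ∑₁ n (bad m₁) ; b₂ = ∑₁ n (bad m₂)
        ; count = ≤-trans h (≤-reflexive sums)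
        ; E-bound = ≤-trans (≤-reflexive (lem V (∑₁ n e₁) (∑₁ n e₂) (∑₁ n (squares m₁)) (∑₁ n (squares m₂)) (∑₁ n rare)))
            (+-mono-≤ (+-mono-≤ (*-monoʳ-≤ V (+-mono-≤ (sum-e₁ n) sum-e₂)) (+-mono-≤ (sum-squares m₁ inj₁′ (λ c _ u → ≤-trans (m∸n≤m c 1) u)) (sum-squares m₂ inj₂′ (λ c _ _ → m∸n≤m n c)))) (*-monoʳ-≤ V sum-rare))
        ; b₁-bound = sum-bad m₁ ; b₂-bound = sum-bad m₂ })
      where
      E = ∑₁ n e₁ + ∑₁ n e₂ + ∑₁ n (squares m₁) + ∑₁ n (squares m₂) + ∑₁ n rare
      lem : ∀ V a b c d e → V * (a + b + c + d + e) ≡ V * (a + b) + (V * c + V * d) + V * e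
      lem = solve-∀
      sums : ∑₁ n exceptional ≡ E + ∑₁ n (bad m₁) + ∑₁ n (bad m₂)
      sums = trans (∑₁-+ n _ (bad m₂)) (cong (_+ ∑₁ n (bad m₂)) (trans (∑₁-+ n _ (bad m₁)) (cong (_+ ∑₁ n (bad m₁))
        (trans (∑₁-+ n _ rare) (cong (_+ ∑₁ n rare) (trans (∑₁-+ n _ (squares m₂)) (cong (_+ ∑₁ n (squares m₂)) (trans (∑₁-+ n _ (squares m₁)) (cong (_+ ∑₁ n (squares m₁)) (∑₁-+ n e₁ e₂)))))))))) 
      inj₁′ : ∀ a b → 1 ≤ a → a ≤ n → 1 ≤ b → b ≤ n → m₁ a ≡ m₁ b → a ≡ b
      inj₁′ (suc a) (suc b) _ _ _ _ e = cong suc e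
      inj₂′ : ∀ a b → 1 ≤ a → a ≤ n → 1 ≤ b → b ≤ n → m₂ a ≡ m₂ b → a ≡ b
      inj₂′ a b _ u _ u′ e = ∸-cancelˡ-≡ u u′ e

    class₁ : ∀ d .{{_ : NonZero d}} → ∃ λ ρ → ∀ c → 1 ≤ c → c ≤ n → d ∣ m₁ c → c % d ≡ ρ
    class₁ d = 1 % d , λ { (suc c) _ _ (divides q e) → trans (cong (λ t → suc t % d) e) ([m+kn]%n≡m%n 1 q d) }

    class₂ : ∀ d .{{_ : NonZero d}} → ∃ λ ρ → ∀ c → 1 ≤ c → c ≤ n → d ∣ m₂ c → c % d ≡ ρ
    class₂ d = n % d , λ { c _ u (divides q e) → sym (trans (cong (_% d) (trans (sym (m+[n∸m]≡n u)) (cong (c +_) e))) ([m+kn]%n≡m%n c q d)) }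

-- The estimates combined for large n.

module Asymptotic where

  open import Data.Nat
  open import Data.Nat.Properties
  open import Data.Nat.DivMod
  open import Data.Nat.Divisibility
  open import Data.Nat.Primality using (Prime; prime?)
  open import Data.Nat.Tactic.RingSolver using (solve-∀)
  open import Data.Product using (_,_; ∃; proj₂)
  open import Data.Sum using ([_,_]′)
  open import Data.Empty using (⊥; ⊥-elim)
  open import Relation.Nullary using (_×-dec_)
  open import Relation.Binary.PropositionalEquality
  open Sums
  open PrimeBasics
  open Multiples
  open Weights
  open PairCount
  open Chebyshev
  open GoodPrime

  2^+ : ∀ a b → 2 ^ (a + b) ≡ 2 ^ a * 2 ^ b
  2^+ = ^-distribˡ-+-* 2

  ^-cancel-< : ∀ k {a b} → a ^ k < b ^ k → a < b
  ^-cancel-< k {a} {b} h = ≰⇒> λ le → <-irrefl refl (<-≤-trans h (^-monoˡ-≤ k le))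

  -- After multiplication by α v D the three upper bounds turn the right side of Chebyshev's
  -- inequality into at most γ n, apart from an additive term that n exceeds. So γ < α v D is the
  -- numerical core: there are fewer bad primes than primes.
  final-arithmetic : ∀ α v D x μ E b₁ b₂ n β γ → γ ≡ x * (5 * α + 2 * (v * D * β)) → γ < α * (v * D) → α * (v * D) < n →
    n ≤ 1 + x * μ * (E + b₁ + b₂) → v * (D * μ) * E ≤ 5 * n → α * (μ * b₁) ≤ β * n → α * (μ * b₂) ≤ β * n → ⊥
  final-arithmetic α v D x μ E b₁ b₂ n β γ γ≡ num big n≤ E≤ B₁ B₂ = <-irrefl refl (<-≤-trans big (+-cancelʳ-≤ (γ * n) n A (begin
    n + γ * n ≤⟨ *-monoˡ-≤ n num ⟩
    A * n ≤⟨ *-monoʳ-≤ A n≤ ⟩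
    A * (1 + x * μ * (E + b₁ + b₂)) ≡⟨ lem₀ A x μ (E + b₁ + b₂) ⟩
    A + x * (A * (μ * (E + b₁ + b₂))) ≡⟨ cong (λ y → A + x * y) (lem₁ α v D μ E b₁ b₂) ⟩
    A + x * (α * (v * (D * μ) * E) + v * D * (α * (μ * b₁) + α * (μ * b₂))) ≤⟨ +-monoʳ-≤ A (*-monoʳ-≤ x (+-mono-≤ (*-monoʳ-≤ α E≤) (*-monoʳ-≤ (v * D) (+-mono-≤ B₁ B₂)))) ⟩
    A + x * (α * (5 * n) + v * D * (β * n + β * n)) ≡⟨ cong (A +_) (trans (lem₂ x α 5 n (v * D) β) (cong (_* n) (sym γ≡))) ⟩
    A + γ * n ∎)))
    where
    open ≤-Reasoning
    A = α * (v * D)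
    lem₀ : ∀ a x m s → a * (1 + x * m * s) ≡ a + x * (a * (m * s))
    lem₀ = solve-∀
    lem₁ : ∀ a v D m e b c → a * (v * D) * (m * (e + b + c)) ≡ a * (v * (D * m) * e) + v * D * (a * (m * b) + a * (m * c))
    lem₁ = solve-∀
    lem₂ : ∀ x a k n v b → x * (a * (k * n) + v * (b * n + b * n)) ≡ x * (k * a + 2 * (v * b)) * n
    lem₂ = solve-∀

  -- Logarithms are measured in units of μ: `D` for n, `D₄` for its fourth root r, `d` for the sieve
  -- level z and, times M, `s` for `single` and `t` for what the diagonal leaves of it. As 2^μ
  -- exceeds the powers of lg n that occur, giving up one unit absorbs each of them.
  module Estimate (d D₄ D₁ D M s t v B θ₁ C α β γ : ℕ) (D₄≡ : D₄ ≡ suc d) (D≡ : D ≡ 4 * D₄) (D₁≡ : D ≡ suc D₁)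
    (α≡ : α ≡ D * (s * t * (θ₁ * d))) (β≡ : β ≡ C * (suc D * ((2 + D₄) * (2 + D₄)))) (γ≡ : γ ≡ (2 + D) * (5 * α + 2 * (v * D * β))) (num₃ : γ < α * (v * D))
    (1≤M : 1 ≤ M) (1≤B : 1 ≤ B) (1≤v : 1 ≤ v)
    (num₁ : suc M * (M * s + 1) < M * (M * D₁)) (num₂ : t + suc D₄ ≤ s)
    (bt : ∀ l₁ l₂ → Prime l₁ → Prime l₂ → B ≤ l₁ → B ≤ l₂ → ∀ a K z → 1 ≤ z →
      ∑₁ K (λ k → ♯ (prime? (a + l₁ * l₂ * k) ×-dec (suc z <? (a + l₁ * l₂ * k)))) * (θ₁ * (lg z ∸ 5)) ≤ C * (K + 64 * (z * z))) where

    module _ (n μ r : ℕ) (1≤n : 1 ≤ n) (D≤μ : D ≤ μ) (3≤μ : 3 ≤ μ) (65≤L : 65 ≤ lg n)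
      (Dμ≤L : D * μ ≤ lg n) (L≤ : lg n ≤ suc D * μ) (r≤ : r ^ 4 ≤ n) (<r : n < suc r ^ 4)
      (V-small : 2 * (v * lg n * (v * lg n) * (v * lg n)) ≤ 2 ^ μ) (L-small : 32 * lg n ≤ 2 ^ μ) (B-small : B * Weight.w M 1≤M B ≤ μ)
      (n-large : α * (v * D) < n) where

      open Weight M 1≤M

      private
        L = lg n
        V = v * L

        1≤μ : 1 ≤ μ
        1≤μ = ≤-trans (s≤s z≤n) 3≤μ

        1≤L : 1 ≤ L
        1≤L = ≤-trans (s≤s z≤n) 65≤L

        instance
          D≢0 : NonZero D
          D≢0 = >-nonZero (≤-trans (s≤s z≤n) (≤-reflexive (sym D₁≡)))
          D₄≢0 : NonZero D₄
          D₄≢0 = >-nonZero (≤-trans (s≤s z≤n) (≤-reflexive (sym D₄≡)))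
          L≢0 : NonZero L
          L≢0 = >-nonZero 1≤L
          V≢0 : NonZero V
          V≢0 = >-nonZero (*-mono-≤ 1≤v 1≤L)

        1≤V : 1 ≤ V
        1≤V = *-mono-≤ 1≤v 1≤L

        fourth : ∀ e → (2 ^ (e * μ)) ^ 4 ≡ 2 ^ (4 * e * μ)
        fourth e = trans (^-*-assoc 2 (e * μ) 4) (cong (2 ^_) (lem e μ))
          where lem : ∀ e m → e * m * 4 ≡ 4 * e * m
                lem = solve-∀

        r-lower : 2 ^ (D₄ * μ) ≤ r
        r-lower = ≤-pred (^-cancel-< 4 (≤-<-trans (≤-reflexive (trans (fourth D₄) (cong (λ x → 2 ^ (x * μ)) (sym D≡)))) (≤-<-trans (≤-trans (^-monoʳ-≤ 2 Dμ≤L) (2^lg≤ 1≤n)) <r)))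

        r-upper : r ≤ 2 ^ (suc D₄ * μ)
        r-upper = <⇒≤ (^-cancel-< 4 (≤-<-trans r≤ (<-≤-trans (<2^lg n) (≤-trans (^-monoʳ-≤ 2 (≤-trans (s≤s L≤) four)) (≤-reflexive (sym (fourth (suc D₄))))))))
          where
          lem : ∀ x m → 4 * suc x * m ≡ suc (4 * x) * m + (m + m + m)
          lem = solve-∀
          four : suc (suc D * μ) ≤ 4 * suc D₄ * μ
          four = ≤-trans (≤-trans (≤-reflexive (+-comm 1 (suc D * μ))) (+-monoʳ-≤ (suc D * μ) (≤-trans 1≤μ (≤-trans (m≤m+n μ μ) (m≤m+n (μ + μ) μ))))) (≤-reflexive (trans (cong (λ x → suc x * μ + (μ + μ + μ)) D≡) (sym (lem D₄ μ))))

        V≤2^μ : V ≤ 2 ^ μ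
        V≤2^μ = ≤-trans (≤-trans (m≤m*n V (V * V) {{>-nonZero (*-mono-≤ 1≤V 1≤V)}}) (≤-trans (≤-reflexive (sym (*-assoc V V V))) (m≤n*m (V * V * V) 2))) V-small

        2^μ≤r : 2 ^ μ ≤ r
        2^μ≤r = ≤-trans (^-monoʳ-≤ 2 (m≤n*m μ D₄)) r-lower

        V≤r : V ≤ r
        V≤r = ≤-trans V≤2^μ 2^μ≤r

        L≤2^μ : L ≤ 2 ^ μ
        L≤2^μ = ≤-trans (m≤n*m L 32) L-small

        2≤r : 2 ≤ r
        2≤r = ≤-trans (≤-trans (≤-reflexive (sym (*-identityʳ 2))) (^-monoʳ-≤ 2 1≤μ)) 2^μ≤r

        1≤r : 1 ≤ r
        1≤r = <⇒≤ 2≤r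

        -- Dividing by L keeps the total sieve error over all pairs l₁, l₂ ≤ r a factor of order L²
        -- below the main term.
        z = r / L

        z-lower : 2 ^ (d * μ + 5) ≤ z
        z-lower = subst (_≤ z) (m*n/n≡m (2 ^ (d * μ + 5)) L) (/-monoˡ-≤ L (begin
          2 ^ (d * μ + 5) * L ≡⟨ cong (_* L) (2^+ (d * μ) 5) ⟩
          2 ^ (d * μ) * 32 * L ≡⟨ *-assoc (2 ^ (d * μ)) 32 L ⟩
          2 ^ (d * μ) * (32 * L) ≤⟨ *-monoʳ-≤ (2 ^ (d * μ)) L-small ⟩
          2 ^ (d * μ) * 2 ^ μ ≡⟨ trans (sym (2^+ (d * μ) μ)) (cong (2 ^_) (trans (+-comm (d * μ) μ) (cong (_* μ) (sym D₄≡)))) ⟩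
          2 ^ (D₄ * μ) ≤⟨ r-lower ⟩
          r ∎))
          where open ≤-Reasoning

        1≤z : 1 ≤ z
        1≤z = ≤-trans (m^n>0 2 (d * μ + 5)) z-lower

        lgz : d * μ ≤ lg z ∸ 5
        lgz = subst (_≤ lg z ∸ 5) (m+n∸n≡m (d * μ) 5) (∸-monoˡ-≤ 5 (lg-max (d * μ + 5) z-lower))

        wr≤ : w r ≤ M * (suc D₄ * μ)
        wr≤ = w≤ 1≤r r-upper

        W = M * ((2 + D₄) * μ)

        wr≤W : w r ≤ W
        wr≤W = ≤-trans wr≤ (*-monoʳ-≤ M (*-monoˡ-≤ μ (n≤1+n (suc D₄))))

        wN≤W : w (r * L) ≤ W
        wN≤W = w≤ (*-mono-≤ 1≤r 1≤L) (≤-trans (*-mono-≤ r-upper L≤2^μ) (≤-reflexive (trans (sym (2^+ (suc D₄ * μ) μ)) (cong (2 ^_) (+-comm (suc D₄ * μ) μ)))))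

        -- The primes up to Y number at most n / (v L), about the proportion 1/v of the n / L primes
        -- that Chebyshev's bound provides.
        Y = n / V

        r⁴ : r * r * (r * r) ≤ n
        r⁴ = ≤-trans (≤-reflexive (lem r)) r≤
          where lem : ∀ r → r * r * (r * r) ≡ r * (r * (r * (r * 1)))
                lem = solve-∀

        r²≤Y : r * r ≤ Y
        r²≤Y = subst (_≤ Y) (m*n/n≡m (r * r) V) (/-monoˡ-≤ V (≤-trans (*-monoʳ-≤ (r * r) (≤-trans V≤r (m≤m*n r r {{>-nonZero 1≤r}}))) r⁴))

        1≤Y : 1 ≤ Y
        1≤Y = ≤-trans (*-mono-≤ 1≤r 1≤r) r²≤Y

        -- The sieve bounds only the primes above z + 1; those under consideration exceed Y.
        z<Y : suc z ≤ Y
        z<Y = ≤-trans (s≤s (m/n≤m r L)) (≤-trans (≤-trans (≤-reflexive (+-comm 1 r)) (≤-trans (+-monoʳ-≤ r 1≤r) (≤-reflexive (cong (r +_) (sym (+-identityʳ r)))))) (≤-trans (*-monoˡ-≤ r 2≤r) r²≤Y))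

        VY≤n : V * Y ≤ n
        VY≤n = ≤-trans (≤-reflexive (*-comm V Y)) (m/n*n≤m n V)

        n<VY : n < V * suc Y
        n<VY = ≤-<-trans (≤-reflexive (m≡m%n+[m/n]*n n V)) (<-≤-trans (+-monoˡ-< (Y * V) (m%n<n n V)) (≤-reflexive (*-comm (suc Y) V)))

        -- One unit less than `D`, given up for the factor 2 V³ between n and m in `lg-hyp`.
        λ′ = D₁ * μ

        lg-hyp : ∀ m → 1 ≤ m → Y ≤ V * V * m → λ′ ≤ lg m
        lg-hyp m 1≤m h = lg-max λ′ (<⇒≤ (*-cancelˡ-< (2 ^ μ) _ _ (begin-strict
          2 ^ μ * 2 ^ λ′ ≡⟨ sym (2^+ μ λ′) ⟩
          2 ^ (μ + λ′) ≤⟨ ≤-trans (^-monoʳ-≤ 2 (subst (λ x → x * μ ≤ L) D₁≡ Dμ≤L)) (2^lg≤ 1≤n) ⟩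
          n <⟨ n<VY ⟩
          V * suc Y ≤⟨ *-monoʳ-≤ V (≤-trans (≤-reflexive (+-comm 1 Y)) (+-monoʳ-≤ Y 1≤Y)) ⟩
          V * (Y + Y) ≤⟨ *-monoʳ-≤ V (+-mono-≤ h h) ⟩
          V * (V * V * m + V * V * m) ≡⟨ lem V m ⟩
          2 * (V * V * V) * m ≤⟨ *-monoˡ-≤ m V-small ⟩
          2 ^ μ * m ∎)))
          where
          open ≤-Reasoning
          lem : ∀ V m → V * (V * V * m + V * V * m) ≡ 2 * (V * V * V) * m
          lem = solve-∀

        σ = M * (s * μ)
        τ = M * (t * μ)

        σ-hyp : ∀ S → M * (M * λ′) ≤ suc M * (S + B * w B) → σ ≤ S
        σ-hyp S h = ≮⇒≥ λ S<σ → <-irrefl refl (≤-<-trans h (begin-strict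
          suc M * (S + B * w B) ≤⟨ *-monoʳ-≤ (suc M) (+-mono-≤ (<⇒≤ S<σ) B-small) ⟩
          suc M * (M * (s * μ) + μ) ≡⟨ lem M s μ ⟩
          suc M * (M * s + 1) * μ <⟨ *-monoˡ-< μ {{>-nonZero 1≤μ}} num₁ ⟩
          M * (M * D₁) * μ ≡⟨ lem₂ M D₁ μ ⟩
          M * (M * λ′) ∎))
          where
          open ≤-Reasoning
          lem : ∀ M s m → suc M * (M * (s * m) + m) ≡ suc M * (M * s + 1) * m
          lem = solve-∀
          lem₂ : ∀ M x m → M * (M * x) * m ≡ M * (M * (x * m))
          lem₂ = solve-∀

        τ-hyp : τ + w r ≤ σ
        τ-hyp = ≤-trans (+-monoʳ-≤ τ wr≤) (≤-trans (≤-reflexive (lem M t (suc D₄) μ)) (*-monoʳ-≤ M (*-monoˡ-≤ μ num₂)))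
          where lem : ∀ M t x m → M * (t * m) + M * (x * m) ≡ M * ((t + x) * m)
                lem = solve-∀

      open Search M 1≤M B n r V Y λ′ σ τ 1≤B 1≤n 1≤V (m/n≤m n V) 1≤Y V≤r n<VY lg-hyp σ-hyp τ-hyp
      open Pairs B r using (pairs)

      private
        θ = θ₁ * (lg z ∸ 5)
        Q = 64 * (z * z)

        bt′ : ∀ l₁ l₂ → Prime l₁ → Prime l₂ → B ≤ l₁ → B ≤ l₂ → ∀ a K → ∑₁ K (λ k → ♯ (P? (a + l₁ * l₂ * k))) * θ ≤ C * (K + Q)
        bt′ l₁ l₂ p₁ p₂ b₁ b₂ a K = ≤-trans (*-monoˡ-≤ θ (∑₁-mono K (λ k _ _ → ♯-mono (P? (a + l₁ * l₂ * k)) (prime? (a + l₁ * l₂ * k) ×-dec (suc z <? (a + l₁ * l₂ * k)))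
          (λ { (pc , lt) → pc , ≤-<-trans z<Y lt })))) (bt l₁ l₂ p₁ p₂ b₁ b₂ a K z 1≤z)

        pair-sum : ∀ m → (∀ d .{{_ : NonZero d}} → ∃ λ ρ → ∀ c → 1 ≤ c → c ≤ n → d ∣ m c → c % d ≡ ρ) →
          D * (∑₁ n (λ c → ♯ (P? c) * pairs (m c)) * θ) ≤ C * (suc D * (W * W)) * n
        pair-sum m class = *-cancelˡ-≤ (L * L) {{>-nonZero (*-mono-≤ 1≤L 1≤L)}} (begin
          L * L * (D * X) ≡⟨ lem₁ L D X ⟩
          D * (L * L * X) ≤⟨ *-monoʳ-≤ D (Count.total-bound M 1≤M B n r L Y θ C Q 1≤r 1≤L r²≤Y P P? proj₂ bt′ m class) ⟩
          D * (C * (n * (suc L * suc L) * (w (r * L) * w (r * L)) + L * L * (r * w r * (r * w r) * Q))) ≤⟨ *-monoʳ-≤ D (*-monoʳ-≤ C (+-mono-≤ (*-monoʳ-≤ (n * (suc L * suc L)) (*-mono-≤ wN≤W wN≤W)) second)) ⟩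
          D * (C * (n * (suc L * suc L) * (W * W) + 64 * (n * (W * W)))) ≡⟨ lem₂ D C n (suc L * suc L) 64 (W * W) ⟩
          C * (W * W) * n * (D * (suc L * suc L + 64)) ≤⟨ *-monoʳ-≤ (C * (W * W) * n) close ⟩
          C * (W * W) * n * (suc D * (L * L)) ≡⟨ lem₃ C (W * W) n (suc D) (L * L) ⟩
          L * L * (C * (suc D * (W * W)) * n) ∎)
          where
          open ≤-Reasoning
          X = ∑₁ n (λ c → ♯ (P? c) * pairs (m c)) * θ
          lem₁ : ∀ L D X → L * L * (D * X) ≡ D * (L * L * X)
          lem₁ = solve-∀
          lem₂ : ∀ D C n x k y → D * (C * (n * x * y + k * (n * y))) ≡ C * y * n * (D * (x + k))
          lem₂ = solve-∀
          lem₃ : ∀ C y n x l → C * y * n * (x * l) ≡ l * (C * (x * y) * n)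
          lem₃ = solve-∀
          zL≤r : z * L ≤ r
          zL≤r = m/n*n≤m r L
          lem₄ : ∀ L r w k z → L * L * (r * w * (r * w) * (k * (z * z))) ≡ k * ((z * L) * (z * L) * (r * r) * (w * w))
          lem₄ = solve-∀
          second : L * L * (r * w r * (r * w r) * Q) ≤ 64 * (n * (W * W))
          second = ≤-trans (≤-reflexive (lem₄ L r (w r) 64 z)) (*-monoʳ-≤ 64 (*-mono-≤ (≤-trans (*-monoˡ-≤ (r * r) (*-mono-≤ zL≤r zL≤r)) r⁴) (*-mono-≤ wr≤W wr≤W)))
          D≤L : 3 * D ≤ L
          D≤L = ≤-trans (≤-trans (≤-reflexive (*-comm 3 D)) (*-monoʳ-≤ D 3≤μ)) Dμ≤L
          lem₅ : ∀ L k → suc L * suc L + k ≡ L * L + (L + L) + (1 + k)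
          lem₅ = solve-∀
          lem₆ : ∀ D L → D * (L * L + (L + L) + L) ≡ D * (L * L) + 3 * D * L
          lem₆ = solve-∀
          -- Divided by D L² this is (1 + 1/L)² + 64/L² ≤ 1 + 3/L ≤ 1 + 1/D, by 65 ≤ L and 3 D ≤ L.
          close : D * (suc L * suc L + 64) ≤ suc D * (L * L)
          close = ≤-trans (*-monoʳ-≤ D (≤-trans (≤-reflexive (lem₅ L 64)) (+-monoʳ-≤ (L * L + (L + L)) 65≤L)))
            (≤-trans (≤-reflexive (lem₆ D L)) (≤-trans (+-monoʳ-≤ (D * (L * L)) (*-monoˡ-≤ L D≤L)) (≤-reflexive (+-comm (D * (L * L)) (L * L)))))

        bad-bound : ∀ b X → σ * τ * b ≤ X → D * (X * θ) ≤ C * (suc D * (W * W)) * n → α * (μ * b) ≤ β * n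
        bad-bound b X h₁ h₂ = *-cancelˡ-≤ (M * M * (μ * μ)) {{>-nonZero (*-mono-≤ (*-mono-≤ 1≤M 1≤M) (*-mono-≤ 1≤μ 1≤μ))}} (begin
          M * M * (μ * μ) * (α * (μ * b)) ≡⟨ cong (λ x → M * M * (μ * μ) * (x * (μ * b))) α≡ ⟩
          M * M * (μ * μ) * (D * (s * t * (θ₁ * d)) * (μ * b)) ≡⟨ lem₁ M μ D s t θ₁ d b ⟩
          D * (M * (s * μ) * (M * (t * μ)) * b * (θ₁ * (d * μ))) ≤⟨ *-monoʳ-≤ D (*-mono-≤ h₁ (*-monoʳ-≤ θ₁ lgz)) ⟩
          D * (X * θ) ≤⟨ h₂ ⟩
          C * (suc D * (W * W)) * n ≡⟨ lem₂ C (suc D) M (2 + D₄) μ n ⟩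
          M * M * (μ * μ) * (C * (suc D * ((2 + D₄) * (2 + D₄))) * n) ≡⟨ cong (λ x → M * M * (μ * μ) * (x * n)) (sym β≡) ⟩
          M * M * (μ * μ) * (β * n) ∎)
          where
          open ≤-Reasoning
          lem₁ : ∀ M m D s t h d b → M * M * (m * m) * (D * (s * t * (h * d)) * (m * b)) ≡ D * (M * (s * m) * (M * (t * m)) * b * (h * (d * m)))
          lem₁ = solve-∀
          lem₂ : ∀ C D M x m n → C * (D * (M * (x * m) * (M * (x * m)))) * n ≡ M * M * (m * m) * (C * (D * (x * x)) * n)
          lem₂ = solve-∀

        contradict : ∀ E b₁ b₂ → primeCount n ≤ E + b₁ + b₂ → V * E ≤ V * (Y + Y) + (n + n) + V * (V * V) → α * (μ * b₁) ≤ β * n → α * (μ * b₂) ≤ β * n → ⊥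
        contradict E b₁ b₂ count E-bound B₁ B₂ = final-arithmetic α v D (2 + D) μ E b₁ b₂ n β γ γ≡ num₃ n-large n≤ E≤ B₁ B₂
          where
          V³≤n : V * (V * V) ≤ n
          V³≤n = ≤-trans (≤-trans (≤-reflexive (sym (*-assoc V V V))) (m≤n*m (V * V * V) 2)) (≤-trans V-small (≤-trans (^-monoʳ-≤ 2 (≤-trans (m≤n*m μ D) Dμ≤L)) (2^lg≤ 1≤n)))
          lem₃ : ∀ V Y → V * (Y + Y) ≡ V * Y + V * Y
          lem₃ = solve-∀
          lem₄ : ∀ n → n + n + (n + n) + n ≡ 5 * n
          lem₄ = solve-∀
          E≤ : v * (D * μ) * E ≤ 5 * n
          E≤ = ≤-trans (*-monoˡ-≤ E (*-monoʳ-≤ v Dμ≤L)) (≤-trans E-bound (≤-trans (+-mono-≤ (+-monoˡ-≤ (n + n) (≤-trans (≤-reflexive (lem₃ V Y)) (+-mono-≤ VY≤n VY≤n))) V³≤n) (≤-reflexive (lem₄ n))))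
          π-lower : ∀ n → 1 ≤ n → n ≤ 1 + suc (lg n) * primeCount n
          π-lower (suc n) _ = s≤s (primeCount-lower n)
          L+1≤ : suc L ≤ (2 + D) * μ
          L+1≤ = +-mono-≤ 1≤μ L≤
          n≤ : n ≤ 1 + (2 + D) * μ * (E + b₁ + b₂)
          n≤ = ≤-trans (π-lower n 1≤n) (s≤s (*-mono-≤ L+1≤ count))

        contradiction : Few → ⊥
        contradiction few = contradict (Few.E few) (Few.b₁ few) (Few.b₂ few) (Few.count few) (Few.E-bound few)
          (bad-bound (Few.b₁ few) _ (Few.b₁-bound few) (pair-sum m₁ class₁)) (bad-bound (Few.b₂ few) _ (Few.b₂-bound few) (pair-sum m₂ class₂))

      good : Good
      good = [ (λ g → g) , (λ few → ⊥-elim (contradiction few)) ]′ dichotomy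

-- Existence of the primes c, p and q for all large n.

module PrimeExistence where

  open import Data.Nat
  open import Data.Nat.Properties
  open import Data.Nat.DivMod
  open import Data.Nat.Divisibility
  open import Data.Nat.Primality using (Prime; prime?)
  open import Data.Nat.Tactic.RingSolver using (solve-∀)
  open import Data.Product using (_,_; _×_; ∃; proj₁; proj₂)
  open import Relation.Nullary using (¬_; yes; no; _×-dec_)
  open import Data.Unit using (tt)
  open import Relation.Binary.PropositionalEquality
  open Sums
  open Weights
  open BrunTitchmarsh using (brun-titchmarsh)
  open Asymptotic

  fourth-power-≤ : ∀ k → (16 + k) ^ 4 ≤ 2 ^ (16 + k)
  -- Equality holds at 16: both sides are 65536.
  fourth-power-≤ zero = ≤-refl
  fourth-power-≤ (suc k) = ≤-trans (step (16 + k) (m≤m+n 16 k)) (*-monoʳ-≤ 2 (fourth-power-≤ k))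
    where
    lem : ∀ m → suc m * (suc m * (suc m * (suc m * 1))) ≡ m * (m * (m * (m * 1))) + (4 * (m * m * m) + 6 * (m * m) + 4 * m + 1)
    lem = solve-∀
    lem₂ : ∀ x → 4 * x + 6 * x + 4 * x + x ≡ 15 * x
    lem₂ = solve-∀
    lem₃ : ∀ m → m * (m * m * m) ≡ m * (m * (m * (m * 1)))
    lem₃ = solve-∀
    step : ∀ m → 16 ≤ m → suc m ^ 4 ≤ 2 * m ^ 4
    step m h = ≤-trans (≤-reflexive (lem m)) (≤-trans (+-monoʳ-≤ (m ^ 4) small) (≤-reflexive (cong (m ^ 4 +_) (sym (+-identityʳ (m ^ 4))))))
      where
      1≤m : 1 ≤ m
      1≤m = ≤-trans (s≤s z≤n) h
      m≤m³ : m ≤ m * m * m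
      m≤m³ = ≤-trans (m≤m*n m m {{>-nonZero 1≤m}}) (m≤m*n (m * m) m {{>-nonZero 1≤m}})
      small : 4 * (m * m * m) + 6 * (m * m) + 4 * m + 1 ≤ m ^ 4
      small = ≤-trans (+-mono-≤ (+-mono-≤ (+-monoʳ-≤ (4 * (m * m * m)) (*-monoʳ-≤ 6 (m≤m*n (m * m) m {{>-nonZero 1≤m}}))) (*-monoʳ-≤ 4 m≤m³)) (≤-trans 1≤m m≤m³))
        (≤-trans (≤-reflexive (lem₂ (m * m * m))) (≤-trans (*-monoˡ-≤ (m * m * m) (≤-trans (n≤1+n 15) h)) (≤-reflexive (lem₃ m))))

  fourth-power-bound : ∀ m → 16 ≤ m → m ^ 4 ≤ 2 ^ m
  fourth-power-bound m h = subst (λ t → t ^ 4 ≤ 2 ^ t) (m+[n∸m]≡n h) (fourth-power-≤ (m ∸ 16))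

  root₄ : ℕ → ℕ
  root₄ zero = 0
  root₄ (suc n) with suc (root₄ n) ^ 4 ≤? suc n
  ... | yes _ = suc (root₄ n)
  ... | no _  = root₄ n

  root₄-spec : ∀ n → root₄ n ^ 4 ≤ n × n < suc (root₄ n) ^ 4
  root₄-spec zero = z≤n , s≤s z≤n
  root₄-spec (suc n) with root₄-spec n | suc (root₄ n) ^ 4 ≤? suc n
  ... | lo , hi | yes le = le , ≤-<-trans hi (^-monoˡ-< 4 (n<1+n (suc (root₄ n))))
  ... | lo , hi | no nle = m≤n⇒m≤1+n lo , ≰⇒> nle

  record PrimeData (v n : ℕ) : Set where
    field
      c p q k : ℕ
      prime-c : Prime c
      prime-p : Prime p
      prime-q : Prime q
      root<p : root₄ n < p
      root<q : root₄ n < q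
      q∣c-1 : q ∣ c ∸ 1
      n≡c+kp : n ≡ c + k * p
      c-large : n ≤ v * lg n * c
      -- The bound known for k p is a quotient rounded down; the successor makes up for the
      -- rounding.
      kp-large : n ≤ v * lg n * suc (k * p)
      c∤ : ¬ c ∣ k * (p ∸ 1)

  module Eventually (d D₄ D₁ D M s t v B θ₁ C α β γ : ℕ) (D₄≡ : D₄ ≡ suc d) (D≡ : D ≡ 4 * D₄) (D₁≡ : D ≡ suc D₁)
    (α≡ : α ≡ D * (s * t * (θ₁ * d))) (β≡ : β ≡ C * (suc D * ((2 + D₄) * (2 + D₄)))) (γ≡ : γ ≡ (2 + D) * (5 * α + 2 * (v * D * β))) (num₃ : γ < α * (v * D))
    (1≤M : 1 ≤ M) (1≤B : 1 ≤ B) (1≤v : 1 ≤ v)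
    (num₁ : suc M * (M * s + 1) < M * (M * D₁)) (num₂ : t + suc D₄ ≤ s)
    (bt : ∀ l₁ l₂ → Prime l₁ → Prime l₂ → B ≤ l₁ → B ≤ l₂ → ∀ a K z → 1 ≤ z →
      ∑₁ K (λ k → ♯ (prime? (a + l₁ * l₂ * k) ×-dec (suc z <? (a + l₁ * l₂ * k)))) * (θ₁ * (lg z ∸ 5)) ≤ C * (K + 64 * (z * z))) where

    open Estimate d D₄ D₁ D M s t v B θ₁ C α β γ D₄≡ D≡ D₁≡ α≡ β≡ γ≡ num₃ 1≤M 1≤B 1≤v num₁ num₂ bt
    open Weight M 1≤M using (w)

    private
     instance
      D≢0 : NonZero D
      D≢0 = >-nonZero (≤-trans (s≤s z≤n) (≤-reflexive (sym D₁≡)))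

    module _ where

      private
        a₁ a₂ a₃ a₄ μ₀ : ℕ
        a₁ = 2 * (v * suc D * (v * suc D) * (v * suc D))
        a₂ = 32 * suc D
        a₃ = B * w B
        a₄ = α * (v * D)
        -- A sum, in place of a maximum, of all the lower bounds required of μ.
        μ₀ = a₁ + a₂ + a₃ + a₄ + D + 65

        conclude : ∀ n → 1 ≤ n → ∀ μ → D * μ ≤ lg n → lg n ≤ suc D * μ → μ₀ ≤ μ → PrimeData v n
        conclude n 1≤n μ lo hi big = record
          { c = c ; p = p ; q = q ; k = k ; prime-c = prime-c ; prime-p = prime-p ; prime-q = prime-q ; root<p = r<p ; root<q = r<q ; q∣c-1 = q∣ ; n≡c+kp = n≡
          ; c-large = ≤-trans (<⇒≤ n<) (*-monoʳ-≤ V Y<c) ; kp-large = ≤-trans (<⇒≤ n<) (*-monoʳ-≤ V (s≤s Y≤kp)) ; c∤ = c∤ }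
          where
          L = lg n
          V = v * L
          D≤ : D ≤ μ
          D≤ = ≤-trans (≤-trans (m≤n+m D (a₁ + a₂ + a₃ + a₄)) (m≤m+n _ 65)) big
          65≤ : 65 ≤ μ
          65≤ = ≤-trans (m≤n+m 65 (a₁ + a₂ + a₃ + a₄ + D)) big
          a₁≤ : a₁ ≤ μ
          a₁≤ = ≤-trans (≤-trans (m≤m+n a₁ a₂) (≤-trans (m≤m+n _ a₃) (≤-trans (m≤m+n _ a₄) (≤-trans (m≤m+n _ D) (m≤m+n _ 65))))) big
          a₂≤ : a₂ ≤ μ
          a₂≤ = ≤-trans (≤-trans (m≤n+m a₂ a₁) (≤-trans (m≤m+n _ a₃) (≤-trans (m≤m+n _ a₄) (≤-trans (m≤m+n _ D) (m≤m+n _ 65))))) big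
          a₃≤ : a₃ ≤ μ
          a₃≤ = ≤-trans (≤-trans (m≤n+m a₃ (a₁ + a₂)) (≤-trans (m≤m+n _ a₄) (≤-trans (m≤m+n _ D) (m≤m+n _ 65)))) big
          a₄≤ : a₄ ≤ μ
          a₄≤ = ≤-trans (≤-trans (m≤n+m a₄ (a₁ + a₂ + a₃)) (≤-trans (m≤m+n _ D) (m≤m+n _ 65))) big
          1≤μ : 1 ≤ μ
          1≤μ = ≤-trans (s≤s z≤n) 65≤
          pow : μ ^ 4 ≤ 2 ^ μ
          pow = fourth-power-bound μ (≤-trans (m≤m+n 16 49) 65≤)
          lem₁ : ∀ v D m → 2 * (v * (D * m) * (v * (D * m)) * (v * (D * m))) ≡ 2 * (v * D * (v * D) * (v * D)) * (m * (m * (m * 1)))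
          lem₁ = solve-∀
          V-small : 2 * (V * V * V) ≤ 2 ^ μ
          V-small = ≤-trans (*-monoʳ-≤ 2 (*-mono-≤ (*-mono-≤ (*-monoʳ-≤ v hi) (*-monoʳ-≤ v hi)) (*-monoʳ-≤ v hi)))
            (≤-trans (≤-reflexive (lem₁ v (suc D) μ)) (≤-trans (*-monoˡ-≤ (μ * (μ * (μ * 1))) a₁≤) pow))
          L-small : 32 * L ≤ 2 ^ μ
          L-small = ≤-trans (*-monoʳ-≤ 32 hi) (≤-trans (≤-reflexive (sym (*-assoc 32 (suc D) μ))) (≤-trans (*-monoˡ-≤ μ a₂≤)
            (≤-trans (≤-trans (m≤m*n (μ * μ) (μ * μ) {{>-nonZero (*-mono-≤ 1≤μ 1≤μ)}}) (≤-reflexive (lem₂ μ))) pow)))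
            where lem₂ : ∀ m → m * m * (m * m) ≡ m * (m * (m * (m * 1)))
                  lem₂ = solve-∀
          μ≤L : μ ≤ L
          μ≤L = ≤-trans (m≤n*m μ D) lo
          n-large : α * (v * D) < n
          n-large = ≤-<-trans a₄≤ (<-≤-trans (n<b^n ≤-refl μ) (≤-trans (^-monoʳ-≤ 2 μ≤L) (2^lg≤ 1≤n)))
          open GoodPrime using (module Search)
          G = good n μ (root₄ n) 1≤n D≤ (≤-trans (m≤m+n 3 62) 65≤) (≤-trans 65≤ μ≤L) lo hi (proj₁ (root₄-spec n)) (proj₂ (root₄-spec n)) V-small L-small a₃≤ n-large
          open Search.Good G
          instance
            V≢0 : NonZero V
            V≢0 = >-nonZero (*-mono-≤ 1≤v (≤-trans 1≤μ μ≤L))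
          n< : n < V * suc (n / V)
          n< = ≤-<-trans (≤-reflexive (m≡m%n+[m/n]*n n V)) (<-≤-trans (+-monoˡ-< (n / V * V) (m%n<n n V)) (≤-reflexive (*-comm (suc (n / V)) V)))

      eventually : ∃ λ N → ∀ n → N ≤ n → PrimeData v n
      eventually = 2 ^ (D * μ₀) , λ n le → conclude n (≤-trans (m^n>0 2 (D * μ₀)) le) (lg n / D)
          (≤-trans (≤-reflexive (*-comm D (lg n / D))) (m/n*n≤m (lg n) D))
          (≤-trans (<⇒≤ (below n)) (+-monoˡ-≤ (D * (lg n / D)) (D≤μ n le)))
          (μ₀≤ n le)
        where
        μ₀≤ : ∀ n → 2 ^ (D * μ₀) ≤ n → μ₀ ≤ lg n / D
        μ₀≤ n le = subst (_≤ lg n / D) (m*n/n≡m μ₀ D) (/-monoˡ-≤ D (≤-trans (≤-reflexive (*-comm μ₀ D)) (lg-max (D * μ₀) le)))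
        D≤μ : ∀ n → 2 ^ (D * μ₀) ≤ n → D ≤ lg n / D
        D≤μ n le = ≤-trans (≤-trans (m≤n+m D (a₁ + a₂ + a₃ + a₄)) (m≤m+n _ 65)) (μ₀≤ n le)
        below : ∀ n → lg n < D + D * (lg n / D)
        below n = ≤-<-trans (≤-reflexive (m≡m%n+[m/n]*n (lg n) D)) (<-≤-trans (+-monoˡ-< (lg n / D * D) (m%n<n (lg n) D)) (≤-reflexive (cong (D +_) (*-comm (lg n / D) D))))

  -- The constants only have to satisfy the three numerical inequalities; the second and third bound the proportion of
  -- primes c for which c - 1 or n - c is free of prime factors above the fourth root of n.
  abstract
    prime-data : ∃ λ N → ∀ n → N ≤ n → PrimeData 1000 n
    prime-data = Eventually.eventually 2499 2500 9999 10000 10000 9996 7495 1000 1000 (998 * 68) (100 * 1000) _ _ _ refl refl refl refl refl refl (≤ᵇ⇒≤ _ _ tt)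
      (s≤s z≤n) (s≤s z≤n) (s≤s z≤n) (≤ᵇ⇒≤ _ _ tt) (≤ᵇ⇒≤ _ _ tt)
      (λ l₁ l₂ p₁ p₂ b₁ b₂ a K z 1≤z → ≤-trans (≤-reflexive (cong (∑₁ K (λ k → ♯ (prime? (a + l₁ * l₂ * k) ×-dec (suc z <? (a + l₁ * l₂ * k)))) *_) (*-assoc 998 68 (lg z ∸ 5))))
        (brun-titchmarsh l₁ l₂ p₁ p₂ b₁ b₂ a K z 1≤z))

-- Edge counts and degrees.

module Degree where

  open import Defs
  open import Data.Nat
  open import Data.Nat.Properties
  open import Data.Nat.ListAction using (sum)
  open import Data.Nat.Tactic.RingSolver using (solve-∀)
  open import Data.Bool using (true)
  open import Data.Fin as Fin using (Fin; zero; suc)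
  import Data.Fin.Properties as Fin
  open import Data.List using (map; allFin; tabulate)
  open import Data.List.Properties using (map-tabulate)
  open import Data.Product using (Σ; _,_; proj₁; proj₂)
  open import Data.Empty using (⊥-elim)
  open import Function using (_∘_; id)
  open import Relation.Nullary using (yes; no)
  open import Relation.Binary.PropositionalEquality
  open Sums using (♯; ♯-yes)

  ΣF : ∀ n → (Fin n → ℕ) → ℕ
  ΣF zero    f = 0
  ΣF (suc n) f = f zero + ΣF n (f ∘ suc)

  ΣF-sum : ∀ n (f : Fin n → ℕ) → sum (map f (allFin n)) ≡ ΣF n f
  ΣF-sum n f = trans (cong sum (map-tabulate id f)) (go n f)
    where
    go : ∀ n (f : Fin n → ℕ) → sum (tabulate f) ≡ ΣF n f
    go zero    f = refl
    go (suc n) f = cong (f zero +_) (go n (f ∘ suc))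

  ΣF-cong : ∀ n {f g : Fin n → ℕ} → (∀ i → f i ≡ g i) → ΣF n f ≡ ΣF n g
  ΣF-cong zero    h = refl
  ΣF-cong (suc n) h = cong₂ _+_ (h zero) (ΣF-cong n (h ∘ suc))

  ΣF-mono : ∀ n {f g : Fin n → ℕ} → (∀ i → f i ≤ g i) → ΣF n f ≤ ΣF n g
  ΣF-mono zero    h = z≤n
  ΣF-mono (suc n) h = +-mono-≤ (h zero) (ΣF-mono n (h ∘ suc))

  ΣF-+ : ∀ n (f g : Fin n → ℕ) → ΣF n (λ i → f i + g i) ≡ ΣF n f + ΣF n g
  ΣF-+ zero    f g = refl
  ΣF-+ (suc n) f g = trans (cong (f zero + g zero +_) (ΣF-+ n (f ∘ suc) (g ∘ suc))) (lem (f zero) (g zero) _ _)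
    where lem : ∀ a b c d → a + b + (c + d) ≡ (a + c) + (b + d)
          lem = solve-∀

  ΣF-const : ∀ n a → ΣF n (λ _ → a) ≡ n * a
  ΣF-const zero    a = refl
  ΣF-const (suc n) a = cong (a +_) (ΣF-const n a)

  ΣF-*ʳ : ∀ n a (f : Fin n → ℕ) → ΣF n (λ i → f i * a) ≡ ΣF n f * a
  ΣF-*ʳ zero    a f = refl
  ΣF-*ʳ (suc n) a f = trans (cong (f zero * a +_) (ΣF-*ʳ n a (f ∘ suc))) (sym (*-distribʳ-+ a (f zero) _))

  ΣF-swap : ∀ n m (f : Fin n → Fin m → ℕ) → ΣF n (λ i → ΣF m (f i)) ≡ ΣF m (λ j → ΣF n (λ i → f i j))
  ΣF-swap zero    m f = sym (trans (ΣF-const m 0) (*-zeroʳ m))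
  ΣF-swap (suc n) m f = trans (cong (ΣF m (f zero) +_) (ΣF-swap n m (f ∘ suc))) (sym (ΣF-+ m (f zero) (λ j → ΣF n (λ i → f (suc i) j))))

  ΣF-term : ∀ n (f : Fin n → ℕ) i → f i ≤ ΣF n f
  ΣF-term (suc n) f zero    = m≤m+n _ _
  ΣF-term (suc n) f (suc i) = ≤-trans (ΣF-term n (f ∘ suc) i) (m≤n+m _ _)

  ΣF-injective : ∀ {m n} (h : Fin m → Fin n) → (∀ {i j} → h i ≡ h j → i ≡ j) → ∀ (f : Fin n → ℕ) → ΣF m (f ∘ h) ≤ ΣF n f
  ΣF-injective {m} {n} h inj f = ≤-trans (ΣF-mono m (λ b → ≤-trans (≤-reflexive (sym (trans (cong (_* f (h b)) (♯-yes (h b Fin.≟ h b) refl)) (*-identityˡ _)))) (ΣF-term n (λ v → ♯ (h b Fin.≟ v) * f v) (h b))))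
    (≤-trans (≤-reflexive (ΣF-swap m n (λ b v → ♯ (h b Fin.≟ v) * f v))) (ΣF-mono n (λ v → ≤-trans (≤-reflexive (ΣF-*ʳ m (f v) (λ b → ♯ (h b Fin.≟ v)))) (≤-trans (*-monoˡ-≤ (f v) (unique m h inj v)) (≤-reflexive (*-identityˡ (f v)))))))
    where
    unique : ∀ m (h : Fin m → Fin n) → (∀ {i j} → h i ≡ h j → i ≡ j) → ∀ v → ΣF m (λ b → ♯ (h b Fin.≟ v)) ≤ 1
    unique zero h inj v = z≤n
    unique (suc m) h inj v with h zero Fin.≟ v
    ... | no _  = unique m (h ∘ suc) (λ e → Fin.suc-injective (inj e)) v
    ... | yes e = ≤-reflexive (cong suc (trans (ΣF-cong m none) (trans (ΣF-const m 0) (*-zeroʳ m))))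
      where
      none : ∀ b → ♯ (h (suc b) Fin.≟ v) ≡ 0
      none b with h (suc b) Fin.≟ v
      ... | no _ = refl
      ... | yes e′ with inj (trans e (sym e′))
      ...   | ()

  module _ {n : ℕ} (G : Graph n) where

    upper : Fin n → Fin n → ℕ
    upper i j with i Fin.<? j
    ... | yes p = bit (G ((i , j) , p))
    ... | no _  = 0

    private
      -- The summand of `edgeCount` is local to its definition; unification recovers it here, so
      -- that it can be compared with `upper`.
      summand : Σ (Fin n → Fin n → ℕ) λ f → edgeCount G ≡ sum (map (λ i → sum (map (λ j → f i j) (allFin n))) (allFin n))
      summand = _ , refl

      summand-upper : ∀ i j → proj₁ summand i j ≡ upper i j
      summand-upper i j with i Fin.<? j
      ... | yes _ = refl
      ... | no _  = refl

    edgeCount-ΣF : edgeCount G ≡ ΣF n (λ i → ΣF n (upper i))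
    edgeCount-ΣF = trans (proj₂ summand) (trans (ΣF-sum n _) (ΣF-cong n (λ i → trans (ΣF-sum n _) (ΣF-cong n (summand-upper i)))))

    adj-upper : ∀ i j → bit (adj G i j) ≡ upper i j + upper j i
    adj-upper i j with i Fin.<? j | j Fin.<? i
    ... | yes p | yes q = ⊥-elim (<-asym p q)
    ... | yes _ | no _  = sym (+-identityʳ _)
    ... | no _  | yes _ = refl
    ... | no _  | no _  = refl

    handshake : ΣF n (λ i → ΣF n (λ j → bit (adj G i j))) ≡ 2 * edgeCount G
    handshake = trans (ΣF-cong n (λ i → trans (ΣF-cong n (adj-upper i)) (ΣF-+ n (upper i) (λ j → upper j i))))
      (trans (ΣF-+ n (λ i → ΣF n (upper i)) (λ i → ΣF n (λ j → upper j i))) (trans (cong (ΣF n (λ i → ΣF n (upper i)) +_) (ΣF-swap n n (λ i j → upper j i)))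
        (cong₂ _+_ (sym edgeCount-ΣF) (trans (sym edgeCount-ΣF) (sym (+-identityʳ _))))))

    -- Ordered pairs are counted, so an edge between two of the vertices `U a` may be met from both
    -- ends; hence the factor 2 in all the edge bounds.
    degree-bound : ∀ {m t} (U : Fin m → Fin n) → (∀ {i j} → U i ≡ U j → i ≡ j) → (V : Fin m → Fin t → Fin n) →
      (∀ a {i j} → V a i ≡ V a j → i ≡ j) → (∀ a b → adj G (U a) (V a b) ≡ true) → m * t ≤ 2 * edgeCount G
    degree-bound {m} {t} U U-inj V V-inj h = ≤-trans (≤-reflexive (trans (sym (ΣF-const m t)) (ΣF-cong m (λ a → trans (sym (*-identityʳ t)) (sym (ΣF-const t 1))))))
      (≤-trans (ΣF-mono m (λ a → ≤-trans (≤-reflexive (ΣF-cong t (λ b → sym (cong bit (h a b))))) (ΣF-injective (V a) (V-inj a) (λ j → bit (adj G (U a) j)))))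
      (≤-trans (ΣF-injective U U-inj (λ i → ΣF n (λ j → bit (adj G i j)))) (≤-reflexive handshake)))

-- Elements of given order modulo a prime.

module Modular where

  open import Data.Nat as ℕ using (ℕ; zero; suc; _≤_; _<_; z≤n; s≤s; NonZero; _^_; _!)
  import Data.Nat.Properties as ℕ
  open import Data.Nat.DivMod
  open import Data.Nat.Divisibility
  open import Data.Nat.Primality using (Prime; euclidsLemma)
  open import Data.Nat.Coprimality using (Coprime; coprime-Bézout; coprime-divisor)
  import Data.Nat.Coprimality as Cop
  open import Data.Nat.GCD using (module Bézout)
  open import Data.Nat.Induction using (<-rec)
  open import Data.Nat.Tactic.RingSolver using () renaming (solve-∀ to ℕ-solve-∀)
  open import Data.Integer as ℤ using (ℤ; +_; 0ℤ; 1ℤ; _+_; _-_; _*_; -_)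
  import Data.Integer.Properties as ℤ
  open import Data.Integer.Tactic.RingSolver using (solve-∀)
  open import Data.Product using (_,_; _×_; ∃; proj₁; proj₂)
  open import Data.Sum using (inj₁; inj₂; [_,_]′)
  open import Data.Empty using (⊥; ⊥-elim)
  open import Relation.Nullary using (¬_; yes; no; ¬?)
  open import Relation.Nullary.Decidable using (decidable-stable)
  open import Relation.Binary.PropositionalEquality
  open Congruence
  open PrimeBasics
  open Sums using (∑₁; ^-distribʳ-*)
  open Chebyshev using (binom; absorption)

  Δ : (ℕ → ℤ) → ℕ → ℤ
  Δ f x = f (suc x) - f x

  -- f is a polynomial function of degree at most m in which x^m has coefficient a.
  Leading : ℕ → ℤ → (ℕ → ℤ) → Set
  Leading zero    a f = ∀ x → f x ≡ a
  Leading (suc m) a f = Leading m (+ suc m * a) (Δ f)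

  Leading-≡ : ∀ m {a b f g} → a ≡ b → (∀ x → f x ≡ g x) → Leading m a f → Leading m b g
  Leading-≡ zero    refl e h x = trans (sym (e x)) (h x)
  Leading-≡ (suc m) refl e h = Leading-≡ m refl (λ x → cong₂ _-_ (e (suc x)) (e x)) h

  Leading-+ : ∀ m {a b f g} → Leading m a f → Leading m b g → Leading m (a + b) (λ x → f x + g x)
  Leading-+ zero h k x = cong₂ _+_ (h x) (k x)
  Leading-+ (suc m) {a} {b} {f} {g} h k = Leading-≡ m (lem (+ suc m) a b) (λ x → lem₂ (f (suc x)) (f x) (g (suc x)) (g x)) (Leading-+ m {+ suc m * a} {+ suc m * b} {Δ f} {Δ g} h k)
    where
    lem : ∀ m a b → m * a + m * b ≡ m * (a + b)
    lem = solve-∀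
    lem₂ : ∀ a b c d → (a - b) + (c - d) ≡ (a + c) - (b + d)
    lem₂ = solve-∀

  Leading-raise : ∀ m {a f} → Leading m a f → Leading (suc m) 0ℤ f
  Leading-raise zero {a} h x = ℤ.i≡j⇒i-j≡0 (trans (h (suc x)) (sym (h x)))
  Leading-raise (suc m) {a} {f} h = Leading-≡ (suc m) {0ℤ} {+ suc (suc m) * 0ℤ} {Δ f} {Δ f} (sym (ℤ.*-zeroʳ (+ suc (suc m)))) (λ _ → refl) (Leading-raise m {_} {Δ f} h)

  Leading-x* : ∀ m {a f} → Leading m a f → Leading (suc m) a (λ x → + x * f x)
  Leading-x* zero {a} {f} h x = trans (cong₂ (λ s t → + suc x * s - + x * t) (h (suc x)) (h x)) (lem (+ x) a)
    where lem : ∀ x a → (1ℤ + x) * a - x * a ≡ 1ℤ * a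
          lem = solve-∀
  Leading-x* (suc m) {a} {f} h = Leading-≡ (suc m) (lem (+ suc m) a) (λ x → lem₂ (+ x) (f (suc x)) (f x))
    (Leading-+ (suc m) {+ suc m * a} {a + 0ℤ} {λ x → + x * Δ f x} {λ x → f x + Δ f x} (Leading-x* m h) (Leading-+ (suc m) {a} {0ℤ} {f} {Δ f} h (Leading-raise m h)))
    where
    lem : ∀ m a → m * a + (a + 0ℤ) ≡ (1ℤ + m) * a
    lem = solve-∀
    lem₂ : ∀ x y z → x * (y - z) + (z + (y - z)) ≡ (1ℤ + x) * y - x * z
    lem₂ = solve-∀

  Leading-^ : ∀ m → Leading m 1ℤ (λ x → + (x ^ m))
  Leading-^ zero x = refl
  Leading-^ (suc m) = Leading-≡ (suc m) {1ℤ} {1ℤ} {λ x → + x * + (x ^ m)} {λ x → + (x ^ suc m)} refl (λ x → sym (ℤ.pos-* x (x ^ m)))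
    (Leading-x* m {1ℤ} {λ x → + (x ^ m)} (Leading-^ m))

  iterate-Δ : ℕ → (ℕ → ℤ) → ℕ → ℤ
  iterate-Δ zero    f = f
  iterate-Δ (suc m) f = iterate-Δ m (Δ f)

  Leading-factorial : ∀ m {a f} → Leading m a f → ∀ x → iterate-Δ m f x ≡ + (m !) * a
  Leading-factorial zero {a} h x = trans (h x) (sym (ℤ.*-identityˡ a))
  Leading-factorial (suc m) {a} h x = trans (Leading-factorial m h x) (trans (lem (+ (m !)) (+ suc m) a) (cong (_* a) (sym (ℤ.pos-* (suc m) (m !)))))
    where lem : ∀ x y a → x * (y * a) ≡ y * x * a
          lem = solve-∀

  module _ (p : ℕ) where
    open Modulo (+ p)

    Δ-≈0 : ∀ m f x → (∀ i → i ≤ m → f (i ℕ.+ x) ≈ 0ℤ) → iterate-Δ m f x ≈ 0ℤ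
    Δ-≈0 zero f x h = h 0 z≤n
    Δ-≈0 (suc m) f x h = Δ-≈0 m (Δ f) x (λ i le → 0-≈ (h (suc i) (s≤s le)) (h i (ℕ.m≤n⇒m≤1+n le)))

    -- If x^m ≡ 1 at m + 1 consecutive points then p divides the m-th difference m! of x^m.
    no-identity : Prime p → ∀ m → suc m < p → ¬ (∀ i → i ≤ suc m → + (suc i ^ suc m) ≈ 1ℤ)
    no-identity pp m lt h = not-factorial (suc m) ℕ.≤-refl p∣
      where
      f : ℕ → ℤ
      f x = + (x ^ suc m)
      fact : iterate-Δ (suc m) f 1 ≈ 0ℤ
      fact = Δ-≈0 m (Δ f) 1 (λ i le → ≈⇒≈0 (≈-trans (subst (λ t → + (t ^ suc m) ≈ 1ℤ) (cong suc (ℕ.+-comm 1 i)) (h (suc i) (s≤s le)))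
        (≈-sym (subst (λ t → + (t ^ suc m) ≈ 1ℤ) (ℕ.+-comm 1 i) (h i (ℕ.m≤n⇒m≤1+n le))))))
      p∣ : p ∣ suc m !
      p∣ with fact
      ... | congruent k e = divides ℤ.∣ k ∣ (trans (cong ℤ.∣_∣ (trans (sym (ℤ.*-identityʳ (+ (suc m !)))) (trans (sym (Leading-factorial (suc m) {1ℤ} {f} (Leading-^ (suc m)) 1)) (trans e (ℤ.+-identityˡ (k * + p)))))) (ℤ.abs-* k (+ p)))
      not-factorial : ∀ k → k ≤ suc m → p ∣ k ! → ⊥
      not-factorial zero le d = ℕ.<-irrefl refl (ℕ.≤-trans (prime>1 pp) (∣⇒≤ d))
      not-factorial (suc k) le d with euclidsLemma (suc k) (k !) pp d
      ... | inj₁ d′ = ℕ.<-irrefl refl (ℕ.≤-trans (s≤s (∣⇒≤ d′)) (ℕ.≤-trans (s≤s le) lt))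
      ... | inj₂ d′ = not-factorial k (ℕ.<⇒≤ le) d′

  module Residues (p : ℕ) (pp : Prime p) where

    instance
      p≢0 : NonZero p
      p≢0 = ℕ.>-nonZero (prime>0 pp)

    infix 4 _≋_
    _≋_ : ℕ → ℕ → Set
    x ≋ y = x % p ≡ y % p

    *-≋ : ∀ {a b c d} → a ≋ b → c ≋ d → a ℕ.* c ≋ b ℕ.* d
    *-≋ {a} {b} {c} {d} h k = trans (%-distribˡ-* a c p) (trans (cong₂ (λ s t → (s ℕ.* t) % p) h k) (sym (%-distribˡ-* b d p)))

    +-≋ : ∀ {a b c d} → a ≋ b → c ≋ d → a ℕ.+ c ≋ b ℕ.+ d
    +-≋ {a} {b} {c} {d} h k = trans (%-distribˡ-+ a c p) (trans (cong₂ (λ s t → (s ℕ.+ t) % p) h k) (sym (%-distribˡ-+ b d p)))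

    ^-≋ : ∀ {a b} k → a ≋ b → a ^ k ≋ b ^ k
    ^-≋ zero    h = refl
    ^-≋ (suc k) h = *-≋ h (^-≋ k h)

    ^-one : ∀ {a} k → a ≋ 1 → a ^ k ≋ 1
    ^-one k h = trans (^-≋ k h) (cong (_% p) (ℕ.^-zeroˡ k))

    ≋⇒∣ : ∀ {a b} → a ≤ b → a ≋ b → p ∣ b ℕ.∸ a
    ≋⇒∣ {a} {b} le h = divides (b / p ℕ.∸ a / p) (trans (cong₂ ℕ._∸_ (m≡m%n+[m/n]*n b p) (trans (m≡m%n+[m/n]*n a p) (cong (ℕ._+ a / p ℕ.* p) h)))
      (trans (ℕ.[m+n]∸[m+o]≡n∸o (b % p) (b / p ℕ.* p) (a / p ℕ.* p)) (sym (ℕ.*-distribʳ-∸ p (b / p) (a / p)))))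

    ∣⇒≋ : ∀ {a b} → a ≤ b → p ∣ b ℕ.∸ a → a ≋ b
    ∣⇒≋ {a} {b} le (divides q e) = sym (trans (cong (_% p) (trans (sym (ℕ.m+[n∸m]≡n le)) (cong (a ℕ.+_) e))) ([m+kn]%n≡m%n a q p))

    cancel-≋ : ∀ {u a b} → ¬ p ∣ u → u ℕ.* a ≋ u ℕ.* b → a ≋ b
    cancel-≋ {u} {a} {b} nu h with ℕ.≤-total a b
    ... | inj₁ le = ∣⇒≋ le (coprime-divisor (prime-∤⇒coprime pp nu) (subst (p ∣_) (sym (ℕ.*-distribˡ-∸ u b a)) (≋⇒∣ (ℕ.*-monoʳ-≤ u le) h)))
    ... | inj₂ le = sym (∣⇒≋ le (coprime-divisor (prime-∤⇒coprime pp nu) (subst (p ∣_) (sym (ℕ.*-distribˡ-∸ u a b)) (≋⇒∣ (ℕ.*-monoʳ-≤ u le) (sym h)))))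

    unit : ∀ {x} k → 1 ≤ k → x ^ k ≋ 1 → ¬ p ∣ x
    unit {x} (suc k) _ h (divides q refl) = ℕ.<-irrefl (trans (sym (n∣m⇒m%n≡0 (q ℕ.* p ℕ.* (q ℕ.* p) ^ k) p (∣m⇒∣m*n _ (n∣m*n q)))) (trans h (m<n⇒m%n≡m (prime>1 pp)))) (s≤s z≤n)

    private
      beyond : ∀ n k → n < k → binom n k ≡ 0
      beyond zero (suc k) lt = refl
      beyond (suc n) (suc k) (s≤s lt) = cong₂ ℕ._+_ (beyond n k lt) (beyond n (suc k) (ℕ.m<n⇒m<1+n lt))

      binomial : ∀ n x → suc x ^ n ≡ 1 ℕ.+ ∑₁ n (λ k → binom n k ℕ.* x ^ k)
      binomial zero x = refl
      binomial (suc n) x = trans (cong (suc x ℕ.*_) (binomial n x)) (trans (lem x S) (cong suc (sym total)))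
        where
        f : ℕ → ℕ → ℕ
        f n k = binom n k ℕ.* x ^ k
        S = ∑₁ n (f n)
        lem : ∀ x s → suc x ℕ.* (1 ℕ.+ s) ≡ suc (x ℕ.+ x ℕ.* s ℕ.+ s)
        lem = ℕ-solve-∀
        pascal : ∀ m → ∑₁ (suc m) (f (suc n)) ≡ (x ℕ.+ x ℕ.* ∑₁ m (f n)) ℕ.+ ∑₁ (suc m) (f n)
        pascal zero = base (binom n 1) x
          where base : ∀ b x → (1 ℕ.+ b) ℕ.* (x ℕ.* 1) ≡ x ℕ.+ x ℕ.* 0 ℕ.+ b ℕ.* (x ℕ.* 1)
                base = ℕ-solve-∀
        pascal (suc m) = trans (cong (ℕ._+ f (suc n) (suc (suc m))) (pascal m)) (step x (∑₁ m (f n)) (∑₁ (suc m) (f n)) (binom n (suc m)) (binom n (suc (suc m))) (x ^ m))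
          where step : ∀ x a b c d y → x ℕ.+ x ℕ.* a ℕ.+ b ℕ.+ (c ℕ.+ d) ℕ.* (x ℕ.* (x ℕ.* y)) ≡ x ℕ.+ x ℕ.* (a ℕ.+ c ℕ.* (x ℕ.* y)) ℕ.+ (b ℕ.+ d ℕ.* (x ℕ.* (x ℕ.* y)))
                step = ℕ-solve-∀
        total : ∑₁ (suc n) (f (suc n)) ≡ x ℕ.+ x ℕ.* S ℕ.+ S
        total = trans (pascal n) (cong (x ℕ.+ x ℕ.* S ℕ.+_) (trans (cong (S ℕ.+_) (cong (ℕ._* x ^ suc n) (beyond n (suc n) ℕ.≤-refl))) (ℕ.+-identityʳ S)))

      p∣binom : ∀ k n → suc n ≡ p → suc k < p → p ∣ binom (suc n) (suc k)
      p∣binom k n refl lt with euclidsLemma (suc k) (binom (suc n) (suc k)) pp (subst (suc n ∣_) (sym (absorption n k)) (m∣m*n (binom n k)))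
      ... | inj₁ d = ⊥-elim (ℕ.<-irrefl refl (ℕ.≤-trans lt (∣⇒≤ d)))
      ... | inj₂ d = d

      freshman : ∀ n → suc n ≡ p → ∀ x → suc x ^ suc n ≋ 1 ℕ.+ x ^ suc n
      freshman n refl x = trans (cong (_% p) (binomial (suc n) x)) (+-≋ {1} {1} {∑₁ (suc n) (λ k → binom (suc n) k ℕ.* x ^ k)} {x ^ suc n} refl (trans (+-≋ {∑₁ n (λ k → binom (suc n) k ℕ.* x ^ k)} {0} {1*} {1*} (sums n ℕ.≤-refl) refl) (cong (_% p) top)))
        where
        1* = binom (suc n) (suc n) ℕ.* x ^ suc n
        sums : ∀ m → m ≤ n → ∑₁ m (λ k → binom (suc n) k ℕ.* x ^ k) ≋ 0
        sums zero le = refl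
        sums (suc m) le = +-≋ {∑₁ m (λ k → binom (suc n) k ℕ.* x ^ k)} {0} {binom (suc n) (suc m) ℕ.* x ^ suc m} {0} (sums m (ℕ.<⇒≤ le)) (trans (n∣m⇒m%n≡0 _ p (∣m⇒∣m*n (x ^ suc m) (p∣binom m n refl (s≤s le)))) (sym (m<n⇒m%n≡m (prime>0 pp))))
        diag : ∀ n → binom n n ≡ 1
        diag zero = refl
        diag (suc n) = cong₂ ℕ._+_ (diag n) (beyond n (suc n) ℕ.≤-refl)
        top : 1* ≡ x ^ suc n
        top = trans (cong (ℕ._* x ^ suc n) (diag (suc n))) (ℕ.*-identityˡ _)

    fermat : ∀ x → x ^ p ≋ x
    fermat x = subst (λ t → x ^ t ≋ x) (ℕ.suc-pred p) (go x)
      where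
      go : ∀ x → x ^ suc (ℕ.pred p) ≋ x
      go zero = refl
      go (suc x) = trans (freshman (ℕ.pred p) (ℕ.suc-pred p) x) (+-≋ {1} {1} {x ^ suc (ℕ.pred p)} {x} refl (go x))

    fermat-unit : ∀ {x} → ¬ p ∣ x → x ^ (p ℕ.∸ 1) ≋ 1
    fermat-unit {x} nx = cancel-≋ nx (trans (cong (λ t → (x ^ t) % p) (ℕ.m+[n∸m]≡n (prime>0 pp))) (trans (fermat x) (cong (_% p) (sym (ℕ.*-identityʳ x)))))

    -- Takes the place of the bound on the number of roots of x^m - 1 modulo p: the congruence
    -- cannot hold at all of 1, ..., m + 1.
    nonroot : ∀ m → 1 ≤ m → suc m < p → ∃ λ x → ¬ p ∣ x × ¬ x ^ m ≋ 1
    nonroot (suc m) _ lt with ℕ.anyUpTo? (λ i → ¬? ((suc i ^ suc m) % p ℕ.≟ 1 % p)) (suc (suc m))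
    ... | yes (i , i< , h) = suc i , (λ d → ℕ.<-irrefl refl (ℕ.≤-trans (s≤s (∣⇒≤ d)) (ℕ.≤-trans (s≤s i<) lt))) , h
    ... | no none = ⊥-elim (no-identity p pp m (ℕ.<-trans (ℕ.n<1+n (suc m)) lt) (λ i le → toℤ (decidable-stable ((suc i ^ suc m) % p ℕ.≟ 1 % p) (λ n → none (i , s≤s le , n)))))
      where
      open Modulo (+ p)
      toℤ : ∀ {i} → suc i ^ suc m ≋ 1 → + (suc i ^ suc m) ≈ 1ℤ
      toℤ {i} h with ≋⇒∣ (ℕ.m^n>0 (suc i) (suc m)) (sym h)
      ... | divides q e = congruent (+ q) (trans (cong +_ (trans (sym (ℕ.m+[n∸m]≡n (ℕ.m^n>0 (suc i) (suc m)))) (cong (1 ℕ.+_) e))) (cong (λ t → 1ℤ + t) (ℤ.pos-* q p)))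

    Order : ℕ → ℕ → Set
    Order a e = a ^ e ≋ 1 × (∀ j → a ^ j ≋ 1 → e ∣ j)

    coprime-exponents : ∀ {y} m k → Coprime m k → y ^ m ≋ 1 → y ^ k ≋ 1 → y ≋ 1
    coprime-exponents {y} m k cop hm hk with coprime-Bézout cop
    ... | Bézout.+- u v e = trans (sym (trans (*-≋ {y} {y} refl (power v k hk)) (cong (_% p) (ℕ.*-identityʳ y)))) (trans (cong (λ t → (y ^ t) % p) e) (power u m hm))
      where
      power : ∀ u m → y ^ m ≋ 1 → y ^ (u ℕ.* m) ≋ 1
      power u m h = trans (cong (λ t → (y ^ t) % p) (ℕ.*-comm u m)) (trans (cong (_% p) (sym (ℕ.^-*-assoc y m u))) (^-one u h))
    ... | Bézout.-+ u v e = trans (sym (trans (*-≋ {y} {y} refl (power u m hm)) (cong (_% p) (ℕ.*-identityʳ y)))) (trans (cong (λ t → (y ^ t) % p) e) (power v k hk))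
      where
      power : ∀ u m → y ^ m ≋ 1 → y ^ (u ℕ.* m) ≋ 1
      power u m h = trans (cong (λ t → (y ^ t) % p) (ℕ.*-comm u m)) (trans (cong (_% p) (sym (ℕ.^-*-assoc y m u))) (^-one u h))

    coprime-power : ∀ {l k} → Prime l → ¬ l ∣ k → ∀ w → Coprime (l ^ w) k
    coprime-power pl nd zero (d₁ , _) = ∣1⇒≡1 d₁
    coprime-power {l} pl nd (suc w) {f} (d₁ , d₂) = coprime-power pl nd w (coprime-divisor {f} {l} (λ (g₁ , g₂) → prime-∤⇒coprime pl nd (g₂ , ∣-trans g₁ d₂)) d₁ , d₂)

    -- If the exact power of l in j were l^u with u ≤ v, then b^(l^u) would be killed by two coprime
    -- exponents, the cofactor of j and a power of l. It would be 1, against the second hypothesis.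
    order-criterion : ∀ {l} → Prime l → ∀ v b → b ^ (l ^ suc v) ≋ 1 → ¬ b ^ (l ^ v) ≋ 1 → ∀ j → b ^ j ≋ 1 → l ^ suc v ∣ j
    order-criterion {l} pl v b b^ b≢ zero _ = _ ∣0
    order-criterion {l} pl v b b^ b≢ j@(suc _) hj = split (extract pl j (s≤s z≤n))
      where
      low : ∀ u k → j ≡ l ^ u ℕ.* k → ¬ l ∣ k → u ≤ v → ⊥
      low u k ej nd u≤v = b≢ (trans (cong (λ t → (b ^ t) % p) halves) (trans (cong (_% p) (sym (ℕ.^-*-assoc b (l ^ u) (l ^ (v ℕ.∸ u))))) (^-one (l ^ (v ℕ.∸ u)) y≋1)))
        where
        halves : l ^ v ≡ l ^ u ℕ.* l ^ (v ℕ.∸ u)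
        halves = trans (cong (l ^_) (sym (ℕ.m+[n∸m]≡n u≤v))) (ℕ.^-distribˡ-+-* l u (v ℕ.∸ u))
        y≋1 : b ^ (l ^ u) ≋ 1
        y≋1 = coprime-exponents k (l ^ (suc v ℕ.∸ u)) (Cop.sym (coprime-power pl nd (suc v ℕ.∸ u)))
          (trans (cong (_% p) (ℕ.^-*-assoc b (l ^ u) k)) (trans (cong (λ t → (b ^ t) % p) (sym ej)) hj))
          (trans (cong (_% p) (trans (ℕ.^-*-assoc b (l ^ u) _) (cong (b ^_) (trans (sym (ℕ.^-distribˡ-+-* l u (suc v ℕ.∸ u))) (cong (l ^_) (ℕ.m+[n∸m]≡n (ℕ.m≤n⇒m≤1+n u≤v))))))) b^)
      power-∣ : ∀ {a c} → a ≤ c → l ^ a ∣ l ^ c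
      power-∣ {a} {c} le = subst (l ^ a ∣_) (trans (sym (ℕ.^-distribˡ-+-* l a (c ℕ.∸ a))) (cong (l ^_) (ℕ.m+[n∸m]≡n le))) (m∣m*n (l ^ (c ℕ.∸ a)))
      split : (∃ λ u → ∃ λ k → j ≡ l ^ u ℕ.* k × ¬ l ∣ k) → l ^ suc v ∣ j
      split (u , k , ej , nd) = [ (λ le → subst (l ^ suc v ∣_) (sym ej) (∣m⇒∣m*n k (power-∣ le))) , (λ lt → ⊥-elim (low u k ej nd (ℕ.≤-pred lt))) ]′ (ℕ.≤-<-connex (suc v) u)

    -- Some x has a power with exponent (p - 1) / l different from 1; its power with exponent (p -
    -- 1) / l^(v + 1) is the element sought.
    order-prime-power : ∀ {l} → Prime l → ∀ v → l ^ suc v ∣ p ℕ.∸ 1 → ∃ λ b → Order b (l ^ suc v)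
    order-prime-power {l} pl v (divides q e) = finish (nonroot m 1≤m m<p)
      where
      h = p ℕ.∸ 1
      m = q ℕ.* l ^ v
      h≡ : h ≡ m ℕ.* l
      h≡ = trans e (lem q l (l ^ v))
        where lem : ∀ q l x → q ℕ.* (l ℕ.* x) ≡ q ℕ.* x ℕ.* l
              lem = ℕ-solve-∀
      1≤m : 1 ≤ m
      1≤m = ∣⇒>0 (ℕ.m<n⇒0<n∸m (prime>1 pp)) (divides l (trans h≡ (ℕ.*-comm m l)))
      m<h : suc m ≤ h
      m<h = ℕ.≤-trans (ℕ.≤-trans (ℕ.≤-trans (ℕ.≤-reflexive (ℕ.+-comm 1 m)) (ℕ.+-monoʳ-≤ m 1≤m)) (ℕ.≤-reflexive (trans (cong (m ℕ.+_) (sym (ℕ.+-identityʳ m))) (ℕ.*-comm 2 m)))) (ℕ.≤-trans (ℕ.*-monoʳ-≤ m (prime>1 pl)) (ℕ.≤-reflexive (sym h≡)))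
      m<p : suc m < p
      m<p = ℕ.≤-trans (s≤s m<h) (ℕ.≤-reflexive (ℕ.m+[n∸m]≡n (prime>0 pp)))
      finish : (∃ λ x → ¬ p ∣ x × ¬ x ^ m ≋ 1) → ∃ λ b → Order b (l ^ suc v)
      finish (x , p∤x , x≢) = x ^ q , b^ , order-criterion pl v (x ^ q) b^ (λ h → x≢ (trans (cong (_% p) (sym (ℕ.^-*-assoc x q (l ^ v)))) h))
        where
        b^ : (x ^ q) ^ (l ^ suc v) ≋ 1
        b^ = trans (cong (_% p) (trans (ℕ.^-*-assoc x q (l ^ suc v)) (cong (x ^_) (sym e)))) (fermat-unit p∤x)

    order-product : ∀ {a b e f} → Coprime e f → Order a e → Order b f → Order (a ℕ.* b) (e ℕ.* f)
    order-product {a} {b} {e} {f} cop (ha , ma) (hb , mb) = top , minimal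
      where
      pow : ∀ x e k → x ^ e ≋ 1 → x ^ (e ℕ.* k) ≋ 1
      pow x e k h = trans (cong (_% p) (sym (ℕ.^-*-assoc x e k))) (^-one k h)
      top : (a ℕ.* b) ^ (e ℕ.* f) ≋ 1
      top = trans (cong (_% p) (^-distribʳ-* (e ℕ.* f) a b)) (*-≋ {a ^ (e ℕ.* f)} {1} {b ^ (e ℕ.* f)} {1} (pow a e f ha) (trans (cong (λ t → (b ^ t) % p) (ℕ.*-comm e f)) (pow b f e hb)))
      minimal : ∀ j → (a ℕ.* b) ^ j ≋ 1 → e ℕ.* f ∣ j
      minimal j hj = both (coprime-divisor {e} {f} cop (ma (f ℕ.* j) (side a b f (pow b f j hb) (raise f))))
                          (coprime-divisor {f} {e} (Cop.sym cop) (mb (e ℕ.* j) (side b a e (pow a e j ha) (trans (cong (λ t → (t ^ (e ℕ.* j)) % p) (ℕ.*-comm b a)) (raise e)))))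
        where
        raise : ∀ k → (a ℕ.* b) ^ (k ℕ.* j) ≋ 1
        raise k = trans (cong (λ t → ((a ℕ.* b) ^ t) % p) (ℕ.*-comm k j)) (pow (a ℕ.* b) j k hj)
        side : ∀ x y k → y ^ (k ℕ.* j) ≋ 1 → (x ℕ.* y) ^ (k ℕ.* j) ≋ 1 → x ^ (k ℕ.* j) ≋ 1
        side x y k hy hxy = trans (sym (trans (*-≋ {x ^ (k ℕ.* j)} refl hy) (cong (_% p) (ℕ.*-identityʳ _)))) (trans (cong (_% p) (sym (^-distribʳ-* (k ℕ.* j) x y))) hxy)
        both : e ∣ j → f ∣ j → e ℕ.* f ∣ j
        both (divides q refl) h = subst (e ℕ.* f ∣_) (ℕ.*-comm e q) (*-monoʳ-∣ e (coprime-divisor (Cop.sym cop) (subst (f ∣_) (ℕ.*-comm q e) h)))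

    -- Elements whose orders are powers of distinct primes are multiplied together. The case e = p -
    -- 1 gives a primitive root.
    order-divisor : ∀ e → 1 ≤ e → e ∣ p ℕ.∸ 1 → ∃ λ a → Order a e
    order-divisor = <-rec _ go
      where
      go : ∀ e → (∀ {f} → f < e → 1 ≤ f → f ∣ p ℕ.∸ 1 → ∃ λ a → Order a f) → 1 ≤ e → e ∣ p ℕ.∸ 1 → ∃ λ a → Order a e
      go e rec 1≤e d with e ℕ.≤? 1
      ... | yes le = 1 , subst (Order 1) (ℕ.≤-antisym 1≤e le) (refl , λ j _ → 1∣ j)
      ... | no nle with prime-divisor (ℕ.≰⇒> nle)
      ...   | l , pl , l∣e with extract pl e 1≤e
      ...     | zero , m , refl , nd = ⊥-elim (nd (subst (l ∣_) (ℕ.*-identityˡ m) l∣e))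
      ...     | suc v , m , refl , nd = proj₁ b ℕ.* proj₁ a , order-product (coprime-power pl nd (suc v)) (proj₂ b) (proj₂ a)
        where
        1≤m : 1 ≤ m
        1≤m = ∣⇒>0 1≤e (n∣m*n (l ^ suc v))
        m<e : m < l ^ suc v ℕ.* m
        m<e = subst (_< l ^ suc v ℕ.* m) (ℕ.*-identityˡ m) (ℕ.*-monoˡ-< m {{ℕ.>-nonZero 1≤m}} (ℕ.≤-trans (prime>1 pl) (ℕ.m≤m*n l (l ^ v) {{ℕ.>-nonZero (ℕ.m^n>0 l {{ℕ.>-nonZero (prime>0 pl)}} v)}})))
        a = rec m<e 1≤m (∣-trans (n∣m*n (l ^ suc v)) d)
        b = order-prime-power pl v (∣-trans (m∣m*n m) d)

    order-distinct : ∀ {a e} → 1 ≤ e → Order a e → ∀ {i j} → i < e → j < e → a ^ i ≋ a ^ j → i ≡ j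
    order-distinct {a} {e} 1≤e (h , min) {i} {j} i<e j<e q = [ (λ le → half i j le j<e q) , (λ le → sym (half j i le i<e (sym q))) ]′ (ℕ.≤-total i j)
      where
      half : ∀ i j → i ≤ j → j < e → a ^ i ≋ a ^ j → i ≡ j
      half i j le lt q with j ℕ.∸ i in d
      ... | zero = ℕ.≤-antisym le (ℕ.m∸n≡0⇒m≤n d)
      ... | suc t = ⊥-elim (ℕ.<-irrefl refl (ℕ.≤-trans (s≤s (ℕ.≤-trans (∣⇒≤ e∣) (ℕ.≤-trans (ℕ.≤-reflexive (sym d)) (ℕ.m∸n≤m j i)))) lt))
        where
        na : ¬ p ∣ a ^ i
        na dv = unit e 1≤e h (prime-∣-^ a i pp dv)
        e∣ : e ∣ suc t
        e∣ = min (suc t) (sym (cancel-≋ {a ^ i} na (trans (cong (_% p) (ℕ.*-identityʳ (a ^ i))) (trans q (cong (_% p) (trans (cong (a ^_) (trans (sym (ℕ.m+[n∸m]≡n le)) (cong (i ℕ.+_) d))) (ℕ.^-distribˡ-+-* a i (suc t))))))))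

-- The group of vertex permutations.

module Vertices where

  open import Defs
  open import Data.Nat as ℕ using (ℕ; zero; suc; _+_; _*_; _∸_; _^_; _≤_; NonZero)
  import Data.Nat.Properties as ℕ
  open import Data.Nat.DivMod
  open import Data.Nat.Divisibility
  open import Data.Nat.Primality using (Prime)
  import Data.Nat.Coprimality as Cop
  open import Data.Nat.Tactic.RingSolver using (solve-∀)
  open import Data.Bool using (Bool)
  open import Data.Fin as Fin using (Fin; zero; suc; toℕ; splitAt; join; combine; remQuot)
  import Data.Fin.Properties as Fin
  open import Data.List using (List; map; allFin)
  open import Data.List.Membership.Propositional using (_∈_)
  open import Data.List.Membership.Propositional.Properties using (∈-map⁻; ∈-map⁺; ∈-allFin)
  open import Data.Product using (_,_; _×_; ∃; proj₁; proj₂)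
  open import Data.Sum using (_⊎_; inj₁; inj₂)
  open import Data.Empty using (⊥-elim)
  open import Function using (_∘_)
  open import Relation.Nullary using (¬_; Dec; yes; no)
  open import Relation.Binary.PropositionalEquality
  open Orbit using (iter)
  open PrimeBasics
  open Multiples using (residue)
  open Modular
  open GraphAction
  open Degree

  module Cyclic (m : ℕ) .{{_ : NonZero m}} where

    red : ℕ → Fin m
    red t = t mod m

    toℕ-red : ∀ t → toℕ (red t) ≡ t % m
    toℕ-red t = Fin.toℕ-fromℕ< (m%n<n t m)

    red-cong : ∀ {s t} → s % m ≡ t % m → red s ≡ red t
    red-cong {s} {t} h = Fin.toℕ-injective (trans (toℕ-red s) (trans h (sym (toℕ-red t))))

    red-injective : ∀ {s t} → red s ≡ red t → s % m ≡ t % m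
    red-injective {s} {t} h = trans (sym (toℕ-red s)) (trans (cong toℕ h) (toℕ-red t))

    red-toℕ : ∀ x → red (toℕ x) ≡ x
    red-toℕ x = Fin.toℕ-injective (trans (toℕ-red (toℕ x)) (m<n⇒m%n≡m (Fin.toℕ<n x)))

    red-+ : ∀ s t → red (s + toℕ (red t)) ≡ red (s + t)
    red-+ s t = red-cong (trans (cong (λ z → (s + z) % m) (toℕ-red t)) (trans (%-distribˡ-+ s (t % m) m)
      (trans (cong (λ z → (s % m + z) % m) (m%n%n≡m%n t m)) (sym (%-distribˡ-+ s t m)))))

    red-* : ∀ s t → red (s * toℕ (red t)) ≡ red (s * t)
    red-* s t = red-cong (trans (cong (λ z → (s * z) % m) (toℕ-red t)) (trans (%-distribˡ-* s (t % m) m)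
      (trans (cong (λ z → (s % m * z) % m) (m%n%n≡m%n t m)) (sym (%-distribˡ-* s t m)))))

    red-period : ∀ j t → red (j * m + t) ≡ red t
    red-period j t = red-cong (trans (cong (_% m) (ℕ.+-comm (j * m) t)) ([m+kn]%n≡m%n t j m))

  -- Adding s (m - 1) undoes the addition of s.
  %-cancelˡ : ∀ m .{{_ : NonZero m}} s {a b} → (s + a) % m ≡ (s + b) % m → a % m ≡ b % m
  %-cancelˡ m@(suc m′) s {a} {b} h = trans (sym (back a)) (trans (trans (%-distribˡ-+ (s * m′) (s + a) m) (trans (cong (λ z → ((s * m′) % m + z) % m) h) (sym (%-distribˡ-+ (s * m′) (s + b) m)))) (back b))
    where
    lem : ∀ s m a → s * m + (s + a) ≡ a + s * suc m
    lem = solve-∀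
    back : ∀ a → (s * m′ + (s + a)) % m ≡ a % m
    back a = trans (cong (_% m) (lem s m′ a)) ([m+kn]%n≡m%n a s m)

  module Group (c k p q : ℕ) (pc : Prime c) (pp : Prime p) (pq : Prime q) (1≤k : 1 ≤ k) (c∤ : ¬ c ∣ k * (p ∸ 1))
    (ν : ℕ) (ν-order : Residues.Order p pp ν (p ∸ 1)) (μ : ℕ) (μ-order : Residues.Order c pc μ q) where

    instance
      c≢0 : NonZero c
      c≢0 = ℕ.>-nonZero (prime>0 pc)
      p≢0 : NonZero p
      p≢0 = ℕ.>-nonZero (prime>0 pp)
      k≢0 : NonZero k
      k≢0 = ℕ.>-nonZero 1≤k

    module C = Cyclic c
    module K = Cyclic k
    module P = Cyclic p

    n : ℕ
    n = c + k * p

    -- ℤ/c together with k copies of ℤ/p. Below, g is y ↦ y + 1 on ℤ/c and carries each copy of ℤ/p to the next one,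
    -- multiplying by the primitive root ν when it wraps around; s multiplies ℤ/c by μ.
    W : Set
    W = Fin c ⊎ (Fin k × Fin p)

    enc : W → Fin n
    enc (inj₁ y)       = join c (k * p) (inj₁ y)
    enc (inj₂ (i , x)) = join c (k * p) (inj₂ (combine i x))

    private
      dec′ : Fin c ⊎ Fin (k * p) → W
      dec′ (inj₁ y) = inj₁ y
      dec′ (inj₂ z) = inj₂ (remQuot p z)

    dec : Fin n → W
    dec v = dec′ (splitAt c v)

    dec-enc : ∀ u → dec (enc u) ≡ u
    dec-enc (inj₁ y)       = cong dec′ (Fin.splitAt-join c (k * p) (inj₁ y))
    dec-enc (inj₂ (i , x)) = trans (cong dec′ (Fin.splitAt-join c (k * p) (inj₂ (combine i x)))) (cong inj₂ (Fin.remQuot-combine i x))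

    enc-dec : ∀ v → enc (dec v) ≡ v
    enc-dec v with splitAt c v in e
    ... | inj₁ y = trans (cong (join c (k * p)) (sym e)) (Fin.join-splitAt c (k * p) v)
    ... | inj₂ z = trans (cong (join c (k * p) ∘ inj₂) (Fin.combine-remQuot {k} p z)) (trans (cong (join c (k * p)) (sym e)) (Fin.join-splitAt c (k * p) v))

    enc-injective : ∀ {u v} → enc u ≡ enc v → u ≡ v
    enc-injective {u} {v} e = trans (sym (dec-enc u)) (trans (cong dec e) (dec-enc v))

    lift : (W → W) → Fin n → Fin n
    lift h v = enc (h (dec v))

    iter-lift : ∀ h j v → iter (lift h) j v ≡ enc (iter h j (dec v))
    iter-lift h zero    v = sym (enc-dec v)
    iter-lift h (suc j) v = trans (cong (lift h) (iter-lift h j v)) (cong (enc ∘ h) (dec-enc (iter h j (dec v))))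

    symmetry : (h : W → W) (N : ℕ) → (∀ u → iter h (suc N) u ≡ u) → Symmetry {n}
    symmetry h N per = record { move = lift h ; order = N ; periodic = λ v → trans (iter-lift h (suc N) v) (trans (cong enc (per (dec v))) (enc-dec v)) }

    bump : ∀ {X : Set} → Dec X → ℕ → Fin p → Fin p
    bump (yes _) e x = P.red (e + toℕ x)
    bump (no _)  e x = x

    shift : Fin k → ℕ → W → W
    shift j e (inj₁ y)       = inj₁ y
    shift j e (inj₂ (i , x)) = inj₂ (i , bump (i Fin.≟ j) e x)

    iter-shift : ∀ j e u → iter (shift j 1) e u ≡ shift j e u
    iter-shift j e (inj₁ y) = go e
      where go : ∀ e → iter (shift j 1) e (inj₁ y) ≡ inj₁ y
            go zero    = refl
            go (suc e) = cong (shift j 1) (go e)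
    iter-shift j zero (inj₂ (i , x)) with i Fin.≟ j
    ... | yes _ = cong (λ t → inj₂ (i , t)) (sym (P.red-toℕ x))
    ... | no _  = refl
    iter-shift j (suc e) (inj₂ (i , x)) = trans (cong (shift j 1) (iter-shift j e (inj₂ (i , x)))) (step (i Fin.≟ j))
      where
      step : (d : Dec (i ≡ j)) → inj₂ (i , bump d 1 (bump d e x)) ≡ inj₂ (i , bump d (suc e) x)
      step (yes _) = cong (λ t → inj₂ (i , t)) (P.red-+ 1 (e + toℕ x))
      step (no _)  = refl

    shift-period : ∀ j u → iter (shift j 1) (suc (ℕ.pred p)) u ≡ u
    shift-period j u = trans (cong (λ t → iter (shift j 1) t u) (ℕ.suc-pred p)) (trans (iter-shift j p u) (fin u))
      where
      fin : ∀ u → shift j p u ≡ u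
      fin (inj₁ y) = refl
      fin (inj₂ (i , x)) with i Fin.≟ j
      ... | yes _ = cong (λ t → inj₂ (i , t)) (trans (cong (λ t → P.red (t + toℕ x)) (sym (ℕ.*-identityˡ p))) (trans (P.red-period 1 (toℕ x)) (P.red-toℕ x)))
      ... | no _  = refl

    -- `t` counts the steps of the rotation without reduction modulo k: its remainder is the block,
    -- and its quotient the number of multiplications by ν that have occurred. The iterates of `g`
    -- then act by adding to `t`.
    rot : ℕ → ℕ → Fin k × Fin p
    rot t x = K.red t , P.red (ν ^ (t / k) * x)

    g : W → W
    g (inj₁ y)       = inj₁ (C.red (1 + toℕ y))
    g (inj₂ (i , x)) = inj₂ (rot (1 + toℕ i) (toℕ x))

    rot-step : ∀ t x → rot (1 + toℕ (K.red t)) (toℕ (P.red (ν ^ (t / k) * x))) ≡ rot (1 + t) x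
    rot-step t x = cong₂ _,_ (K.red-+ 1 t) (trans (P.red-* (ν ^ ((1 + toℕ (K.red t)) / k)) (ν ^ (t / k) * x)) (cong P.red (trans (sym (ℕ.*-assoc (ν ^ ((1 + toℕ (K.red t)) / k)) (ν ^ (t / k)) x))
      (cong (_* x) (trans (sym (ℕ.^-distribˡ-+-* ν ((1 + toℕ (K.red t)) / k) (t / k))) (cong (ν ^_) exponent))))))
      where
      exponent : (1 + toℕ (K.red t)) / k + t / k ≡ (1 + t) / k
      exponent = trans (cong₂ (λ a b → (1 + a) / k + b) (K.toℕ-red t) (sym (m*n/n≡m (t / k) k))) (trans (sym (+-distrib-/-∣ʳ (1 + t % k) (n∣m*n (t / k)))) (cong (λ z → suc z / k) (sym (m≡m%n+[m/n]*n t k))))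

    iter-g₁ : ∀ j y → iter g j (inj₁ y) ≡ inj₁ (C.red (j + toℕ y))
    iter-g₁ zero    y = cong inj₁ (sym (C.red-toℕ y))
    iter-g₁ (suc j) y = trans (cong g (iter-g₁ j y)) (cong inj₁ (C.red-+ 1 (j + toℕ y)))

    iter-g₂ : ∀ j i x → iter g j (inj₂ (i , x)) ≡ inj₂ (rot (j + toℕ i) (toℕ x))
    iter-g₂ zero    i x = cong inj₂ (sym (cong₂ _,_ (K.red-toℕ i) (trans (cong (λ e → P.red (ν ^ e * toℕ x)) (m<n⇒m/n≡0 (Fin.toℕ<n i))) (trans (cong P.red (ℕ.*-identityˡ (toℕ x))) (P.red-toℕ x)))))
    iter-g₂ (suc j) i x = trans (cong g (iter-g₂ j i x)) (cong inj₂ (rot-step (j + toℕ i) (toℕ x)))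

    -- The order of `g` on the blocks: k steps lead back to the same block with a factor ν, whose
    -- order is p - 1.
    N₁ : ℕ
    N₁ = k * (p ∸ 1)

    rot-period : ∀ e t x → rot (e * N₁ + t) x ≡ rot t x
    rot-period e t x = cong₂ _,_ (trans (cong (λ z → K.red (z + t)) (lem e k (p ∸ 1))) (K.red-period (e * (p ∸ 1)) t))
      (P.red-cong (trans (cong (λ z → (ν ^ z * x) % p) exponent) (trans (cong (λ z → (z * x) % p) (ℕ.^-distribˡ-+-* ν (e * (p ∸ 1)) (t / k)))
        (trans (cong (_% p) (ℕ.*-assoc (ν ^ (e * (p ∸ 1))) (ν ^ (t / k)) x)) (trans (Residues.*-≋ p pp {ν ^ (e * (p ∸ 1))} {1} {ν ^ (t / k) * x} one refl) (cong (_% p) (ℕ.*-identityˡ _)))))))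
      where
      lem : ∀ e k h → e * (k * h) ≡ e * h * k
      lem = solve-∀
      exponent : (e * N₁ + t) / k ≡ e * (p ∸ 1) + t / k
      exponent = trans (cong (λ z → (z + t) / k) (lem e k (p ∸ 1))) (trans (+-distrib-/-∣ˡ {e * (p ∸ 1) * k} t (n∣m*n (e * (p ∸ 1)))) (cong (_+ t / k) (m*n/n≡m (e * (p ∸ 1)) k)))
      one : (ν ^ (e * (p ∸ 1))) % p ≡ 1 % p
      one = trans (cong (λ z → (ν ^ z) % p) (ℕ.*-comm e (p ∸ 1))) (trans (cong (_% p) (sym (ℕ.^-*-assoc ν (p ∸ 1) e))) (Residues.^-one p pp e (proj₁ ν-order)))

    1≤p-1 : 1 ≤ p ∸ 1
    1≤p-1 = ℕ.m<n⇒0<n∸m (prime>1 pp)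

    instance
      N≢0 : NonZero (c * N₁)
      N≢0 = ℕ.>-nonZero (ℕ.*-mono-≤ (prime>0 pc) (ℕ.*-mono-≤ 1≤k 1≤p-1))

    g-period : ∀ u → iter g (suc (ℕ.pred (c * N₁))) u ≡ u
    g-period u = trans (cong (λ t → iter g t u) (ℕ.suc-pred (c * N₁))) (fin u)
      where
      fin : ∀ u → iter g (c * N₁) u ≡ u
      fin (inj₁ y) = trans (iter-g₁ (c * N₁) y) (cong inj₁ (trans (cong (λ z → C.red (z + toℕ y)) (ℕ.*-comm c N₁)) (trans (C.red-period N₁ (toℕ y)) (C.red-toℕ y))))
      fin (inj₂ (i , x)) = trans (iter-g₂ (c * N₁) i x) (trans (cong inj₂ (rot-period c (toℕ i) (toℕ x))) (sym (iter-g₂ 0 i x)))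

    s : W → W
    s (inj₁ y) = inj₁ (C.red (μ * toℕ y))
    s (inj₂ w) = inj₂ w

    iter-s₁ : ∀ j y → iter s j (inj₁ y) ≡ inj₁ (C.red (μ ^ j * toℕ y))
    iter-s₁ zero    y = cong inj₁ (sym (trans (cong C.red (ℕ.*-identityˡ (toℕ y))) (C.red-toℕ y)))
    iter-s₁ (suc j) y = trans (cong s (iter-s₁ j y)) (cong inj₁ (trans (C.red-* μ (μ ^ j * toℕ y)) (cong C.red (sym (ℕ.*-assoc μ (μ ^ j) (toℕ y))))))

    s-period : ∀ u → iter s (suc (ℕ.pred q)) u ≡ u
    s-period u = trans (cong (λ t → iter s t u) (ℕ.suc-pred q {{ℕ.>-nonZero (prime>0 pq)}})) (fin u)
      where
      fin : ∀ u → iter s q u ≡ u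
      fin (inj₁ y) = trans (iter-s₁ q y) (cong inj₁ (trans (C.red-cong (trans (Residues.*-≋ c pc {μ ^ q} {1} {toℕ y} (proj₁ μ-order) refl) (cong (_% c) (ℕ.*-identityˡ (toℕ y))))) (C.red-toℕ y)))
      fin (inj₂ w) = go q
        where go : ∀ j → iter s j (inj₂ w) ≡ inj₂ w
              go zero    = refl
              go (suc j) = cong s (go j)

    τ : Fin k → Symmetry {n}
    τ j = symmetry (shift j 1) (ℕ.pred p) (shift-period j)

    γ ς : Symmetry {n}
    γ = symmetry g (ℕ.pred (c * N₁)) g-period
    ς = symmetry s (ℕ.pred q) s-period

    translations : List (Symmetry {n})
    translations = map τ (allFin k)

    translation : ∀ {σ} → σ ∈ translations → ∃ λ j → σ ≡ τ j
    translation i with ∈-map⁻ τ i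
    ... | j , _ , e = j , e

    InvW : (W → W) → (Fin n → Fin n → Bool) → Set
    InvW h a = ∀ u v → a (enc (h u)) (enc (h v)) ≡ a (enc u) (enc v)

    toW : ∀ h {a} → Invariant (lift h) a → InvW h a
    toW h {a} inv u v = trans (cong₂ a (cong (enc ∘ h) (sym (dec-enc u))) (cong (enc ∘ h) (sym (dec-enc v)))) (inv (enc u) (enc v))

    iterW : ∀ h {a} → InvW h a → ∀ e → InvW (iter h e) a
    iterW h inv zero    u v = refl
    iterW h {a} inv (suc e) u v = trans (inv (iter h e u) (iter h e v)) (iterW h {a} inv e u v)

    shiftW : ∀ {a} → (∀ {σ} → σ ∈ translations → Invariant (move σ) a) → ∀ j e → InvW (shift j e) a
    shiftW {a} inv j e u v = trans (cong₂ (λ s t → a (enc s) (enc t)) (sym (iter-shift j e u)) (sym (iter-shift j e v)))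
      (iterW (shift j 1) {a} (toW (shift j 1) {a} (inv (∈-map⁺ τ (∈-allFin j)))) e u v)

    commute : ∀ {σ ρ} → σ ∈ translations → ρ ∈ translations → ∀ v → move σ (move ρ v) ≡ move ρ (move σ v)
    commute i j v with translation i | translation j
    ... | a , refl | b , refl = trans (cong (enc ∘ shift a 1) (dec-enc (shift b 1 (dec v)))) (trans (cong enc (swap (dec v))) (sym (cong (enc ∘ shift b 1) (dec-enc (shift a 1 (dec v))))))
      where
      swap : ∀ u → shift a 1 (shift b 1 u) ≡ shift b 1 (shift a 1 u)
      swap (inj₁ y) = refl
      swap (inj₂ (i , x)) with i Fin.≟ a | i Fin.≟ b
      ... | yes _ | yes _ = refl
      ... | yes _ | no _  = refl
      ... | no _  | yes _ = refl
      ... | no _  | no _  = refl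

    -- g conjugates a translation of one block into a multiple translation of the next one.
    g-shift : ∀ j u → g (shift j 1 u) ≡ shift (K.red (1 + toℕ j)) (ν ^ ((1 + toℕ j) / k)) (g u)
    g-shift j (inj₁ y) = refl
    g-shift j (inj₂ (i , x)) = cong inj₂ (go (i Fin.≟ j) (K.red (1 + toℕ i) Fin.≟ K.red (1 + toℕ j)))
      where
      lem : ∀ e x → e * (1 + x) ≡ e + e * x
      lem = solve-∀
      go : (d : Dec (i ≡ j)) (d′ : Dec (K.red (1 + toℕ i) ≡ K.red (1 + toℕ j))) →
        rot (1 + toℕ i) (toℕ (bump d 1 x)) ≡ (K.red (1 + toℕ i) , bump d′ (ν ^ ((1 + toℕ j) / k)) (P.red (ν ^ ((1 + toℕ i) / k) * toℕ x)))
      go (yes refl) (yes _) = cong (K.red (1 + toℕ i) ,_) (trans (P.red-* (ν ^ ((1 + toℕ i) / k)) (1 + toℕ x)) (trans (cong P.red (lem (ν ^ ((1 + toℕ i) / k)) (toℕ x))) (sym (P.red-+ (ν ^ ((1 + toℕ i) / k)) _))))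
      go (yes refl) (no n) = ⊥-elim (n refl)
      go (no _) (no _) = refl
      go (no n) (yes e) = ⊥-elim (n (trans (sym (K.red-toℕ i)) (trans (K.red-cong (%-cancelˡ k 1 (K.red-injective e))) (K.red-toℕ j))))

    γ-normalises : ∀ a → (∀ {σ} → σ ∈ translations → Invariant (move σ) a) → ∀ {σ} → σ ∈ translations → Invariant (move σ) (λ i j → a (move γ i) (move γ j))
    γ-normalises a inv i u v with translation i
    ... | j , refl = trans (cong₂ a (eq u) (eq v)) (shiftW inv (K.red (1 + toℕ j)) (ν ^ ((1 + toℕ j) / k)) (g (dec u)) (g (dec v)))
      where
      eq : ∀ u → lift g (lift (shift j 1) u) ≡ enc (shift (K.red (1 + toℕ j)) (ν ^ ((1 + toℕ j) / k)) (g (dec u)))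
      eq u = trans (cong (enc ∘ g) (dec-enc (shift j 1 (dec u)))) (cong enc (g-shift j (dec u)))

    ς-normalises : ∀ a → (∀ {σ} → σ ∈ translations → Invariant (move σ) a) → ∀ {σ} → σ ∈ translations → Invariant (move σ) (λ i j → a (move ς i) (move ς j))
    ς-normalises a inv i u v with translation i
    ... | j , refl = trans (cong₂ a (eq u) (eq v)) (shiftW inv j 1 (s (dec u)) (s (dec v)))
      where
      comm : ∀ u → s (shift j 1 u) ≡ shift j 1 (s u)
      comm (inj₁ y) = refl
      comm (inj₂ w) = refl
      eq : ∀ u → lift s (lift (shift j 1) u) ≡ enc (shift j 1 (s (dec u)))
      eq u = trans (cong (enc ∘ s) (dec-enc (shift j 1 (dec u)))) (cong enc (comm (dec u)))

    -- As the prime c does not divide N₁, the exponents in a given class modulo N₁ reach every class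
    -- modulo c. The powers of the single permutation `g` thus act independently on ℤ/c and on the
    -- blocks.
    solve-mod : ∀ A y → ∃ λ t → (A + N₁ * t) % c ≡ y % c
    solve-mod A y with residue (A + y * (c ∸ 1)) N₁ c (Cop.sym (prime-∤⇒coprime pc c∤))
    ... | r , h = t , trans (sym ([m+kn]%n≡m%n (A + N₁ * t) y c)) (trans (cong (_% c) rearrange) ([m+kn]%n≡m%n y (quotient div) c))
      where
      t = r * (c ∸ 1)
      c≡ : 1 + (c ∸ 1) ≡ c
      c≡ = ℕ.m+[n∸m]≡n (prime>0 pc)
      div : c ∣ A + y * (c ∸ 1) + N₁ * t
      div = proj₂ (h t) (divides r (trans (lem₀ r (c ∸ 1)) (cong (r *_) c≡)))
        where lem₀ : ∀ r d → r + r * d ≡ r * (1 + d)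
              lem₀ = solve-∀
      lem : ∀ A x m d → A + x + m * (1 + d) ≡ m + (A + m * d + x)
      lem = solve-∀
      rearrange : A + N₁ * t + y * c ≡ y + quotient div * c
      rearrange = trans (cong (λ z → A + N₁ * t + y * z) (sym c≡)) (trans (lem A (N₁ * t) y (c ∸ 1)) (cong (y +_) (_∣_.equality div)))

    -- An exponent congruent to 1 modulo N₁ and to μ modulo c.
    exponent : ∃ λ t → (1 + N₁ * t) % c ≡ μ % c
    exponent = solve-mod 1 μ

    -- `s` normalises the cyclic group of `g`: on ℤ/c it turns the translation by 1 into that by μ,
    -- on the blocks it changes nothing, and one power of `g` does both.
    s-g : ∀ u → s (g u) ≡ iter g (1 + N₁ * proj₁ exponent) (s u)
    s-g (inj₁ y) = sym (trans (iter-g₁ (1 + N₁ * t) (C.red (μ * toℕ y))) (cong inj₁ (trans (C.red-+ (1 + N₁ * t) (μ * toℕ y)) (trans (C.red-cong (Residues.+-≋ c pc {1 + N₁ * t} {μ} {μ * toℕ y} (proj₂ exponent) refl))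
        (trans (cong C.red (lem μ (toℕ y))) (sym (C.red-* μ (1 + toℕ y))))))))
      where
      t = proj₁ exponent
      lem : ∀ m y → m + m * y ≡ m * (1 + y)
      lem = solve-∀
    s-g (inj₂ (i , x)) = sym (trans (iter-g₂ (1 + N₁ * t) i x) (cong inj₂ (trans (cong (λ z → rot z (toℕ x)) (lem N₁ t (toℕ i))) (rot-period t (1 + toℕ i) (toℕ x)))))
      where
      t = proj₁ exponent
      lem : ∀ N t i → 1 + N * t + i ≡ t * N + (1 + i)
      lem = solve-∀

    ς-γ : ∀ a → Invariant (move γ) a → Invariant (move γ) (λ i j → a (move ς i) (move ς j))
    ς-γ a inv u v = trans (cong₂ a (eq u) (eq v)) (iterW g {a} (toW g {a} inv) (1 + N₁ * proj₁ exponent) (s (dec u)) (s (dec v)))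
      where
      eq : ∀ u → lift s (lift g u) ≡ enc (iter g (1 + N₁ * proj₁ exponent) (s (dec u)))
      eq u = trans (cong (enc ∘ s) (dec-enc (g (dec u)))) (cong enc (s-g (dec u)))

-- Lower bounds for the number of edges of invariant graphs.

module EdgeBound where

  open import Defs
  open import Data.Nat as ℕ using (ℕ; _+_; _*_; _∸_; _^_; _≤_; _<_; z≤n; s≤s; NonZero)
  import Data.Nat.Properties as ℕ
  open import Data.Nat.DivMod
  open import Data.Nat.Divisibility
  open import Data.Nat.Primality using (Prime)
  open import Data.Nat.Tactic.RingSolver using (solve-∀)
  open import Data.Bool using (Bool; true; false)
  open import Data.Fin as Fin using (Fin; toℕ; combine; remQuot)
  import Data.Fin.Properties as Fin
  open import Data.List.Membership.Propositional using (_∈_)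
  open import Data.Product using (_,_; proj₁; proj₂; uncurry)
  open import Data.Sum using (inj₁; inj₂)
  open import Data.Sum.Properties using (inj₁-injective; inj₂-injective)
  open import Data.Product.Properties using (,-injectiveʳ)
  open import Data.Empty using (⊥-elim)
  open import Function using (_∘_)
  open import Relation.Nullary using (¬_; Dec; yes; no)
  open import Relation.Binary.PropositionalEquality
  open Orbit using (iter)
  open PrimeBasics
  open Modular
  open GraphAction
  open Degree
  open Vertices


  -- A nonnegative representative of y - x modulo m.
  difference : ∀ m .{{_ : NonZero m}} (x y : Fin m) → ℕ
  difference m x y = toℕ y + (m ∸ toℕ x)

  difference-∤ : ∀ m .{{_ : NonZero m}} {x y : Fin m} → ¬ x ≡ y → ¬ m ∣ difference m x y
  difference-∤ m {x} {y} x≢y (divides r e) = x≢y (trans (sym (Cyclic.red-toℕ m x)) (trans (Cyclic.red-cong m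
      (trans (sym (trans (cong (λ z → (z + toℕ x) % m) e) (trans (cong (_% m) (ℕ.+-comm (r * m) (toℕ x))) ([m+kn]%n≡m%n (toℕ x) r m))))
        (trans (cong (_% m) (trans (ℕ.+-assoc (toℕ y) (m ∸ toℕ x) (toℕ x)) (cong (toℕ y +_) (ℕ.m∸n+n≡m (ℕ.<⇒≤ (Fin.toℕ<n x)))))) ([m+n]%n≡m%n (toℕ y) m)))) (Cyclic.red-toℕ m y)))

  ray-injective : ∀ {p} (pp : Prime p) .{{_ : NonZero p}} {a e D} y → Residues.Order p pp a e → ¬ p ∣ D → {i j : Fin e} →
    Cyclic.red p (y + a ^ toℕ i * D) ≡ Cyclic.red p (y + a ^ toℕ j * D) → i ≡ j
  ray-injective {p} pp {a} {e} {D} y ord p∤D {i} {j} h = Fin.toℕ-injective (Residues.order-distinct p pp {a} {e} (ℕ.≤-trans (s≤s z≤n) (Fin.toℕ<n i)) ord (Fin.toℕ<n i) (Fin.toℕ<n j)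
    (Residues.cancel-≋ p pp {D} {a ^ toℕ i} {a ^ toℕ j} p∤D (trans (cong (_% p) (ℕ.*-comm D (a ^ toℕ i))) (trans (%-cancelˡ p y (Cyclic.red-injective p h)) (cong (_% p) (ℕ.*-comm (a ^ toℕ j) D))))))

  module _ (c k p q : ℕ) (pc : Prime c) (pp : Prime p) (pq : Prime q) (1≤k : 1 ≤ k) (c∤ : ¬ c ∣ k * (p ∸ 1))
    (ν : ℕ) (ν-order : Residues.Order p pp ν (p ∸ 1)) (μ : ℕ) (μ-order : Residues.Order c pc μ q) where

    open Group c k p q pc pp pq 1≤k c∤ ν ν-order μ μ-order

    module _ (G : Graph n) (inv-τ : ∀ {σ} → σ ∈ translations → Invariant (move σ) (adj G))
      (inv-γ : Invariant (move γ) (adj G)) (inv-ς : Invariant (move ς) (adj G)) where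

      private
        record Adj (u v : W) : Set where
          constructor adjacent
          field proof : adj G (enc u) (enc v) ≡ true

        Adj-sym : ∀ {u v} → Adj u v → Adj v u
        Adj-sym {u} {v} (adjacent h) = adjacent (trans (adj-sym G (enc v) (enc u)) h)

        by-g : ∀ e {u v} → Adj u v → Adj (iter g e u) (iter g e v)
        by-g e {u} {v} (adjacent h) = adjacent (trans (iterW g {adj G} (toW g {adj G} inv-γ) e u v) h)

        by-s : ∀ e {u v} → Adj u v → Adj (iter s e u) (iter s e v)
        by-s e {u} {v} (adjacent h) = adjacent (trans (iterW s {adj G} (toW s {adj G} inv-ς) e u v) h)

        by-shift : ∀ j e {u v} → Adj u v → Adj (shift j e u) (shift j e v)
        by-shift j e {u} {v} (adjacent h) = adjacent (trans (shiftW {adj G} inv-τ j e u v) h)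

        shift-same : ∀ j e x → shift j e (inj₂ (j , x)) ≡ inj₂ (j , P.red (e + toℕ x))
        shift-same j e x = go (j Fin.≟ j)
          where go : (d : Dec (j ≡ j)) → inj₂ (j , bump d e x) ≡ inj₂ (j , P.red (e + toℕ x))
                go (yes _) = refl
                go (no n)  = ⊥-elim (n refl)

        shift-other : ∀ {i j} e x → ¬ i ≡ j → shift j e (inj₂ (i , x)) ≡ inj₂ (i , x)
        shift-other {i} {j} e x i≢j = go (i Fin.≟ j)
          where go : (d : Dec (i ≡ j)) → inj₂ (i , bump d e x) ≡ inj₂ (i , x)
                go (yes e) = ⊥-elim (i≢j e)
                go (no _)  = refl

        shift-to : ∀ x₀ x → P.red (toℕ x + (p ∸ toℕ x₀) + toℕ x₀) ≡ x
        shift-to x₀ x = trans (P.red-cong (trans (cong (_% p) (trans (ℕ.+-assoc (toℕ x) _ _) (cong (toℕ x +_) (ℕ.m∸n+n≡m (ℕ.<⇒≤ (Fin.toℕ<n x₀)))))) ([m+n]%n≡m%n (toℕ x) p))) (P.red-toℕ x)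

        block : Fin (k * p) → Fin n
        block z = enc (inj₂ (remQuot p z))

        block-injective : ∀ {z z′} → block z ≡ block z′ → z ≡ z′
        block-injective {z} {z′} e = trans (sym (Fin.combine-remQuot {k} p z)) (trans (cong (uncurry combine) (inj₂-injective (enc-injective e))) (Fin.combine-remQuot {k} p z′))

        k≤N₁ : k ≤ N₁
        k≤N₁ = ℕ.≤-trans (ℕ.≤-reflexive (sym (ℕ.*-identityʳ k))) (ℕ.*-monoʳ-≤ k 1≤p-1)

        -- The first N₁ - i₀ steps complete the index i₀ to a full period, so that `t` is counted
        -- from block 0.
        back : ∀ (i₀ : Fin k) t → N₁ ∸ toℕ i₀ + t + toℕ i₀ ≡ 1 * N₁ + t
        back i₀ t = trans (lem (N₁ ∸ toℕ i₀) t (toℕ i₀)) (cong (λ z → 1 * z + t) (ℕ.m∸n+n≡m (ℕ.≤-trans (ℕ.<⇒≤ (Fin.toℕ<n i₀)) k≤N₁)))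
          where lem : ∀ a t i → a + t + i ≡ 1 * (a + i) + t
                lem = solve-∀

        affine : ∀ y b x₀ z m → y + b * (m ∸ x₀) + b * z ≡ y + b * (z + (m ∸ x₀))
        affine y b x₀ z m = lem y b (m ∸ x₀) z
          where lem : ∀ y b d z → y + b * d + b * z ≡ y + b * (z + d)
                lem = solve-∀

        affine-back : ∀ y b {x₀ m} .{{_ : NonZero m}} → x₀ ≤ m → (y + b * (m ∸ x₀) + b * x₀) % m ≡ y % m
        affine-back y b {x₀} {m} le = trans (cong (_% m) (trans (affine y b x₀ x₀ m) (cong (λ z → y + b * z) (ℕ.m+[n∸m]≡n le)))) ([m+kn]%n≡m%n y b m)

        rot-own : ∀ (i : Fin k) t x → rot (toℕ i + k * t) x ≡ (i , P.red (ν ^ t * x))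
        rot-own i t x = cong₂ _,_ (trans (cong K.red (trans (ℕ.+-comm (toℕ i) (k * t)) (cong (_+ toℕ i) (ℕ.*-comm k t)))) (trans (K.red-period t (toℕ i)) (K.red-toℕ i)))
          (cong (λ e → P.red (ν ^ e * x)) (trans (+-distrib-/-∣ʳ (toℕ i) (m∣m*n t)) (cong₂ _+_ (m<n⇒m/n≡0 (Fin.toℕ<n i)) (trans (cong (_/ k) (ℕ.*-comm k t)) (m*n/n≡m t k)))))

        rot-here : ∀ (i : Fin k) x → rot (toℕ i) (toℕ x) ≡ (i , x)
        rot-here i x = trans (cong (λ t → rot t (toℕ x)) (sym (trans (cong (toℕ i +_) (ℕ.*-zeroʳ k)) (ℕ.+-identityʳ (toℕ i)))))
          (trans (rot-own i 0 (toℕ x)) (cong (i ,_) (trans (cong P.red (ℕ.*-identityˡ (toℕ x))) (P.red-toℕ x))))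

        -- The powers of `s` multiply the difference of the two ends by the q powers of μ, and `g`
        -- translates, so every vertex of ℤ/c has at least q neighbours.
        inside-C : ∀ {y₀ y₁} → ¬ y₀ ≡ y₁ → Adj (inj₁ y₀) (inj₁ y₁) → c * q ≤ 2 * edgeCount G
        inside-C {y₀} {y₁} y₀≢y₁ h = degree-bound G (enc ∘ inj₁) (λ e → inj₁-injective (enc-injective e))
            (λ y j → enc (inj₁ (C.red (toℕ y + μ ^ toℕ j * D))))
            (λ y {i} {j} e → ray-injective pc {μ} {q} {D} (toℕ y) μ-order (difference-∤ c y₀≢y₁) (inj₁-injective (enc-injective e))) (λ y j → Adj.proof (edge y j))
          where
          D = difference c y₀ y₁
          edge : ∀ y (j : Fin q) → Adj (inj₁ y) (inj₁ (C.red (toℕ y + μ ^ toℕ j * D)))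
          edge y j = subst₂ Adj
            (trans (cong (iter g m) (iter-s₁ (toℕ j) y₀)) (trans (iter-g₁ m _) (cong inj₁ (trans (C.red-+ m (b * toℕ y₀)) (trans (C.red-cong (affine-back (toℕ y) b (ℕ.<⇒≤ (Fin.toℕ<n y₀)))) (C.red-toℕ y))))))
            (trans (cong (iter g m) (iter-s₁ (toℕ j) y₁)) (trans (iter-g₁ m _) (cong inj₁ (trans (C.red-+ m (b * toℕ y₁)) (cong C.red (affine (toℕ y) b (toℕ y₀) (toℕ y₁) c))))))
            (by-g m (by-s (toℕ j) h))
            where
            b = μ ^ toℕ j
            m = toℕ y + b * (c ∸ toℕ y₀)

        -- Full turns of `g` multiply the difference of the two ends by all powers of the primitive
        -- root, so every block is a complete graph.
        inside-block : ∀ {i₀ x₀ x₁} → ¬ x₀ ≡ x₁ → Adj (inj₂ (i₀ , x₀)) (inj₂ (i₀ , x₁)) → k * p * (p ∸ 1) ≤ 2 * edgeCount G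
        inside-block {i₀} {x₀} {x₁} x₀≢x₁ h = degree-bound G block block-injective
            (λ z j → enc (inj₂ (proj₁ (remQuot {k} p z) , P.red (toℕ (proj₂ (remQuot {k} p z)) + ν ^ toℕ j * D))))
            (λ z {i} {j} e → ray-injective pp {ν} {p ∸ 1} {D} (toℕ (proj₂ (remQuot {k} p z))) ν-order (difference-∤ p x₀≢x₁) (,-injectiveʳ (inj₂-injective (enc-injective e))))
            (λ z j → Adj.proof (edge (proj₁ (remQuot {k} p z)) (proj₂ (remQuot {k} p z)) j))
          where
          D = difference p x₀ x₁
          edge : ∀ i x (j : Fin (p ∸ 1)) → Adj (inj₂ (i , x)) (inj₂ (i , P.red (toℕ x + ν ^ toℕ j * D)))
          edge i x j = subst₂ Adj
            (trans (cong (shift i e) (turn x₀)) (trans (shift-same i e _) (cong (λ z → inj₂ (i , z)) (trans (P.red-+ e (b * toℕ x₀)) (trans (P.red-cong (affine-back (toℕ x) b (ℕ.<⇒≤ (Fin.toℕ<n x₀)))) (P.red-toℕ x))))))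
            (trans (cong (shift i e) (turn x₁)) (trans (shift-same i e _) (cong (λ z → inj₂ (i , z)) (trans (P.red-+ e (b * toℕ x₁)) (cong P.red (affine (toℕ x) b (toℕ x₀) (toℕ x₁) p))))))
            (by-shift i e (by-g m h))
            where
            b = ν ^ toℕ j
            e = toℕ x + b * (p ∸ toℕ x₀)
            t = toℕ i + k * toℕ j
            m = N₁ ∸ toℕ i₀ + t
            turn : ∀ z → iter g m (inj₂ (i₀ , z)) ≡ inj₂ (i , P.red (b * toℕ z))
            turn z = trans (iter-g₂ m i₀ z) (cong inj₂ (trans (cong (λ s → rot s (toℕ z)) (back i₀ t)) (trans (rot-period 1 t (toℕ z)) (rot-own i (toℕ j) (toℕ z)))))

        -- Ends in different blocks are translated independently, so each vertex is joined to all p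
        -- vertices of some other block.
        across-blocks : ∀ {i₀ i₁ x₀ x₁} → ¬ i₀ ≡ i₁ → Adj (inj₂ (i₀ , x₀)) (inj₂ (i₁ , x₁)) → k * p * p ≤ 2 * edgeCount G
        across-blocks {i₀} {i₁} {x₀} {x₁} i₀≢i₁ h = degree-bound G block block-injective
            (λ z x → enc (inj₂ (other (proj₁ (remQuot {k} p z)) , x)))
            (λ z e → ,-injectiveʳ (inj₂-injective (enc-injective e)))
            (λ z x → Adj.proof (edge (proj₁ (remQuot {k} p z)) (proj₂ (remQuot {k} p z)) x))
          where
          m : Fin k → ℕ
          m i = N₁ ∸ toℕ i₀ + toℕ i
          other : Fin k → Fin k
          other i = K.red (m i + toℕ i₁)
          other≢ : ∀ i → ¬ i ≡ other i
          other≢ i e = i₀≢i₁ (trans (sym (K.red-toℕ i₀)) (trans (K.red-cong (%-cancelˡ k (m i) {toℕ i₀} {toℕ i₁} (K.red-injective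
            (trans (cong K.red (back i₀ (toℕ i))) (trans (cong proj₁ (rot-period 1 (toℕ i) 0)) (trans (K.red-toℕ i) e)))))) (K.red-toℕ i₁)))
          edge : ∀ i x x′ → Adj (inj₂ (i , x)) (inj₂ (other i , x′))
          edge i x x′ = subst₂ Adj
              (trans (cong (shift (other i) e′ ∘ shift i e) turn) (trans (cong (shift (other i) e′) (shift-same i e x₀)) (trans (shift-other e′ _ (other≢ i)) (cong (λ z → inj₂ (i , z)) (shift-to x₀ x)))))
              (trans (cong (shift (other i) e′ ∘ shift i e) (iter-g₂ (m i) i₁ x₁)) (trans (cong (shift (other i) e′) (shift-other e w (other≢ i ∘ sym))) (trans (shift-same (other i) e′ w) (cong (λ z → inj₂ (other i , z)) (shift-to w x′)))))
              (by-shift (other i) e′ (by-shift i e (by-g (m i) h)))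
            where
            w : Fin p
            w = proj₂ (rot (m i + toℕ i₁) (toℕ x₁))
            e e′ : ℕ
            e = toℕ x + (p ∸ toℕ x₀)
            e′ = toℕ x′ + (p ∸ toℕ w)
            turn : iter g (m i) (inj₂ (i₀ , x₀)) ≡ inj₂ (i , x₀)
            turn = trans (iter-g₂ (m i) i₀ x₀) (cong inj₂ (trans (cong (λ s → rot s (toℕ x₀)) (back i₀ (toℕ i))) (trans (rot-period 1 (toℕ i) (toℕ x₀)) (rot-here i x₀))))

        -- By `solve-mod` one power of `g` moves the end in ℤ/c and the block of the other end to
        -- any two places; translations then reach every vertex of that block.
        cross : ∀ {y₀ i₀ x₀} → Adj (inj₁ y₀) (inj₂ (i₀ , x₀)) → c * (k * p) ≤ 2 * edgeCount G
        cross {y₀} {i₀} {x₀} h = degree-bound G (enc ∘ inj₁) (λ e → inj₁-injective (enc-injective e)) (λ _ → block) (λ _ → block-injective)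
            (λ y z → Adj.proof (edge y (proj₁ (remQuot {k} p z)) (proj₂ (remQuot {k} p z))))
          where
          edge : ∀ y i x → Adj (inj₁ y) (inj₂ (i , x))
          edge y i x = subst₂ Adj
              (cong (shift i e) (trans (iter-g₁ m y₀) (cong inj₁ (trans (C.red-cong (trans (cong (_% c) (lem (N₁ ∸ toℕ i₀) (toℕ i) (toℕ y₀) (N₁ * t))) (proj₂ sol))) (C.red-toℕ y)))))
              (trans (cong (shift i e) turn) (trans (shift-same i e x₀) (cong (λ z → inj₂ (i , z)) (shift-to x₀ x))))
              (by-shift i e (by-g m h))
            where
            sol = solve-mod (N₁ ∸ toℕ i₀ + toℕ i + toℕ y₀) (toℕ y)
            t = proj₁ sol
            e = toℕ x + (p ∸ toℕ x₀)
            m = N₁ ∸ toℕ i₀ + (toℕ i + N₁ * t)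
            lem : ∀ a i y x → a + (i + x) + y ≡ a + i + y + x
            lem = solve-∀
            lem′ : ∀ i N t → i + N * t ≡ t * N + i
            lem′ = solve-∀
            turn : iter g m (inj₂ (i₀ , x₀)) ≡ inj₂ (i , x₀)
            turn = trans (iter-g₂ m i₀ x₀) (cong inj₂ (trans (cong (λ s → rot s (toℕ x₀)) (back i₀ (toℕ i + N₁ * t))) (trans (rot-period 1 _ (toℕ x₀))
              (trans (cong (λ s → rot s (toℕ x₀)) (lem′ (toℕ i) N₁ t)) (trans (rot-period t (toℕ i) (toℕ x₀)) (rot-here i x₀))))))

        irreflexive : ∀ {u} → ¬ Adj u u
        irreflexive {u} (adjacent h) with trans (sym h) (adj-irrefl G (enc u))
        ... | ()

      edge-bound : ∀ {B} → B ≤ c * q → B ≤ k * p * (p ∸ 1) → B ≤ c * (k * p) → ∀ u v → adj G u v ≡ true → B ≤ 2 * edgeCount G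
      edge-bound {B} b₁ b₂ b₃ u v h = go (dec u) (dec v) (adjacent (subst₂ (λ s t → adj G s t ≡ true) (sym (enc-dec u)) (sym (enc-dec v)) h))
        where
        go : ∀ u v → Adj u v → B ≤ 2 * edgeCount G
        go (inj₁ y₀) (inj₁ y₁) h = ℕ.≤-trans b₁ (inside-C {y₀} {y₁} (λ e → irreflexive (subst (λ z → Adj (inj₁ y₀) (inj₁ z)) (sym e) h)) h)
        go (inj₁ y) (inj₂ w) h = ℕ.≤-trans b₃ (cross h)
        go (inj₂ w) (inj₁ y) h = ℕ.≤-trans b₃ (cross (Adj-sym h))
        go (inj₂ (i₀ , x₀)) (inj₂ (i₁ , x₁)) h = split (i₀ Fin.≟ i₁)
          where
          split : Dec (i₀ ≡ i₁) → B ≤ 2 * edgeCount G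
          split (yes refl) = ℕ.≤-trans b₂ (inside-block {i₀} {x₀} {x₁} (λ e → irreflexive (subst (λ z → Adj (inj₂ (i₀ , x₀)) (inj₂ (i₀ , z))) (sym e) h)) h)
          split (no i₀≢i₁) = ℕ.≤-trans b₂ (ℕ.≤-trans (ℕ.*-monoʳ-≤ (k * p) (ℕ.m∸n≤m p 1)) (across-blocks i₀≢i₁ h))

      sparse-empty : ∀ {B} → B ≤ c * q → B ≤ k * p * (p ∸ 1) → B ≤ c * (k * p) → 2 * edgeCount G < B → ∀ e → G e ≡ false
      sparse-empty {B} b₁ b₂ b₃ lt ((u , v) , u<v) = decide (G ((u , v) , u<v)) refl
        where
        decide : ∀ b → G ((u , v) , u<v) ≡ b → b ≡ false
        decide false _ = refl
        decide true  h = ⊥-elim (ℕ.<⇒≱ lt (edge-bound b₁ b₂ b₃ u v (trans (adj-< G u<v) h)))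

    sparse-evasive : ∀ {P : Graph n → Bool} → IsGraphProperty P → Monotone P → Nontrivial P →
      ∀ {B} → B ≤ c * q → B ≤ k * p * (p ∸ 1) → B ≤ c * (k * p) → (∀ G → P G ≡ true → 2 * edgeCount G < B) → EvasiveProperty n P
    sparse-evasive {P} isP mono nontrivial b₁ b₂ b₃ sparse =
      evasive-by-symmetry P isP mono nontrivial (ℕ.pred p) (subst Prime (sym (ℕ.suc-pred p)) pp) translations ordered commute
        γ ς (subst Prime (sym (ℕ.suc-pred q {{ℕ.>-nonZero (prime>0 pq)}})) pq) γ-normalises ς-normalises ς-γ
        (λ G PG iτ iγ iς → sparse-empty G iτ iγ iς b₁ b₂ b₃ (sparse G PG))
      where
      ordered : ∀ {σ} → σ ∈ translations → order σ ≡ ℕ.pred p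
      ordered i with translation i
      ... | _ , refl = refl

-- The threshold function and the conclusion.

open import Defs
open import Data.Nat using (ℕ; zero; suc; _+_; _*_; _∸_; _^_; _≤_; _⊔_; _/_; _%_; z≤n; s≤s; NonZero; >-nonZero)
open import Data.Nat.Properties
open import Data.Nat.DivMod using (/-monoˡ-≤; m*n/n≡m; m/n*n≤m; m%n<n; m≡m%n+[m/n]*n; m≥n⇒m/n>0; m/n≤m)
open import Data.Nat.Divisibility using (∣⇒≤; ∣-refl)
open import Data.Nat.Tactic.RingSolver using (solve-∀)
open import Data.Bool using (Bool; true)
open import Data.Product using (Σ; _,_; _×_; ∃; proj₁; proj₂)
open import Data.Empty using (⊥-elim)
open import Relation.Binary.PropositionalEquality
open PrimeBasics
open Sums
open Modular
open PrimeExistence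
open EdgeBound

-- With V = v lg n, each of the three edge bounds is at least n times the rounded fourth root of n,
-- divided by 2 V, and it has to exceed 2 f, where 1 + 2 f ≤ 3 f; hence the 6. The successor makes
-- the divisor positive.
ratio : ℕ → ℕ → ℕ
ratio v n = suc (6 * (v * lg n))

-- The maximum with 1 secures positivity for the small n at which the quotient is 0.
threshold : ℕ → ℕ → ℕ
threshold v n = 1 ⊔ (n * root₄ n / ratio v n)

1≤threshold : ∀ v n → 1 ≤ threshold v n
1≤threshold v n = m≤m⊔n 1 (n * root₄ n / ratio v n)

private
  -- With m the rounded quotient of lg n by k, the base on the left is at most a constant times m,
  -- where the constant depends on v and k. It is therefore at most m² and then 2^m for large m, and
  -- 2^(m k) ≤ n.
  polylog-step : ∀ v k A M n .{{_ : NonZero k}} → A ≡ 4 + 24 * v → 2 * A * k + 16 ≤ M → 2 ^ (M * k) ≤ n → (4 * ratio v n) ^ k ≤ n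
  polylog-step v k A M n A≡ M-large N≤n = ≤-trans (^-monoˡ-≤ k base) (≤-trans (≤-reflexive (^-*-assoc 2 m k)) (≤-trans (^-monoʳ-≤ 2 (m/n*n≤m (lg n) k)) (2^lg≤ (≤-trans (m^n>0 2 (M * k)) N≤n))))
    where
    big : M * k ≤ lg n
    big = lg-max (M * k) N≤n
    m = lg n / k
    M≤m : M ≤ m
    M≤m = ≤-trans (≤-reflexive (sym (m*n/n≡m M k))) (/-monoˡ-≤ k big)
    16≤m : 16 ≤ m
    16≤m = ≤-trans (m≤n+m 16 (2 * A * k)) (≤-trans M-large M≤m)
    1≤m : 1 ≤ m
    1≤m = ≤-trans (s≤s z≤n) 16≤m
    lg≤ : lg n ≤ 2 * k * m
    lg≤ = ≤-trans (≤-reflexive (m≡m%n+[m/n]*n (lg n) k)) (≤-trans (+-monoˡ-≤ (m * k) (≤-trans (<⇒≤ (m%n<n (lg n) k)) (m≤n*m k m {{>-nonZero 1≤m}}))) (≤-reflexive (lem m k)))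
      where lem : ∀ m k → m * k + m * k ≡ 2 * k * m
            lem = solve-∀
    1≤lg : 1 ≤ lg n
    1≤lg = ≤-trans 1≤m (m/n≤m (lg n) k)
    square : m * m ≤ m ^ 4
    square = ≤-trans (≤-reflexive (cong (m *_) (sym (*-identityʳ m)))) (^-monoʳ-≤ m {{>-nonZero 1≤m}} {2} {4} (s≤s (s≤s z≤n)))
    base : 4 * ratio v n ≤ 2 ^ m
    base = begin
      4 * ratio v n              ≡⟨ lem₁ v (lg n) ⟩
      4 * 1 + 24 * v * lg n      ≤⟨ +-monoˡ-≤ (24 * v * lg n) (*-monoʳ-≤ 4 1≤lg) ⟩
      4 * lg n + 24 * v * lg n   ≡⟨ *-distribʳ-+ (lg n) 4 (24 * v) ⟨
      (4 + 24 * v) * lg n        ≡⟨ cong (_* lg n) A≡ ⟨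
      A * lg n                   ≤⟨ *-monoʳ-≤ A lg≤ ⟩
      A * (2 * k * m)            ≡⟨ lem₂ A k m ⟩
      2 * A * k * m              ≤⟨ *-monoˡ-≤ m (≤-trans (m≤m+n (2 * A * k) 16) (≤-trans M-large M≤m)) ⟩
      m * m                      ≤⟨ square ⟩
      m ^ 4                      ≤⟨ fourth-power-bound m 16≤m ⟩
      2 ^ m                      ∎
      where
      open ≤-Reasoning
      lem₁ : ∀ v l → 4 * suc (6 * (v * l)) ≡ 4 * 1 + 24 * v * l
      lem₁ = solve-∀
      lem₂ : ∀ A k m → A * (2 * k * m) ≡ 2 * A * k * m
      lem₂ = solve-∀

abstract
  polylog : ∀ v k → 1 ≤ k → ∃ λ N → ∀ n → N ≤ n → (4 * ratio v n) ^ k ≤ n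
  polylog v k 1≤k = 2 ^ ((2 * (4 + 24 * v) * k + 16) * k) , λ n → polylog-step v k (4 + 24 * v) (2 * (4 + 24 * v) * k + 16) n {{>-nonZero 1≤k}} refl ≤-refl

fourth-mul : ∀ a b → (a * b) ^ 4 ≡ a ^ 4 * b ^ 4
fourth-mul a b = ^-distribʳ-* 4 a b

1≤root₄ : ∀ n → 1 ≤ n → 1 ≤ root₄ n
1≤root₄ n 1≤n with root₄ n | root₄-spec n
... | suc _ | _ = s≤s z≤n
... | zero | _ , n<1 = ⊥-elim (<⇒≱ n<1 1≤n)

threshold-upper : ∀ v n k → 1 ≤ n → threshold v n ^ (4 * k) ≤ n ^ (5 * k + 4)
threshold-upper v n k 1≤n = begin
  f ^ (4 * k)            ≡⟨ ^-*-assoc f 4 k ⟨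
  (f ^ 4) ^ k            ≤⟨ ^-monoˡ-≤ k (^-monoˡ-≤ 4 f≤) ⟩
  ((n * r) ^ 4) ^ k      ≡⟨ cong (_^ k) (fourth-mul n r) ⟩
  (n ^ 4 * r ^ 4) ^ k    ≤⟨ ^-monoˡ-≤ k (*-monoʳ-≤ (n ^ 4) (proj₁ (root₄-spec n))) ⟩
  (n ^ 4 * n) ^ k        ≡⟨ cong (_^ k) (*-comm (n ^ 4) n) ⟩
  (n ^ 5) ^ k            ≡⟨ ^-*-assoc n 5 k ⟩
  n ^ (5 * k)            ≤⟨ ^-monoʳ-≤ n {{>-nonZero 1≤n}} (m≤m+n (5 * k) 4) ⟩
  n ^ (5 * k + 4)        ∎
  where
  open ≤-Reasoning
  f = threshold v n
  r = root₄ n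
  f≤ : f ≤ n * r
  f≤ = ⊔-lub (*-mono-≤ 1≤n (1≤root₄ n 1≤n)) (m/n≤m (n * r) (ratio v n))

-- With r the rounded fourth root and H the ratio, n ≤ (2 r)⁴ and n r ≤ 2 H f, so n⁵ ≤ (4 H f)⁴. The
-- power of 4 H with exponent k is at most n, so that after raising to the power k the factor 4 H
-- costs no more than n⁴.
threshold-lower : ∀ v n k → 1 ≤ n → 1 ≤ k → (4 * ratio v n) ^ k ≤ n → n ^ (5 * k ∸ 4) ≤ threshold v n ^ (4 * k)
threshold-lower v n k 1≤n 1≤k small = *-cancelˡ-≤ (n ^ 4) {{m^n≢0 n 4}} (begin
  n ^ 4 * n ^ (5 * k ∸ 4)          ≡⟨ ^-distribˡ-+-* n 4 (5 * k ∸ 4) ⟨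
  n ^ (4 + (5 * k ∸ 4))            ≡⟨ cong (n ^_) (m+[n∸m]≡n (≤-trans (s≤s (s≤s (s≤s (s≤s z≤n)))) (*-monoʳ-≤ 5 1≤k))) ⟩
  n ^ (5 * k)                      ≡⟨ ^-*-assoc n 5 k ⟨
  (n ^ 5) ^ k                      ≤⟨ ^-monoˡ-≤ k fifth ⟩
  (X ^ 4 * f ^ 4) ^ k              ≡⟨ ^-distribʳ-* k (X ^ 4) (f ^ 4) ⟩
  (X ^ 4) ^ k * (f ^ 4) ^ k        ≡⟨ cong₂ _*_ (trans (^-*-assoc X 4 k) (trans (cong (X ^_) (*-comm 4 k)) (sym (^-*-assoc X k 4)))) (^-*-assoc f 4 k) ⟩
  (X ^ k) ^ 4 * f ^ (4 * k)        ≤⟨ *-monoˡ-≤ (f ^ (4 * k)) (^-monoˡ-≤ 4 small) ⟩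
  n ^ 4 * f ^ (4 * k)              ∎)
  where
  open ≤-Reasoning
  instance
    n≢0 : NonZero n
    n≢0 = >-nonZero 1≤n
  f = threshold v n
  r = root₄ n
  H = ratio v n
  X = 4 * H
  n≤ : n ≤ (2 * r) ^ 4
  n≤ = ≤-trans (<⇒≤ (proj₂ (root₄-spec n))) (^-monoˡ-≤ 4 (≤-trans (+-monoˡ-≤ r (1≤root₄ n 1≤n)) (≤-reflexive (cong (r +_) (sym (+-identityʳ r))))))
  nr≤ : n * r ≤ 2 * H * f
  nr≤ = begin
    n * r                           ≡⟨ m≡m%n+[m/n]*n (n * r) H ⟩
    n * r % H + n * r / H * H       ≤⟨ +-mono-≤ (<⇒≤ (m%n<n (n * r) H)) (*-monoˡ-≤ H (m≤n⊔m 1 (n * r / H))) ⟩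
    H + f * H                       ≤⟨ +-monoˡ-≤ (f * H) (m≤n*m H f {{>-nonZero (1≤threshold v n)}}) ⟩
    f * H + f * H                   ≡⟨ lem f H ⟩
    2 * H * f                       ∎
    where lem : ∀ f H → f * H + f * H ≡ 2 * H * f
          lem = solve-∀
  fifth : n ^ 5 ≤ X ^ 4 * f ^ 4
  fifth = begin
    n ^ 5                    ≡⟨ *-comm n (n ^ 4) ⟩
    n ^ 4 * n                ≤⟨ *-monoʳ-≤ (n ^ 4) n≤ ⟩
    n ^ 4 * (2 * r) ^ 4      ≡⟨ fourth-mul n (2 * r) ⟨
    (n * (2 * r)) ^ 4        ≤⟨ ^-monoˡ-≤ 4 (≤-trans (≤-reflexive (lem₁ n r)) (≤-trans (*-monoʳ-≤ 2 nr≤) (≤-reflexive (lem₂ H f)))) ⟩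
    (X * f) ^ 4              ≡⟨ fourth-mul X f ⟩
    X ^ 4 * f ^ 4            ∎
    where
    lem₁ : ∀ n r → n * (2 * r) ≡ 2 * (n * r)
    lem₁ = solve-∀
    lem₂ : ∀ H f → 2 * (2 * H * f) ≡ 4 * H * f
    lem₂ = solve-∀

sparse-bound : ∀ {V f m X} → 1 ≤ V → 1 ≤ f → suc (6 * V) * f ≤ m → m ≤ 2 * V * X → suc (2 * f) ≤ X
sparse-bound {V} {f} {m} {X} 1≤V 1≤f low high = *-cancelˡ-≤ (2 * V) {{>-nonZero (≤-trans 1≤V (m≤n*m V 2))}} (begin
  2 * V * suc (2 * f)         ≡⟨ lem₁ V f ⟩
  2 * V * 1 + 4 * V * f       ≤⟨ +-monoˡ-≤ (4 * V * f) (*-monoʳ-≤ (2 * V) 1≤f) ⟩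
  2 * V * f + 4 * V * f       ≤⟨ m≤n+m _ f ⟩
  f + (2 * V * f + 4 * V * f) ≡⟨ lem₂ V f ⟩
  suc (6 * V) * f             ≤⟨ ≤-trans low high ⟩
  2 * V * X                   ∎)
  where
  open ≤-Reasoning
  lem₁ : ∀ V f → 2 * V * suc (2 * f) ≡ 2 * V * 1 + 4 * V * f
  lem₁ = solve-∀
  lem₂ : ∀ V f → f + (2 * V * f + 4 * V * f) ≡ suc (6 * V) * f
  lem₂ = solve-∀

large-evasive : ∀ v n → PrimeData v n → 1 ≤ n → ratio v n ≤ n → ∀ (P : Graph n → Bool) → IsGraphProperty P → Monotone P → Nontrivial P →
  (∀ G → P G ≡ true → edgeCount G ≤ threshold v n) → EvasiveProperty n P
large-evasive v n d 1≤n H≤n P isP mono nontrivial sparse = go n n≡c+kp refl P isP mono nontrivial sparse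
  where
  open PrimeData d
  V = v * lg n
  r = root₄ n
  f = threshold v n
  1≤V : 1 ≤ V
  1≤V = positive V (≤-trans 1≤n c-large)
    where positive : ∀ V → 1 ≤ V * c → 1 ≤ V
          positive (suc _) _ = s≤s z≤n
  1≤k : 1 ≤ k
  1≤k = positive k kp-large
    where positive : ∀ k → n ≤ V * suc (k * p) → 1 ≤ k
          positive (suc _) _ = s≤s z≤n
          positive zero h = ⊥-elim (<⇒≱ (≤-trans (s≤s (m≤n*m V 6)) H≤n) (≤-trans h (≤-reflexive (*-identityʳ V))))
  1≤kp : 1 ≤ k * p
  1≤kp = *-mono-≤ 1≤k (prime>0 prime-p)
  f≡ : f ≡ n * r / ratio v n
  f≡ = m≤n⇒m⊔n≡n (m≥n⇒m/n>0 (≤-trans H≤n (m≤m*n n r {{>-nonZero (1≤root₄ n 1≤n)}})))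
  low : suc (6 * V) * f ≤ n * r
  low = ≤-trans (≤-reflexive (trans (cong (suc (6 * V) *_) f≡) (*-comm (ratio v n) (n * r / ratio v n)))) (m/n*n≤m (n * r) (ratio v n))
  n≤kp : n ≤ 2 * V * (k * p)
  n≤kp = ≤-trans kp-large (≤-trans (*-monoʳ-≤ V (+-monoˡ-≤ (k * p) 1≤kp)) (≤-reflexive (lem V (k * p))))
    where lem : ∀ V x → V * (x + x) ≡ 2 * V * x
          lem = solve-∀
  r≤c : r ≤ c
  r≤c = ≤-trans (<⇒≤ root<q) (≤-trans (∣⇒≤ {{>-nonZero (m<n⇒0<n∸m (prime>1 prime-c))}} q∣c-1) (m∸n≤m c 1))
  b₁ : suc (2 * f) ≤ c * q
  b₁ = sparse-bound {V} 1≤V (1≤threshold v n) low (≤-trans (*-mono-≤ c-large (<⇒≤ root<q)) (≤-trans (m≤n*m _ 2) (≤-reflexive (lem V c q))))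
    where lem : ∀ V c q → 2 * (V * c * q) ≡ 2 * V * (c * q)
          lem = solve-∀
  b₂ : suc (2 * f) ≤ k * p * (p ∸ 1)
  b₂ = sparse-bound {V} 1≤V (1≤threshold v n) low (≤-trans (*-mono-≤ n≤kp (∸-monoˡ-≤ 1 root<p)) (≤-reflexive (*-assoc (2 * V) (k * p) (p ∸ 1))))
  b₃ : suc (2 * f) ≤ c * (k * p)
  b₃ = sparse-bound {V} 1≤V (1≤threshold v n) low (≤-trans (*-mono-≤ n≤kp r≤c) (≤-reflexive (trans (*-assoc (2 * V) (k * p) c) (cong (2 * V *_) (*-comm (k * p) c)))))
  ν = Residues.order-divisor p prime-p (p ∸ 1) (m<n⇒0<n∸m (prime>1 prime-p)) ∣-refl
  μ = Residues.order-divisor c prime-c q (prime>0 prime-q) q∣c-1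
  -- The number of vertices is made a variable so that it can be replaced by c + k p.
  go : ∀ m → m ≡ c + k * p → m ≡ n → (P : Graph m → Bool) → IsGraphProperty P → Monotone P → Nontrivial P → (∀ G → P G ≡ true → edgeCount G ≤ f) → EvasiveProperty m P
  go .(c + k * p) refl _ P isP mono nontrivial sparse =
    sparse-evasive c k p q prime-c prime-p prime-q 1≤k c∤ (proj₁ ν) (proj₂ ν) (proj₁ μ) (proj₂ μ) isP mono nontrivial b₁ b₂ b₃ (λ G PG → s≤s (*-monoʳ-≤ 2 (sparse G PG)))

threshold-exponent : ∀ v k → 1 ≤ k → ∃ λ N → ∀ n → N ≤ n → (n ^ (5 * k ∸ 4) ≤ threshold v n ^ (4 * k)) × (threshold v n ^ (4 * k) ≤ n ^ (5 * k + 4))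
threshold-exponent v k 1≤k = suc (proj₁ small) , λ n N<n →
  threshold-lower v n k (≤-trans (s≤s z≤n) N<n) 1≤k (proj₂ small n (<⇒≤ N<n)) , threshold-upper v n k (≤-trans (s≤s z≤n) N<n)
  where small = polylog v k 1≤k

eventually-evasive : ∀ v → (∃ λ N → ∀ n → N ≤ n → PrimeData v n) → ∃ λ N → ∀ n → N ≤ n → ∀ (P : Graph n → Bool) →
  IsGraphProperty P → Monotone P → Nontrivial P → (∀ G → P G ≡ true → edgeCount G ≤ threshold v n) → EvasiveProperty n P
eventually-evasive v (N , d) = suc (N + M) , λ n le → large-evasive v n (d n (≤-trans (m≤m+n N M) (<⇒≤ le))) (≤-trans (s≤s z≤n) le)
    (≤-trans (m≤n*m (ratio v n) 4) (≤-trans (≤-reflexive (sym (*-identityʳ (4 * ratio v n)))) (proj₂ small n (≤-trans (m≤n+m M N) (<⇒≤ le)))))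
  where
  small = polylog v 1 ≤-refl
  M = proj₁ small

-- The exponent 5/4 + o(1) is expressed without real powers: for each k the exponents 5/4 - 1/k and
-- 5/4 + 1/k enclose that of f n eventually, all multiplied by 4 k.
theorem1 : Σ (ℕ → ℕ) (λ f →
      (∀ n → 1 ≤ f n)
    × (∀ k → 1 ≤ k → ∃ λ N → ∀ n → N ≤ n →
         (n ^ (5 * k ∸ 4) ≤ f n ^ (4 * k)) × (f n ^ (4 * k) ≤ n ^ (5 * k + 4)))
    × (∃ λ N → ∀ n → N ≤ n → ∀ (P : Graph n → Bool) →
         IsGraphProperty P → Monotone P → Nontrivial P →
         (∀ G → P G ≡ true → edgeCount G ≤ f n) →
         EvasiveProperty n P))
theorem1 = threshold 1000 , 1≤threshold 1000 , threshold-exponent 1000 , eventually-evasive 1000 prime-data
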